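{- Let $n\ge2$ and $m\ge0$. The map $P_{\mathsf{dec}}$ defines a $\mathfrak q_n$-crystal quasi-isomorphism $\mathbb B_n^{\otimes m}\to\bigsqcup_{\lambda}\textsf{DecTab}_n(\lambda)$ and a $\mathfrak q^+_n$-crystal quasi-isomorphism $(\mathbb B^+_n)^{\otimes m}\to\bigsqcup_{\lambda}\textsf{DecTab}^+_n(\lambda)$, where both disjoint unions range over strict partitions $\lambda$ of $m$ with at most $n$ parts. Moreover, the full $\mathfrak q_n$-subcrystals of $\mathbb B_n^{\otimes m}$ and the full $\mathfrak q^+_n$-subcrystals of $(\mathbb B^+_n)^{\otimes m}$ are exactly the subsets on which $Q_{\mathsf{dec}}$ is constant.
   Context: Primed numbers: $i':=i-\tfrac12$, ordered $1'<1<2'<2<\cdots$; adding/subtracting 1 keeps prime status; $\lceil\cdot\rceil$ removes a prime. For a word $w=w_1\cdots w_m$ in $\{1'<1<\dots<n'<n\}$: $\mathsf{wt}(w)_i$ = number of letters in $\{i',i\}$. For $i\in[n-1]$, mark letters in $\{i',i\}$ by ")" and letters in $\{(i+1)',i+1\}$ by "("; $i$-unpaired letters are those not matched in the usual parenthesis matching; $e_i(w)=0$ if no $i$-unpaired letter is in $\{(i+1)',i+1\}$, else subtract 1 from the first such letter; $f_i(w)=0$ if no $i$-unpaired letter is in $\{i',i\}$, else add 1 to the last such letter. $e_0(w)=0$ if $w$ has no $1'$ or a $1$ occurs before the first $1'$, else change the first $1'$ to $1$; $f_0(w)=0$ if $w$ has no $1$ or a $1'$ occurs before the first $1$, else change the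 first $1$ to $1'$. $e_{\overline1}$: let $j,k$ be minimal with $w_j\in\{2',2\}$, $w_k\in\{1',1\}$; if $j$ does not exist or $j>k$ then $0$; if $j$ exists and $k$ does not, subtract 1 from $w_j$; otherwise replace $w_j$ by $w_k$ and $w_k$ by $w_j-1$. $f_{\overline1}$: let $j<k$ be the two smallest indices with $w_j,w_k\in\{1',1\}$; if $j$ does not exist or a letter before position $j$ lies in $\{2',2\}$ then $0$; if $j$ exists and $k$ does not, add 1 to $w_j$; otherwise replace $w_j$ by $w_k+1$ and $w_k$ by $w_j$. All operators send $0$ to $0$. $(\mathbb B^+_n)^{\otimes m}$ is the set of such words of length $m$ with $\mathsf{wt}$ and all $e_i,f_i$ ($i\in\{\overline1,0,1,\dots,n-1\}$), a $\mathfrak q^+_n$-crystal; $\mathbb B^{\otimes m}_n$ is its subset of unprimed words with $\mathsf{wt}$ and $e_i,f_i$ for $i\in\{\overline1,1,\dots,n-1\}$, a $\mathfrak q_n$-crystal. Decomposition tableaux. For strict $\lambda=(\lambda_1>\dots>\lambda_\ell>0)$ the shifted diagram is $\{(i,i+j-1):i\in[\ell],j\in[\lambda_i]\}$; row $i$ = boxes $(i,\cdot)$. A hook word is a sequence of positive integers $w_1\cdots w_k$ with $w_1\ge\dots\ge w_p<w_{p+1}<\dots<w_k$ for some $p\in[k]$; $w_1\cdots w_p$ is its weakly decreasing part, $w_{p+1}\cdots w_k$ its increasing part, $w_p$ its middle element. A decomposition tableau of shape $\lambda$ assigns positive integers to the shifted diagram so that each row $\rho_i$ (read left to right) is a hook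 word and $\rho_i$ is a hook subword of maximal length in $\rho_{i+1}\rho_i$; a primed decomposition tableau adds primes to the middle elements of some subset of rows. $\textsf{DecTab}_n(\lambda)$, $\textsf{DecTab}^+_n(\lambda)$: decomposition / primed decomposition tableaux of shape $\lambda$ with entries in $\{1'<\dots<n'<n\}$. $\mathsf{revrow}(T)$ reads row 1 right to left, then row 2 right to left, etc. The crystal structure on $\textsf{DecTab}^+_n(\lambda)$: $\mathsf{wt}(T)_i$ = number of entries in $\{i',i\}$; $e_i(T)$ is $0$ if $e_i(\mathsf{revrow}(T))=0$ and otherwise the tableau of shape $\lambda$ with reverse row reading word $e_i(\mathsf{revrow}(T))$, similarly $f_i$ (these lie in $\textsf{DecTab}^+_n(\lambda)\sqcup\{0\}$); $\textsf{DecTab}_n(\lambda)$ carries the restricted operators with $i\neq0$. Decomposition insertion. For a primed decomposition tableau $T$ and primed number $x$, $x\xrightarrow{\mathsf{dec}}T$ is computed as follows. At step $i$ a primed number $a_i$ is inserted into row $i$ (row $i$ may be empty), starting with $a_1=x$. Put $a=\lceil a_i\rceil$ and remove any prime from the middle element $m_i$ of row $i$ (if the row is nonempty), remembering whether $m_i$ was primed. If appending $a$ to the end of the (now unprimed) row gives a hook word, append it; otherwise $a$ replaces the leftmost entry $b$ of the increasing part with $b\ge a$, and then $b$ replaces the leftmost entry $c$ of the weakly decreasing part with $c<b$. Then: (1) if row $i$ was initially empty or the position of the middle element of the row changed: if $a_i$ is primed, prime the new middle element; if a box was appended, halt, and the insertion is even if row $i$ was initially empty or $m_i$ was unprimed,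 odd otherwise; else set $a_{i+1}=c$ if $m_i$ was unprimed and $a_{i+1}=c'$ if $m_i$ was primed. (2) If the position of the middle element did not change: if $m_i$ was primed, prime the middle element; if a box was appended, halt, and the insertion is even if $a_i$ is unprimed and odd if $a_i$ is primed; else set $a_{i+1}=c$ if $a_i$ is unprimed and $a_{i+1}=c'$ if $a_i$ is primed. For a primed word $w=w_m\cdots w_2w_1$ (so $w_1$ is its last letter), $P_{\mathsf{dec}}(w):=w_m\xrightarrow{\mathsf{dec}}(\cdots(w_2\xrightarrow{\mathsf{dec}}(w_1\xrightarrow{\mathsf{dec}}\emptyset))\cdots)$, and $Q_{\mathsf{dec}}(w)$ is the tableau of the same shape with entry $i$ (resp. $i'$) in the box added when inserting $w_i$, if that insertion is even (resp. odd). Crystal terms. The crystal graph has edges $b\to f_i(b)$ for all indices $i$ of the type; a full subcrystal is a connected component with restricted maps. An isomorphism is a weight-preserving bijection commuting with all $e_i,f_i$. A map $\phi:\mathcal B\to\mathcal C$ is a quasi-isomorphism if for each full subcrystal $\mathcal B'\subseteq\mathcal B$ there is a full subcrystal $\mathcal C'\subseteq\mathcal C$ such that $\phi|_{\mathcal B'}:\mathcal B'\to\mathcal C'$ is an isomorphism. -}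

module Defs where

open import Data.Nat using (ℕ; zero; suc; _+_; _∸_; _≤_; _<_; _≥_; _>_; _≤ᵇ_; _<ᵇ_; _≡ᵇ_)
open import Data.Bool using (Bool; true; false; if_then_else_; not; _∧_; _∨_)
open import Data.List using (List; []; _∷_; [_]; _++_; map; length; take; drop; reverse; concat)
open import Data.Bool.ListAction using (any)
open import Data.Nat.ListAction using (sum)
open import Data.Maybe using (Maybe; just; nothing)
import Data.Maybe as Maybe
open import Data.Product using (Σ; _×_; _,_; proj₁; proj₂; ∃)
open import Data.Unit using (⊤)
open import Data.Empty using (⊥)
open import Data.List.Relation.Unary.All using (All)
open import Data.List.Relation.Unary.Linked using (Linked)
open import Data.List.Relation.Binary.Sublist.Propositional using (_⊆_)
open import Relation.Binary.PropositionalEquality using (_≡_)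
open import Relation.Binary.Construct.Closure.Equivalence using (EqClosure)

-- Primed numbers.  ⟨ b , false ⟩ is the number b, ⟨ b , true ⟩ is b' = b - 1/2.
-- Order 1' < 1 < 2' < 2 < ...; adding/subtracting 1 acts on the base and
-- keeps the prime status; ⌈x⌉ = base x.

record PN : Set where
  constructor ⟨_,_⟩
  field
    base : ℕ
    primed : Bool
open PN public

incr : PN → PN
incr ⟨ b , p ⟩ = ⟨ suc b , p ⟩

decr : PN → PN
decr ⟨ b , p ⟩ = ⟨ b ∸ 1 , p ⟩

unprime : PN → PN
unprime ⟨ b , _ ⟩ = ⟨ b , false ⟩

withPrime : Bool → PN → PN
withPrime p ⟨ b , _ ⟩ = ⟨ b , p ⟩

Word : Set
Word = List PN

firstIdx : {A : Set} → (A → Bool) → List A → Maybe ℕ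
firstIdx p [] = nothing
firstIdx p (x ∷ xs) = if p x then just 0 else Maybe.map suc (firstIdx p xs)

lastTrue : List Bool → Maybe ℕ
lastTrue [] = nothing
lastTrue (b ∷ bs) with lastTrue bs
... | just j = just (suc j)
... | nothing = if b then just 0 else nothing

nth : {A : Set} → ℕ → List A → Maybe A
nth _ [] = nothing
nth zero (x ∷ xs) = just x
nth (suc j) (x ∷ xs) = nth j xs

modAt : {A : Set} → ℕ → (A → A) → List A → List A
modAt _ g [] = []
modAt zero g (x ∷ xs) = g x ∷ xs
modAt (suc j) g (x ∷ xs) = x ∷ modAt j g xs

setAt : {A : Set} → ℕ → A → List A → List A
setAt j v = modAt j (λ _ → v)

-- Crystal indices: ī (= 1̄), i0 (= 0), ix i (= i ∈ [n-1]).
data Idx : Set where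
  ī : Idx
  i0 : Idx
  ix : ℕ → Idx

-- letters in {i',i} are ")" ; letters in {(i+1)',i+1} are "("
isClose isOpen : ℕ → PN → Bool
isClose i x = base x ≡ᵇ i
isOpen i x = base x ≡ᵇ suc i

-- scan left to right, c = number of pending "(" ; flags unpaired ")"
unpairedClose : ℕ → ℕ → Word → List Bool
unpairedClose i c [] = []
unpairedClose i c (x ∷ xs) with isOpen i x | isClose i x | c
... | true | _ | _ = false ∷ unpairedClose i (suc c) xs
... | false | true | zero = true ∷ unpairedClose i zero xs
... | false | true | suc c' = false ∷ unpairedClose i c' xs
... | false | false | _ = false ∷ unpairedClose i c xs

-- scan a REVERSED word (right to left), c = number of pending ")" ; flags unpaired "("
unpairedOpenRev : ℕ → ℕ → Word → List Bool
unpairedOpenRev i c [] = []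
unpairedOpenRev i c (x ∷ xs) with isClose i x | isOpen i x | c
... | true | _ | _ = false ∷ unpairedOpenRev i (suc c) xs
... | false | true | zero = true ∷ unpairedOpenRev i zero xs
... | false | true | suc c' = false ∷ unpairedOpenRev i c' xs
... | false | false | _ = false ∷ unpairedOpenRev i c xs

eI : ℕ → Word → Maybe Word
eI i w with firstIdx (λ b → b) (reverse (unpairedOpenRev i 0 (reverse w)))
... | nothing = nothing
... | just j = just (modAt j decr w)

fI : ℕ → Word → Maybe Word
fI i w with lastTrue (unpairedClose i 0 w)
... | nothing = nothing
... | just j = just (modAt j incr w)

e0 : Word → Maybe Word
e0 w with firstIdx (λ x → base x ≡ᵇ 1) w
... | nothing = nothing
... | just k with nth k w
...   | just ⟨ _ , true ⟩ = just (setAt k ⟨ 1 , false ⟩ w)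
...   | _ = nothing

f0 : Word → Maybe Word
f0 w with firstIdx (λ x → base x ≡ᵇ 1) w
... | nothing = nothing
... | just k with nth k w
...   | just ⟨ _ , false ⟩ = just (setAt k ⟨ 1 , true ⟩ w)
...   | _ = nothing

e1̄ : Word → Maybe Word
e1̄ w with firstIdx (λ x → base x ≡ᵇ 2) w | firstIdx (λ x → base x ≡ᵇ 1) w
... | nothing | _ = nothing
... | just j | nothing = just (modAt j decr w)
... | just j | just k with k <ᵇ j | nth j w | nth k w
...   | true | _ | _ = nothing
...   | false | just wj | just wk = just (setAt k (decr wj) (setAt j wk w))
...   | false | _ | _ = nothing

f1̄ : Word → Maybe Word
f1̄ w with firstIdx (λ x → base x ≡ᵇ 1) w
... | nothing = nothing
... | just j with any (λ x → base x ≡ᵇ 2) (take j w)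
...   | true = nothing
...   | false with firstIdx (λ x → base x ≡ᵇ 1) (drop (suc j) w)
...     | nothing = just (modAt j incr w)
...     | just t with nth j w | nth (suc j + t) w
...       | just wj | just wk = just (setAt (suc j + t) wj (setAt j (incr wk) w))
...       | _ | _ = nothing

eW fW : Idx → Word → Maybe Word
eW ī = e1̄
eW i0 = e0
eW (ix i) = eI i
fW ī = f1̄
fW i0 = f0
fW (ix i) = fI i

QIdx : ℕ → Idx → Set
QIdx n ī = ⊤
QIdx n i0 = ⊥
QIdx n (ix i) = 1 ≤ i × i < n

QIdx⁺ : ℕ → Idx → Set
QIdx⁺ n ī = ⊤
QIdx⁺ n i0 = ⊤
QIdx⁺ n (ix i) = 1 ≤ i × i < n

count : ℕ → Word → ℕ
count i [] = 0
count i (x ∷ xs) = if base x ≡ᵇ i then suc (count i xs) else count i xs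

upFrom : ℕ → ℕ → List ℕ
upFrom s zero = []
upFrom s (suc k) = s ∷ upFrom (suc s) k

wtW : ℕ → Word → List ℕ
wtW n w = map (λ i → count i w) (upFrom 1 n)

-- Abstract crystals (as subsets of a carrier type, with partial operators)

record Crystal : Set₁ where
  field
    Elt : Set
    Mem : Elt → Set
    Ix : Idx → Set
    wt : Elt → List ℕ
    e f : Idx → Elt → Maybe Elt

module _ (C : Crystal) where
  open Crystal C

  Edge : Elt → Elt → Set
  Edge b c = Σ Idx λ i → Ix i × Mem b × Mem c × f i b ≡ just c

  -- same connected component (= same full subcrystal)
  Connected : Elt → Elt → Set
  Connected = EqClosure Edge

IsoOnComponents : (B C : Crystal) → (Crystal.Elt B → Crystal.Elt C) →
                  Crystal.Elt B → Crystal.Elt C → Set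
IsoOnComponents B C φ b c =
  (∀ x → Connected B b x → Connected C c (φ x)) ×
  (∀ x y → Connected B b x → Connected B b y → φ x ≡ φ y → x ≡ y) ×
  (∀ z → Connected C c z → ∃ λ x → Connected B b x × φ x ≡ z) ×
  (∀ x → Connected B b x → Crystal.wt C (φ x) ≡ Crystal.wt B x) ×
  (∀ i → Crystal.Ix B i → ∀ x → Connected B b x →
      Maybe.map φ (Crystal.e B i x) ≡ Crystal.e C i (φ x) ×
      Maybe.map φ (Crystal.f B i x) ≡ Crystal.f C i (φ x))

QuasiIso : (B C : Crystal) → (Crystal.Elt B → Crystal.Elt C) → Set
QuasiIso B C φ =
  ∀ b → Crystal.Mem B b → Σ (Crystal.Elt C) λ c → Crystal.Mem C c × IsoOnComponents B C φ b c

InAlph : ℕ → PN → Set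
InAlph n x = 1 ≤ base x × base x ≤ n

Unprimed : PN → Set
Unprimed x = primed x ≡ false

BWord : ℕ → ℕ → Crystal
BWord n m = record
  { Elt = Word
  ; Mem = λ w → length w ≡ m × All (λ x → InAlph n x × Unprimed x) w
  ; Ix = QIdx n ; wt = wtW n ; e = eW ; f = fW }

BWord⁺ : ℕ → ℕ → Crystal
BWord⁺ n m = record
  { Elt = Word
  ; Mem = λ w → length w ≡ m × All (InAlph n) w
  ; Ix = QIdx⁺ n ; wt = wtW n ; e = eW ; f = fW }

IsHook : List ℕ → Set
IsHook w = Σ ℕ λ p → 1 ≤ p × p ≤ length w ×
  Linked _≥_ (take p w) × Linked _<_ (drop (p ∸ 1) w)

-- position (1-based) of the middle element = length of the longest weakly
-- decreasing prefix
midPos : List ℕ → ℕ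
midPos [] = 0
midPos (x ∷ []) = 1
midPos (x ∷ y ∷ r) = if y ≤ᵇ x then suc (midPos (y ∷ r)) else 1

strictIncB : List ℕ → Bool
strictIncB [] = true
strictIncB (x ∷ []) = true
strictIncB (x ∷ y ∷ r) = (x <ᵇ y) ∧ strictIncB (y ∷ r)

isHookB : List ℕ → Bool
isHookB [] = false
isHookB w@(_ ∷ _) = strictIncB (drop (midPos w ∸ 1) w)

-- Shifted tableaux are stored as the list of their rows (row 1 first), each
-- row read left to right; the shape is the list of row lengths.
Tableau : Set
Tableau = List (List PN)

shape : Tableau → List ℕ
shape = map length

StrictPartitionOf : ℕ → ℕ → List ℕ → Set
StrictPartitionOf n m λ' = All (λ k → 1 ≤ k) λ' × Linked _>_ λ' × sum λ' ≡ m × length λ' ≤ n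

MaxHookIn : List ℕ → List ℕ → Set
MaxHookIn ρ ρ' = ∀ s → s ⊆ (ρ' ++ ρ) → IsHook s → length s ≤ length ρ

IsDecRows : Tableau → Set
IsDecRows T = All (λ ρ → IsHook (map base ρ)) T ×
              Linked (λ ρ ρ' → MaxHookIn (map base ρ) (map base ρ')) T

PrimesOnlyMiddle : List PN → Set
PrimesOnlyMiddle ρ = All Unprimed (take (midPos (map base ρ) ∸ 1) ρ) ×
                     All Unprimed (drop (midPos (map base ρ)) ρ)

-- ⊔_λ DecTabₙ(λ) over strict partitions λ of m with at most n parts
IsDecTab : ℕ → ℕ → Tableau → Set
IsDecTab n m T = StrictPartitionOf n m (shape T) × IsDecRows T ×
                 All (All (λ x → InAlph n x × Unprimed x)) T

IsDecTab⁺ : ℕ → ℕ → Tableau → Set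
IsDecTab⁺ n m T = StrictPartitionOf n m (shape T) × IsDecRows T ×
                  All (All (InAlph n)) T × All PrimesOnlyMiddle T

revrow : Tableau → Word
revrow T = concat (map reverse T)

fromRevrow : List ℕ → Word → Tableau
fromRevrow [] w = []
fromRevrow (k ∷ ks) w = reverse (take k w) ∷ fromRevrow ks (drop k w)

eT fT : Idx → Tableau → Maybe Tableau
eT i T = Maybe.map (fromRevrow (shape T)) (eW i (revrow T))
fT i T = Maybe.map (fromRevrow (shape T)) (fW i (revrow T))

wtT : ℕ → Tableau → List ℕ
wtT n T = wtW n (revrow T)

DecTabCrystal : ℕ → ℕ → Crystal
DecTabCrystal n m = record
  { Elt = Tableau ; Mem = IsDecTab n m ; Ix = QIdx n
  ; wt = wtT n ; e = eT ; f = fT }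

DecTabCrystal⁺ : ℕ → ℕ → Crystal
DecTabCrystal⁺ n m = record
  { Elt = Tableau ; Mem = IsDecTab⁺ n m ; Ix = QIdx⁺ n
  ; wt = wtT n ; e = eT ; f = fT }

bumpInc : ℕ → List ℕ → List ℕ × ℕ
bumpInc a [] = [] , a
bumpInc a (b ∷ r) = if a ≤ᵇ b then (a ∷ r , b)
                    else (b ∷ proj₁ (bumpInc a r) , proj₂ (bumpInc a r))

bumpDec : ℕ → List ℕ → List ℕ × ℕ
bumpDec b [] = [] , b
bumpDec b (c ∷ r) = if c <ᵇ b then (b ∷ r , c)
                    else (c ∷ proj₁ (bumpDec b r) , proj₂ (bumpDec b r))

bumpRow : ℕ → List ℕ → List ℕ × ℕ
bumpRow a u =
  let p = midPos u
      r1 = bumpInc a (drop p u)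
      r2 = bumpDec (proj₂ r1) (take p u)
  in (proj₁ r2 ++ proj₁ r1) , proj₂ r2

-- x →dec T : returns (new tableau , 0-based index of the row in which a box
-- was appended , whether the insertion is odd)
decIns : PN → Tableau → Tableau × ℕ × Bool
decIns x [] = [ x ] ∷ [] , 0 , false
decIns x (r ∷ rs) with isHookB (map base r ++ [ base x ])
... | true =
  let u = map base r
      p = midPos u
      mPr = Maybe.maybe primed false (nth (p ∸ 1) r)
      u' = u ++ [ base x ]
      p' = midPos u'
      changed = not (p ≡ᵇ p')
      newPr = if changed then primed x else mPr
      r' = setAt (p' ∸ 1) ⟨ Maybe.maybe (λ k → k) 0 (nth (p' ∸ 1) u') , newPr ⟩
                 (map (λ k → ⟨ k , false ⟩) u')
  in r' ∷ rs , 0 , (if changed then mPr else primed x)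
... | false =
  let u = map base r
      p = midPos u
      mPr = Maybe.maybe primed false (nth (p ∸ 1) r)
      br = bumpRow (base x) u
      u' = proj₁ br
      c = proj₂ br
      p' = midPos u'
      changed = not (p ≡ᵇ p')
      newPr = if changed then primed x else mPr
      r' = setAt (p' ∸ 1) ⟨ Maybe.maybe (λ k → k) 0 (nth (p' ∸ 1) u') , newPr ⟩
                 (map (λ k → ⟨ k , false ⟩) u')
      nxt = ⟨ c , (if changed then mPr else primed x) ⟩
      rec = decIns nxt rs
  in r' ∷ proj₁ rec , suc (proj₁ (proj₂ rec)) , proj₂ (proj₂ rec)

addBox : ℕ → PN → Tableau → Tableau
addBox _ x [] = [ x ] ∷ []
addBox zero x (r ∷ rs) = (r ++ [ x ]) ∷ rs
addBox (suc k) x (r ∷ rs) = r ∷ addBox k x rs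

-- For the list w = l₁ ⋯ lₘ (so w_i := l_{m+1-i} in the paper's notation
-- w = w_m ⋯ w₁) the letters are inserted from the right; returns
-- (P_dec(w) , Q_dec(w) , number of letters inserted).
PQdec : Word → Tableau × Tableau × ℕ
PQdec [] = [] , [] , 0
PQdec (x ∷ xs) =
  let prev = PQdec xs
      k = suc (proj₂ (proj₂ prev))
      ins = decIns x (proj₁ prev)
  in proj₁ ins ,
     addBox (proj₁ (proj₂ ins)) ⟨ k , proj₂ (proj₂ ins) ⟩ (proj₁ (proj₂ prev)) ,
     k

Pdec : Word → Tableau
Pdec w = proj₁ (PQdec w)

Qdec : Word → Tableau
Qdec w = proj₁ (proj₂ (PQdec w))

{-# OPTIONS --safe #-}
module Submission where

-- Each letter inserted acts on the row reading words by elementary bumps, and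
-- these are natural for the operators: replacing the word being inserted by its
-- image under e_i or f_i leaves the recording tableau unchanged and applies the
-- same operator to revrow of the insertion tableau.  So P commutes with all
-- operators and Q is constant on components.
-- For the converse one needs enough paths.  As long as the sum of the squares
-- of the weights can grow, move along such a path; when it cannot, the weights can
-- be permuted freely, which forces a word that starts with n n.  Applied to the
-- rows of P(w) one after another (paths lift along P), this makes the rows of P
-- equal to n⋯n, n-1⋯n-1, …; in the primed case the primes can then be removed
-- by operators of index 0.
-- The result depends on the shape only.
-- An insertion ending in constant rows can be undone from P and Q, and so can
-- every insertion, by transport along a path; hence (P,Q) is injective.
-- The maximal lengths of hook subwords are crystal invariants as well, so the same
-- paths reduce the maximality condition on the rows to constant rows.

open import Defs
open import Data.Bool using (Bool; true; false; if_then_else_; not; T)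
open import Data.Bool.ListAction using (any)
import Data.Bool.Properties as Bool
open import Data.Empty using (⊥; ⊥-elim)
open import Data.List using (List; []; _∷_; [_]; _++_; map; length; take; drop; reverse; concat; replicate)
open import Data.List.Membership.Propositional using (_∈_)
open import Data.List.Properties using (∷ʳ-injective; ++-assoc; ++-identityʳ; length-++; map-++; map-cong; ∷-injective; ∷-injectiveˡ; ∷-injectiveʳ; unfold-reverse; reverse-++; reverse-map; reverse-involutive; length-map; length-reverse; length-replicate; length-drop; length-take; take++drop≡id)
open import Data.List.Relation.Binary.Permutation.Propositional using (_↭_; ↭-refl; ↭-trans; ↭-sym; ↭-reflexive; prep; swap)
import Data.List.Relation.Binary.Permutation.Propositional.Properties as Perm
open import Data.List.Relation.Binary.Sublist.Propositional using (_⊆_; []; _∷_; _∷ʳ_)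
import Data.List.Relation.Binary.Sublist.Propositional as Sub
import Data.List.Relation.Binary.Sublist.Propositional.Properties as Sub
open import Data.List.Relation.Unary.All using (All; []; _∷_)
import Data.List.Relation.Unary.All as All
import Data.List.Relation.Unary.All.Properties as All
open import Data.List.Relation.Unary.AllPairs using (AllPairs; []; _∷_)
open import Data.List.Relation.Unary.Linked using (Linked; []; [-]; _∷_)
open import Data.List.Relation.Unary.Linked.Properties using (Linked⇒AllPairs; AllPairs⇒Linked)
open import Data.Maybe using (Maybe; just; nothing)
import Data.Maybe as Maybe
open import Data.Maybe.Properties using (just-injective)
open import Data.Nat using (>-nonZero; ℕ; zero; suc; pred; _+_; _*_; _∸_; _≤_; _<_; _≥_; _>_; z≤n; s≤s; _≤ᵇ_; _<ᵇ_; _≡ᵇ_; _≟_; _≤?_; _<?_)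
open import Data.Nat.ListAction using (sum)
open import Data.Nat.Properties
open import Data.Product using (_×_; _,_; proj₁; proj₂; ∃; ∃₂)
open import Data.Sum using (_⊎_; inj₁; inj₂)
open import Data.Unit using (⊤; tt)
open import Function using (_∘_; id)
open import Function.Bundles using (_⇔_; mk⇔)
open import Relation.Binary.Definitions using (tri<; tri≈; tri>)
open import Relation.Binary.PropositionalEquality hiding ([_]; J)
import Relation.Binary.Construct.Closure.ReflexiveTransitive as Star
import Relation.Binary.Construct.Closure.Symmetric as Sym
open import Relation.Nullary using (yes; no)

-- Bracket signatures

-- The operators f_i see only bases, while the odd ones also move primes, and this splits the
-- naturality proof. Under f_i the position of the middle element of a row is invariant, so the
-- prime rules never change their case, and a bump may be studied on unprimed rows as two elementary
-- bumps. The operator of index 1-bar can move the middle element, since it may lower a 2 standing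
-- next to a middle 1; there a bump is treated as a whole, and the exchange of primes made by the
-- operator offsets the change of case in the insertion rule. Insertion is handled as a relation
-- between words, indexed by the row lengths and by the row and parity of the new box. Such
-- relations are closed under concatenation and composition, and as their indices do not change,
-- constancy of Q comes with naturality. The sum of squares is chosen because lowering a letter i+1
-- increases it whenever the weight of i is at least that of i+1. If it cannot grow, no such i+1 is
-- unmatched, and raising all unmatched letters i interchanges the two weights.

data Kind : Set where
  op cl ne : Kind

kindᵇ : Bool → Bool → Kind
kindᵇ true _ = op
kindᵇ false true = cl
kindᵇ false false = ne

kind : ℕ → ℕ → Kind
kind i y = kindᵇ (y ≡ᵇ suc i) (y ≡ᵇ i)

≡ᵇ-refl : ∀ n → (n ≡ᵇ n) ≡ true
≡ᵇ-refl zero = refl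
≡ᵇ-refl (suc n) = ≡ᵇ-refl n

≢⇒≡ᵇ : ∀ {m n} → m ≢ n → (m ≡ᵇ n) ≡ false
≢⇒≡ᵇ {m} {n} p with m ≡ᵇ n in eq
... | false = refl
... | true = ⊥-elim (p (≡ᵇ⇒≡ m n (subst T (sym eq) tt)))

≡ᵇ-true : ∀ {m n} → (m ≡ᵇ n) ≡ true → m ≡ n
≡ᵇ-true {m} {n} eq = ≡ᵇ⇒≡ m n (subst T (sym eq) tt)

kind-op : ∀ i → kind i (suc i) ≡ op
kind-op i rewrite ≡ᵇ-refl i = refl

kind-cl : ∀ i → kind i i ≡ cl
kind-cl i rewrite ≢⇒≡ᵇ (<⇒≢ (n<1+n i)) | ≡ᵇ-refl i = refl

kind-ne : ∀ {i y} → y ≢ i → y ≢ suc i → kind i y ≡ ne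
kind-ne p q rewrite ≢⇒≡ᵇ q | ≢⇒≡ᵇ p = refl

data KindView (i : ℕ) : ℕ → Kind → Set where
  isOp : KindView i (suc i) op
  isCl : KindView i i cl
  isNe : ∀ {y} → y ≢ i → y ≢ suc i → KindView i y ne

kindView : ∀ i y → KindView i y (kind i y)
kindView i y with y ≟ suc i
... | yes refl rewrite kind-op i = isOp
... | no q with y ≟ i
...   | yes refl rewrite kind-cl i = isCl
...   | no p rewrite kind-ne p q = isNe p q

kinds : ℕ → Word → List Kind
kinds i = map (λ x → kind i (base x))

-- φ c counts the unmatched closing brackets and ω c the pending opening ones
-- after a scan that starts with c pending opening brackets.
φ ω : ℕ → List Kind → ℕ
φ c [] = 0
φ c (op ∷ ks) = φ (suc c) ks
φ zero (cl ∷ ks) = suc (φ zero ks)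
φ (suc c) (cl ∷ ks) = φ c ks
φ c (ne ∷ ks) = φ c ks
ω c [] = c
ω c (op ∷ ks) = ω (suc c) ks
ω zero (cl ∷ ks) = ω zero ks
ω (suc c) (cl ∷ ks) = ω c ks
ω c (ne ∷ ks) = ω c ks

φ-++ : ∀ c ks ls → φ c (ks ++ ls) ≡ φ c ks + φ (ω c ks) ls
φ-++ c [] ls = refl
φ-++ c (op ∷ ks) ls = φ-++ (suc c) ks ls
φ-++ zero (cl ∷ ks) ls = cong suc (φ-++ zero ks ls)
φ-++ (suc c) (cl ∷ ks) ls = φ-++ c ks ls
φ-++ c (ne ∷ ks) ls = φ-++ c ks ls

ω-++ : ∀ c ks ls → ω c (ks ++ ls) ≡ ω (ω c ks) ls
ω-++ c [] ls = refl
ω-++ c (op ∷ ks) ls = ω-++ (suc c) ks ls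
ω-++ zero (cl ∷ ks) ls = ω-++ zero ks ls
ω-++ (suc c) (cl ∷ ks) ls = ω-++ c ks ls
ω-++ c (ne ∷ ks) ls = ω-++ c ks ls

-- One more pending opening bracket absorbs one unmatched closing bracket if there is one; truncated
-- subtraction expresses this.
φ-suc : ∀ c ks → φ (suc c) ks ≡ φ c ks ∸ 1
φ-suc c [] = refl
φ-suc c (op ∷ ks) = φ-suc (suc c) ks
φ-suc zero (cl ∷ ks) = refl
φ-suc (suc c) (cl ∷ ks) = φ-suc c ks
φ-suc c (ne ∷ ks) = φ-suc c ks

φ-∸ : ∀ c ks → φ c ks ≡ φ 0 ks ∸ c
φ-∸ zero ks = refl
φ-∸ (suc c) ks = begin
  φ (suc c) ks ≡⟨ φ-suc c ks ⟩
  φ c ks ∸ 1 ≡⟨ cong (_∸ 1) (φ-∸ c ks) ⟩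
  φ 0 ks ∸ c ∸ 1 ≡⟨ ∸-+-assoc (φ 0 ks) c 1 ⟩
  φ 0 ks ∸ (c + 1) ≡⟨ cong (φ 0 ks ∸_) (+-comm c 1) ⟩
  φ 0 ks ∸ suc c ∎
  where open ≡-Reasoning

-- The additional bracket stays pending exactly when all closing brackets already find partners
-- without it, that is, when `φ c ks` is 0.
ω-suc : ∀ c ks → ω (suc c) ks ≡ ω c ks + (1 ∸ φ c ks)
ω-suc c [] = +-comm 1 c
ω-suc c (op ∷ ks) = ω-suc (suc c) ks
ω-suc zero (cl ∷ ks) = trans (sym (+-identityʳ _)) (cong (ω 0 ks +_) (sym (0∸n≡0 (φ 0 ks))))
ω-suc (suc c) (cl ∷ ks) = ω-suc c ks
ω-suc c (ne ∷ ks) = ω-suc c ks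

ω-+ : ∀ c ks → ω c ks ≡ ω 0 ks + (c ∸ φ 0 ks)
ω-+ zero ks = trans (sym (+-identityʳ _)) (cong (ω 0 ks +_) (sym (0∸n≡0 (φ 0 ks))))
ω-+ (suc c) ks = begin
  ω (suc c) ks ≡⟨ ω-suc c ks ⟩
  ω c ks + (1 ∸ φ c ks) ≡⟨ cong₂ _+_ (ω-+ c ks) (cong (1 ∸_) (φ-∸ c ks)) ⟩
  ω 0 ks + (c ∸ f) + (1 ∸ (f ∸ c)) ≡⟨ +-assoc (ω 0 ks) _ _ ⟩
  ω 0 ks + ((c ∸ f) + (1 ∸ (f ∸ c))) ≡⟨ cong (ω 0 ks +_) (lem c f) ⟩
  ω 0 ks + (suc c ∸ f) ∎
  where
  open ≡-Reasoning
  f = φ 0 ks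
  lem : ∀ c f → (c ∸ f) + (1 ∸ (f ∸ c)) ≡ suc c ∸ f
  lem c zero rewrite 0∸n≡0 c = +-comm c 1
  lem zero (suc f) = refl
  lem (suc c) (suc f) = lem c f

ω0⇒ : ∀ c ks → ω c ks ≡ 0 → ω 0 ks ≡ 0 × c ≤ φ 0 ks
ω0⇒ c ks eq = m+n≡0⇒m≡0 _ e , m∸n≡0⇒m≤n (m+n≡0⇒n≡0 (ω 0 ks) e)
  where e = trans (sym (ω-+ c ks)) eq

⇒ω0 : ∀ c ks → ω 0 ks ≡ 0 → c ≤ φ 0 ks → ω c ks ≡ 0
⇒ω0 c ks e le = trans (ω-+ c ks) (cong₂ _+_ e (m≤n⇒m∸n≡0 le))

φ0⇒ : ∀ c ks → φ c ks ≡ 0 → φ 0 ks ≤ c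
φ0⇒ c ks eq = m∸n≡0⇒m≤n (trans (sym (φ-∸ c ks)) eq)

⇒φ0 : ∀ c ks → φ 0 ks ≤ c → φ c ks ≡ 0
⇒φ0 c ks le = trans (φ-∸ c ks) (m≤n⇒m∸n≡0 le)

-- The raising relation: f_i turns the letter i at the displayed position into i+1.

record F (i : ℕ) (w w' : Word) : Set where
  constructor mkF
  field
    pre : Word
    bit : Bool
    post : Word
    src : w ≡ pre ++ ⟨ i , bit ⟩ ∷ post
    tgt : w' ≡ pre ++ ⟨ suc i , bit ⟩ ∷ post
    pre-ω : ω 0 (kinds i pre) ≡ 0
    post-φ : φ 0 (kinds i post) ≡ 0

kinds-++ : ∀ i u v → kinds i (u ++ v) ≡ kinds i u ++ kinds i v
kinds-++ i u v = map-++ _ u v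

φW ωW : ℕ → Word → ℕ
φW i w = φ 0 (kinds i w)
ωW i w = ω 0 (kinds i w)

φW-++ : ∀ i u v → φW i (u ++ v) ≡ φW i u + φ (ωW i u) (kinds i v)
φW-++ i u v = trans (cong (φ 0) (kinds-++ i u v)) (φ-++ 0 (kinds i u) (kinds i v))

ωW-++ : ∀ i u v → ωW i (u ++ v) ≡ ω (ωW i u) (kinds i v)
ωW-++ i u v = trans (cong (ω 0) (kinds-++ i u v)) (ω-++ 0 (kinds i u) (kinds i v))

φ-cl : ∀ i ks → φ 0 (kind i i ∷ ks) ≡ suc (φ 0 ks)
φ-cl i ks rewrite kind-cl i = refl

ω-cl : ∀ i ks → ω 0 (kind i i ∷ ks) ≡ ω 0 ks
ω-cl i ks rewrite kind-cl i = refl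

φ-op : ∀ i c ks → φ c (kind i (suc i) ∷ ks) ≡ φ (suc c) ks
φ-op i c ks rewrite kind-op i = refl

ω-op : ∀ i c ks → ω c (kind i (suc i) ∷ ks) ≡ ω (suc c) ks
ω-op i c ks rewrite kind-op i = refl

++-split : ∀ {A : Set} (u : List A) y v P Q → u ++ y ∷ v ≡ P ++ Q →
  (∃ λ r → P ≡ u ++ y ∷ r × v ≡ r ++ Q) ⊎ (∃ λ r → u ≡ P ++ r × Q ≡ r ++ y ∷ v)
++-split u y v [] Q eq = inj₂ (u , refl , sym eq)
++-split [] y v (p ∷ P) Q eq with ∷-injective eq
... | refl , e = inj₁ (P , refl , e)
++-split (x ∷ u) y v (p ∷ P) Q eq with ∷-injective eq
... | refl , e with ++-split u y v P Q e
...   | inj₁ (r , e1 , e2) = inj₁ (r , cong (x ∷_) e1 , e2)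
...   | inj₂ (r , e1 , e2) = inj₂ (r , cong (x ∷_) e1 , e2)

module _ {i : ℕ} where

  F-φ : ∀ {w w'} → F i w w' → ∃ λ n → φW i w ≡ suc n × φW i w' ≡ n
  F-φ (mkF u p v refl refl a b) = φW i u
    , trans (φW-++ i u _) (trans (cong (λ z → φW i u + φ z (kind i i ∷ kinds i v)) a)
        (trans (cong (φW i u +_) (trans (φ-cl i _) (cong suc b))) (+-comm _ 1)))
    , trans (φW-++ i u _) (trans (cong (λ z → φW i u + φ z (kind i (suc i) ∷ kinds i v)) a)
        (trans (cong (φW i u +_) (trans (φ-op i 0 _) (⇒φ0 1 (kinds i v) (subst (_≤ 1) (sym b) z≤n)))) (+-identityʳ _)))

  F-ω : ∀ {w w'} → F i w w' → ωW i w' ≡ suc (ωW i w)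
  F-ω (mkF u p v refl refl a b) = begin
    ωW i (u ++ ⟨ suc i , p ⟩ ∷ v) ≡⟨ ωW-++ i u _ ⟩
    ω (ωW i u) (kind i (suc i) ∷ kinds i v) ≡⟨ cong (λ z → ω z (kind i (suc i) ∷ kinds i v)) a ⟩
    ω 0 (kind i (suc i) ∷ kinds i v) ≡⟨ ω-op i 0 (kinds i v) ⟩
    ω 1 (kinds i v) ≡⟨ ω-suc 0 (kinds i v) ⟩
    ω 0 (kinds i v) + (1 ∸ φ 0 (kinds i v)) ≡⟨ cong (λ z → ω 0 (kinds i v) + (1 ∸ z)) b ⟩
    ω 0 (kinds i v) + 1 ≡⟨ +-comm _ 1 ⟩
    suc (ω 0 (kinds i v)) ≡⟨ cong suc (ω-cl i (kinds i v)) ⟨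
    suc (ω 0 (kind i i ∷ kinds i v)) ≡⟨ cong (λ z → suc (ω z (kind i i ∷ kinds i v))) a ⟨
    suc (ω (ωW i u) (kind i i ∷ kinds i v)) ≡⟨ cong suc (ωW-++ i u _) ⟨
    suc (ωW i (u ++ ⟨ i , p ⟩ ∷ v)) ∎
    where open ≡-Reasoning

  F-joinˡ : ∀ {P P'} Q → F i P P' → φW i Q ≤ ωW i P → F i (P ++ Q) (P' ++ Q)
  F-joinˡ Q (mkF u p v refl refl a b) le =
    mkF u p (v ++ Q) (++-assoc u _ Q) (++-assoc u _ Q) a
      (trans (φW-++ i v Q) (cong₂ _+_ b (⇒φ0 (ωW i v) (kinds i Q) (subst (φW i Q ≤_) eq le))))
    where
    eq : ωW i (u ++ ⟨ i , p ⟩ ∷ v) ≡ ωW i v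
    eq = trans (ωW-++ i u _) (trans (cong (λ z → ω z (kind i i ∷ kinds i v)) a) (ω-cl i (kinds i v)))

  F-joinʳ : ∀ P {Q Q'} → F i Q Q' → ωW i P < φW i Q → F i (P ++ Q) (P ++ Q')
  F-joinʳ P (mkF u p v refl refl a b) lt =
    mkF (P ++ u) p v (sym (++-assoc P u _)) (sym (++-assoc P u _))
      (trans (ωW-++ i P u) (⇒ω0 (ωW i P) (kinds i u) a (≤-pred (subst (ωW i P <_) eq lt)))) b
    where
    eq : φW i (u ++ ⟨ i , p ⟩ ∷ v) ≡ suc (φW i u)
    eq = trans (φW-++ i u _) (trans (cong (λ z → φW i u + φ z (kind i i ∷ kinds i v)) a)
        (trans (cong (φW i u +_) (trans (φ-cl i _) (cong suc b))) (+-comm _ 1)))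

  -- The inequalities exclude each other and are those of the two joins, so together these lemmas
  -- are the full tensor product rule.
  F-split : ∀ P Q {W} → F i (P ++ Q) W →
    (∃ λ P' → F i P P' × W ≡ P' ++ Q × φW i Q ≤ ωW i P) ⊎
    (∃ λ Q' → F i Q Q' × W ≡ P ++ Q' × ωW i P < φW i Q)
  F-split P Q (mkF u p v s refl a b) with ++-split u _ v P Q (sym s)
  ... | inj₁ (r , refl , refl) = inj₁ (_ , mkF u p r refl refl a (m+n≡0⇒m≡0 _ b') , sym (++-assoc u _ Q)
        , subst (φW i Q ≤_) (sym eq) (φ0⇒ (ωW i r) (kinds i Q) (m+n≡0⇒n≡0 (φW i r) b')))
    where
    b' = trans (sym (φW-++ i r Q)) b
    eq : ωW i (u ++ ⟨ i , p ⟩ ∷ r) ≡ ωW i r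
    eq = trans (ωW-++ i u _) (trans (cong (λ z → ω z (kind i i ∷ kinds i r)) a) (ω-cl i (kinds i r)))
  ... | inj₂ (r , refl , refl) = inj₂ (_ , mkF r p v refl refl (proj₁ z) b , ++-assoc P r _
        , subst (ωW i P <_) (sym eq) (s≤s (proj₂ z)))
    where
    z = ω0⇒ (ωW i P) (kinds i r) (trans (sym (ωW-++ i P r)) a)
    eq : φW i (r ++ ⟨ i , p ⟩ ∷ v) ≡ suc (φW i r)
    eq = trans (φW-++ i r _) (trans (cong (λ z → φW i r + φ z (kind i i ∷ kinds i v)) (proj₁ z))
        (trans (cong (φW i r +_) (trans (φ-cl i _) (cong suc b))) (+-comm _ 1)))

-- The index-based operators of the statement

uc-op : ∀ i c x xs → kind i (base x) ≡ op → unpairedClose i c (x ∷ xs) ≡ false ∷ unpairedClose i (suc c) xs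
uc-op i c x xs e with isOpen i x | isClose i x
... | true | _ = refl
uc-op i c x xs () | false | true
uc-op i c x xs () | false | false

uc-cl0 : ∀ i x xs → kind i (base x) ≡ cl → unpairedClose i 0 (x ∷ xs) ≡ true ∷ unpairedClose i 0 xs
uc-cl0 i x xs e with isOpen i x | isClose i x
uc-cl0 i x xs () | true | _
... | false | true = refl
uc-cl0 i x xs () | false | false

uc-cl1 : ∀ i c x xs → kind i (base x) ≡ cl → unpairedClose i (suc c) (x ∷ xs) ≡ false ∷ unpairedClose i c xs
uc-cl1 i c x xs e with isOpen i x | isClose i x
uc-cl1 i c x xs () | true | _
... | false | true = refl
uc-cl1 i c x xs () | false | false

uc-ne : ∀ i c x xs → kind i (base x) ≡ ne → unpairedClose i c (x ∷ xs) ≡ false ∷ unpairedClose i c xs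
uc-ne i c x xs e with isOpen i x | isClose i x
uc-ne i c x xs () | true | _
uc-ne i c x xs () | false | true
... | false | false = refl

lastTrue-false : ∀ bs → lastTrue bs ≡ nothing → lastTrue (false ∷ bs) ≡ nothing
lastTrue-false bs e with lastTrue bs
lastTrue-false bs refl | .nothing = refl

lastTrue-just : ∀ b bs {j} → lastTrue bs ≡ just j → lastTrue (b ∷ bs) ≡ just (suc j)
lastTrue-just b bs e with lastTrue bs
lastTrue-just b bs refl | .(just _) = refl

lastTrue-true : ∀ bs → lastTrue bs ≡ nothing → lastTrue (true ∷ bs) ≡ just 0
lastTrue-true bs e with lastTrue bs
lastTrue-true bs refl | .nothing = refl

uc-nothing : ∀ i c w → φ c (kinds i w) ≡ 0 → lastTrue (unpairedClose i c w) ≡ nothing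
uc-nothing i c [] e = refl
uc-nothing i c (x ∷ w) e with kind i (base x) in k
... | op rewrite uc-op i c x w k = lastTrue-false (unpairedClose i (suc c) w) (uc-nothing i (suc c) w e)
... | ne rewrite uc-ne i c x w k = lastTrue-false (unpairedClose i c w) (uc-nothing i c w e)
uc-nothing i zero (x ∷ w) () | cl
uc-nothing i (suc c) (x ∷ w) e | cl rewrite uc-cl1 i c x w k = lastTrue-false (unpairedClose i c w) (uc-nothing i c w e)

-- These are the two conditions stored in `F`: nothing is pending when the displayed `i` is reached,
-- so it is unmatched, and no later closing bracket is unmatched, so it is the last one.
uc-just : ∀ i c u p v → ω c (kinds i u) ≡ 0 → φ 0 (kinds i v) ≡ 0 →
  lastTrue (unpairedClose i c (u ++ ⟨ i , p ⟩ ∷ v)) ≡ just (length u)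
uc-just i .0 [] p v refl b rewrite uc-cl0 i ⟨ i , p ⟩ v (kind-cl i) = lastTrue-true (unpairedClose i 0 v) (uc-nothing i 0 v b)
uc-just i c (x ∷ u) p v a b with kind i (base x) in k
... | op rewrite uc-op i c x (u ++ ⟨ i , p ⟩ ∷ v) k = lastTrue-just false (unpairedClose i (suc c) (u ++ ⟨ i , p ⟩ ∷ v)) (uc-just i (suc c) u p v a b)
... | ne rewrite uc-ne i c x (u ++ ⟨ i , p ⟩ ∷ v) k = lastTrue-just false (unpairedClose i c (u ++ ⟨ i , p ⟩ ∷ v)) (uc-just i c u p v a b)
uc-just i zero (x ∷ u) p v a b | cl rewrite uc-cl0 i x (u ++ ⟨ i , p ⟩ ∷ v) k = lastTrue-just true (unpairedClose i 0 (u ++ ⟨ i , p ⟩ ∷ v)) (uc-just i 0 u p v a b)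
uc-just i (suc c) (x ∷ u) p v a b | cl rewrite uc-cl1 i c x (u ++ ⟨ i , p ⟩ ∷ v) k = lastTrue-just false (unpairedClose i c (u ++ ⟨ i , p ⟩ ∷ v)) (uc-just i c u p v a b)

modAt-++ : ∀ {A : Set} (g : A → A) u x v → modAt (length u) g (u ++ x ∷ v) ≡ u ++ g x ∷ v
modAt-++ g [] x v = refl
modAt-++ g (y ∷ u) x v = cong (y ∷_) (modAt-++ g u x v)

fI-F : ∀ {i w w'} → F i w w' → fI i w ≡ just w'
fI-F {i} (mkF u p v refl refl a b) rewrite uc-just i 0 u p v a b = cong just (modAt-++ incr u _ v)

fI-nothing : ∀ i w → φW i w ≡ 0 → fI i w ≡ nothing
fI-nothing i w e rewrite uc-nothing i 0 w e = refl

F-exists′ : ∀ i c w → 0 < φ c (kinds i w) →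
  ∃ λ u → ∃ λ p → ∃ λ v → w ≡ u ++ ⟨ i , p ⟩ ∷ v × ω c (kinds i u) ≡ 0 × φ 0 (kinds i v) ≡ 0
F-exists′ i c (⟨ y , p ⟩ ∷ w) lt with kind i y in k | kindView i y
... | op | _ with F-exists′ i (suc c) w lt
...   | u , q , v , refl , a , b = ⟨ y , p ⟩ ∷ u , q , v , refl , a' , b
  where a' : ω c (kind i y ∷ kinds i u) ≡ 0
        a' rewrite k = a
F-exists′ i c (⟨ y , p ⟩ ∷ w) lt | ne | _ with F-exists′ i c w lt
...   | u , q , v , refl , a , b = ⟨ y , p ⟩ ∷ u , q , v , refl , a' , b
  where a' : ω c (kind i y ∷ kinds i u) ≡ 0
        a' rewrite k = a
F-exists′ i (suc c) (⟨ y , p ⟩ ∷ w) lt | cl | _ with F-exists′ i c w lt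
...   | u , q , v , refl , a , b = ⟨ y , p ⟩ ∷ u , q , v , refl , a' , b
  where a' : ω (suc c) (kind i y ∷ kinds i u) ≡ 0
        a' rewrite k = a
F-exists′ i zero (⟨ .i , p ⟩ ∷ w) lt | cl | isCl with φW i w in e
... | zero = [] , p , w , refl , refl , e
... | suc _ with F-exists′ i 0 w (subst (0 <_) (sym e) (s≤s z≤n))
...   | u , q , v , refl , a , b = ⟨ i , p ⟩ ∷ u , q , v , refl , trans (ω-cl i _) a , b

F-exists : ∀ i w → 0 < φW i w → ∃ λ w' → F i w w'
F-exists i w lt with F-exists′ i 0 w lt
... | u , p , v , e , a , b = _ , mkF u p v e refl a b

E-exists′ : ∀ i w → 0 < ωW i w →
  ∃ λ u → ∃ λ p → ∃ λ v → w ≡ u ++ ⟨ suc i , p ⟩ ∷ v × ωW i u ≡ 0 × φW i v ≡ 0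
E-exists′ i (⟨ y , p ⟩ ∷ w) lt with kind i y in k | kindView i y
... | cl | _ with E-exists′ i w lt
...   | u , q , v , refl , a , b = ⟨ y , p ⟩ ∷ u , q , v , refl , a' , b
  where a' : ω 0 (kind i y ∷ kinds i u) ≡ 0
        a' rewrite k = a
E-exists′ i (⟨ y , p ⟩ ∷ w) lt | ne | _ with E-exists′ i w lt
...   | u , q , v , refl , a , b = ⟨ y , p ⟩ ∷ u , q , v , refl , a' , b
  where a' : ω 0 (kind i y ∷ kinds i u) ≡ 0
        a' rewrite k = a
E-exists′ i (⟨ .(suc i) , p ⟩ ∷ w) lt | op | isOp with φW i w in e
... | zero = [] , p , w , refl , refl , e
... | suc n with E-exists′ i w (subst (0 <_) e' lt)
  where e' : ω 1 (kinds i w) ≡ ωW i w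
        e' = trans (ω-suc 0 (kinds i w)) (trans (cong (λ z → ωW i w + (1 ∸ z)) e) (trans (cong (ωW i w +_) (0∸n≡0 n)) (+-identityʳ _)))
...   | u , q , v , refl , a , b = ⟨ suc i , p ⟩ ∷ u , q , v , refl , trans (ω-op i 0 _) (⇒ω0 1 (kinds i u) a le) , b
  where
  le : 1 ≤ φW i u
  le = subst (1 ≤_) (trans (sym e) (trans (φW-++ i u _) (trans (cong (λ z → φW i u + φ z (kind i (suc i) ∷ kinds i v)) a)
        (trans (cong (φW i u +_) (trans (φ-op i 0 _) (⇒φ0 1 (kinds i v) (subst (_≤ 1) (sym b) z≤n)))) (+-identityʳ _))))) (s≤s z≤n)

E-exists : ∀ i w → 0 < ωW i w → ∃ λ w' → F i w' w
E-exists i w lt with E-exists′ i w lt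
... | u , p , v , e , a , b = _ , mkF u p v refl e a b

kindOpen : Kind → ℕ → Bool
kindOpen op zero = true
kindOpen _ _ = false

pendStep : Kind → ℕ → ℕ
pendStep cl c = suc c
pendStep op c = pred c
pendStep ne c = c

uor-step : ∀ i c x xs → unpairedOpenRev i c (x ∷ xs) ≡
  kindOpen (kind i (base x)) c ∷ unpairedOpenRev i (pendStep (kind i (base x)) c) xs
uor-step i c ⟨ y , p ⟩ xs with kindView i y
uor-step i c ⟨ y , p ⟩ xs | v with kind i y in k
uor-step i c ⟨ .(suc i) , p ⟩ xs | isOp | op
  rewrite ≢⇒≡ᵇ {suc i} {i} (λ e → <⇒≢ (n<1+n i) (sym e)) | ≡ᵇ-refl i with c
... | zero = refl
... | suc _ = refl
uor-step i c ⟨ .i , p ⟩ xs | isCl | cl rewrite ≡ᵇ-refl i = refl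
uor-step i c ⟨ y , p ⟩ xs | isNe a b | ne rewrite ≢⇒≡ᵇ a | ≢⇒≡ᵇ b = refl

-- Scanning from the right: the unmatched closing brackets of a suffix are
-- pending when the scan reaches its left end.
pend : ℕ → ℕ → Word → ℕ
pend i c [] = c
pend i c (x ∷ xs) = pend i (pendStep (kind i (base x)) c) xs

uor-++ : ∀ i c r s → unpairedOpenRev i c (r ++ s) ≡ unpairedOpenRev i c r ++ unpairedOpenRev i (pend i c r) s
uor-++ i c [] s = refl
uor-++ i c (x ∷ r) s rewrite uor-step i c x (r ++ s) | uor-step i c x r = cong (_ ∷_) (uor-++ i _ r s)

pend-++ : ∀ i c r s → pend i c (r ++ s) ≡ pend i (pend i c r) s
pend-++ i c [] s = refl
pend-++ i c (x ∷ r) s = pend-++ i _ r s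

φ-cons : ∀ k ks → φ 0 (k ∷ ks) ≡ pendStep k (φ 0 ks)
φ-cons op ks = trans (φ-suc 0 ks) (sym (pred[n]≡n∸1 {φ 0 ks}))
  where pred[n]≡n∸1 : ∀ {n} → pred n ≡ n ∸ 1
        pred[n]≡n∸1 {zero} = refl
        pred[n]≡n∸1 {suc n} = refl
φ-cons cl ks = refl
φ-cons ne ks = refl

pend-reverse : ∀ i w → pend i 0 (reverse w) ≡ φW i w
pend-reverse i [] = refl
pend-reverse i (x ∷ w) rewrite unfold-reverse x w | pend-++ i 0 (reverse w) [ x ] | pend-reverse i w = sym (φ-cons (kind i (base x)) (kinds i w))

opens : ℕ → Word → List Bool
opens i w = reverse (unpairedOpenRev i 0 (reverse w))

opens-++ : ∀ i u x v → opens i (u ++ x ∷ v) ≡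
  reverse (unpairedOpenRev i (pendStep (kind i (base x)) (φW i v)) (reverse u)) ++ kindOpen (kind i (base x)) (φW i v) ∷ opens i v
opens-++ i u x v
  rewrite reverse-++ u (x ∷ v) | unfold-reverse x v | ++-assoc (reverse v) [ x ] (reverse u)
        | uor-++ i 0 (reverse v) (x ∷ reverse u) | pend-reverse i v | uor-step i (φW i v) x (reverse u)
        | reverse-++ (unpairedOpenRev i 0 (reverse v)) (kindOpen (kind i (base x)) (φW i v) ∷ unpairedOpenRev i (pendStep (kind i (base x)) (φW i v)) (reverse u))
        | unfold-reverse (kindOpen (kind i (base x)) (φW i v)) (unpairedOpenRev i (pendStep (kind i (base x)) (φW i v)) (reverse u))
  = ++-assoc (reverse (unpairedOpenRev i (pendStep (kind i (base x)) (φW i v)) (reverse u))) _ _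

opens-cons : ∀ i x v → opens i (x ∷ v) ≡ kindOpen (kind i (base x)) (φW i v) ∷ opens i v
opens-cons i x v = opens-++ i [] x v

opens-false : ∀ i w → ωW i w ≡ 0 → ∀ bs → firstIdx id (opens i w ++ bs) ≡ Maybe.map (length w +_) (firstIdx id bs)
opens-false i [] e bs with firstIdx id bs
... | just _ = refl
... | nothing = refl
opens-false i (x ∷ w) e bs rewrite opens-cons i x w = lem (kind i (base x)) refl e
  where
  rec : ωW i w ≡ 0 → Maybe.map suc (firstIdx id (opens i w ++ bs)) ≡ Maybe.map (suc (length w) +_) (firstIdx id bs)
  rec e' rewrite opens-false i w e' bs with firstIdx id bs
  ... | just _ = refl
  ... | nothing = refl
  lem : ∀ k → k ≡ kind i (base x) → ω 0 (k ∷ kinds i w) ≡ 0 →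
    firstIdx id (kindOpen k (φW i w) ∷ opens i w ++ bs) ≡ Maybe.map (suc (length w) +_) (firstIdx id bs)
  lem cl _ e' = rec e'
  lem ne _ e' = rec e'
  lem op _ e' with φW i w | ω0⇒ 1 (kinds i w) e'
  ... | suc _ | e'' , s≤s _ = rec e''

-- The conditions in `F` are self-dual. Before the letter `suc i` every opening bracket is matched,
-- and behind it no closing bracket is left over, so it is the first unmatched opening bracket.
eI-F : ∀ {i w w'} → F i w' w → eI i w ≡ just w'
eI-F {i} (mkF u p v refl refl a b)
  rewrite opens-++ i u ⟨ suc i , p ⟩ v | kind-op i | b | opens-false i u a (true ∷ opens i v) | +-identityʳ (length u)
  = cong just (modAt-++ decr u _ v)

eI-nothing : ∀ i w → ωW i w ≡ 0 → eI i w ≡ nothing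
eI-nothing i w e with firstIdx id (opens i w) in q
... | nothing = refl
... | just j with trans (sym q) (trans (cong (firstIdx id) (sym (++-identityʳ (opens i w)))) (opens-false i w e []))
...   | ()

F-fI : ∀ {i w w'} → fI i w ≡ just w' → F i w w'
F-fI {i} {w} e with φW i w in q
... | zero with trans (sym e) (fI-nothing i w q)
...   | ()
F-fI {i} {w} e | suc n with F-exists i w (subst (0 <_) (sym q) (s≤s z≤n))
...   | a , fa with trans (sym e) (fI-F fa)
...     | refl = fa

F-eI : ∀ {i w w'} → eI i w ≡ just w' → F i w' w
F-eI {i} {w} e with ωW i w in q
... | zero with trans (sym e) (eI-nothing i w q)
...   | ()
F-eI {i} {w} e | suc n with E-exists i w (subst (0 <_) (sym q) (s≤s z≤n))
...   | a , fa with trans (sym e) (eI-F fa)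
...     | refl = fa
-- The odd operators by structural recursion

bit1 : Word → Maybe Bool
bit1 [] = nothing
bit1 (⟨ 1 , p ⟩ ∷ xs) = just p
bit1 (x ∷ xs) = bit1 xs

setb1 : Bool → Word → Word
setb1 q [] = []
setb1 q (⟨ 1 , p ⟩ ∷ xs) = ⟨ 1 , q ⟩ ∷ xs
setb1 q (x ∷ xs) = x ∷ setb1 q xs

first12 : Word → Maybe ℕ
first12 [] = nothing
first12 (⟨ 1 , p ⟩ ∷ xs) = just 1
first12 (⟨ 2 , p ⟩ ∷ xs) = just 2
first12 (x ∷ xs) = first12 xs

-- In the statement two letters trade places with a change of base. Seen position by position, only
-- the base of the first of them changes, to `y`, and the two primes are exchanged.
swapBits : ℕ → Bool → Word → Maybe Bool → Word
swapBits y p xs nothing = ⟨ y , p ⟩ ∷ xs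
swapBits y p xs (just q) = ⟨ y , q ⟩ ∷ setb1 p xs

E1 F1 : Word → Maybe Word
E1 [] = nothing
E1 (⟨ 1 , p ⟩ ∷ xs) = nothing
E1 (⟨ 2 , p ⟩ ∷ xs) = just (swapBits 1 p xs (bit1 xs))
E1 (x ∷ xs) = Maybe.map (x ∷_) (E1 xs)
F1 [] = nothing
F1 (⟨ 1 , p ⟩ ∷ xs) = just (swapBits 2 p xs (bit1 xs))
F1 (⟨ 2 , p ⟩ ∷ xs) = nothing
F1 (x ∷ xs) = Maybe.map (x ∷_) (F1 xs)

is1 is2 : PN → Bool
is1 x = base x ≡ᵇ 1
is2 x = base x ≡ᵇ 2

data IsFirst1 (w : Word) (k : ℕ) : Set where
  isFirst1 : ∀ q → nth k w ≡ just ⟨ 1 , q ⟩ → bit1 w ≡ just q → (∀ p → setAt k ⟨ 1 , p ⟩ w ≡ setb1 p w) → IsFirst1 w k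

firstIdx-1 : ∀ w {k} → firstIdx is1 w ≡ just k → IsFirst1 w k
firstIdx-1 (⟨ 1 , p ⟩ ∷ xs) refl = isFirst1 p refl refl (λ _ → refl)
firstIdx-1 (⟨ 0 , p ⟩ ∷ xs) e with firstIdx is1 xs in q
firstIdx-1 (⟨ 0 , p ⟩ ∷ xs) refl | just k with firstIdx-1 xs q
... | isFirst1 r a b c = isFirst1 r a b (λ z → cong (_ ∷_) (c z))
firstIdx-1 (⟨ suc (suc y) , p ⟩ ∷ xs) e with firstIdx is1 xs in q
firstIdx-1 (⟨ suc (suc y) , p ⟩ ∷ xs) refl | just k with firstIdx-1 xs q
... | isFirst1 r a b c = isFirst1 r a b (λ z → cong (_ ∷_) (c z))

firstIdx-1-none : ∀ w → firstIdx is1 w ≡ nothing → bit1 w ≡ nothing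
firstIdx-1-none [] e = refl
firstIdx-1-none (⟨ 0 , p ⟩ ∷ xs) e with firstIdx is1 xs in q
... | nothing = firstIdx-1-none xs q
firstIdx-1-none (⟨ suc (suc y) , p ⟩ ∷ xs) e with firstIdx is1 xs in q
... | nothing = firstIdx-1-none xs q

e1̄-skip : ∀ x xs → is1 x ≡ false → is2 x ≡ false → e1̄ (x ∷ xs) ≡ Maybe.map (x ∷_) (e1̄ xs)
e1̄-skip x xs a b rewrite a | b with firstIdx is2 xs | firstIdx is1 xs
... | nothing | _ = refl
... | just j | nothing = refl
... | just j | just k with k <ᵇ j | nth j xs | nth k xs
...   | true | _ | _ = refl
...   | false | just _ | just _ = refl
...   | false | nothing | _ = refl
...   | false | just _ | nothing = refl

e1̄≡E1 : ∀ w → e1̄ w ≡ E1 w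
e1̄≡E1 [] = refl
e1̄≡E1 (⟨ 0 , p ⟩ ∷ xs) = trans (e1̄-skip _ xs refl refl) (cong (Maybe.map _) (e1̄≡E1 xs))
e1̄≡E1 (⟨ 1 , p ⟩ ∷ xs) with firstIdx is2 xs
... | nothing = refl
... | just j = refl
e1̄≡E1 (⟨ 2 , p ⟩ ∷ xs) with firstIdx is1 xs in q
... | nothing rewrite firstIdx-1-none xs q = refl
... | just k with firstIdx-1 xs q
...   | isFirst1 r a b c rewrite a | b = cong (λ z → just (_ ∷ z)) (c p)
e1̄≡E1 (⟨ suc (suc (suc y)) , p ⟩ ∷ xs) = trans (e1̄-skip _ xs refl refl) (cong (Maybe.map _) (e1̄≡E1 xs))

f1̄-skip : ∀ x xs → is1 x ≡ false → is2 x ≡ false → f1̄ (x ∷ xs) ≡ Maybe.map (x ∷_) (f1̄ xs)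
f1̄-skip x xs a b rewrite a with firstIdx is1 xs
... | nothing = refl
... | just j rewrite b with any is2 (take j xs)
...   | true = refl
...   | false with firstIdx is1 (drop (suc j) xs)
...     | nothing = refl
...     | just t with nth j xs | nth (suc j + t) xs
...       | just _ | just _ = refl
...       | just _ | nothing = refl
...       | nothing | _ = refl

f1̄-2 : ∀ p xs → f1̄ (⟨ 2 , p ⟩ ∷ xs) ≡ nothing
f1̄-2 p xs with firstIdx is1 xs
... | nothing = refl
... | just j = refl

f1̄≡F1 : ∀ w → f1̄ w ≡ F1 w
f1̄≡F1 [] = refl
f1̄≡F1 (⟨ 0 , p ⟩ ∷ xs) = trans (f1̄-skip _ xs refl refl) (cong (Maybe.map _) (f1̄≡F1 xs))
f1̄≡F1 (⟨ 1 , p ⟩ ∷ xs) with firstIdx is1 xs in q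
... | nothing rewrite firstIdx-1-none xs q = refl
... | just k with firstIdx-1 xs q
...   | isFirst1 r a b c rewrite a | b = cong (λ z → just (_ ∷ z)) (c p)
f1̄≡F1 (⟨ 2 , p ⟩ ∷ xs) = f1̄-2 p xs
f1̄≡F1 (⟨ suc (suc (suc y)) , p ⟩ ∷ xs) = trans (f1̄-skip _ xs refl refl) (cong (Maybe.map _) (f1̄≡F1 xs))

bit1-setb1 : ∀ q w {r} → bit1 w ≡ just r → bit1 (setb1 q w) ≡ just q
bit1-setb1 q (⟨ 0 , p ⟩ ∷ w) e = bit1-setb1 q w e
bit1-setb1 q (⟨ 1 , p ⟩ ∷ w) e = refl
bit1-setb1 q (⟨ suc (suc _) , p ⟩ ∷ w) e = bit1-setb1 q w e

setb1-setb1 : ∀ q r w → setb1 q (setb1 r w) ≡ setb1 q w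
setb1-setb1 q r [] = refl
setb1-setb1 q r (⟨ 0 , p ⟩ ∷ w) = cong (_ ∷_) (setb1-setb1 q r w)
setb1-setb1 q r (⟨ 1 , p ⟩ ∷ w) = refl
setb1-setb1 q r (⟨ suc (suc _) , p ⟩ ∷ w) = cong (_ ∷_) (setb1-setb1 q r w)

setb1-bit1 : ∀ w {q} → bit1 w ≡ just q → setb1 q w ≡ w
setb1-bit1 (⟨ 0 , p ⟩ ∷ w) e = cong (_ ∷_) (setb1-bit1 w e)
setb1-bit1 (⟨ 1 , p ⟩ ∷ w) refl = refl
setb1-bit1 (⟨ suc (suc _) , p ⟩ ∷ w) e = cong (_ ∷_) (setb1-bit1 w e)

setb1-none : ∀ q w → bit1 w ≡ nothing → setb1 q w ≡ w
setb1-none q [] e = refl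
setb1-none q (⟨ 0 , p ⟩ ∷ w) e = cong (_ ∷_) (setb1-none q w e)
setb1-none q (⟨ suc (suc _) , p ⟩ ∷ w) e = cong (_ ∷_) (setb1-none q w e)

base-setb1 : ∀ q w → map base (setb1 q w) ≡ map base w
base-setb1 q [] = refl
base-setb1 q (⟨ 0 , p ⟩ ∷ w) = cong (_ ∷_) (base-setb1 q w)
base-setb1 q (⟨ 1 , p ⟩ ∷ w) = refl
base-setb1 q (⟨ suc (suc _) , p ⟩ ∷ w) = cong (_ ∷_) (base-setb1 q w)

E1-F1 : ∀ w {v} → E1 w ≡ just v → F1 v ≡ just w
E1-F1 (⟨ 0 , p ⟩ ∷ w) e with E1 w in q
E1-F1 (⟨ 0 , p ⟩ ∷ w) refl | just v = cong (Maybe.map _) (E1-F1 w q)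
E1-F1 (⟨ 2 , p ⟩ ∷ w) e with bit1 w in q
E1-F1 (⟨ 2 , p ⟩ ∷ w) refl | nothing rewrite q = refl
E1-F1 (⟨ 2 , p ⟩ ∷ w) refl | just r rewrite bit1-setb1 p w q | setb1-setb1 r p w | setb1-bit1 w q = refl
E1-F1 (⟨ suc (suc (suc _)) , p ⟩ ∷ w) e with E1 w in q
E1-F1 (⟨ suc (suc (suc _)) , p ⟩ ∷ w) refl | just v = cong (Maybe.map _) (E1-F1 w q)

F1-E1 : ∀ w {v} → F1 w ≡ just v → E1 v ≡ just w
F1-E1 (⟨ 0 , p ⟩ ∷ w) e with F1 w in q
F1-E1 (⟨ 0 , p ⟩ ∷ w) refl | just v = cong (Maybe.map _) (F1-E1 w q)
F1-E1 (⟨ 1 , p ⟩ ∷ w) e with bit1 w in q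
F1-E1 (⟨ 1 , p ⟩ ∷ w) refl | nothing rewrite q = refl
F1-E1 (⟨ 1 , p ⟩ ∷ w) refl | just r rewrite bit1-setb1 p w q | setb1-setb1 r p w | setb1-bit1 w q = refl
F1-E1 (⟨ suc (suc (suc _)) , p ⟩ ∷ w) e with F1 w in q
F1-E1 (⟨ suc (suc (suc _)) , p ⟩ ∷ w) refl | just v = cong (Maybe.map _) (F1-E1 w q)

E1-none : ∀ w → E1 w ≡ nothing → first12 w ≢ just 2
E1-none (⟨ 0 , p ⟩ ∷ w) e with E1 w in q
... | nothing = E1-none w q
E1-none (⟨ 1 , p ⟩ ∷ w) e ()
E1-none (⟨ suc (suc (suc _)) , p ⟩ ∷ w) e with E1 w in q
... | nothing = E1-none w q

E1-some : ∀ w {v} → E1 w ≡ just v → first12 w ≡ just 2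
E1-some (⟨ 0 , p ⟩ ∷ w) e with E1 w in q
... | just _ = E1-some w q
E1-some (⟨ 2 , p ⟩ ∷ w) e = refl
E1-some (⟨ suc (suc (suc _)) , p ⟩ ∷ w) e with E1 w in q
... | just _ = E1-some w q

F1-none : ∀ w → F1 w ≡ nothing → first12 w ≢ just 1
F1-none (⟨ 0 , p ⟩ ∷ w) e with F1 w in q
... | nothing = F1-none w q
F1-none (⟨ 2 , p ⟩ ∷ w) e ()
F1-none (⟨ suc (suc (suc _)) , p ⟩ ∷ w) e with F1 w in q
... | nothing = F1-none w q

F1-some : ∀ w {v} → F1 w ≡ just v → first12 w ≡ just 1
F1-some (⟨ 0 , p ⟩ ∷ w) e with F1 w in q
... | just _ = F1-some w q
F1-some (⟨ 1 , p ⟩ ∷ w) e = refl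
F1-some (⟨ suc (suc (suc _)) , p ⟩ ∷ w) e with F1 w in q
... | just _ = F1-some w q

e0-case f0-case : Maybe Bool → Word → Maybe Word
e0-case (just true) w = just (setb1 false w)
e0-case (just false) w = nothing
e0-case nothing w = nothing
f0-case (just true) w = nothing
f0-case (just false) w = just (setb1 true w)
f0-case nothing w = nothing

e0-set : ∀ w → e0 w ≡ e0-case (bit1 w) w
e0-set w with firstIdx is1 w in q
... | nothing rewrite firstIdx-1-none w q = refl
... | just k with firstIdx-1 w q
...   | isFirst1 true a b c rewrite a | b = cong just (c false)
...   | isFirst1 false a b c rewrite a | b = refl

f0-set : ∀ w → f0 w ≡ f0-case (bit1 w) w
f0-set w with firstIdx is1 w in q
... | nothing rewrite firstIdx-1-none w q = refl
... | just k with firstIdx-1 w q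
...   | isFirst1 false a b c rewrite a | b = cong just (c true)
...   | isFirst1 true a b c rewrite a | b = refl

-- Tensor rules

bit1-++ : ∀ u v {q} → bit1 u ≡ just q → bit1 (u ++ v) ≡ just q
bit1-++ (⟨ 0 , p ⟩ ∷ u) v e = bit1-++ u v e
bit1-++ (⟨ 1 , p ⟩ ∷ u) v e = e
bit1-++ (⟨ suc (suc _) , p ⟩ ∷ u) v e = bit1-++ u v e

bit1-++-none : ∀ u v → bit1 u ≡ nothing → bit1 (u ++ v) ≡ bit1 v
bit1-++-none [] v e = refl
bit1-++-none (⟨ 0 , p ⟩ ∷ u) v e = bit1-++-none u v e
bit1-++-none (⟨ suc (suc _) , p ⟩ ∷ u) v e = bit1-++-none u v e

setb1-++ : ∀ r u v {q} → bit1 u ≡ just q → setb1 r (u ++ v) ≡ setb1 r u ++ v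
setb1-++ r (⟨ 0 , p ⟩ ∷ u) v e = cong (_ ∷_) (setb1-++ r u v e)
setb1-++ r (⟨ 1 , p ⟩ ∷ u) v e = refl
setb1-++ r (⟨ suc (suc _) , p ⟩ ∷ u) v e = cong (_ ∷_) (setb1-++ r u v e)

setb1-++-none : ∀ r u v → bit1 u ≡ nothing → setb1 r (u ++ v) ≡ u ++ setb1 r v
setb1-++-none r [] v e = refl
setb1-++-none r (⟨ 0 , p ⟩ ∷ u) v e = cong (_ ∷_) (setb1-++-none r u v e)
setb1-++-none r (⟨ suc (suc _) , p ⟩ ∷ u) v e = cong (_ ∷_) (setb1-++-none r u v e)

first12-++ : ∀ u v {q} → first12 u ≡ just q → first12 (u ++ v) ≡ just q
first12-++ (⟨ 0 , p ⟩ ∷ u) v e = first12-++ u v e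
first12-++ (⟨ 1 , p ⟩ ∷ u) v e = e
first12-++ (⟨ 2 , p ⟩ ∷ u) v e = e
first12-++ (⟨ suc (suc (suc _)) , p ⟩ ∷ u) v e = first12-++ u v e

first12-++-none : ∀ u v → first12 u ≡ nothing → first12 (u ++ v) ≡ first12 v
first12-++-none [] v e = refl
first12-++-none (⟨ 0 , p ⟩ ∷ u) v e = first12-++-none u v e
first12-++-none (⟨ suc (suc (suc _)) , p ⟩ ∷ u) v e = first12-++-none u v e

E1-++-none : ∀ u v → first12 u ≡ nothing → E1 (u ++ v) ≡ Maybe.map (u ++_) (E1 v)
E1-++-none [] v e with E1 v
... | just _ = refl
... | nothing = refl
E1-++-none (⟨ 0 , p ⟩ ∷ u) v e rewrite E1-++-none u v e with E1 v
... | just _ = refl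
... | nothing = refl
E1-++-none (⟨ suc (suc (suc _)) , p ⟩ ∷ u) v e rewrite E1-++-none u v e with E1 v
... | just _ = refl
... | nothing = refl

-- What the tensor factor u ++ v becomes when the distinguished 2 lies in u and u turns into u'
glue : Maybe Bool → Maybe Bool → Word → Word → Word
glue (just _) _ u' v = u' ++ v
glue nothing nothing u' v = u' ++ v
glue nothing (just q) u' v = setb1 q u' ++ setb1 (Maybe.fromMaybe false (bit1 u')) v

-- The prime is exchanged with that of the first 1 of the product. If `u` has a 1 this happens
-- inside `u`; if not, the lowered letter is the only 1 of `u'` and trades primes with the first 1
-- of `v`. This is the origin of `glue`.
E1-++-some : ∀ u v {u'} → E1 u ≡ just u' → E1 (u ++ v) ≡ just (glue (bit1 u) (bit1 v) u' v)
E1-++-some (⟨ 0 , p ⟩ ∷ u) v e with E1 u in q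
E1-++-some (⟨ 0 , p ⟩ ∷ u) v refl | just u' rewrite E1-++-some u v q with bit1 u | bit1 v
... | just _ | _ = refl
... | nothing | nothing = refl
... | nothing | just _ = refl
E1-++-some (⟨ suc (suc (suc _)) , p ⟩ ∷ u) v e with E1 u in q
E1-++-some (⟨ suc (suc (suc _)) , p ⟩ ∷ u) v refl | just u' rewrite E1-++-some u v q with bit1 u | bit1 v
... | just _ | _ = refl
... | nothing | nothing = refl
... | nothing | just _ = refl
E1-++-some (⟨ 2 , p ⟩ ∷ u) v e with bit1 u in q
E1-++-some (⟨ 2 , p ⟩ ∷ u) v refl | just r rewrite bit1-++ u v q | setb1-++ p u v q = refl
E1-++-some (⟨ 2 , p ⟩ ∷ u) v refl | nothing rewrite bit1-++-none u v q with bit1 v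
... | nothing = refl
... | just r rewrite setb1-++-none p u v q = refl

-- Natural relations between words: invariants agree and operators on the
-- left-hand word are matched on the right-hand one.

Rel : Set₁
Rel = Word → Word → Set

record NatF (R : Rel) : Set where
  field
    φ≡ : ∀ {i a b} → R a b → φW i a ≡ φW i b
    ω≡ : ∀ {i a b} → R a b → ωW i a ≡ ωW i b
    simF : ∀ {i a a' b} → R a a' → F i a b → ∃ λ b' → F i a' b' × R b b'

-- `set-R` ranges over both primes: it yields the operators of index 0, and `glue` asks for it in
-- each factor of a product. The behaviour of `F1` follows from that of its inverse `E1`.
record NatE (R : Rel) : Set where
  field
    first≡ : ∀ {a b} → R a b → first12 a ≡ first12 b
    bit≡ : ∀ {a b} → R a b → bit1 a ≡ bit1 b
    set-R : ∀ {a b} q → R a b → R (setb1 q a) (setb1 q b)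
    simE : ∀ {a a' b} → R a a' → E1 a ≡ just b → ∃ λ b' → E1 a' ≡ just b' × R b b'

data _⊗_ (R S : Rel) : Rel where
  tens : ∀ {a a' b b'} → R a a' → S b b' → (R ⊗ S) (a ++ b) (a' ++ b')

data _⨾_ (R S : Rel) : Rel where
  comp : ∀ {a b c} → R a b → S b c → (R ⨾ S) a c

NatF-≡ : NatF _≡_
NatF-≡ = record { φ≡ = λ { refl → refl } ; ω≡ = λ { refl → refl } ; simF = λ { refl f → _ , f , refl } }

NatE-≡ : NatE _≡_
NatE-≡ = record { first≡ = λ { refl → refl } ; bit≡ = λ { refl → refl } ; set-R = λ { q refl → refl } ; simE = λ { refl f → _ , f , refl } }

module _ {R S : Rel} where

  NatF-⨾ : NatF R → NatF S → NatF (R ⨾ S)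
  NatF-⨾ r s = record
    { φ≡ = λ { (comp x y) → trans (R.φ≡ x) (S.φ≡ y) }
    ; ω≡ = λ { (comp x y) → trans (R.ω≡ x) (S.ω≡ y) }
    ; simF = λ { (comp x y) f → let (_ , g , x') = R.simF x f ; (_ , h , y') = S.simF y g in _ , h , comp x' y' } }
    where
    module R = NatF r
    module S = NatF s

  NatE-⨾ : NatE R → NatE S → NatE (R ⨾ S)
  NatE-⨾ r s = record
    { first≡ = λ { (comp x y) → trans (R.first≡ x) (S.first≡ y) }
    ; bit≡ = λ { (comp x y) → trans (R.bit≡ x) (S.bit≡ y) }
    ; set-R = λ { q (comp x y) → comp (R.set-R q x) (S.set-R q y) }
    ; simE = λ { (comp x y) f → let (_ , g , x') = R.simE x f ; (_ , h , y') = S.simE y g in _ , h , comp x' y' } }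
    where
    module R = NatE r
    module S = NatE s

  NatF-⊗ : NatF R → NatF S → NatF (R ⊗ S)
  NatF-⊗ r s = record { φ≡ = φe ; ω≡ = ωe ; simF = sim }
    where
    module R = NatF r
    module S = NatF s
    φe : ∀ {i a b} → (R ⊗ S) a b → φW i a ≡ φW i b
    φe {i} (tens {a} {a'} {b} {b'} x y) = begin
      φW i (a ++ b) ≡⟨ φW-++ i a b ⟩
      φW i a + φ (ωW i a) (kinds i b) ≡⟨ cong (φW i a +_) (φ-∸ (ωW i a) (kinds i b)) ⟩
      φW i a + (φW i b ∸ ωW i a) ≡⟨ cong₂ _+_ (R.φ≡ x) (cong₂ _∸_ (S.φ≡ y) (R.ω≡ x)) ⟩
      φW i a' + (φW i b' ∸ ωW i a') ≡⟨ cong (φW i a' +_) (φ-∸ (ωW i a') (kinds i b')) ⟨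
      φW i a' + φ (ωW i a') (kinds i b') ≡⟨ φW-++ i a' b' ⟨
      φW i (a' ++ b') ∎
      where open ≡-Reasoning
    ωe : ∀ {i a b} → (R ⊗ S) a b → ωW i a ≡ ωW i b
    ωe {i} (tens {a} {a'} {b} {b'} x y) = begin
      ωW i (a ++ b) ≡⟨ ωW-++ i a b ⟩
      ω (ωW i a) (kinds i b) ≡⟨ ω-+ (ωW i a) (kinds i b) ⟩
      ωW i b + (ωW i a ∸ φW i b) ≡⟨ cong₂ _+_ (S.ω≡ y) (cong₂ _∸_ (R.ω≡ x) (S.φ≡ y)) ⟩
      ωW i b' + (ωW i a' ∸ φW i b') ≡⟨ ω-+ (ωW i a') (kinds i b') ⟨
      ω (ωW i a') (kinds i b') ≡⟨ ωW-++ i a' b' ⟨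
      ωW i (a' ++ b') ∎
      where open ≡-Reasoning
    sim : ∀ {i a a' b} → (R ⊗ S) a a' → F i a b → ∃ λ b' → F i a' b' × (R ⊗ S) b b'
    sim (tens {a} {a'} {b} {b'} x y) f with F-split a b f
    ... | inj₁ (_ , g , refl , le) with R.simF x g
    ...   | _ , h , x' = _ , F-joinˡ b' h (subst₂ _≤_ (S.φ≡ y) (R.ω≡ x) le) , tens x' y
    sim (tens {a} {a'} {b} {b'} x y) f | inj₂ (_ , g , refl , lt) with S.simF y g
    ...   | _ , h , y' = _ , F-joinʳ a' h (subst₂ _<_ (R.ω≡ x) (S.φ≡ y) lt) , tens x y'

  NatE-⊗ : NatE R → NatE S → NatE (R ⊗ S)
  NatE-⊗ r s = record { first≡ = fe ; bit≡ = be ; set-R = se ; simE = sim }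
    where
    module R = NatE r
    module S = NatE s
    fe : ∀ {a b} → (R ⊗ S) a b → first12 a ≡ first12 b
    fe (tens {a} {a'} {b} {b'} x y) with first12 a in q
    ... | just _ = trans (first12-++ a b q) (sym (first12-++ a' b' (trans (sym (R.first≡ x)) q)))
    ... | nothing = trans (first12-++-none a b q) (trans (S.first≡ y) (sym (first12-++-none a' b' (trans (sym (R.first≡ x)) q))))
    be : ∀ {a b} → (R ⊗ S) a b → bit1 a ≡ bit1 b
    be (tens {a} {a'} {b} {b'} x y) with bit1 a in q
    ... | just _ = trans (bit1-++ a b q) (sym (bit1-++ a' b' (trans (sym (R.bit≡ x)) q)))
    ... | nothing = trans (bit1-++-none a b q) (trans (S.bit≡ y) (sym (bit1-++-none a' b' (trans (sym (R.bit≡ x)) q))))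
    se : ∀ {a b} q → (R ⊗ S) a b → (R ⊗ S) (setb1 q a) (setb1 q b)
    se p (tens {a} {a'} {b} {b'} x y) with bit1 a in q
    ... | just _ rewrite setb1-++ p a b q | setb1-++ p a' b' (trans (sym (R.bit≡ x)) q) = tens (R.set-R p x) y
    ... | nothing rewrite setb1-++-none p a b q | setb1-++-none p a' b' (trans (sym (R.bit≡ x)) q) = tens x (S.set-R p y)
    gl : ∀ {a a' b b'} m n → R a a' → S b b' → (R ⊗ S) (glue m n a b) (glue m n a' b')
    gl (just _) _ x y = tens x y
    gl nothing nothing x y = tens x y
    gl {a' = a'} nothing (just p) x y rewrite R.bit≡ x = tens (R.set-R p x) (S.set-R (Maybe.fromMaybe false (bit1 a')) y)
    sim : ∀ {a a' b} → (R ⊗ S) a a' → E1 a ≡ just b → ∃ λ b' → E1 a' ≡ just b' × (R ⊗ S) b b'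
    sim (tens {a} {a'} {b} {b'} x y) e with E1 a in q
    ... | just c with R.simE x q
    ...   | c' , q' , x' rewrite E1-++-some a b q with e
    ...     | refl = _ , E1-++-some a' b' q' , subst₂ (λ m n → (R ⊗ S) _ (glue m n c' b')) (R.bit≡ x) (S.bit≡ y) (gl (bit1 a) (bit1 b) x' y)
    sim (tens {a} {a'} {b} {b'} x y) e | nothing with first12 a in p
    ... | nothing rewrite E1-++-none a b p with E1 b in q'
    ...   | just c with S.simE y q' | e
    ...     | c' , e' , y' | refl = _ , trans (E1-++-none a' b' (trans (sym (R.first≡ x)) p)) (cong (Maybe.map _) e') , tens x y'
    sim (tens {a} {a'} {b} {b'} x y) e | nothing | just z with trans (sym (E1-some (a ++ b) e)) (first12-++ a b p)
    ... | refl = ⊥-elim (E1-none a q p)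
-- Unprimed words

up : List ℕ → Word
up = map (λ k → ⟨ k , false ⟩)

up-++ : ∀ u v → up (u ++ v) ≡ up u ++ up v
up-++ = map-++ _

base-up : ∀ w → map base (up w) ≡ w
base-up [] = refl
base-up (x ∷ w) = cong (x ∷_) (base-up w)

φu ωu : ℕ → List ℕ → ℕ
φu i w = φW i (up w)
ωu i w = ωW i (up w)

kinds-base : ∀ i w → kinds i (up (map base w)) ≡ kinds i w
kinds-base i [] = refl
kinds-base i (x ∷ w) = cong (_ ∷_) (kinds-base i w)

record Position (i : ℕ) (w : List ℕ) (W : Word) : Set where
  constructor position
  field
    pre post : List ℕ
    src : w ≡ pre ++ i ∷ post
    tgt : W ≡ up (pre ++ suc i ∷ post)
    pre-ω : ωu i pre ≡ 0
    post-φ : φu i post ≡ 0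

up-split : ∀ w u x v → up w ≡ u ++ x ∷ v → u ≡ up (map base u) × x ≡ ⟨ base x , false ⟩ × v ≡ up (map base v) × w ≡ map base u ++ base x ∷ map base v
up-split (y ∷ w) [] x v refl = refl , refl , cong up (sym (base-up w)) , cong (y ∷_) (sym (base-up w))
up-split (y ∷ w) (z ∷ u) x v e with ∷-injective e
... | refl , e' with up-split w u x v e'
...   | a , b , c , d = cong (_ ∷_) a , b , c , cong (_ ∷_) d

F-position : ∀ {i w W} → F i (up w) W → Position i w W
F-position {i} {w} (mkF u p v s refl a b) with up-split w u _ v s
... | eu , refl , ev , ew = position (map base u) (map base v) ew
  (trans (cong₂ (λ y z → y ++ ⟨ suc i , false ⟩ ∷ z) eu ev) (sym (up-++ (map base u) _)))
  (trans (cong (ω 0) (kinds-base i u)) a) (trans (cong (φ 0) (kinds-base i v)) b)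

F-at : ∀ i u v → ωu i u ≡ 0 → φu i v ≡ 0 → F i (up (u ++ i ∷ v)) (up (u ++ suc i ∷ v))
F-at i u v a b = mkF (up u) false (up v) (up-++ u _) (up-++ u _) a b

φu-++ : ∀ i u v → φu i (u ++ v) ≡ φu i u + φ (ωu i u) (kinds i (up v))
φu-++ i u v = trans (cong (φW i) (up-++ u v)) (φW-++ i (up u) (up v))

ωu-++ : ∀ i u v → ωu i (u ++ v) ≡ ω (ωu i u) (kinds i (up v))
ωu-++ i u v = trans (cong (ωW i) (up-++ u v)) (ωW-++ i (up u) (up v))

ωu-++0 : ∀ i u v → ωu i u ≡ 0 → ωu i v ≡ 0 → ωu i (u ++ v) ≡ 0
ωu-++0 i u v a b = trans (ωu-++ i u v) (trans (cong (λ z → ω z (kinds i (up v))) a) b)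

φu-++0⁻ : ∀ i u v → φu i (u ++ v) ≡ 0 → φu i u ≡ 0
φu-++0⁻ i u v e = m+n≡0⇒m≡0 _ (trans (sym (φu-++ i u v)) e)

-- Strictly decreasing (`SD`) and weakly increasing (`WI`) lists

SD WI : List ℕ → Set
SD [] = ⊤
SD (x ∷ xs) = All (_< x) xs × SD xs
WI [] = ⊤
WI (x ∷ xs) = All (x ≤_) xs × WI xs

SD-++⁻ : ∀ u v → SD (u ++ v) → SD u × SD v × All (λ a → All (_< a) v) u
SD-++⁻ [] v s = tt , s , []
SD-++⁻ (x ∷ u) v (a , s) with SD-++⁻ u v s
... | p , q , r = (All.++⁻ˡ u a , p) , q , All.++⁻ʳ u a ∷ r

SD-++⁺ : ∀ u v → SD u → SD v → All (λ a → All (_< a) v) u → SD (u ++ v)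
SD-++⁺ [] v p q r = q
SD-++⁺ (x ∷ u) v (a , p) q (b ∷ r) = All.++⁺ a b , SD-++⁺ u v p q r

WI-++⁻ : ∀ u v → WI (u ++ v) → WI u × WI v × All (λ a → All (a ≤_) v) u
WI-++⁻ [] v s = tt , s , []
WI-++⁻ (x ∷ u) v (a , s) with WI-++⁻ u v s
... | p , q , r = (All.++⁻ˡ u a , p) , q , All.++⁻ʳ u a ∷ r

WI-++⁺ : ∀ u v → WI u → WI v → All (λ a → All (a ≤_) v) u → WI (u ++ v)
WI-++⁺ [] v p q r = q
WI-++⁺ (x ∷ u) v (a , p) q (b ∷ r) = All.++⁺ a b , WI-++⁺ u v p q r

All-heads : ∀ {A : Set} {R : A → A → Set} {u x v} → All (λ a → All (R a) (x ∷ v)) u → All (λ a → R a x) u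
All-heads = All.map All.head

-- Signatures of inert and of sorted lists

Inert : ℕ → List ℕ → Set
Inert i = All (λ y → kind i y ≡ ne)

lt-ne : ∀ {i y} → y < i → kind i y ≡ ne
lt-ne p = kind-ne (<⇒≢ p) (<⇒≢ (m<n⇒m<1+n p))

gt-ne : ∀ {i y} → suc i < y → kind i y ≡ ne
gt-ne p = kind-ne (λ e → <⇒≢ (<-trans (n<1+n _) p) (sym e)) (λ e → <⇒≢ p (sym e))

φ-inert : ∀ {i} c {w} → Inert i w → ∀ ks → φ c (kinds i (up w) ++ ks) ≡ φ c ks
φ-inert c [] ks = refl
φ-inert c (p ∷ ps) ks rewrite p = φ-inert c ps ks

φu-inert : ∀ {i w} → Inert i w → φu i w ≡ 0
φu-inert [] = refl
φu-inert (p ∷ ps) rewrite p = φu-inert ps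

ωu-inert : ∀ {i w} → Inert i w → ωu i w ≡ 0
ωu-inert [] = refl
ωu-inert (p ∷ ps) rewrite p = ωu-inert ps

kinds-up-++ : ∀ i u v → kinds i (up (u ++ v)) ≡ kinds i (up u) ++ kinds i (up v)
kinds-up-++ i u v = trans (cong (kinds i) (up-++ u v)) (kinds-++ i (up u) (up v))

no-op : ∀ {i w} → All (_≤ i) w → ∀ c → ω c (kinds i (up w)) ≤ c
no-op [] c = ≤-refl
no-op {i} {y ∷ w} (p ∷ ps) c with kind i y | kindView i y
no-op {i} (p ∷ ps) c | .op | isOp = ⊥-elim (<-irrefl refl p)
no-op (p ∷ ps) zero | .cl | isCl = no-op ps zero
no-op (p ∷ ps) (suc c) | .cl | isCl = m≤n⇒m≤1+n (no-op ps c)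
no-op (p ∷ ps) c | .ne | isNe _ _ = no-op ps c

ωu-le : ∀ {i w} → All (_≤ i) w → ωu i w ≡ 0
ωu-le p = n≤0⇒n≡0 (no-op p 0)

no-cl : ∀ {i w} → All (i <_) w → ∀ c → φ c (kinds i (up w)) ≡ 0
no-cl [] c = refl
no-cl {i} {y ∷ w} (p ∷ ps) c with kind i y | kindView i y
no-cl (p ∷ ps) c | .op | isOp = no-cl ps (suc c)
no-cl {i} (p ∷ ps) c | .cl | isCl = ⊥-elim (<-irrefl refl p)
no-cl (p ∷ ps) c | .ne | isNe _ _ = no-cl ps c

ω-gt : ∀ {i w} → All (i <_) w → ∀ c → c ≤ ω c (kinds i (up w))
ω-gt [] c = ≤-refl
ω-gt {i} {y ∷ w} (p ∷ ps) c with kind i y | kindView i y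
ω-gt (p ∷ ps) c | .op | isOp = ≤-trans (n≤1+n c) (ω-gt ps (suc c))
ω-gt {i} (p ∷ ps) c | .cl | isCl = ⊥-elim (<-irrefl refl p)
ω-gt (p ∷ ps) c | .ne | isNe _ _ = ω-gt ps c

ω0-gt : ∀ {i w} → All (i <_) w → ωu i w ≡ 0 → All (suc i <_) w
ω0-gt [] e = []
ω0-gt {i} {y ∷ w} (p ∷ ps) e with kind i y | kindView i y
ω0-gt {i} {_ ∷ w} (p ∷ ps) e | .op | isOp = ⊥-elim (<-irrefl refl (subst (1 ≤_) e (ω-gt ps 1)))
ω0-gt {i} (p ∷ ps) e | .cl | isCl = ⊥-elim (<-irrefl refl p)
ω0-gt (p ∷ ps) e | .ne | isNe _ q = ≤∧≢⇒< p (λ r → q (sym r)) ∷ ω0-gt ps e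

φ0-WI : ∀ {i w} → All (i ≤_) w → WI w → φu i w ≡ 0 → All (i <_) w
φ0-WI [] s e = []
φ0-WI {i} {y ∷ w} (p ∷ ps) s e with i ≟ y
... | yes refl with trans (sym (φ-cl i (kinds i (up w)))) e
...   | ()
φ0-WI {i} {y ∷ w} (p ∷ ps) (a , s) e | no q = lt ∷ All.map (<-≤-trans lt) a
  where lt = ≤∧≢⇒< p q

-- Behaviour of F on sorted lists

F-All : ∀ {i w w'} {P : ℕ → Set} → F i (up w) (up w') → (P i → P (suc i)) → All P w → All P w'
F-All {w = w} {w'} f g ps with F-position {w = w} f
... | position u v refl t _ _ = subst (All _) (sym (up-inj w' _ t)) (All.++⁺ (All.++⁻ˡ u ps) (g (All.head q) ∷ All.tail q))
  where
  q = All.++⁻ʳ u ps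
  up-inj : ∀ a b → up a ≡ up b → a ≡ b
  up-inj a b e = trans (sym (base-up a)) (trans (cong (map base) e) (base-up b))

up-injective : ∀ a b → up a ≡ up b → a ≡ b
up-injective a b e = trans (sym (base-up a)) (trans (cong (map base) e) (base-up b))

F-up : ∀ {i w W} → F i (up w) W → ∃ λ w' → W ≡ up w'
F-up {w = w} f = _ , Position.tgt (F-position {w = w} f)

-- Only a letter `suc i` before the raised `i` could spoil strictness. All letters there exceed `i`,
-- so none closes a bracket and such a `suc i` would be pending, against the first condition of `F`.
SD-F : ∀ {i w w'} → SD w → F i (up w) (up w') → SD w'
SD-F {i} {w} {w'} s f with F-position {w = w} f
... | position u v refl t a b with SD-++⁻ u (i ∷ v) s
...   | su , (vi , sv) , uv = subst SD (sym (up-injective w' _ t))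
        (SD-++⁺ u _ su (All.map (λ p → m<n⇒m<1+n p) vi , sv) (All.zipWith (λ (p , q) → p ∷ All.tail q) (ω0-gt (All-heads uv) a , uv)))

-- Only a second `i` behind the raised one could spoil the order. It would come next and be a
-- closing bracket with nothing pending, against the second condition of `F`.
WI-F : ∀ {i w w'} → WI w → F i (up w) (up w') → WI w'
WI-F {i} {w} {w'} s f with F-position {w = w} f
... | position u v refl t a b with WI-++⁻ u (i ∷ v) s
...   | su , (vi , sv) , uv = subst WI (sym (up-injective w' _ t))
        (WI-++⁺ u _ su (φ0-WI vi sv b , sv) (All.map (λ { (p ∷ q) → m≤n⇒m≤1+n p ∷ q }) uv))

Fu-split : ∀ {i} P Q {W} → F i (up (P ++ Q)) W →
    (∃ λ P' → F i (up P) (up P') × W ≡ up (P' ++ Q) × φu i Q ≤ ωu i P) ⊎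
    (∃ λ Q' → F i (up Q) (up Q') × W ≡ up (P ++ Q') × ωu i P < φu i Q)
Fu-split {i} P Q {W} f with F-split (up P) (up Q) (subst (λ z → F i z W) (up-++ P Q) f)
... | inj₁ (_ , g , e , le) with F-up {w = P} g
...   | P' , refl = inj₁ (P' , g , trans e (sym (up-++ P' Q)) , le)
Fu-split {i} P Q {W} f | inj₂ (_ , g , e , lt) with F-up {w = Q} g
...   | Q' , refl = inj₂ (Q' , g , trans e (sym (up-++ P Q')) , lt)

Fu-joinˡ : ∀ {i} {P P'} Q → F i (up P) (up P') → φu i Q ≤ ωu i P → F i (up (P ++ Q)) (up (P' ++ Q))
Fu-joinˡ {i} {P} {P'} Q f le = subst₂ (F i) (sym (up-++ P Q)) (sym (up-++ P' Q)) (F-joinˡ (up Q) f le)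

Fu-joinʳ : ∀ {i} P {Q Q'} → F i (up Q) (up Q') → ωu i P < φu i Q → F i (up (P ++ Q)) (up (P ++ Q'))
Fu-joinʳ {i} P {Q} {Q'} f lt = subst₂ (F i) (sym (up-++ P Q)) (sym (up-++ P Q')) (F-joinʳ (up P) f lt)

F-pos : ∀ {i w w'} → F i w w' → 0 < φW i w
F-pos f with F-φ f
... | n , e , _ = subst (0 <_) (sym e) (s≤s z≤n)

F-absurd : ∀ {i w w'} {A : Set} → φW i w ≡ 0 → F i w w' → A
F-absurd e f = ⊥-elim (<-irrefl (sym e) (F-pos f))

Fu-inertˡ : ∀ {i} P Q {W} → Inert i P → F i (up (P ++ Q)) W → ∃ λ Q' → F i (up Q) (up Q') × W ≡ up (P ++ Q')
Fu-inertˡ P Q ip f with Fu-split P Q f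
... | inj₁ (_ , g , _) = F-absurd (φu-inert ip) g
... | inj₂ (Q' , g , e , _) = Q' , g , e

Fu-φ0ʳ : ∀ {i} P Q {W} → φu i Q ≡ 0 → F i (up (P ++ Q)) W → ∃ λ P' → F i (up P) (up P') × W ≡ up (P' ++ Q)
Fu-φ0ʳ P Q iq f with Fu-split P Q f
... | inj₁ (P' , g , e , _) = P' , g , e
... | inj₂ (_ , g , _) = F-absurd iq g

Fu-right : ∀ {i} P {Q Q'} → ωu i P ≡ 0 → F i (up Q) (up Q') → F i (up (P ++ Q)) (up (P ++ Q'))
Fu-right P {Q} e f = Fu-joinʳ P f (subst (_< φu _ Q) (sym e) (F-pos f))

Fu-left : ∀ {i} {P P'} Q → φu i Q ≡ 0 → F i (up P) (up P') → F i (up (P ++ Q)) (up (P' ++ Q))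
Fu-left Q e f = Fu-joinˡ Q f (subst (_≤ _) (sym e) z≤n)

F-single : ∀ {i x W} → F i (up [ x ]) W → x ≡ i × W ≡ up [ suc i ]
F-single {x = x} f with F-position {w = [ x ]} f
... | position [] [] refl t _ _ = refl , t
... | position (_ ∷ []) v () t _ _
... | position (_ ∷ _ ∷ _) v () t _ _

-- Rows read backwards: J strictly decreasing, then the middle element m, then
-- the rest; k = length J is the position of the middle element.

record Hook (k : ℕ) (w : List ℕ) : Set where
  constructor hook
  field
    J : List ℕ
    m : ℕ
    E : List ℕ
    eq : w ≡ J ++ m ∷ E
    len : length J ≡ k
    desc : SD J
    J>m : All (m <_) J
    asc : WI (m ∷ E)

F-length : ∀ {i w w'} → F i w w' → length w ≡ length w'
F-length (mkF u p v refl refl _ _) = trans (length-++ u) (sym (length-++ u))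

F-ulength : ∀ {i w w'} → F i (up w) (up w') → length w ≡ length w'
F-ulength {w = w} {w'} f = trans (sym (length-map _ w)) (trans (F-length f) (length-map _ w'))

-- The place of the middle element is invariant. If the middle element `i` itself is raised, the
-- tensor rule forces `ωu i J` to be 0; the letters of `J` exceed `i`, so none of them is `suc i`
-- and they still exceed the new middle element.
Hook-F : ∀ {i k w w'} → Hook k w → F i (up w) (up w') → Hook k w'
Hook-F {i} {w' = w'} (hook J m E refl l d jm s) f with Fu-split J (m ∷ E) f
... | inj₁ (J' , g , e , _) = hook J' m E (up-injective w' _ e) (trans (sym (F-ulength {w = J} {J'} g)) l) (SD-F {w = J} d g)
  (F-All {w = J} {J'} g (λ p → m<n⇒m<1+n p) jm) s
... | inj₂ (Q' , g , e , lt) with F-position {w = m ∷ E} g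
...   | position [] v refl t a b with up-injective Q' _ t
...     | refl = hook J (suc i) v (up-injective w' _ e) l d (ω0-gt jm (n<1⇒n≡0 (subst (ωu i J <_) (trans (φ-cl i _) (cong suc b)) lt))) (WI-F {w = i ∷ E} {suc i ∷ E} s g)
Hook-F {i} {w' = w'} (hook J m E refl l d jm s) f | inj₂ (Q' , g , e , lt) | position (x ∷ u) v refl t a b with up-injective Q' _ t
... | refl = hook J m _ (up-injective w' _ e) l d jm (WI-F {w = m ∷ E} s g)

-- Equality of signatures

infix 4 _≈_
record _≈_ (ks ls : List Kind) : Set where
  constructor sig
  field at : ∀ c → φ c ks ≡ φ c ls × ω c ks ≡ ω c ls
open _≈_

≈-refl : ∀ {ks} → ks ≈ ks
≈-refl = sig λ c → refl , refl

≈-sym : ∀ {ks ls} → ks ≈ ls → ls ≈ ks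
≈-sym e = sig λ c → sym (proj₁ (at e c)) , sym (proj₂ (at e c))

≈-trans : ∀ {ks ls ms} → ks ≈ ls → ls ≈ ms → ks ≈ ms
≈-trans e f = sig λ c → trans (proj₁ (at e c)) (proj₁ (at f c)) , trans (proj₂ (at e c)) (proj₂ (at f c))

≈-≡ : ∀ {ks ls} → ks ≡ ls → ks ≈ ls
≈-≡ refl = ≈-refl

≈-++ : ∀ {ks ks' ls ls'} → ks ≈ ks' → ls ≈ ls' → ks ++ ls ≈ ks' ++ ls'
≈-++ {ks} {ks'} {ls} {ls'} e f = sig λ c →
  trans (φ-++ c ks ls) (trans (cong₂ _+_ (proj₁ (at e c)) (trans (proj₁ (at f (ω c ks))) (cong (λ z → φ z ls') (proj₂ (at e c))))) (sym (φ-++ c ks' ls'))) ,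
  trans (ω-++ c ks ls) (trans (proj₂ (at f (ω c ks))) (trans (cong (λ z → ω z ls') (proj₂ (at e c))) (sym (ω-++ c ks' ls'))))

K : ℕ → List ℕ → List Kind
K i w = kinds i (up w)

≈-inert : ∀ {i w} → Inert i w → K i w ≈ []
≈-inert [] = ≈-refl
≈-inert (p ∷ ps) rewrite p = sig (at (≈-inert ps))

≈-cl : ∀ i → K i [ i ] ≈ [ cl ]
≈-cl i rewrite kind-cl i = ≈-refl

≈-op : ∀ i → K i [ suc i ] ≈ [ op ]
≈-op i rewrite kind-op i = ≈-refl

K-4 : ∀ i a b c d → K i (a ++ b ++ c ++ d) ≡ K i a ++ K i b ++ K i c ++ K i d
K-4 i a b c d rewrite kinds-up-++ i a (b ++ c ++ d) | kinds-up-++ i b (c ++ d) | kinds-up-++ i c d = refl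

≈-4 : ∀ {a b c d a' b' c' d'} → a ≈ a' → b ≈ b' → c ≈ c' → d ≈ d' → a ++ b ++ c ++ d ≈ a' ++ b' ++ c' ++ d'
≈-4 {a} {b} {c} {d} {a'} {b'} {c'} {d'} p q r s = ≈-++ {a} {a'} p (≈-++ {b} {b'} q (≈-++ {c} {c'} {d} {d'} r s))

φu≈ : ∀ {i} u v → K i u ≈ K i v → φu i u ≡ φu i v
φu≈ u v e = proj₁ (at e 0)

ωu≈ : ∀ {i} u v → K i u ≈ K i v → ωu i u ≡ ωu i v
ωu≈ u v e = proj₂ (at e 0)

-- Row insertion into the strictly increasing part: x replaces b

data BI (k : ℕ) : Rel where
  bi : ∀ x A b B → SD (A ++ b ∷ B) → x ≤ b → All (_< x) B → length (A ++ b ∷ B) ≡ k →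
    BI k (up (x ∷ A ++ b ∷ B)) (up (A ++ x ∷ B ++ [ b ]))

-- The bump moves `x` across `A` and `b` across `B`. The order relations leave five patterns,
-- according to which blocks contain neither `i` nor `suc i`; the delicate ones are the last two,
-- where `x` equals `b`.
data BICase (i x : ℕ) (A : List ℕ) (b : ℕ) (B : List ℕ) : Set where
  inert-xB : Inert i [ x ] → Inert i B → BICase i x A b B
  inert-Ab : Inert i A → Inert i [ b ] → BICase i x A b B
  inert-AB : Inert i A → Inert i B → BICase i x A b B
  both-cl : x ≡ i → b ≡ i → Inert i B → BICase i x A b B
  both-op : x ≡ suc i → b ≡ suc i → Inert i A → BICase i x A b B

SD-φ≤1 : ∀ {i w} → SD w → φu i w ≤ 1
SD-φ≤1 {i} {[]} s = z≤n
SD-φ≤1 {i} {y ∷ w} (a , s) with kind i y | kindView i y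
... | .op | isOp = ≤-trans (≤-reflexive (φ-suc 0 (K i w))) (≤-trans (m∸n≤m (φu i w) 1) (SD-φ≤1 {i} {w} s))
... | .cl | isCl = s≤s (≤-reflexive (φu-inert (All.map lt-ne a)))
... | .ne | isNe _ _ = SD-φ≤1 {i} {w} s

bicase : ∀ i x A b B → SD (A ++ b ∷ B) → x ≤ b → All (_< x) B → BICase i x A b B
bicase i x A b B s x≤b B<x with SD-++⁻ A (b ∷ B) s
... | _ , _ , A>b with <-cmp b i
...   | tri< b<i _ _ = inert-xB (lt-ne (≤-<-trans x≤b b<i) ∷ []) (All.map (λ p → lt-ne (<-trans p (≤-<-trans x≤b b<i))) B<x)
...   | tri≈ _ refl _ with m≤n⇒m<n∨m≡n x≤b
...     | inj₁ x<i = inert-xB (lt-ne x<i ∷ []) (All.map (λ p → lt-ne (<-trans p x<i)) B<x)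
...     | inj₂ refl = both-cl refl refl (All.map lt-ne B<x)
bicase i x A b B s x≤b B<x | _ , _ , A>b | tri> _ _ b>i with m≤n⇒m<n∨m≡n b>i
... | inj₁ b>si = inert-Ab (All.map (λ p → gt-ne (<-trans b>si (All.head p))) A>b) (gt-ne b>si ∷ [])
... | inj₂ refl with m≤n⇒m<n∨m≡n x≤b
...   | inj₂ refl = both-op refl refl (All.map (λ p → gt-ne (All.head p)) A>b)
...   | inj₁ (s≤s x≤i) = inert-AB (All.map (λ p → gt-ne (All.head p)) A>b) (All.map (λ p → lt-ne (<-≤-trans p x≤i)) B<x)

gt-shape : ∀ {i A} → SD A → All (i <_) A → Inert i A ⊎ ∃ λ A₀ → A ≡ A₀ ++ [ suc i ] × Inert i A₀
gt-shape {A = []} s g = inj₁ []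
gt-shape {i} {y ∷ A} (a , s) (p ∷ g) with m≤n⇒m<n∨m≡n p
gt-shape {i} {y ∷ []} (a , s) (p ∷ g) | inj₂ refl = inj₂ ([] , refl , [])
gt-shape {i} {y ∷ z ∷ A} ((q ∷ a) , s) (p ∷ r ∷ g) | inj₂ refl = ⊥-elim (<-irrefl refl (<-≤-trans r (≤-pred q)))
... | inj₁ q with gt-shape s g
...   | inj₁ j = inj₁ (gt-ne q ∷ j)
...   | inj₂ (A₀ , refl , j) = inj₂ (y ∷ A₀ , refl , gt-ne q ∷ j)

BI-≈ : ∀ i x A b B → SD (A ++ b ∷ B) → x ≤ b → All (_< x) B → K i (x ∷ A ++ b ∷ B) ≈ K i (A ++ x ∷ B ++ [ b ])
BI-≈ i x A b B s x≤b B<x = ≈-trans (≈-≡ (K-4 i [ x ] A [ b ] B)) (≈-trans (go (bicase i x A b B s x≤b B<x)) (≈-≡ (sym (K-4 i A [ x ] B [ b ]))))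
  where
  kA = K i A ; kB = K i B ; kx = K i [ x ] ; kb = K i [ b ]
  reps : ∀ {x' A' b' B'} → kx ≈ x' → kA ≈ A' → kb ≈ b' → kB ≈ B' → x' ++ A' ++ b' ++ B' ≈ A' ++ x' ++ B' ++ b' →
    kx ++ kA ++ kb ++ kB ≈ kA ++ kx ++ kB ++ kb
  reps {x'} {A'} {b'} {B'} p q r t e = ≈-trans {ls = x' ++ A' ++ b' ++ B'} (≈-4 {kx} {kA} {kb} {kB} {x'} {A'} {b'} {B'} p q r t)
    (≈-trans {ls = A' ++ x' ++ B' ++ b'} e (≈-sym (≈-4 {kA} {kx} {kB} {kb} {A'} {x'} {B'} {b'} q p t r)))
  le-shape : ∀ B → SD B → All (_< suc i) B → K i B ≈ [] ⊎ K i B ≈ [ cl ]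
  le-shape [] s a = inj₁ ≈-refl
  le-shape (y ∷ B) (a , s) (p ∷ q) with m≤n⇒m<n∨m≡n (≤-pred p)
  ... | inj₁ y<i = inj₁ (≈-inert {i} {y ∷ B} (lt-ne y<i ∷ All.map (λ r → lt-ne (<-trans r y<i)) a))
  ... | inj₂ refl = inj₂ (≈-++ {K i [ y ]} {[ cl ]} {K i B} {[]} (≈-cl i) (≈-inert (All.map lt-ne a)))
  SDB = proj₁ (proj₂ (SD-++⁻ A (b ∷ B) s))
  A>b = All-heads (proj₂ (proj₂ (SD-++⁻ A (b ∷ B) s)))
  SDA = proj₁ (SD-++⁻ A (b ∷ B) s)
  go : BICase i x A b B → kx ++ kA ++ kb ++ kB ≈ kA ++ kx ++ kB ++ kb
  go (inert-xB p q) = reps {[]} {kA} {kb} {[]} (≈-inert p) ≈-refl ≈-refl (≈-inert q) ≈-refl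
  go (inert-Ab p q) = reps {kx} {[]} {[]} {kB} ≈-refl (≈-inert p) (≈-inert q) ≈-refl (≈-≡ (cong (kx ++_) (sym (++-identityʳ kB))))
  go (inert-AB p q) = reps {kx} {[]} {kb} {[]} ≈-refl (≈-inert p) ≈-refl (≈-inert q) ≈-refl
  go (both-cl refl refl q) with gt-shape SDA A>b
  ... | inj₁ j = reps {kx} {[]} {kb} {[]} ≈-refl (≈-inert j) ≈-refl (≈-inert q) ≈-refl
  ... | inj₂ (A₀ , refl , j) = reps {[ cl ]} {[ op ]} {[ cl ]} {[]} (≈-cl i)
          (≈-trans (≈-≡ (kinds-up-++ i A₀ [ suc i ])) (≈-++ {K i A₀} {[]} (≈-inert j) (≈-op i))) (≈-cl i) (≈-inert q)
          (sig λ { zero → refl , refl ; (suc c) → refl , refl })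
  go (both-op refl refl p) with le-shape B (proj₂ SDB) B<x
  ... | inj₁ e = reps {kx} {[]} {kb} {[]} ≈-refl (≈-inert p) ≈-refl e ≈-refl
  ... | inj₂ e = reps {[ op ]} {[]} {[ op ]} {[ cl ]} (≈-op i) (≈-inert p) (≈-op i) e (sig λ c → refl , refl)

≈-drop : ∀ {i} u v w → Inert i u → Inert i w → K i (u ++ v ++ w) ≈ K i v
≈-drop {i} u v w p q = ≈-trans (≈-≡ (trans (kinds-up-++ i u (v ++ w)) (cong (K i u ++_) (kinds-up-++ i v w))))
  (≈-trans (≈-++ {K i u} {[]} (≈-inert p) (≈-++ {K i v} {K i v} {K i w} {[]} ≈-refl (≈-inert q))) (≈-≡ (++-identityʳ (K i v))))

sucne : ∀ {i} → kind i (suc i) ≡ ne → ⊥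
sucne {i} e with trans (sym (kind-op i)) e
... | ()

clne : ∀ {i} → kind i i ≡ ne → ⊥
clne {i} e with trans (sym (kind-cl i)) e
... | ()

module _ {k : ℕ} where

  private
    lengths : ∀ {i x A b B w' W} → W ≡ up w' → F i (up (x ∷ A ++ b ∷ B)) W → ∀ x' A' b' B' → w' ≡ x' ∷ A' ++ b' ∷ B' →
      length (A ++ b ∷ B) ≡ k → length (A' ++ b' ∷ B') ≡ k
    lengths {x = x} {A} {b} {B} refl f x' A' b' B' refl l = trans (suc-injective (sym (F-ulength {w = x ∷ A ++ b ∷ B} {x' ∷ A' ++ b' ∷ B'} f))) l

  BI-sim : ∀ {i} x A b B → SD (A ++ b ∷ B) → x ≤ b → All (_< x) B → length (A ++ b ∷ B) ≡ k → ∀ {W} →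
    F i (up (x ∷ A ++ b ∷ B)) W → ∃ λ W' → F i (up (A ++ x ∷ B ++ [ b ])) W' × BI k W W'
  BI-sim {i} x A b B s x≤b B<x l {W} f = go (bicase i x A b B s x≤b B<x)
    where
    Res = ∃ λ W' → F i (up (A ++ x ∷ B ++ [ b ])) W' × BI k W W'
    A>b = proj₂ (proj₂ (SD-++⁻ A (b ∷ B) s))
    SDB = proj₂ (proj₁ (proj₂ (SD-++⁻ A (b ∷ B) s)))
    done : ∀ x' A' b' B' → W ≡ up (x' ∷ A' ++ b' ∷ B') → SD (A' ++ b' ∷ B') → x' ≤ b' → All (_< x') B' →
      F i (up (A ++ x ∷ B ++ [ b ])) (up (A' ++ x' ∷ B' ++ [ b' ])) → Res
    done x' A' b' B' refl s' q r g = _ , g , bi x' A' b' B' s' q r (lengths {x = x} {A} {b} {B} refl f x' A' b' B' refl l)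
    sdF : ∀ {w'} → F i (up (A ++ b ∷ B)) (up w') → SD w'
    sdF {w'} g = SD-F {w = A ++ b ∷ B} s g
    last : φu i B ≡ 0 → b ≡ i → ωu i A ≡ 0 → ωu i [ x ] ≡ 0 → Inert i B → W ≡ up (x ∷ A ++ suc i ∷ B) → Res
    last pb refl a0 x0 ib e = done x A (suc i) B e (sdF {A ++ suc i ∷ B} (F-at i A B a0 pb)) (m≤n⇒m≤1+n x≤b) B<x
      (subst₂ (λ y z → F i (up y) (up z)) (++-assoc A (x ∷ B) [ i ]) (++-assoc A (x ∷ B) [ suc i ])
        (F-at i (A ++ x ∷ B) [] (ωu-++0 i A (x ∷ B) a0 (trans (ωu≈ (x ∷ B) [ x ] (≈-drop [] [ x ] B [] ib)) x0)) refl))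
    first : x ≡ i → suc i ≤ b → Inert i A → φu i (B ++ [ b ]) ≡ 0 → W ≡ up (suc i ∷ A ++ b ∷ B) → Res
    first refl le ia p0 e = done (suc i) A b B e s le (All.map m<n⇒m<1+n B<x) (F-at i A (B ++ [ b ]) (ωu-inert ia) p0)
    go : BICase i x A b B → Res
    go (inert-xB nx iB) with Fu-inertˡ [ x ] (A ++ b ∷ B) nx f
    ... | Q , g , refl with Fu-φ0ʳ (A ++ [ b ]) B (φu-inert iB) (subst (λ z → F i (up z) (up Q)) (sym (++-assoc A [ b ] B)) g)
    ...   | P , h , e with Fu-split A [ b ] h
    ...     | inj₁ (A' , m , e' , le) = done x A' b B (cong (λ z → up (x ∷ z)) eq) (subst SD eq (sdF {Q} g)) x≤b B<x
                (Fu-joinˡ (x ∷ B ++ [ b ]) m (subst (_≤ ωu i A) (sym (φu≈ (x ∷ B ++ [ b ]) [ b ] (≈-trans (≈-≡ (cong (K i) (sym (++-assoc [ x ] B [ b ])))) (≈-drop (x ∷ B) [ b ] [] (All.++⁺ nx iB) [])))) le))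
      where eq : Q ≡ A' ++ b ∷ B
            eq = trans (up-injective Q (P ++ B) e) (trans (cong (_++ B) (up-injective P (A' ++ [ b ]) e')) (++-assoc A' [ b ] B))
    ...     | inj₂ (b' , m , e' , lt) with F-single m | up-injective P (A ++ b') e'
    ...       | refl , e'' | refl = last (φu-inert iB) refl (n<1⇒n≡0 (subst (ωu i A <_) (φ-cl i []) lt)) (ωu-inert nx) iB
                (cong (λ z → up (x ∷ z)) (trans (up-injective Q _ e) (trans (cong (λ z → (A ++ z) ++ B) (up-injective b' _ e'')) (++-assoc A [ suc i ] B))))
    go (inert-Ab iA ib) with Fu-split [ x ] (A ++ b ∷ B) f
    ... | inj₁ (x' , g , refl , le) with F-single g
    ...   | refl , e with up-injective x' _ e
    ...     | refl = first refl (≤∧≢⇒< x≤b (λ { refl → clne {i} (All.head ib) })) iA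
                 (trans (φu≈ (B ++ [ b ]) B (≈-drop [] B [ b ] [] ib)) (n≤0⇒n≡0 (subst₂ _≤_ (φu≈ (A ++ b ∷ B) B (≈-trans (≈-≡ (cong (K i) (trans (sym (++-assoc A [ b ] B)) (cong ((A ++ [ b ]) ++_) (sym (++-identityʳ B)))))) (≈-drop (A ++ [ b ]) B [] (All.++⁺ iA ib) []))) (ω-cl i []) le))) refl
    go (inert-Ab iA ib) | inj₂ (Q , g , refl , lt) with Fu-inertˡ (A ++ [ b ]) B (All.++⁺ iA ib) (subst (λ z → F i (up z) (up Q)) (sym (++-assoc A [ b ] B)) g)
    ... | B' , h , e = done x A b B' (cong (λ z → up (x ∷ z)) eq) (subst SD eq (sdF {Q} g)) x≤b (F-All {w = B} {B'} h (λ p → ≤∧≢⇒< p x≢) B<x)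
          (Fu-right A (ωu-inert iA) (Fu-left {P = x ∷ B} {x ∷ B'} [ b ] (φu-inert ib) (Fu-joinʳ [ x ] h lt')))
      where
      eq : Q ≡ A ++ b ∷ B'
      eq = trans (up-injective Q _ e) (++-assoc A [ b ] B')
      lt' : ωu i [ x ] < φu i B
      lt' = subst (ωu i [ x ] <_) (φu≈ (A ++ b ∷ B) B (≈-trans (≈-≡ (cong (K i) (trans (sym (++-assoc A [ b ] B)) (cong ((A ++ [ b ]) ++_) (sym (++-identityʳ B)))))) (≈-drop (A ++ [ b ]) B [] (All.++⁺ iA ib) []))) lt
      x≢ : suc i ≢ x
      x≢ refl = <⇒≱ (subst (_< φu i B) (ω-op i 0 []) lt') (SD-φ≤1 {i} {B} SDB)
    go (inert-AB iA iB) with Fu-split [ x ] (A ++ b ∷ B) f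
    ... | inj₁ (x' , g , refl , le) with F-single g
    ...   | refl , e with up-injective x' _ e
    ...     | refl = first refl (≤∧≢⇒< x≤b b≢) iA (trans (φu≈ (B ++ [ b ]) [ b ] (≈-drop B [ b ] [] iB [])) pb) refl
      where
      pb : φu i [ b ] ≡ 0
      pb = n≤0⇒n≡0 (subst₂ _≤_ (φu≈ (A ++ b ∷ B) [ b ] (≈-drop A [ b ] B iA iB)) (ω-cl i []) le)
      b≢ : i ≢ b
      b≢ refl with trans (sym (φ-cl i [])) pb
      ... | ()
    go (inert-AB iA iB) | inj₂ (Q , g , refl , lt) with Fu-inertˡ A (b ∷ B) iA g
    ... | Q₁ , g₁ , e₁ with Fu-φ0ʳ [ b ] B (φu-inert iB) g₁
    ...   | b' , g₂ , e₂ with F-single g₂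
    ...     | refl , e₃ = last (φu-inert iB) refl (ωu-inert iA) (n<1⇒n≡0 (subst (ωu i [ x ] <_) (trans (φu≈ (A ++ i ∷ B) [ i ] (≈-drop A [ i ] B iA iB)) (φ-cl i [])) lt)) iB
                (cong (λ z → up (x ∷ z)) (trans (up-injective Q _ e₁) (cong (A ++_) (trans (up-injective Q₁ _ e₂) (cong (_++ B) (up-injective b' _ e₃))))))
    go (both-cl refl refl iB) with Fu-split [ i ] (A ++ i ∷ B) f
    ... | inj₂ (Q , g , refl , lt) with Fu-split A (i ∷ B) g
    ...   | inj₁ (_ , h , _) = F-absurd (no-cl (All-heads A>b) 0) h
    ...   | inj₂ (Q₁ , g₁ , e₁ , lt₁) with Fu-φ0ʳ [ i ] B (φu-inert iB) g₁
    ...     | b' , g₂ , e₂ with F-single g₂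
    ...       | _ , e₃ = last (φu-inert iB) refl (n<1⇒n≡0 (subst (ωu i A <_) (trans (φ-cl i _) (cong suc (φu-inert iB))) lt₁)) (ω-cl i []) iB
                (cong (λ z → up (i ∷ z)) (trans (up-injective Q _ e₁) (cong (A ++_) (trans (up-injective Q₁ _ e₂) (cong (_++ B) (up-injective b' _ e₃))))))
    go (both-cl refl refl iB) | inj₁ (x' , g , refl , le) with F-single g
    ... | _ , e with up-injective x' _ e | gt-shape (proj₁ (SD-++⁻ A (i ∷ B) s)) (All-heads A>b)
    ...   | refl | inj₁ iA = ⊥-elim (<⇒≱ (subst₂ _<_ (sym (ω-cl i [])) (sym (trans (φu≈ (A ++ i ∷ B) [ i ] (≈-drop A [ i ] B iA iB)) (φ-cl i []))) (s≤s z≤n)) le)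
    ...   | refl | inj₂ (A₀ , refl , iA₀) =
              -- The raised letter now bumps the `suc i` at the end of `A`, and the former `b`, an
              -- `i`, joins the last block. On the other side this shows as raising the expelled
              -- letter.
              done (suc i) A₀ (suc i) (i ∷ B) (cong (λ z → up (suc i ∷ z)) eq) (subst SD eq s) ≤-refl (≤-refl ∷ All.map m<n⇒m<1+n B<x)
                (subst₂ (λ y z → F i (up y) (up z)) (trans (++-assoc A₀ (suc i ∷ i ∷ B) [ i ]) (sym (++-assoc A₀ [ suc i ] _))) (++-assoc A₀ (suc i ∷ i ∷ B) [ suc i ])
                  (F-at i (A₀ ++ suc i ∷ i ∷ B) [] (ωu-++0 i A₀ _ (ωu-inert iA₀) w0) refl))
      where
      eq : (A₀ ++ [ suc i ]) ++ i ∷ B ≡ A₀ ++ suc i ∷ i ∷ B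
      eq = ++-assoc A₀ [ suc i ] (i ∷ B)
      w0 : ωu i (suc i ∷ i ∷ B) ≡ 0
      w0 = trans (ω-op i 0 _) (trans (lem (kind-cl i)) (ωu-inert iB))
        where lem : kind i i ≡ cl → ω 1 (kind i i ∷ K i B) ≡ ω 0 (K i B)
              lem e rewrite e = refl
    -- Two letters `suc i` precede `B`, which contains at most one `i`, so no closing bracket is
    -- left to raise.
    go (both-op refl refl iA) = F-absurd {w = up (suc i ∷ A ++ suc i ∷ B)} p0 f
      where
      p0 : φu i (suc i ∷ A ++ suc i ∷ B) ≡ 0
      p0 = trans (φ-op i 0 _) (trans (cong (φ 1) (kinds-up-++ i A (suc i ∷ B))) (trans (φ-inert 1 iA _) (trans (φ-op i 1 _) (⇒φ0 2 (K i B) (m≤n⇒m≤1+n (SD-φ≤1 {i} {B} SDB))))))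

  NatF-BI : NatF (BI k)
  NatF-BI = record
    { φ≡ = λ { {i} (bi x A b B s p q _) → φu≈ (x ∷ A ++ b ∷ B) (A ++ x ∷ B ++ [ b ]) (BI-≈ i x A b B s p q) }
    ; ω≡ = λ { {i} (bi x A b B s p q _) → ωu≈ (x ∷ A ++ b ∷ B) (A ++ x ∷ B ++ [ b ]) (BI-≈ i x A b B s p q) }
    ; simF = λ { (bi x A b B s p q l) f → BI-sim x A b B s p q l f } }

-- Insertion into the weakly decreasing part: b replaces c

data BD : Rel where
  bd : ∀ b A c B → WI (A ++ c ∷ B) → c < b → All (b ≤_) B → BD (up (b ∷ A ++ c ∷ B)) (up (A ++ b ∷ B ++ [ c ]))

data BDCase (i b : ℕ) (A : List ℕ) (c : ℕ) (B : List ℕ) : Set where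
  inert-bB : Inert i [ b ] → Inert i B → BDCase i b A c B
  inert-Ac : Inert i A → Inert i [ c ] → BDCase i b A c B
  op-cl : b ≡ suc i → c ≡ i → BDCase i b A c B

bdcase : ∀ i b A c B → All (_≤ c) A → c < b → All (b ≤_) B → BDCase i b A c B
bdcase i b A c B A≤c c<b b≤B with <-cmp c i
... | tri< c<i _ _ = inert-Ac (All.map (λ p → lt-ne (≤-<-trans p c<i)) A≤c) (lt-ne c<i ∷ [])
... | tri> _ _ c>i = inert-bB (gt-ne si<b ∷ []) (All.map (λ p → gt-ne (<-≤-trans si<b p)) b≤B)
  where si<b = ≤-<-trans c>i c<b
... | tri≈ _ refl _ with m≤n⇒m<n∨m≡n c<b
...   | inj₁ q = inert-bB (gt-ne q ∷ []) (All.map (λ p → gt-ne (<-≤-trans q p)) b≤B)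
...   | inj₂ refl = op-cl refl refl

cl-slide : ∀ {i A} → All (_≤ i) A → K i A ++ [ cl ] ≈ cl ∷ K i A
cl-slide [] = ≈-refl
cl-slide {i} {y ∷ A} (p ∷ ps) with kind i y | kindView i y
... | .op | isOp = ⊥-elim (<-irrefl refl p)
... | .cl | isCl = ≈-++ {[ cl ]} {[ cl ]} ≈-refl (cl-slide ps)
... | .ne | isNe _ _ = ≈-trans (≈-++ {[ ne ]} {[ ne ]} ≈-refl (cl-slide ps)) (sig λ { zero → refl , refl ; (suc c) → refl , refl })

op-slide : ∀ {i B} → All (i <_) B → op ∷ K i B ≈ K i B ++ [ op ]
op-slide [] = ≈-refl
op-slide {i} {y ∷ B} (p ∷ ps) with kind i y | kindView i y
... | .cl | isCl = ⊥-elim (<-irrefl refl p)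
... | .op | isOp = ≈-++ {[ op ]} {[ op ]} ≈-refl (op-slide ps)
... | .ne | isNe _ _ = ≈-trans (sig λ c → refl , refl) (≈-++ {[ ne ]} {[ ne ]} ≈-refl (op-slide ps))

-- In the pattern `op-cl` the letters `b` and `c` match each other on both sides: `A` has no opening
-- and `B` no closing bracket, so the two brackets can be slid together and cancel.
BD-≈ : ∀ i b A c B → All (_≤ c) A → c < b → All (b ≤_) B → K i (b ∷ A ++ c ∷ B) ≈ K i (A ++ b ∷ B ++ [ c ])
BD-≈ i b A c B A≤c c<b b≤B = ≈-trans (≈-≡ (K-4 i [ b ] A [ c ] B)) (≈-trans (go (bdcase i b A c B A≤c c<b b≤B)) (≈-≡ (sym (K-4 i A [ b ] B [ c ]))))
  where
  kA = K i A ; kB = K i B ; kb = K i [ b ] ; kc = K i [ c ]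
  reps : ∀ {b' A' c' B'} → kb ≈ b' → kA ≈ A' → kc ≈ c' → kB ≈ B' → b' ++ A' ++ c' ++ B' ≈ A' ++ b' ++ B' ++ c' →
    kb ++ kA ++ kc ++ kB ≈ kA ++ kb ++ kB ++ kc
  reps {b'} {A'} {c'} {B'} p q r t e = ≈-trans {ls = b' ++ A' ++ c' ++ B'} (≈-4 {kb} {kA} {kc} {kB} {b'} {A'} {c'} {B'} p q r t)
    (≈-trans {ls = A' ++ b' ++ B' ++ c'} e (≈-sym (≈-4 {kA} {kb} {kB} {kc} {A'} {b'} {B'} {c'} q p t r)))
  go : BDCase i b A c B → kb ++ kA ++ kc ++ kB ≈ kA ++ kb ++ kB ++ kc
  go (inert-bB p q) = reps {[]} {kA} {kc} {[]} (≈-inert p) ≈-refl ≈-refl (≈-inert q) ≈-refl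
  go (inert-Ac p q) = reps {kb} {[]} {[]} {kB} ≈-refl (≈-inert p) (≈-inert q) ≈-refl (≈-≡ (cong (kb ++_) (sym (++-identityʳ kB))))
  go (op-cl refl refl) = reps {[ op ]} {kA} {[ cl ]} {kB} (≈-op i) ≈-refl (≈-cl i) ≈-refl
    (≈-trans (≈-≡ (cong (op ∷_) (sym (++-assoc kA [ cl ] kB))))
    (≈-trans (≈-++ {op ∷ kA ++ [ cl ]} {kA} {kB} {kB} (≈-trans (≈-++ {[ op ]} {[ op ]} ≈-refl (cl-slide {A = A} A≤c)) (sig λ c → refl , refl)) ≈-refl)
    (≈-++ {kA} {kA} ≈-refl (≈-sym (≈-trans (≈-++ {op ∷ kB} {kB ++ [ op ]} {[ cl ]} {[ cl ]} (op-slide {B = B} b≤B) ≈-refl)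
      (≈-trans (≈-≡ (++-assoc kB [ op ] [ cl ])) (≈-trans (≈-++ {kB} {kB} {op ∷ cl ∷ []} {[]} ≈-refl (sig λ c → refl , refl)) (≈-≡ (++-identityʳ kB)))))))))

le-shape : ∀ {i A} → WI A → All (_≤ i) A → Inert i A ⊎ ∃ λ A₀ → A ≡ A₀ ++ [ i ]
le-shape {A = []} s g = inj₁ []
le-shape {i} {y ∷ []} s (p ∷ []) with m≤n⇒m<n∨m≡n p
... | inj₁ q = inj₁ (lt-ne q ∷ [])
... | inj₂ refl = inj₂ ([] , refl)
le-shape {i} {y ∷ z ∷ A} ((y≤z ∷ _) , s) (p ∷ ps) with le-shape {i} {z ∷ A} s ps
... | inj₂ (A₀ , e) = inj₂ (y ∷ A₀ , cong (y ∷_) e)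
... | inj₁ j with m≤n⇒m<n∨m≡n p
...   | inj₁ q = inj₁ (lt-ne q ∷ j)
...   | inj₂ refl = ⊥-elim (clne {y} (subst (λ t → kind y t ≡ ne) (≤-antisym (All.head ps) y≤z) (All.head j)))

BD-sim : ∀ {i} b A c B → WI (A ++ c ∷ B) → c < b → All (b ≤_) B → ∀ {W} →
  F i (up (b ∷ A ++ c ∷ B)) W → ∃ λ W' → F i (up (A ++ b ∷ B ++ [ c ])) W' × BD W W'
BD-sim {i} b A c B s c<b b≤B {W} f = go (bdcase i b A c B A≤c c<b b≤B)
  where
  Res = ∃ λ W' → F i (up (A ++ b ∷ B ++ [ c ])) W' × BD W W'
  A≤c = All-heads (proj₂ (proj₂ (WI-++⁻ A (c ∷ B) s)))
  done : ∀ b' A' c' B' → W ≡ up (b' ∷ A' ++ c' ∷ B') → WI (A' ++ c' ∷ B') → c' < b' → All (b' ≤_) B' →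
    F i (up (A ++ b ∷ B ++ [ c ])) (up (A' ++ b' ∷ B' ++ [ c' ])) → Res
  done b' A' c' B' refl s' q r g = _ , g , bd b' A' c' B' s' q r
  wiF : ∀ {w'} → F i (up (A ++ c ∷ B)) (up w') → WI w'
  wiF {w'} g = WI-F {w = A ++ c ∷ B} s g
  go : BDCase i b A c B → Res
  go (inert-bB nb iB) with Fu-inertˡ [ b ] (A ++ c ∷ B) nb f
  ... | Q , g , refl with Fu-φ0ʳ (A ++ [ c ]) B (φu-inert iB) (subst (λ z → F i (up z) (up Q)) (sym (++-assoc A [ c ] B)) g)
  ...   | P , h , e with Fu-split A [ c ] h
  ...     | inj₁ (A' , m , e' , le) = done b A' c B (cong (λ z → up (b ∷ z)) eq) (subst WI eq (wiF {Q} g)) c<b b≤B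
              (Fu-joinˡ (b ∷ B ++ [ c ]) m (subst (_≤ ωu i A) (sym (φu≈ (b ∷ B ++ [ c ]) [ c ] (≈-drop (b ∷ B) [ c ] [] (All.++⁺ nb iB) []))) le))
    where eq : Q ≡ A' ++ c ∷ B
          eq = trans (up-injective Q (P ++ B) e) (trans (cong (_++ B) (up-injective P (A' ++ [ c ]) e')) (++-assoc A' [ c ] B))
  ...     | inj₂ (c' , m , e' , lt) with F-single m
  ...       | refl , e'' = done b A (suc i) B (cong (λ z → up (b ∷ z)) eq) (subst WI eq (wiF {Q} g))
                (≤∧≢⇒< c<b (λ { refl → sucne {i} (All.head nb) })) b≤B
                (subst₂ (λ y z → F i (up y) (up z)) (++-assoc A (b ∷ B) [ i ]) (++-assoc A (b ∷ B) [ suc i ])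
                  (F-at i (A ++ b ∷ B) [] (ωu-++0 i A (b ∷ B) (n<1⇒n≡0 (subst (ωu i A <_) (φ-cl i []) lt)) (ωu-inert (All.++⁺ nb iB))) refl))
    where eq : Q ≡ A ++ suc i ∷ B
          eq = trans (up-injective Q (P ++ B) e) (trans (cong (_++ B) (trans (up-injective P _ e') (cong (A ++_) (up-injective c' _ e'')))) (++-assoc A [ suc i ] B))
  go (inert-Ac iA nc) with Fu-split [ b ] (A ++ c ∷ B) f
  ... | inj₁ (b' , g , refl , le) with F-single g
  ...   | refl , e with up-injective b' _ e
  ...     | refl = done (suc i) A c B refl s (m<n⇒m<1+n c<b) (φ0-WI b≤B (proj₂ (proj₁ (proj₂ (WI-++⁻ A (c ∷ B) s)))) pB)
               (F-at i A (B ++ [ c ]) (ωu-inert iA) (trans (φu≈ (B ++ [ c ]) B (≈-drop [] B [ c ] [] nc)) pB))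
    where
    pB : φu i B ≡ 0
    pB = n≤0⇒n≡0 (subst₂ _≤_ (φu≈ (A ++ c ∷ B) B (≈-trans (≈-≡ (cong (K i) (trans (sym (++-assoc A [ c ] B)) (cong ((A ++ [ c ]) ++_) (sym (++-identityʳ B)))))) (≈-drop (A ++ [ c ]) B [] (All.++⁺ iA nc) []))) (ω-cl i []) le)
  go (inert-Ac iA nc) | inj₂ (Q , g , refl , lt) with Fu-inertˡ (A ++ [ c ]) B (All.++⁺ iA nc) (subst (λ z → F i (up z) (up Q)) (sym (++-assoc A [ c ] B)) g)
  ... | B' , h , e = done b A c B' (cong (λ z → up (b ∷ z)) eq) (subst WI eq (wiF {Q} g)) c<b (F-All {w = B} {B'} h m≤n⇒m≤1+n b≤B)
        (Fu-right A (ωu-inert iA) (Fu-left {P = b ∷ B} {b ∷ B'} [ c ] (φu-inert nc) (Fu-joinʳ [ b ] h lt')))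
    where
    eq : Q ≡ A ++ c ∷ B'
    eq = trans (up-injective Q _ e) (++-assoc A [ c ] B')
    lt' : ωu i [ b ] < φu i B
    lt' = subst (ωu i [ b ] <_) (φu≈ (A ++ c ∷ B) B (≈-trans (≈-≡ (cong (K i) (trans (sym (++-assoc A [ c ] B)) (cong ((A ++ [ c ]) ++_) (sym (++-identityʳ B)))))) (≈-drop (A ++ [ c ]) B [] (All.++⁺ iA nc) []))) lt
  go (op-cl refl refl) with Fu-split [ suc i ] (A ++ i ∷ B) f
  ... | inj₁ (_ , g , _) = ⊥-elim (1+n≢n (proj₁ (F-single g)))
  ... | inj₂ (Q , g , refl , lt) with Fu-split A (i ∷ B) g
  ...   | inj₁ (_ , _ , _ , le) = ⊥-elim (<⇒≱ (subst₂ _<_ (sym (ωu-le A≤c)) (sym (φ-cl i (K i B))) (s≤s z≤n)) le)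
  ...   | inj₂ (Q₁ , g₁ , e₁ , lt₁) with Fu-φ0ʳ [ i ] B (no-cl b≤B 0) g₁
  ...     | b' , g₂ , e₂ with le-shape (proj₁ (WI-++⁻ A (i ∷ B) s)) A≤c
  ...       | inj₁ iA = ⊥-elim (<-irrefl (sym (trans (trans (cong (φ 0) (kinds-up-++ i A (i ∷ B))) (φ-inert 0 iA _)) (trans (φ-cl i _) (cong suc (no-cl b≤B 0)))))
                (subst (_< φu i (A ++ i ∷ B)) (ω-op i 0 []) lt))
  -- Once `c` has become `suc i` it is no longer smaller than `b`, so `b` now replaces the last `i`
  -- of `A`. Such an `i` exists, since `b` would otherwise match `c` and nothing could be raised.
  ...       | inj₂ (A₀ , refl) = done (suc i) A₀ i (suc i ∷ B) (cong (λ z → up (suc i ∷ z)) eq) (subst WI eq (wiF {Q} g)) ≤-refl (≤-refl ∷ b≤B)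
                (subst (λ y → F i (up y) (up (A₀ ++ suc i ∷ suc i ∷ B ++ [ i ]))) (sym (++-assoc A₀ [ i ] (suc i ∷ B ++ [ i ])))
                  (F-at i A₀ (suc i ∷ B ++ [ i ]) (ωu-le (All.++⁻ˡ A₀ A≤c)) p0))
    where
    eq : Q ≡ A₀ ++ i ∷ suc i ∷ B
    eq = trans (up-injective Q _ e₁) (trans (cong ((A₀ ++ [ i ]) ++_) (trans (up-injective Q₁ _ e₂) (cong (_++ B) (up-injective b' _ (proj₂ (F-single g₂))))))
          (++-assoc A₀ [ i ] (suc i ∷ B)))
    p0 : φu i (suc i ∷ B ++ [ i ]) ≡ 0
    p0 = trans (φu-++ i (suc i ∷ B) [ i ]) (cong₂ _+_ (no-cl (≤-refl ∷ b≤B) 0) (⇒φ0 (ωu i (suc i ∷ B)) (K i [ i ])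
           (subst₂ _≤_ (sym (φ-cl i [])) (sym (ω-op i 0 (K i B))) (ω-gt b≤B 1))))

NatF-BD : NatF BD
NatF-BD = record
  { φ≡ = λ { {i} (bd b A c B s p q) → φu≈ (b ∷ A ++ c ∷ B) (A ++ b ∷ B ++ [ c ]) (BD-≈ i b A c B (All-heads (proj₂ (proj₂ (WI-++⁻ A (c ∷ B) s)))) p q) }
  ; ω≡ = λ { {i} (bd b A c B s p q) → ωu≈ (b ∷ A ++ c ∷ B) (A ++ b ∷ B ++ [ c ]) (BD-≈ i b A c B (All-heads (proj₂ (proj₂ (WI-++⁻ A (c ∷ B) s)))) p q) }
  ; simF = λ { (bd b A c B s p q) f → BD-sim b A c B s p q f } }

-- Row insertion of primed letters.  A row is read backwards:
-- up J ++ ⟨ m , μ ⟩ ∷ up E, only the middle element m carrying a prime.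

Pre : ℕ → List ℕ → ℕ → List ℕ → Set
Pre x A b B = SD (A ++ b ∷ B) × x ≤ b × All (_< x) B

-- Bump x r r' c: inserting x into r gives r' and expels c.  bumpU keeps the
-- position of the middle element, bumpN and bumpX move it by one place.
data Bump : PN → Word → Word → PN → Set where
  bumpU : ∀ x π A b B m μ A′ c B′ → Pre x A b B → m < x → All (m <_) (A ++ b ∷ B) →
    WI (m ∷ A′ ++ c ∷ B′) → c < b → All (b ≤_) B′ → 1 ≤ m →
    Bump ⟨ x , π ⟩ (up (A ++ b ∷ B) ++ ⟨ m , μ ⟩ ∷ up (A′ ++ c ∷ B′))
      (up (A ++ x ∷ B) ++ ⟨ m , μ ⟩ ∷ up (A′ ++ b ∷ B′)) ⟨ c , π ⟩
  bumpN : ∀ x π A b B B₀ y c μ B′ → x ∷ B ≡ B₀ ++ [ y ] → Pre x A b B → All (c <_) (A ++ b ∷ B) →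
    All (b ≤_) B′ → WI B′ → 1 ≤ c → 1 ≤ x →
    Bump ⟨ x , π ⟩ (up (A ++ b ∷ B) ++ ⟨ c , μ ⟩ ∷ up B′)
      (up (A ++ B₀) ++ ⟨ y , π ⟩ ∷ up (b ∷ B′)) ⟨ c , μ ⟩
  bumpX : ∀ x π A b m μ A′ c B′ → SD (A ++ [ b ]) → x ≤ m → All (m <_) (A ++ [ b ]) →
    WI (m ∷ A′ ++ c ∷ B′) → c < b → All (b ≤_) B′ → 1 ≤ x →
    Bump ⟨ x , π ⟩ (up (A ++ [ b ]) ++ ⟨ m , μ ⟩ ∷ up (A′ ++ c ∷ B′))
      (up A ++ ⟨ x , π ⟩ ∷ up (m ∷ A′ ++ b ∷ B′)) ⟨ c , μ ⟩

-- App x r r' o: the row r' is r with x appended; o is the prime not placed in r'.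
data App : PN → Word → Word → Bool → Set where
  appD : ∀ x π m μ E → x ≤ m → WI (m ∷ E) → 1 ≤ x →
    App ⟨ x , π ⟩ (⟨ m , μ ⟩ ∷ up E) (⟨ x , π ⟩ ∷ up (m ∷ E)) μ
  appI : ∀ x π J m μ E → SD (x ∷ J) → All (m <_) (x ∷ J) → WI (m ∷ E) → 1 ≤ m →
    App ⟨ x , π ⟩ (up J ++ ⟨ m , μ ⟩ ∷ up E) (up (x ∷ J) ++ ⟨ m , μ ⟩ ∷ up E) π

-- Naturality of row insertion for the odd operators

Big : ℕ → Word → Set
Big k = All (λ y → k ≤ base y)

big-up : ∀ {k w} → All (k ≤_) w → Big k (up w)
big-up = All.map⁺

big2-bit1 : ∀ {w} → Big 2 w → bit1 w ≡ nothing
big2-bit1 [] = refl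
big2-bit1 {⟨ suc (suc _) , _ ⟩ ∷ w} (s≤s (s≤s z≤n) ∷ ps) = big2-bit1 ps

big3-first : ∀ {w} → Big 3 w → first12 w ≡ nothing
big3-first [] = refl
big3-first {⟨ suc (suc (suc _)) , _ ⟩ ∷ w} (s≤s (s≤s (s≤s z≤n)) ∷ ps) = big3-first ps

first-1-at : ∀ {u p v} → Big 3 u → first12 (u ++ ⟨ 1 , p ⟩ ∷ v) ≡ just 1
first-1-at {u} b = first12-++-none u _ (big3-first b)

E1-at : ∀ {u p v} → Big 3 u → E1 (u ++ ⟨ 2 , p ⟩ ∷ v) ≡ just (u ++ swapBits 1 p v (bit1 v))
E1-at {u} b = E1-++-none u _ (big3-first b)

swap-none : ∀ {p v} → Big 2 v → swapBits 1 p v (bit1 v) ≡ ⟨ 1 , p ⟩ ∷ v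
swap-none b rewrite big2-bit1 b = refl

swap-at : ∀ {p u q v} → Big 2 u → swapBits 1 p (u ++ ⟨ 1 , q ⟩ ∷ v) (bit1 (u ++ ⟨ 1 , q ⟩ ∷ v)) ≡ ⟨ 1 , q ⟩ ∷ u ++ ⟨ 1 , p ⟩ ∷ v
swap-at {p} {u} {q} {v} b rewrite bit1-++-none u (⟨ 1 , q ⟩ ∷ v) (big2-bit1 b) | setb1-++-none p u (⟨ 1 , q ⟩ ∷ v) (big2-bit1 b) = refl

E1-swap : ∀ {u p v w} → Big 3 u → swapBits 1 p v (bit1 v) ≡ w → E1 (u ++ ⟨ 2 , p ⟩ ∷ v) ≡ just (u ++ w)
E1-swap b refl = E1-at b

-- A related pair is inspected twice: here for its first letter 1, whose prime agrees on both sides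
-- and may be replaced simultaneously, and in `OddView` for the action of `E1`. Together the views
-- give all of `NatE`.
data OneView (R : Word → Word → Set) (a a' : Word) : Set where
  no-one : bit1 a ≡ nothing → bit1 a' ≡ nothing → OneView R a a'
  one-at : ∀ u p v u' v' → a ≡ u ++ ⟨ 1 , p ⟩ ∷ v → a' ≡ u' ++ ⟨ 1 , p ⟩ ∷ v' → Big 2 u → Big 2 u' →
    (∀ q → R (u ++ ⟨ 1 , q ⟩ ∷ v) (u' ++ ⟨ 1 , q ⟩ ∷ v')) → OneView R a a'

data OddView (R : Word → Word → Set) (a a' : Word) : Set where
  no-odd : ∀ {t} → first12 a ≡ t → first12 a' ≡ t → t ≢ just 2 → OddView R a a'
  odd : ∀ b b' → E1 a ≡ just b → E1 a' ≡ just b' → R b b' → OddView R a a'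

views⇒NatE : ∀ {R : Rel} → (∀ {a a'} → R a a' → OneView R a a') → (∀ {a a'} → R a a' → OddView R a a') → NatE R
views⇒NatE {R} one od = record { first≡ = fe ; bit≡ = be ; set-R = se ; simE = sim }
  where
  fe : ∀ {a a'} → R a a' → first12 a ≡ first12 a'
  fe {a} {a'} x with od x
  ... | no-odd p q _ = trans p (sym q)
  ... | odd _ _ p q _ = trans (E1-some a p) (sym (E1-some a' q))
  be : ∀ {a a'} → R a a' → bit1 a ≡ bit1 a'
  be x with one x
  ... | no-one p q = trans p (sym q)
  ... | one-at u p v u' v' refl refl b b' _ = trans (bit1-++-none u _ (big2-bit1 b)) (sym (bit1-++-none u' _ (big2-bit1 b')))
  se : ∀ {a a'} q → R a a' → R (setb1 q a) (setb1 q a')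
  se {a} {a'} q x with one x
  ... | no-one p p' rewrite setb1-none q a p | setb1-none q a' p' = x
  ... | one-at u p v u' v' refl refl b b' r = subst₂ R (sym (setb1-++-none q u _ (big2-bit1 b))) (sym (setb1-++-none q u' _ (big2-bit1 b'))) (r q)
  sim : ∀ {a a' b} → R a a' → E1 a ≡ just b → ∃ λ b' → E1 a' ≡ just b' × R b b'
  sim {a} x e with od x
  ... | no-odd p _ ne2 = ⊥-elim (ne2 (trans (sym p) (E1-some a e)))
  ... | odd b b' p q r with trans (sym p) e
  ...   | refl = b' , q , r

data AppR (o : Bool) : Rel where
  appR : ∀ {x r r'} → App x r r' o → AppR o (x ∷ r) r'

data BumpR (L : ℕ) : Rel where
  bumpR : ∀ {x r r' c} → length r' ≡ L → Bump x r r' c → BumpR L (x ∷ r) (r' ++ [ c ])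

two-last : ∀ {J} → SD J → All (2 ≤_) J → All (3 ≤_) J ⊎ ∃ λ J₀ → J ≡ J₀ ++ [ 2 ] × All (3 ≤_) J₀
two-last {[]} s b = inj₁ []
two-last {y ∷ J} (a , s) (p ∷ b) with m≤n⇒m<n∨m≡n p
two-last {y ∷ J} (a , s) (p ∷ b) | inj₁ q with two-last s b
... | inj₁ r = inj₁ (q ∷ r)
... | inj₂ (J₀ , refl , r) = inj₂ (y ∷ J₀ , refl , q ∷ r)
two-last {_ ∷ []} (a , s) (p ∷ b) | inj₂ refl = inj₂ ([] , refl , [])
two-last {_ ∷ z ∷ J} ((q ∷ _) , s) (p ∷ r ∷ b) | inj₂ refl = ⊥-elim (<-irrefl refl (<-≤-trans q r))

≥1-cases : ∀ {m} → 1 ≤ m → m ≡ 1 ⊎ m ≡ 2 ⊎ 3 ≤ m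
≥1-cases {1} p = inj₁ refl
≥1-cases {2} p = inj₂ (inj₁ refl)
≥1-cases {suc (suc (suc _))} p = inj₂ (inj₂ (s≤s (s≤s (s≤s z≤n))))

WI-tail≥ : ∀ {k m E} → k ≤ m → WI (m ∷ E) → All (k ≤_) (m ∷ E)
WI-tail≥ p (a , _) = p ∷ All.map (≤-trans p) a

app-one : ∀ {o a a'} → AppR o a a' → OneView (AppR o) a a'
app-one (appR (appD x π m μ E x≤m s 1≤x)) with m≤n⇒m<n∨m≡n 1≤x
... | inj₂ refl = one-at [] π _ [] _ refl refl [] [] (λ q → appR (appD 1 q m μ E x≤m s 1≤x))
... | inj₁ 2≤x = no-one (big2-bit1 (2≤x ∷ All.head r ∷ big-up (All.tail r))) (big2-bit1 (2≤x ∷ big-up r))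
  where r = WI-tail≥ (≤-trans 2≤x x≤m) s
app-one (appR (appI x π J m μ E d (m<x ∷ m<J) s 1≤m)) with m≤n⇒m<n∨m≡n 1≤m
... | inj₂ refl = one-at (⟨ x , π ⟩ ∷ up J) μ _ (up (x ∷ J)) _ refl refl (m<x ∷ big-up m<J) (big-up (m<x ∷ m<J)) (λ q → appR (appI x π J 1 q E d (m<x ∷ m<J) s 1≤m))
... | inj₁ 2≤m = no-one (big2-bit1 (≤-trans 2≤m (<⇒≤ m<x) ∷ All.++⁺ (big-up g) t)) (big2-bit1 (≤-trans 2≤m (<⇒≤ m<x) ∷ All.++⁺ (big-up g) t))
  where g = All.map (λ p → ≤-trans 2≤m (<⇒≤ p)) m<J
        r = WI-tail≥ 2≤m s
        t = All.head r ∷ big-up (All.tail r)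

app-odd : ∀ {o a a'} → AppR o a a' → OddView (AppR o) a a'
app-odd (appR (appD x π m μ E x≤m s 1≤x)) with ≥1-cases 1≤x
... | inj₁ refl = no-odd refl refl (λ ())
... | inj₂ (inj₁ refl) = odd _ _ (E1-swap [] (swap-none {π} (All.head r ∷ big-up (All.tail r)))) (E1-swap [] (swap-none {π} (big-up r))) (appR (appD 1 π m μ E (≤-trans (s≤s z≤n) x≤m) s ≤-refl))
  where r = WI-tail≥ x≤m s
... | inj₂ (inj₂ 3≤x) = no-odd (big3-first (3≤x ∷ All.head r ∷ big-up (All.tail r))) (big3-first (3≤x ∷ big-up r)) (λ ())
  where r = WI-tail≥ (≤-trans 3≤x x≤m) s
app-odd (appR (appI x π J m μ E (x>J , d) (m<x ∷ m<J) s 1≤m)) with ≥1-cases (≤-trans 1≤m (<⇒≤ m<x))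
... | inj₁ refl = ⊥-elim (<⇒≱ m<x 1≤m)
app-odd (appR (appI x π [] m μ E (x>J , d) (m<x ∷ m<J) s 1≤m)) | inj₂ (inj₁ refl) with ≤-antisym (≤-pred m<x) 1≤m
-- Lowered to 1, the appended letter becomes the middle element, and `appI` turns into `appD`.
-- Because `E1` has exchanged the primes, the prime left over is still `π`.
... | refl = odd _ _ refl refl (appR (appD 1 μ 1 π E ≤-refl s ≤-refl))
app-odd (appR (appI x π (j ∷ J) m μ E ((j<x ∷ x>J) , d) (m<x ∷ m<j ∷ m<J) s 1≤m)) | inj₂ (inj₁ refl) = ⊥-elim (<⇒≱ m<j (≤-trans (≤-pred j<x) 1≤m))
app-odd (appR (appI x π J m μ E (x>J , d) (m<x ∷ m<J) s 1≤m)) | inj₂ (inj₂ 3≤x) with two-last d (All.map (≤-trans (s≤s 1≤m)) m<J)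
... | inj₂ (J₀ , refl , r) with ≤-antisym (≤-pred (All.head (All.++⁻ʳ J₀ m<J))) 1≤m
-- The 2 at the end of `J`, once lowered, takes over the role and the prime of the middle element;
-- the former middle element joins the weakly increasing part unprimed.
...   | refl = odd (⟨ x , π ⟩ ∷ up J₀ ++ ⟨ 1 , μ ⟩ ∷ ⟨ 1 , false ⟩ ∷ up E) _
          (trans (cong (λ z → E1 (⟨ x , π ⟩ ∷ z)) (trans (cong (_++ ⟨ 1 , μ ⟩ ∷ up E) (up-++ J₀ [ 2 ])) (++-assoc (up J₀) _ _))) (E1-at {⟨ x , π ⟩ ∷ up J₀} (3≤x ∷ big-up r)))
          (trans (cong (λ z → E1 (⟨ x , false ⟩ ∷ z)) (trans (cong (_++ ⟨ 1 , μ ⟩ ∷ up E) (up-++ J₀ [ 2 ])) (++-assoc (up J₀) _ _))) (E1-at {⟨ x , false ⟩ ∷ up J₀} (3≤x ∷ big-up r)))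
          (appR (appI x π J₀ 1 μ (1 ∷ E) (All.++⁻ˡ J₀ x>J , proj₁ (SD-++⁻ J₀ _ d)) (m<x ∷ All.++⁻ˡ J₀ m<J) (≤-refl ∷ proj₁ s , s) ≤-refl))
app-odd (appR (appI x π J m μ E (x>J , d) (m<x ∷ m<J) s 1≤m)) | inj₂ (inj₂ 3≤x) | inj₁ r with ≥1-cases 1≤m
... | inj₁ refl = no-odd (first-1-at {⟨ x , π ⟩ ∷ up J} (3≤x ∷ big-up r)) (first-1-at {up (x ∷ J)} (3≤x ∷ big-up r)) (λ ())
... | inj₂ (inj₁ refl) = odd _ _ (E1-swap {⟨ x , π ⟩ ∷ up J} (3≤x ∷ big-up r) (swap-none t)) (E1-swap {up (x ∷ J)} (3≤x ∷ big-up r) (swap-none t))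
      (appR (appI x π J 1 μ E (x>J , d) (<-trans (n<1+n 1) m<x ∷ All.map (<-trans (n<1+n 1)) m<J) (All.map (≤-trans (n≤1+n 1)) (proj₁ s) , proj₂ s) ≤-refl))
  where t = big-up (proj₁ s)
... | inj₂ (inj₂ 3≤m) = no-odd (big3-first (3≤x ∷ All.++⁺ (big-up r) t)) (big3-first (3≤x ∷ All.++⁺ (big-up r) t)) (λ ())
  where t = 3≤m ∷ big-up (All.map (≤-trans 3≤m) (proj₁ s))

NatE-App : ∀ {o} → NatE (AppR o)
NatE-App = views⇒NatE app-one app-odd

module _ {L : ℕ} where

  private
    R = BumpR L

    assoc : ∀ (u : Word) y v z → (u ++ y ∷ v) ++ [ z ] ≡ u ++ y ∷ v ++ [ z ]
    assoc u y v z = ++-assoc u (y ∷ v) [ z ]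

    len : ∀ (u : Word) {y y' v z z'} → length (u ++ y ∷ v) ≡ L → u ++ y' ∷ z' ≡ z → length v ≡ length z' → length z ≡ L
    len u {v = v} l refl e = trans (length-++ u) (trans (cong (λ t → length u + suc t) (sym e)) (trans (sym (length-++ u)) l))

    bigU : ∀ {k A b B m A′ c B′} x → k ≤ m → m < x → All (m <_) (A ++ b ∷ B) → WI (m ∷ A′ ++ c ∷ B′) → c < b → All (b ≤_) B′ →
      k ≤ x × All (k ≤_) (A ++ b ∷ B) × All (k ≤_) (A′ ++ c ∷ B′) × All (k ≤_) (A ++ x ∷ B) × All (k ≤_) (A′ ++ b ∷ B′) × k ≤ c
    bigU {k} {A} {b} {B} {m} {A′} {c} {B′} x k≤m m<x m<J (s , _) c<b b≤B′ =
      k<x , j , e , All.++⁺ (All.++⁻ˡ A j) (k<x ∷ All.tail (All.++⁻ʳ A j)) , All.++⁺ (All.++⁻ˡ A′ e) (kb ∷ All.map (≤-trans kb) b≤B′) , All.head (All.++⁻ʳ A′ e)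
      where
      k<x = ≤-trans k≤m (<⇒≤ m<x)
      j = All.map (λ p → ≤-trans k≤m (<⇒≤ p)) m<J
      e = All.map (≤-trans k≤m) s
      kb = All.head (All.++⁻ʳ A j)

    none-between : ∀ {x c B} → All (_< x) B → All (c <_) B → x ≤ suc c → B ≡ []
    none-between [] [] le = refl
    none-between (p ∷ _) (q ∷ _) le = ⊥-elim (<⇒≱ q (≤-pred (≤-trans p le)))

    snoc-[] : ∀ {x y : ℕ} {B₀} → [ x ] ≡ B₀ ++ [ y ] → B₀ ≡ [] × y ≡ x
    snoc-[] {B₀ = []} refl = refl , refl
    snoc-[] {B₀ = _ ∷ []} ()
    snoc-[] {B₀ = _ ∷ _ ∷ _} ()

    tailJ : ∀ {P : ℕ → Set} A {b B} → All P (A ++ b ∷ B) → All P B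
    tailJ A p = All.tail (All.++⁻ʳ A p)

  bump-one : ∀ {a a'} → R a a' → OneView R a a'
  bump-one (bumpR l (bumpU x π A b B m μ A′ c B′ pre m<x m<J s c<b b≤B′ 1≤m)) with m≤n⇒m<n∨m≡n 1≤m
  ... | inj₂ refl = one-at (⟨ x , π ⟩ ∷ up (A ++ b ∷ B)) μ _ (up (A ++ x ∷ B)) _ refl (assoc (up (A ++ x ∷ B)) _ _ _)
        (m<x ∷ big-up m<J) (big-up (All.++⁺ (All.++⁻ˡ A m<J) (m<x ∷ tailJ A m<J)))
        (λ q → subst (R _) (assoc (up (A ++ x ∷ B)) _ _ _) (bumpR (len (up (A ++ x ∷ B)) l refl refl) (bumpU x π A b B 1 q A′ c B′ pre m<x m<J s c<b b≤B′ 1≤m)))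
  ... | inj₁ 2≤m with bigU {A = A} {B = B} {A′ = A′} x 2≤m m<x m<J s c<b b≤B′
  ...   | p , j , e , j' , e' , q = no-one (big2-bit1 (p ∷ All.++⁺ (big-up j) (2≤m ∷ big-up e))) (big2-bit1 (All.++⁺ (All.++⁺ (big-up j') (2≤m ∷ big-up e')) (q ∷ [])))
  bump-one (bumpR l (bumpN x π A b B B₀ y c μ B′ eq pre@(sd , x≤b , B<x) c<J b≤B′ s 1≤c 1≤x)) with m≤n⇒m<n∨m≡n 1≤x
  ... | inj₂ refl with none-between B<x (tailJ A c<J) (s≤s z≤n)
  ...   | refl with snoc-[] eq
  ...     | refl , refl = one-at [] π _ (up (A ++ [])) _ refl (assoc (up (A ++ [])) _ _ _) []
            (big-up (All.++⁺ (All.map (≤-trans (s≤s 1≤c)) (All.++⁻ˡ A c<J)) []))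
            (λ q → subst (R _) (assoc (up (A ++ [])) _ _ _) (bumpR (len (up (A ++ [])) l refl refl) (bumpN 1 q A b [] [] 1 c μ B′ refl pre c<J b≤B′ s 1≤c ≤-refl)))
  bump-one (bumpR l (bumpN x π A b B B₀ y c μ B′ eq pre@(sd , x≤b , B<x) c<J b≤B′ s 1≤c 1≤x)) | inj₁ 2≤x with m≤n⇒m<n∨m≡n 1≤c
  ... | inj₂ refl = one-at (⟨ x , π ⟩ ∷ up (A ++ b ∷ B)) μ _ (up (A ++ B₀) ++ ⟨ y , π ⟩ ∷ up (b ∷ B′)) _ refl refl (2≤x ∷ big-up c<J)
        (All.++⁺ (big-up (All.++⁺ (All.++⁻ˡ A c<J) (All.++⁻ˡ B₀ xB))) (All.head (All.++⁻ʳ B₀ xB) ∷ big-up (kb ∷ All.map (≤-trans kb) b≤B′)))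
        (λ q → bumpR l (bumpN x π A b B B₀ y 1 q B′ eq pre c<J b≤B′ s 1≤c 1≤x))
    where
    xB : All (2 ≤_) (B₀ ++ [ y ])
    xB = subst (All (2 ≤_)) eq (2≤x ∷ tailJ A c<J)
    kb = All.head (All.++⁻ʳ A c<J)
  ... | inj₁ 2≤c = no-one (big2-bit1 (2≤x ∷ All.++⁺ (big-up j) (2≤c ∷ big-up e)))
        (big2-bit1 (All.++⁺ (All.++⁺ (big-up (All.++⁺ (All.++⁻ˡ A j) (All.++⁻ˡ B₀ xB))) (All.head (All.++⁻ʳ B₀ xB) ∷ big-up (kb ∷ e))) (2≤c ∷ [])))
    where
    j = All.map (λ p → ≤-trans 2≤c (<⇒≤ p)) c<J
    xB : All (2 ≤_) (B₀ ++ [ y ])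
    xB = subst (All (2 ≤_)) eq (2≤x ∷ tailJ A j)
    kb = All.head (All.++⁻ʳ A j)
    e = All.map (≤-trans kb) b≤B′
  bump-one (bumpR l (bumpX x π A b m μ A′ c B′ sd x≤m m<J s c<b b≤B′ 1≤x)) with m≤n⇒m<n∨m≡n 1≤x
  ... | inj₂ refl = one-at [] π _ (up A) _ refl (assoc (up A) _ _ _) []
        (big-up (All.map (≤-trans (s≤s x≤m)) (All.++⁻ˡ A m<J)))
        (λ q → subst (R _) (assoc (up A) _ _ _) (bumpR (len (up A) l refl refl) (bumpX 1 q A b m μ A′ c B′ sd x≤m m<J s c<b b≤B′ ≤-refl)))
  ... | inj₁ 2≤x with bigU {A = A} {B = []} {A′ = A′} (suc m) (≤-trans 2≤x x≤m) ≤-refl m<J s c<b b≤B′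
  ...   | p , j , e , j' , e' , q = no-one (big2-bit1 (2≤x ∷ All.++⁺ (big-up j) (≤-trans 2≤x x≤m ∷ big-up e)))
          (big2-bit1 (All.++⁺ (All.++⁺ (big-up (All.++⁻ˡ A j)) (2≤x ∷ ≤-trans 2≤x x≤m ∷ big-up e')) (q ∷ [])))

  private

    flat₀ : ∀ u (x : ℕ) (v : Word) → up (u ++ [ x ]) ++ v ≡ up u ++ ⟨ x , false ⟩ ∷ v
    flat₀ u x v = trans (cong (_++ v) (up-++ u [ x ])) (++-assoc (up u) _ _)

    flat₁ : ∀ A b B₁ (v : Word) → up (A ++ b ∷ B₁ ++ [ 2 ]) ++ v ≡ up (A ++ b ∷ B₁) ++ ⟨ 2 , false ⟩ ∷ v
    flat₁ A b B₁ v = trans (cong (λ z → up z ++ v) (sym (++-assoc A (b ∷ B₁) [ 2 ]))) (flat₀ (A ++ b ∷ B₁) 2 v)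

  -- Lowering a 2 next to a middle element 1 can change the constructor of `Bump` and with it the
  -- case of the prime rule. The exchange of primes made by `E1` is what keeps the two sides
  -- related.
  bump-odd : ∀ {a a'} → R a a' → OddView R a a'
  bump-odd (bumpR l (bumpU x π A b B m μ A′ c B′ pre@(sd , x≤b , B<x) m<x m<J s c<b b≤B′ 1≤m)) with ≥1-cases (≤-trans 1≤m (<⇒≤ m<x))
  ... | inj₁ refl = ⊥-elim (<⇒≱ m<x 1≤m)
  ... | inj₂ (inj₁ refl) with ≤-antisym (≤-pred m<x) 1≤m
  ...   | refl with none-between B<x (tailJ A m<J) ≤-refl
  ...     | refl = odd _ _ (E1-swap [] (swap-at {u = up (A ++ [ b ])} (big-up m<J)))
            (trans (cong E1 (trans (assoc (up (A ++ [ 2 ])) ⟨ 1 , μ ⟩ _ _) (flat₀ A 2 _))) (E1-at (big-up (All.map (≤-trans (s≤s x≤b)) A>b))))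
            -- `bumpU` becomes `bumpX`: the inserted letter, now 1 with prime `μ`, is the new middle
            -- element, and the old one hands its prime `π` to the expelled letter, which had `π`
            -- before.
            (subst (R _) (assoc (up A) _ _ _) (bumpR (trans (len1 A) l) (bumpX 1 μ A b 1 π A′ c B′ sd ≤-refl m<J s c<b b≤B′ ≤-refl)))
    where
    A>b = All-heads (proj₂ (proj₂ (SD-++⁻ A [ b ] sd)))
    len1 : ∀ A {p q r : PN} {v : Word} → length (up A ++ p ∷ q ∷ v) ≡ length (up (A ++ [ 2 ]) ++ r ∷ v)
    len1 [] = refl
    len1 (_ ∷ A) = cong suc (len1 A)
  bump-odd (bumpR l (bumpU x π A b B m μ A′ c B′ pre@(sd , x≤b , B<x) m<x m<J s c<b b≤B′ 1≤m)) | inj₂ (inj₂ 3≤x)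
    with two-last (proj₂ (proj₁ (proj₂ (SD-++⁻ A (b ∷ B) sd)))) (All.map (≤-trans (s≤s 1≤m)) (tailJ A m<J))
  ... | inj₂ (B₁ , refl , r) with ≤-antisym (≤-pred (All.head (All.++⁻ʳ B₁ (tailJ A m<J)))) 1≤m
  ...   | refl = odd _ _
          (trans (cong (λ z → E1 (⟨ x , π ⟩ ∷ z)) (flat₁ A b B₁ _)) (E1-at {⟨ x , π ⟩ ∷ up (A ++ b ∷ B₁)} (3≤x ∷ big-up (All.++⁺ A3 (3≤b ∷ r)))))
          (trans (cong E1 (trans (assoc (up (A ++ x ∷ B₁ ++ [ 2 ])) _ _ _) (flat₁ A x B₁ _))) (E1-at {up (A ++ x ∷ B₁)} (big-up (All.++⁺ A3 (3≤x ∷ r)))))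
          (subst (R _) (assoc (up (A ++ x ∷ B₁)) _ _ _)
            (bumpR (trans (len2 (up (A ++ x ∷ B₁))) (trans (cong length (sym (flat₁ A x B₁ _))) l))
              (bumpU x π A b B₁ 1 μ (1 ∷ A′) c B′ (proj₁ (SD-++⁻ (A ++ b ∷ B₁) [ 2 ] (subst SD as sd)) , x≤b , All.++⁻ˡ B₁ B<x) m<x
                (All.++⁻ˡ (A ++ b ∷ B₁) (subst (All (1 <_)) as m<J)) (≤-refl ∷ proj₁ s , s) c<b b≤B′ ≤-refl)))
    where
    3≤b = ≤-trans 3≤x x≤b
    A3 : All (3 ≤_) A
    A3 = All.map (λ p → ≤-trans 3≤b (<⇒≤ p)) (All-heads (proj₂ (proj₂ (SD-++⁻ A _ sd))))
    as : A ++ b ∷ B₁ ++ [ 2 ] ≡ (A ++ b ∷ B₁) ++ [ 2 ]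
    as = sym (++-assoc A (b ∷ B₁) [ 2 ])
    len2 : ∀ u {p q r : PN} {v : Word} → length (u ++ p ∷ ⟨ 1 , false ⟩ ∷ v) ≡ length (u ++ q ∷ r ∷ v)
    len2 [] = refl
    len2 (_ ∷ u) = cong suc (len2 u)
  bump-odd (bumpR l (bumpU x π A b B m μ A′ c B′ pre@(sd , x≤b , B<x) m<x m<J s c<b b≤B′ 1≤m)) | inj₂ (inj₂ 3≤x) | inj₁ r = go (≥1-cases 1≤m)
    where
    3≤b = ≤-trans 3≤x x≤b
    A3 : All (3 ≤_) A
    A3 = All.map (λ p → ≤-trans 3≤b (<⇒≤ p)) (All-heads (proj₂ (proj₂ (SD-++⁻ A _ sd))))
    J3 : Big 3 (⟨ x , π ⟩ ∷ up (A ++ b ∷ B))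
    J3 = 3≤x ∷ big-up (All.++⁺ A3 (3≤b ∷ r))
    J3' = big-up (All.++⁺ A3 (3≤x ∷ r))
    P = up (A ++ x ∷ B)
    go : m ≡ 1 ⊎ m ≡ 2 ⊎ 3 ≤ m → OddView R (⟨ x , π ⟩ ∷ up (A ++ b ∷ B) ++ ⟨ m , μ ⟩ ∷ up (A′ ++ c ∷ B′)) ((P ++ ⟨ m , μ ⟩ ∷ up (A′ ++ b ∷ B′)) ++ [ ⟨ c , π ⟩ ])
    go (inj₁ refl) = no-odd (first-1-at {⟨ x , π ⟩ ∷ up (A ++ b ∷ B)} J3) (trans (cong first12 (assoc P _ _ _)) (first-1-at {P} J3')) (λ ())
    go (inj₂ (inj₁ refl)) with bigU {A = A} {B = B} {A′ = A′} x ≤-refl m<x m<J s c<b b≤B′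
    ... | p , j , e , j' , e' , q = odd _ _ (E1-swap {⟨ x , π ⟩ ∷ up (A ++ b ∷ B)} J3 (swap-none (big-up e)))
          (trans (cong E1 (assoc P _ _ _)) (E1-swap {P} J3' (swap-none (All.++⁺ (big-up e') (q ∷ [])))))
          (subst (R _) (assoc P _ _ _) (bumpR (len P l refl refl) (bumpU x π A b B 1 μ A′ c B′ pre (<-trans (n<1+n 1) m<x) (All.map (<-trans (n<1+n 1)) m<J)
            (All.map (≤-trans (n≤1+n 1)) (proj₁ s) , proj₂ s) c<b b≤B′ ≤-refl)))
    go (inj₂ (inj₂ 3≤m)) with bigU {A = A} {B = B} {A′ = A′} x 3≤m m<x m<J s c<b b≤B′
    ... | p , j , e , j' , e' , q = no-odd (big3-first (p ∷ All.++⁺ (big-up j) (3≤m ∷ big-up e))) (big3-first (All.++⁺ (All.++⁺ (big-up j') (3≤m ∷ big-up e')) (q ∷ []))) (λ ())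
  bump-odd (bumpR l (bumpN x π A b B B₀ y c μ B′ eq pre@(sd , x≤b , B<x) c<J b≤B′ s 1≤c 1≤x)) = go (≥1-cases 1≤x)
    where
    A>b = All-heads (proj₂ (proj₂ (SD-++⁻ A (b ∷ B) sd)))
    c<b = All.head (All.++⁻ʳ A c<J)
    2≤b = ≤-trans (s≤s 1≤c) c<b
    A3 : All (3 ≤_) A
    A3 = All.map (≤-trans (s≤s 2≤b)) A>b
    Goal = OddView R (⟨ x , π ⟩ ∷ up (A ++ b ∷ B) ++ ⟨ c , μ ⟩ ∷ up B′) ((up (A ++ B₀) ++ ⟨ y , π ⟩ ∷ up (b ∷ B′)) ++ [ ⟨ c , μ ⟩ ])
    ge : ∀ {k} → k ≤ b → All (k ≤_) (b ∷ B′)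
    ge p = p ∷ All.map (≤-trans p) b≤B′
    go3 : 3 ≤ x → All (3 ≤_) B ⊎ (∃ λ B₁ → B ≡ B₁ ++ [ 2 ] × All (3 ≤_) B₁) → Goal
    go3 3≤x (inj₂ (B₁ , refl , r)) with ≤-antisym (≤-pred (All.head (All.++⁻ʳ B₁ (tailJ A c<J)))) 1≤c | ∷ʳ-injective (x ∷ B₁) B₀ eq
    ... | refl | refl , refl = odd _ _
          (trans (cong (λ z → E1 (⟨ x , π ⟩ ∷ z)) (flat₁ A b B₁ _)) (E1-at {⟨ x , π ⟩ ∷ up (A ++ b ∷ B₁)} (3≤x ∷ big-up (All.++⁺ A3 (≤-trans 3≤x x≤b ∷ r)))))
          (trans (cong E1 (assoc (up (A ++ x ∷ B₁)) _ _ _)) (E1-swap {up (A ++ x ∷ B₁)} (big-up (All.++⁺ A3 (3≤x ∷ r))) (swap-at {u = up (b ∷ B′)} (big-up (ge 2≤b)))))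
          -- `bumpN` becomes `bumpU`: the lowered letter at the end of `B` is the middle element
          -- with prime `μ` and keeps its place, so the expelled 1 carries `π`.
          (subst (R _) (assoc (up (A ++ x ∷ B₁)) _ _ _) (bumpR (len (up (A ++ x ∷ B₁)) l refl refl)
            (bumpU x π A b B₁ 1 μ [] 1 B′ (proj₁ (SD-++⁻ (A ++ b ∷ B₁) [ 2 ] (subst SD as sd)) , x≤b , All.++⁻ˡ B₁ B<x) (≤-trans (s≤s (s≤s z≤n)) 3≤x)
              (All.++⁻ˡ (A ++ b ∷ B₁) (subst (All (1 <_)) as c<J)) (≤-refl ∷ w , w , s) c<b b≤B′ ≤-refl)))
      where
      as : A ++ b ∷ B₁ ++ [ 2 ] ≡ (A ++ b ∷ B₁) ++ [ 2 ]
      as = sym (++-assoc A (b ∷ B₁) [ 2 ])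
      w : All (1 ≤_) B′
      w = All.map (≤-trans (<⇒≤ c<b)) b≤B′
    go3 3≤x (inj₁ r) = go4 (≥1-cases 1≤c)
      where
      J3 : Big 3 (⟨ x , π ⟩ ∷ up (A ++ b ∷ B))
      J3 = 3≤x ∷ big-up (All.++⁺ A3 (≤-trans 3≤x x≤b ∷ r))
      xB : All (3 ≤_) (B₀ ++ [ y ])
      xB = subst (All (3 ≤_)) eq (3≤x ∷ r)
      J3' : Big 3 (up (A ++ B₀) ++ ⟨ y , π ⟩ ∷ up (b ∷ B′))
      J3' = All.++⁺ (big-up (All.++⁺ A3 (All.++⁻ˡ B₀ xB))) (All.head (All.++⁻ʳ B₀ xB) ∷ big-up (ge (≤-trans 3≤x x≤b)))
      go4 : c ≡ 1 ⊎ c ≡ 2 ⊎ 3 ≤ c → Goal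
      go4 (inj₁ refl) = no-odd (first-1-at {⟨ x , π ⟩ ∷ up (A ++ b ∷ B)} J3) (first-1-at J3') (λ ())
      go4 (inj₂ (inj₁ refl)) = odd _ _ (E1-swap {⟨ x , π ⟩ ∷ up (A ++ b ∷ B)} J3 (swap-none (big-up (All.tail (ge 2≤b))))) (E1-swap J3' refl)
        (bumpR l (bumpN x π A b B B₀ y 1 μ B′ eq pre (All.map (<-trans (n<1+n 1)) c<J) b≤B′ s ≤-refl 1≤x))
      go4 (inj₂ (inj₂ 3≤c)) = no-odd (big3-first (3≤x ∷ All.++⁺ (big-up (All.++⁺ A3 (≤-trans 3≤x x≤b ∷ r))) (3≤c ∷ big-up (All.tail (ge (≤-trans 3≤x x≤b))))))
        (big3-first (All.++⁺ J3' (3≤c ∷ []))) (λ ())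
    go2 : x ≡ 2 → c ≡ 1 ⊎ 2 ≤ c → Goal
    go2 refl q with none-between B<x (tailJ A c<J) (s≤s 1≤c)
    ... | refl with snoc-[] eq
    go2 refl (inj₁ refl) | refl | refl , refl = odd _ _ (E1-swap [] (swap-at {u = up (A ++ [ b ])} (big-up c<J)))
      (trans (cong E1 (assoc (up (A ++ [])) _ _ _)) (E1-swap (big-up (All.++⁺ A3 [])) (swap-at {u = up (b ∷ B′)} (big-up (ge 2≤b)))))
      (subst (R _) (assoc (up (A ++ [])) _ _ _) (bumpR (len (up (A ++ [])) l refl refl) (bumpN 1 μ A b [] [] 1 1 π B′ refl (sd , ≤-trans (s≤s z≤n) x≤b , []) c<J b≤B′ s ≤-refl ≤-refl)))
    go2 refl (inj₂ 2≤c) | refl | refl , refl = odd _ _ (E1-swap [] (swap-none (All.++⁺ (big-up (All.map (λ p → ≤-trans 2≤c (<⇒≤ p)) c<J)) (2≤c ∷ big-up (All.tail (ge 2≤b))))))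
      (trans (cong E1 (assoc (up (A ++ [])) _ _ _)) (E1-swap (big-up (All.++⁺ A3 [])) (swap-none (All.++⁺ (big-up (ge 2≤b)) (2≤c ∷ [])))))
      (subst (R _) (assoc (up (A ++ [])) _ _ _) (bumpR (len (up (A ++ [])) l refl refl) (bumpN 1 π A b [] [] 1 c μ B′ refl (sd , ≤-trans (s≤s z≤n) x≤b , []) c<J b≤B′ s 1≤c ≤-refl)))
    go : x ≡ 1 ⊎ x ≡ 2 ⊎ 3 ≤ x → Goal
    go (inj₁ refl) with none-between B<x (tailJ A c<J) (s≤s z≤n)
    ... | refl with snoc-[] eq
    ...   | refl , refl = no-odd refl (trans (cong first12 (assoc (up (A ++ [])) _ _ _)) (first-1-at (big-up (All.++⁺ A3 [])))) (λ ())
    go (inj₂ (inj₁ e)) with m≤n⇒m<n∨m≡n 1≤c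
    ... | inj₂ q = go2 e (inj₁ (sym q))
    ... | inj₁ q = go2 e (inj₂ q)
    go (inj₂ (inj₂ 3≤x)) = go3 3≤x (two-last (proj₂ (proj₁ (proj₂ (SD-++⁻ A (b ∷ B) sd)))) (All.map (≤-trans (s≤s 1≤c)) (tailJ A c<J)))
  bump-odd (bumpR l (bumpX x π A b m μ A′ c B′ sd x≤m m<J s c<b b≤B′ 1≤x)) = go (≥1-cases 1≤x)
    where
    A>b = All-heads (proj₂ (proj₂ (SD-++⁻ A [ b ] sd)))
    A3 : All (3 ≤_) A
    A3 = All.map (≤-trans (s≤s (≤-trans (s≤s (≤-trans 1≤x x≤m)) (All.head (All.++⁻ʳ A m<J))))) A>b
    go : x ≡ 1 ⊎ x ≡ 2 ⊎ 3 ≤ x → OddView R (⟨ x , π ⟩ ∷ up (A ++ [ b ]) ++ ⟨ m , μ ⟩ ∷ up (A′ ++ c ∷ B′)) ((up A ++ ⟨ x , π ⟩ ∷ up (m ∷ A′ ++ b ∷ B′)) ++ [ ⟨ c , μ ⟩ ])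
    go (inj₁ refl) = no-odd refl (trans (cong first12 (assoc (up A) _ _ _)) (first-1-at (big-up A3))) (λ ())
    go (inj₂ (inj₁ refl)) with bigU {A = A} {B = []} {A′ = A′} (suc m) x≤m ≤-refl m<J s c<b b≤B′
    ... | p , j , e , j' , e' , q = odd _ _ (E1-swap [] (swap-none (All.++⁺ (big-up j) (x≤m ∷ big-up e))))
          (trans (cong E1 (assoc (up A) _ _ _)) (E1-swap (big-up A3) (swap-none (x≤m ∷ All.++⁺ (big-up e') (q ∷ [])))))
          (subst (R _) (assoc (up A) _ _ _) (bumpR (len (up A) l refl refl) (bumpX 1 π A b m μ A′ c B′ sd (≤-trans (s≤s z≤n) x≤m) m<J s c<b b≤B′ ≤-refl)))
    go (inj₂ (inj₂ 3≤x)) with bigU {A = A} {B = []} {A′ = A′} (suc m) (≤-trans 3≤x x≤m) ≤-refl m<J s c<b b≤B′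
    ... | p , j , e , j' , e' , q = no-odd (big3-first (3≤x ∷ All.++⁺ (big-up j) (≤-trans 3≤x x≤m ∷ big-up e)))
          (big3-first (All.++⁺ (All.++⁺ (big-up A3) (3≤x ∷ ≤-trans 3≤x x≤m ∷ big-up e')) (q ∷ []))) (λ ())

  NatE-Bump : NatE R
  NatE-Bump = views⇒NatE bump-one bump-odd

-- Words with a single marked prime

mark : ℕ → Bool → List ℕ → Word
mark k μ [] = []
mark zero μ (x ∷ w) = ⟨ x , μ ⟩ ∷ up w
mark (suc k) μ (x ∷ w) = ⟨ x , false ⟩ ∷ mark k μ w

mark-++ : ∀ J μ m E → mark (length J) μ (J ++ m ∷ E) ≡ up J ++ ⟨ m , μ ⟩ ∷ up E
mark-++ [] μ m E = refl
mark-++ (j ∷ J) μ m E = cong (_ ∷_) (mark-++ J μ m E)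

base-mark : ∀ k μ w → map base (mark k μ w) ≡ w
base-mark k μ [] = refl
base-mark zero μ (x ∷ w) = cong (x ∷_) (base-up w)
base-mark (suc k) μ (x ∷ w) = cong (x ∷_) (base-mark k μ w)

length-mark : ∀ k μ w → length (mark k μ w) ≡ length w
length-mark k μ w = trans (sym (length-map base (mark k μ w))) (cong length (base-mark k μ w))

primed-up : ∀ v w → length v ≡ length w → map primed (up v) ≡ map primed (up w)
primed-up [] [] e = refl
primed-up (x ∷ v) (y ∷ w) e = cong (false ∷_) (primed-up v w (suc-injective e))

primed-mark : ∀ k μ v w → length v ≡ length w → map primed (mark k μ v) ≡ map primed (mark k μ w)
primed-mark k μ [] [] e = refl
primed-mark zero μ (x ∷ v) (y ∷ w) e = cong (μ ∷_) (primed-up v w (suc-injective e))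
primed-mark (suc k) μ (x ∷ v) (y ∷ w) e = cong (false ∷_) (primed-mark k μ v w (suc-injective e))

pn-≡ : ∀ a b → map base a ≡ map base b → map primed a ≡ map primed b → a ≡ b
pn-≡ [] [] p q = refl
pn-≡ (⟨ x , s ⟩ ∷ a) (⟨ y , t ⟩ ∷ b) p q with ∷-injective p | ∷-injective q
... | refl , p' | refl , q' = cong (_ ∷_) (pn-≡ a b p' q')

F-base : ∀ {i a b} → F i a b → F i (up (map base a)) (up (map base b)) × map primed a ≡ map primed b
F-base {i} (mkF u p v refl refl a b) = subst₂ (F i) (cong up (sym (map-++ base u _))) (cong up (sym (map-++ base u _)))
    (F-at i (map base u) (map base v) (trans (cong (ω 0) (kinds-base i u)) a) (trans (cong (φ 0) (kinds-base i v)) b)) ,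
  trans (map-++ primed u _) (sym (map-++ primed u _))

base-split : ∀ a u y v → map base a ≡ u ++ y ∷ v → ∃ λ a₁ → ∃ λ p → ∃ λ a₂ → a ≡ a₁ ++ ⟨ y , p ⟩ ∷ a₂ × map base a₁ ≡ u × map base a₂ ≡ v
base-split (⟨ z , p ⟩ ∷ a) [] y v e with ∷-injective e
... | refl , e' = [] , p , a , refl , refl , e'
base-split (x ∷ a) (z ∷ u) y v e with ∷-injective e
... | refl , e' with base-split a u y v e'
...   | a₁ , p , a₂ , refl , e₁ , e₂ = x ∷ a₁ , p , a₂ , refl , cong (_ ∷_) e₁ , e₂

-- `F` reads and changes bases only, so a step between base words lifts to words with equal
-- sequences of primes. This reduces naturality for `F` to unprimed rows.
F-lift : ∀ {i a b} → map primed a ≡ map primed b → F i (up (map base a)) (up (map base b)) → F i a b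
F-lift {i} {a} {b} e f with F-position {w = map base a} f
... | position u v s t pa pb with base-split a u i v s
...   | a₁ , p , a₂ , refl , refl , refl = mkF a₁ p a₂ refl
          (pn-≡ b _ (trans (up-injective _ _ t) (sym (map-++ base a₁ _))) (trans (sym e) (trans (map-++ primed a₁ _) (sym (map-++ primed a₁ _)))))
          (trans (sym (cong (ω 0) (kinds-base i a₁))) pa) (trans (sym (cong (φ 0) (kinds-base i a₂))) pb)

φW-base : ∀ i a → φW i a ≡ φu i (map base a)
φW-base i a = cong (φ 0) (sym (kinds-base i a))

ωW-base : ∀ i a → ωW i a ≡ ωu i (map base a)
ωW-base i a = cong (ω 0) (sym (kinds-base i a))

++-inj-len : ∀ {A : Set} (u u' : List A) {v v'} → length u ≡ length u' → u ++ v ≡ u' ++ v' → u ≡ u' × v ≡ v'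
++-inj-len [] [] l e = refl , e
++-inj-len (x ∷ u) (y ∷ u') l e with ∷-injective e
... | refl , e' with ++-inj-len u u' (suc-injective l) e'
...   | refl , e'' = refl , e''

-- The prescribed length allows a concatenation of related words to be cut again at the right place.
data EqL (k : ℕ) : Rel where
  eql : ∀ u → length u ≡ k → EqL k u u

NatF-EqL : ∀ {k} → NatF (EqL k)
NatF-EqL = record { φ≡ = λ { (eql u l) → refl } ; ω≡ = λ { (eql u l) → refl } ; simF = λ { (eql u l) f → _ , f , eql _ (trans (sym (F-length f)) l) } }

E1-length : ∀ w {v} → E1 w ≡ just v → length v ≡ length w
setb1-length : ∀ q w → length (setb1 q w) ≡ length w
setb1-length q w = trans (sym (length-map base (setb1 q w))) (trans (cong length (base-setb1 q w)) (length-map base w))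
E1-length (⟨ 0 , p ⟩ ∷ w) e with E1 w in q
E1-length (⟨ 0 , p ⟩ ∷ w) refl | just v = cong suc (E1-length w q)
E1-length (⟨ 2 , p ⟩ ∷ w) e with bit1 w
E1-length (⟨ 2 , p ⟩ ∷ w) refl | nothing = refl
E1-length (⟨ 2 , p ⟩ ∷ w) refl | just r = cong suc (setb1-length p w)
E1-length (⟨ suc (suc (suc _)) , p ⟩ ∷ w) e with E1 w in q
E1-length (⟨ suc (suc (suc _)) , p ⟩ ∷ w) refl | just v = cong suc (E1-length w q)

NatE-EqL : ∀ {k} → NatE (EqL k)
NatE-EqL = record { first≡ = λ { (eql u l) → refl } ; bit≡ = λ { (eql u l) → refl }
  ; set-R = λ { q (eql u l) → eql _ (trans (setb1-length q u) l) } ; simE = λ { (eql u l) e → _ , e , eql _ (trans (E1-length u e) l) } }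

-- Row bumping of unprimed rows as a composite of the two elementary insertions

BB : ℕ → Rel
BB k = (BI k ⊗ _≡_) ⨾ (EqL k ⊗ BD)

NatF-BB : ∀ {k} → NatF (BB k)
NatF-BB = NatF-⨾ (NatF-⊗ NatF-BI NatF-≡) (NatF-⊗ NatF-EqL NatF-BD)

-- Bumping in coordinates, and its naturality for `F`

record Seg (k : ℕ) (w v : List ℕ) : Set where
  constructor seg
  field
    x : ℕ
    A : List ℕ
    b : ℕ
    B A' : List ℕ
    c : ℕ
    B' : List ℕ
    w≡ : w ≡ x ∷ (A ++ b ∷ B) ++ A' ++ c ∷ B'
    v≡ : v ≡ ((A ++ x ∷ B) ++ A' ++ b ∷ B') ++ [ c ]
    pre : Pre x A b B
    wi : WI (A' ++ c ∷ B')
    c<b : c < b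
    b≤B' : All (b ≤_) B'
    len : length (A ++ b ∷ B) ≡ k

length-swap : ∀ (A : List ℕ) {x y : ℕ} {B : List ℕ} → length (A ++ x ∷ B) ≡ length (A ++ y ∷ B)
length-swap A = trans (length-++ A) (sym (length-++ A))

Seg⇒BB : ∀ {k w v} → Seg k w v → BB k (up w) (up v)
Seg⇒BB {k} (seg x A b B A' c B' refl refl (sd , x≤b , B<x) wi c<b b≤B' l) =
  subst₂ (BB _) (sym (up-++ (x ∷ A ++ b ∷ B) (A' ++ c ∷ B'))) (trans (sym (up-++ (A ++ x ∷ B) _)) (cong up (trans (cong ((A ++ x ∷ B) ++_) (sym (++-assoc A' (b ∷ B') [ c ]))) (sym (++-assoc (A ++ x ∷ B) _ [ c ])))))
    (comp (tens (bi x A b B sd x≤b B<x l) refl)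
      (subst (λ z → (EqL k ⊗ BD) z (up (A ++ x ∷ B) ++ up (A' ++ b ∷ B' ++ [ c ]))) (sym mid) (tens (eql (up (A ++ x ∷ B)) (trans (length-map _ (A ++ x ∷ B)) (trans (length-swap A) l))) (bd b A' c B' wi c<b b≤B'))))
  where
  mid : up (A ++ x ∷ B ++ [ b ]) ++ up (A' ++ c ∷ B') ≡ up (A ++ x ∷ B) ++ up (b ∷ A' ++ c ∷ B')
  mid = trans (sym (up-++ (A ++ x ∷ B ++ [ b ]) _)) (trans (cong up (trans (cong (_++ A' ++ c ∷ B') (sym (++-assoc A (x ∷ B) [ b ]))) (++-assoc (A ++ x ∷ B) [ b ] _))) (up-++ (A ++ x ∷ B) _))

⊗⁻ : ∀ {R S W V} → (R ⊗ S) W V → ∃₂ λ a a' → ∃₂ λ b b' → W ≡ a ++ b × V ≡ a' ++ b' × R a a' × S b b'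
⊗⁻ (tens x y) = _ , _ , _ , _ , refl , refl , x , y

-- The intermediate word is cut once by `BI` and once by `BD`. The fixed length `k` makes the two
-- cuts coincide, so the letter expelled by the first bump is the one inserted by the second.
BB⇒Seg : ∀ {k w v} → BB k (up w) (up v) → Seg k w v
BB⇒Seg {k} {w} {v} (comp {b = M} p q) with ⊗⁻ p | ⊗⁻ q
... | _ , _ , e , .e , W≡ , M≡ , bi x A b B sd x≤b B<x l , refl | u , .u , _ , _ , M≡' , V≡ , eql .u lu , bd b' A' c B' wi c<b b≤B'
  with ++-inj-len (up (A ++ x ∷ B)) u (trans (length-map _ (A ++ x ∷ B)) (trans (length-swap A) (trans l (sym lu))))
    (trans (sym (trans (cong (_++ e) (trans (cong up (sym (++-assoc A (x ∷ B) [ b ]))) (up-++ (A ++ x ∷ B) [ b ]))) (++-assoc (up (A ++ x ∷ B)) _ e))) (trans (sym M≡) M≡'))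
... | refl , e' with ∷-injective e'
...   | refl , refl = seg x A b B A' c B'
          (up-injective w _ (trans W≡ (sym (up-++ (x ∷ A ++ b ∷ B) _))))
          (up-injective v _ (trans V≡ (trans (sym (up-++ (A ++ x ∷ B) _)) (cong up (trans (cong ((A ++ x ∷ B) ++_) (sym (++-assoc A' (b ∷ B') [ c ]))) (sym (++-assoc (A ++ x ∷ B) _ [ c ])))))))
          (sd , x≤b , B<x) wi c<b b≤B' l

-- Each letter of `J` exceeds the next letter, and from the middle element on none does, so the word
-- itself tells where `J` ends.
Hook-unique : ∀ {k l w} → Hook k w → Hook l w → k ≡ l
Hook-unique (hook J m E eq refl d jm s) (hook J' m' E' eq' refl d' jm' s') = go J J' (trans (sym eq) eq') d jm d' jm' s s'
  where
  go : ∀ J J' {m E m' E'} → J ++ m ∷ E ≡ J' ++ m' ∷ E' → SD J → All (m <_) J → SD J' → All (m' <_) J' → WI (m ∷ E) → WI (m' ∷ E') → length J ≡ length J'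
  go [] [] e _ _ _ _ _ _ = refl
  go (x ∷ J) (y ∷ J') e (_ , d) (_ ∷ jm) (_ , d') (_ ∷ jm') s s' = cong suc (go J J' (∷-injectiveʳ e) d jm d' jm' s s')
  go [] (y ∷ J') refl _ _ (_ , d') (lt ∷ jm') (a , s) s' = ⊥-elim (<⇒≱ lt (All.head (All.++⁻ʳ J' a)))
  go (y ∷ J) [] refl (_ , d) (lt ∷ jm) _ _ s (a , s') = ⊥-elim (<⇒≱ lt (All.head (All.++⁻ʳ J a)))

SD-swap : ∀ {x A b B} → Pre x A b B → SD (A ++ x ∷ B)
SD-swap {x} {A} {b} {B} (sd , x≤b , B<x) with SD-++⁻ A (b ∷ B) sd
... | a , (_ , s) , r = SD-++⁺ A (x ∷ B) a (B<x , s) (All.map (λ { (p ∷ q) → ≤-<-trans x≤b p ∷ q }) r)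

WI-swap : ∀ {b A c B} → WI (A ++ c ∷ B) → c < b → All (b ≤_) B → WI (A ++ b ∷ B)
WI-swap {b} {A} {c} {B} s c<b b≤B with WI-++⁻ A (c ∷ B) s
... | a , (_ , t) , r = WI-++⁺ A (b ∷ B) a (b≤B , t) (All.map (λ { (p ∷ q) → ≤-trans p (<⇒≤ c<b) ∷ q }) r)

hookU : ∀ {x A b B m A′ c B′} → Pre x A b B → m < x → All (m <_) (A ++ b ∷ B) → WI (m ∷ A′ ++ c ∷ B′) → c < b → All (b ≤_) B′ →
  Hook (length (A ++ x ∷ B)) ((A ++ x ∷ B) ++ m ∷ A′ ++ b ∷ B′)
hookU {A = A} {A′ = A′} p m<x m<J s c<b b≤B = hook _ _ _ refl refl (SD-swap p) (All.++⁺ (All.++⁻ˡ A m<J) (m<x ∷ All.tail (All.++⁻ʳ A m<J))) (WI-swap {A = _ ∷ A′} s c<b b≤B)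

hookN : ∀ {x A b B B₀ y B′} → x ∷ B ≡ B₀ ++ [ y ] → Pre x A b B → All (b ≤_) B′ → WI B′ →
  Hook (length (A ++ B₀)) ((A ++ B₀) ++ y ∷ b ∷ B′)
hookN {x} {A} {b} {B} {B₀} {y} eq p@(sd , x≤b , B<x) b≤B s = hook _ _ _ refl refl (proj₁ t) (All-heads (proj₂ (proj₂ t)))
    ((y≤b ∷ All.map (≤-trans y≤b) b≤B) , b≤B , s)
  where
  t = SD-++⁻ (A ++ B₀) [ y ] (subst SD (trans (cong (A ++_) eq) (sym (++-assoc A B₀ [ y ]))) (SD-swap p))
  y≤b : y ≤ b
  y≤b = All.head (All.++⁻ʳ B₀ (subst (All (_≤ b)) eq (x≤b ∷ All.map (λ q → ≤-trans (<⇒≤ q) x≤b) B<x)))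

hookX : ∀ {x A b m A′ c B′} → SD (A ++ [ b ]) → x ≤ m → All (m <_) (A ++ [ b ]) → WI (m ∷ A′ ++ c ∷ B′) → c < b → All (b ≤_) B′ →
  Hook (length A) (A ++ x ∷ m ∷ A′ ++ b ∷ B′)
hookX {x} {A} {b} {m} {A′} {c} {B′} sd x≤m m<J s c<b b≤B = hook A x _ refl refl (proj₁ (SD-++⁻ A _ sd)) (All.map (≤-<-trans x≤m) (All.++⁻ˡ A m<J))
  (WI-tail≥ x≤m t , t)
  where t = WI-swap {b} {m ∷ A′} {c} {B′} s c<b b≤B

choose : {A : Set} → Bool → A → A → A
choose b x y = if b then x else y

-- Coordinates adapted to `F`: the base words move inside `BB`, while `k`, `k'` and the primes stay
-- fixed. The case of the prime rule depends on `k` and `k'` alone and is therefore stable.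
record Form (x : PN) (r r' : Word) (c : PN) : Set where
  constructor form
  field
    k k' : ℕ
    μ : Bool
    w w' : List ℕ
    cb : ℕ
    r≡ : r ≡ mark k μ w
    r'≡ : r' ≡ mark k' (choose (k ≡ᵇ k') μ (primed x)) w'
    c≡ : c ≡ ⟨ cb , choose (k ≡ᵇ k') (primed x) μ ⟩
    hk : Hook k w
    hk' : Hook k' w'
    sg : Seg k (base x ∷ w) (w' ++ [ cb ])
    pos : All (1 ≤_) (base x ∷ w)

suc≢ᵇ : ∀ k → (suc k ≡ᵇ k) ≡ false
suc≢ᵇ k = ≢⇒≡ᵇ {suc k} {k} 1+n≢n

length-snoc : ∀ (A : List ℕ) b → length (A ++ [ b ]) ≡ suc (length A)
length-snoc A b = trans (length-++ A) (+-comm _ 1)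

lengthN : ∀ {x : ℕ} A {b : ℕ} {B B₀} {y : ℕ} → x ∷ B ≡ B₀ ++ [ y ] → length (A ++ b ∷ B) ≡ suc (length (A ++ B₀))
lengthN {x} A {b} {B} {B₀} {y} eq = trans (length-swap A {b} {x} {B}) (trans (cong (λ (z : List ℕ) → length (A ++ z)) eq) (trans (cong length (sym (++-assoc A B₀ [ y ]))) (length-snoc (A ++ B₀) y)))

Bump⇒Form : ∀ {x r r' c} → Bump x r r' c → Form x r r' c
Bump⇒Form (bumpU x π A b B m μ A′ c B′ pre m<x m<J s c<b b≤B′ 1≤m) = form (length (A ++ b ∷ B)) (length (A ++ x ∷ B)) μ _ ((A ++ x ∷ B) ++ m ∷ A′ ++ b ∷ B′) c
  (sym (mark-++ (A ++ b ∷ B) μ m _))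
  (trans (sym (mark-++ (A ++ x ∷ B) μ m _)) (cong (λ z → mark (length (A ++ x ∷ B)) (choose z μ π) ((A ++ x ∷ B) ++ m ∷ A′ ++ b ∷ B′)) (sym e)))
  (cong (λ z → ⟨ c , choose z π μ ⟩) (sym e))
  (hook _ _ _ refl refl (proj₁ pre) m<J s) (hookU {A = A} {A′ = A′} pre m<x m<J s c<b b≤B′)
  (seg x A b B (m ∷ A′) c B′ refl refl pre s c<b b≤B′ refl)
  (≤-trans 1≤m (<⇒≤ m<x) ∷ All.++⁺ (All.map (λ p → ≤-trans 1≤m (<⇒≤ p)) m<J) (WI-tail≥ 1≤m s))
  where e : (length (A ++ b ∷ B) ≡ᵇ length (A ++ x ∷ B)) ≡ true
        e rewrite length-swap A {b} {x} {B} = ≡ᵇ-refl (length (A ++ x ∷ B))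
Bump⇒Form (bumpN x π A b B B₀ y c μ B′ eq pre c<J b≤B′ s 1≤c 1≤x) = form (length (A ++ b ∷ B)) (length (A ++ B₀)) μ _ ((A ++ B₀) ++ y ∷ b ∷ B′) c
  (sym (mark-++ (A ++ b ∷ B) μ c _))
  (trans (sym (mark-++ (A ++ B₀) π y _)) (cong (λ z → mark (length (A ++ B₀)) (choose z μ π) ((A ++ B₀) ++ y ∷ b ∷ B′)) (sym e)))
  (cong (λ z → ⟨ c , choose z π μ ⟩) (sym e))
  (hook _ _ _ refl refl (proj₁ pre) c<J wi) (hookN {A = A} eq pre b≤B′ s)
  (seg x A b B [] c B′ refl (cong (_++ [ c ]) (trans (++-assoc A B₀ _) (trans (cong (A ++_) (trans (sym (++-assoc B₀ [ y ] (b ∷ B′))) (cong (_++ b ∷ B′) (sym eq)))) (sym (++-assoc A (x ∷ B) (b ∷ B′)))))) pre wi c<b b≤B′ refl)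
  (1≤x ∷ All.++⁺ (All.map (λ p → ≤-trans 1≤c (<⇒≤ p)) c<J) (WI-tail≥ 1≤c wi))
  where
  c<b = All.head (All.++⁻ʳ A c<J)
  wi : WI (c ∷ B′)
  wi = All.map (≤-trans (<⇒≤ c<b)) b≤B′ , s
  e : (length (A ++ b ∷ B) ≡ᵇ length (A ++ B₀)) ≡ false
  e rewrite lengthN A {b} eq = suc≢ᵇ (length (A ++ B₀))
Bump⇒Form (bumpX x π A b m μ A′ c B′ sd x≤m m<J s c<b b≤B′ 1≤x) = form (length (A ++ [ b ])) (length A) μ _ (A ++ x ∷ m ∷ A′ ++ b ∷ B′) c
  (sym (mark-++ (A ++ [ b ]) μ m _))
  (trans (sym (mark-++ A π x _)) (cong (λ z → mark (length A) (choose z μ π) (A ++ x ∷ m ∷ A′ ++ b ∷ B′)) (sym e)))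
  (cong (λ z → ⟨ c , choose z π μ ⟩) (sym e))
  (hook _ _ _ refl refl sd m<J s) (hookX {A = A} {A′ = A′} sd x≤m m<J s c<b b≤B′)
  (seg x A b [] (m ∷ A′) c B′ refl (cong (_++ [ c ]) (sym (++-assoc A [ x ] _))) (sd , ≤-trans x≤m (<⇒≤ (All.head (All.++⁻ʳ A m<J))) , []) s c<b b≤B′ refl)
  (1≤x ∷ All.++⁺ (All.map (λ p → ≤-trans 1≤x (≤-trans x≤m (<⇒≤ p))) m<J) (WI-tail≥ (≤-trans 1≤x x≤m) s))
  where
  e : (length (A ++ [ b ]) ≡ᵇ length A) ≡ false
  e rewrite length-snoc A b = suc≢ᵇ (length A)

snoc : ∀ (x : ℕ) B → ∃₂ λ B₀ y → x ∷ B ≡ B₀ ++ [ y ]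
snoc x [] = [] , x , refl
snoc x (z ∷ B) with snoc z B
... | B₀ , y , e = x ∷ B₀ , y , cong (x ∷_) e

snoc-view : ∀ (v : List ℕ) {n} → length v ≡ suc n → ∃₂ λ B₀ y → v ≡ B₀ ++ [ y ] × length B₀ ≡ n
snoc-view (x ∷ v) e with snoc x v
... | B₀ , y , q = B₀ , y , q , suc-injective (trans (sym (length-snoc B₀ y)) (trans (cong length (sym q)) e))

none-below : ∀ {x m B} → All (_< x) B → All (m <_) B → x ≤ m → B ≡ []
none-below [] [] le = refl
none-below (p ∷ _) (q ∷ _) le = ⊥-elim (<⇒≱ (<-trans q p) le)

hook-tail : ∀ {i k x x₁ w w₁} → Hook k w → F i (up ([ x ] ++ w)) (up ([ x₁ ] ++ w₁)) → Hook k w₁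
hook-tail {i} {k} {x} {x₁} {w} {w₁} hk g with Fu-split [ x ] w g
... | inj₁ (u , q , e , _) = subst (Hook k) (sym (proj₂ (++-inj-len [ x₁ ] u (F-ulength {w = [ x ]} {u} q) (up-injective (x₁ ∷ w₁) _ e)))) hk
... | inj₂ (_ , q , e , _) = Hook-F hk (subst (λ z → F i (up w) (up z)) (sym (∷-injectiveʳ (up-injective (x₁ ∷ w₁) _ e))) q)

-- The rule is read off from the bases. If `A'` is empty, the middle element is expelled (`bumpN`);
-- otherwise `x` is at most the middle element and replaces it in this role (`bumpX`), or leaves it
-- in place (`bumpU`).
Form⇒Bump : ∀ {x r r' c} → Form x r r' c → Bump x r r' c
Form⇒Bump {⟨ x , π ⟩} (form k k' μ w w' cb refl refl refl (hook J m E refl lJ d m<J s) hk' (seg x₂ A b B A' c B' w≡ v≡ pre@(sd , x≤b , B<x) wi c<b b≤B' l) (1≤x ∷ p1))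
  with ∷-injective w≡ | ∷ʳ-injective w' _ v≡
... | refl , e | refl , refl
  with ++-inj-len J (A ++ b ∷ B) (trans lJ (sym l)) e
... | refl , e' with lJ
...   | refl = subst (λ z → Bump _ z _ _) (sym (mark-++ (A ++ b ∷ B) μ m E)) (go A' e' wi hk')
  where
  1≤m = All.head (All.++⁻ʳ J p1)
  Goal : List ℕ → Set
  Goal A' = Bump ⟨ x , π ⟩ (up (A ++ b ∷ B) ++ ⟨ m , μ ⟩ ∷ up E) (mark k' (choose (length (A ++ b ∷ B) ≡ᵇ k') μ π) ((A ++ x ∷ B) ++ A' ++ b ∷ B')) ⟨ c , choose (length (A ++ b ∷ B) ≡ᵇ k') π μ ⟩
  go : ∀ A' → m ∷ E ≡ A' ++ c ∷ B' → WI (A' ++ c ∷ B') → Hook k' ((A ++ x ∷ B) ++ A' ++ b ∷ B') → Goal A'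
  go [] refl wi h with snoc x B
  ... | B₀ , y , eq with Hook-unique h (subst (Hook (length (A ++ B₀))) re (hookN {x} {A} {b} {B} {B₀} {y} eq pre b≤B' (proj₂ wi)))
    where
    re : (A ++ B₀) ++ y ∷ b ∷ B' ≡ (A ++ x ∷ B) ++ b ∷ B'
    re = trans (++-assoc A B₀ _) (trans (cong (A ++_) (trans (sym (++-assoc B₀ [ y ] (b ∷ B'))) (cong (_++ b ∷ B') (sym eq)))) (sym (++-assoc A (x ∷ B) (b ∷ B'))))
  ...   | refl = subst₂ (Bump _ _)
      (trans (sym (mark-++ (A ++ B₀) π y (b ∷ B'))) (cong₂ (λ z t → mark (length (A ++ B₀)) (choose z μ π) t) (sym ne') re))
      (cong (λ z → ⟨ c , choose z π μ ⟩) (sym ne')) (bumpN x π A b B B₀ y c μ B' eq pre m<J b≤B' (proj₂ wi) 1≤m 1≤x)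
    where
    ne' : (length (A ++ b ∷ B) ≡ᵇ length (A ++ B₀)) ≡ false
    ne' rewrite lengthN A {b} eq = suc≢ᵇ (length (A ++ B₀))
    re : (A ++ B₀) ++ y ∷ b ∷ B' ≡ (A ++ x ∷ B) ++ b ∷ B'
    re = trans (++-assoc A B₀ _) (trans (cong (A ++_) (trans (sym (++-assoc B₀ [ y ] (b ∷ B'))) (cong (_++ b ∷ B') (sym eq)))) (sym (++-assoc A (x ∷ B) (b ∷ B'))))
  go (.m ∷ A″) refl wi h with x ≤? m
  ... | yes x≤m with none-below B<x (All.tail (All.++⁻ʳ A m<J)) x≤m
  ...   | refl with Hook-unique h (subst (Hook (length A)) (sym (++-assoc A [ x ] _)) (hookX {x} {A} {b} {m} {A″} {c} {B'} sd x≤m m<J wi c<b b≤B'))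
  ...     | refl = subst₂ (Bump _ _)
      (trans (sym (mark-++ A π x _)) (cong₂ (λ z t → mark (length A) (choose z μ π) t) (sym ne') (sym (++-assoc A [ x ] _))))
      (cong (λ z → ⟨ c , choose z π μ ⟩) (sym ne')) (bumpX x π A b m μ A″ c B' sd x≤m m<J wi c<b b≤B' 1≤x)
    where
    ne' : (length (A ++ [ b ]) ≡ᵇ length A) ≡ false
    ne' rewrite length-snoc A b = suc≢ᵇ (length A)
  go (.m ∷ A″) refl wi h | no x≰m with Hook-unique h (hookU {x} {A} {b} {B} {m} {A″} {c} {B'} pre (≰⇒> x≰m) m<J wi c<b b≤B')
  ...   | refl = subst₂ (Bump _ _)
      (trans (sym (mark-++ (A ++ x ∷ B) μ m _)) (cong (λ z → mark (length (A ++ x ∷ B)) (choose z μ π) ((A ++ x ∷ B) ++ m ∷ A″ ++ b ∷ B')) (sym eq')))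
      (cong (λ z → ⟨ c , choose z π μ ⟩) (sym eq')) (bumpU x π A b B m μ A″ c B' pre (≰⇒> x≰m) m<J wi c<b b≤B' 1≤m)
    where
    eq' : (length (A ++ b ∷ B) ≡ᵇ length (A ++ x ∷ B)) ≡ true
    eq' rewrite length-swap A {b} {x} {B} = ≡ᵇ-refl (length (A ++ x ∷ B))

NatF-Bump : ∀ {L} → NatF (BumpR L)
NatF-Bump {L} = record
  { φ≡ = λ { {i} (bumpR l p) → inv (φW i) (φW-base i) (NatF.φ≡ NatF-BB) (Bump⇒Form p) }
  ; ω≡ = λ { {i} (bumpR l p) → inv (ωW i) (ωW-base i) (NatF.ω≡ NatF-BB) (Bump⇒Form p) }
  ; simF = λ { (bumpR l p) f → sim l (Bump⇒Form p) f } }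
  where
  base-snoc : ∀ (r' : Word) c → map base (r' ++ [ c ]) ≡ map base r' ++ [ base c ]
  base-snoc r' c = map-++ base r' [ c ]
  inv : ∀ {x r r' c} (g : Word → ℕ) → (∀ a → g a ≡ g (up (map base a))) → (∀ {k a b} → BB k a b → g a ≡ g b) → Form x r r' c → g (x ∷ r) ≡ g (r' ++ [ c ])
  inv {x} g gb gB (form k k' μ w w' cb refl refl refl hk hk' sg pos) =
    trans (gb (x ∷ mark k μ w)) (trans (cong (λ z → g (up (base x ∷ z))) (base-mark k μ w)) (trans (gB (Seg⇒BB sg))
      (trans (cong (g ∘ up) (sym (trans (base-snoc (mark k' _ w') _) (cong (_++ [ cb ]) (base-mark k' _ w'))))) (sym (gb _)))))
  sim : ∀ {i x r r' c b} → length r' ≡ L → Form x r r' c → F i (x ∷ r) b → ∃ λ b' → F i (r' ++ [ c ]) b' × BumpR L b b'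
  sim {b = []} l frm f with F-length f
  ... | ()
  sim {i} {⟨ x , π ⟩} {b = ⟨ x₁ , π₁ ⟩ ∷ b} l (form k k' μ w w' cb refl refl refl hk hk' sg pos) f with F-base f
  ... | g , bits with NatF.simF NatF-BB (Seg⇒BB sg) (subst (λ z → F i (up (x ∷ z)) _) (base-mark k μ w) g)
  ...   | _ , h , bb with F-up {w = w' ++ [ cb ]} h
  ...     | v , refl with snoc-view v (trans (sym (F-ulength {w = w' ++ [ cb ]} {v} h)) (length-snoc w' cb))
  ...       | w₁' , c₁ , refl , lw = _ , F-lift {b = mark k' β w₁' ++ [ ⟨ c₁ , γ ⟩ ]} bits' (subst₂ (F i) (sym (cong up (ends w' cb))) (sym (cong up (ends w₁' c₁))) h) , bumpR len' (Form⇒Bump frm)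
    where
    β = choose (k ≡ᵇ k') μ π
    γ = choose (k ≡ᵇ k') π μ
    w₁ = map base b
    ends : ∀ w' cb → map base (mark k' β w' ++ [ ⟨ cb , γ ⟩ ]) ≡ w' ++ [ cb ]
    ends w' cb = trans (base-snoc (mark k' β w') _) (cong (_++ [ cb ]) (base-mark k' β w'))
    bits' : map primed (mark k' β w' ++ [ ⟨ cb , γ ⟩ ]) ≡ map primed (mark k' β w₁' ++ [ ⟨ c₁ , γ ⟩ ])
    bits' = trans (map-++ primed (mark k' β w') _) (trans (cong (_++ [ γ ]) (primed-mark k' β w' w₁' (sym lw))) (sym (map-++ primed (mark k' β w₁') _)))
    lb : length w₁ ≡ length w
    lb = trans (length-map base b) (trans (sym (suc-injective (F-length f))) (trans (sym (length-map base (mark k μ w))) (cong length (base-mark k μ w))))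
    g' : F i (up ([ x ] ++ w)) (up ([ x₁ ] ++ w₁))
    g' = subst (λ z → F i (up (x ∷ z)) _) (base-mark k μ w) g
    hk₁ : Hook k w₁
    hk₁ = hook-tail hk g'
    hk₁' : Hook k' w₁'
    hk₁' with Fu-split w' [ cb ] h
    ... | inj₁ (u , q , e , _) = Hook-F hk' (subst (λ z → F i (up w') (up z)) (sym (proj₁ (++-inj-len w₁' u (trans lw (F-ulength {w = w'} {u} q)) (up-injective (w₁' ++ [ c₁ ]) _ e)))) q)
    ... | inj₂ (u , q , e , _) = subst (Hook k') (sym (proj₁ (++-inj-len w₁' w' lw (up-injective (w₁' ++ [ c₁ ]) _ e)))) hk'
    len' : length (mark k' β w₁') ≡ L
    len' = trans (trans (length-mark k' β w₁') lw) (trans (sym (length-mark k' β w')) l)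
    pos₁ : All (1 ≤_) (x₁ ∷ w₁)
    pos₁ = F-All {w = x ∷ w} {x₁ ∷ w₁} g' (λ _ → s≤s z≤n) pos
    bx : π ≡ π₁
    bx = ∷-injectiveˡ bits
    b≡ : b ≡ mark k μ w₁
    b≡ = pn-≡ b _ (sym (base-mark k μ w₁)) (trans (sym (∷-injectiveʳ bits)) (primed-mark k μ w w₁ (sym lb)))
    frm : Form ⟨ x₁ , π₁ ⟩ b (mark k' β w₁') ⟨ c₁ , γ ⟩
    frm = form k k' μ w₁ w₁' c₁ b≡ (cong (λ z → mark k' (choose (k ≡ᵇ k') μ z) w₁') bx) (cong (λ z → ⟨ c₁ , choose (k ≡ᵇ k') z μ ⟩) bx) hk₁ hk₁'
      (BB⇒Seg bb) pos₁

-- Positions are counted from the end of the row where the box is added, so the middle element keeps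
-- its place in the row exactly when `k'` is `suc k`.
record AForm (x : PN) (r r' : Word) (o : Bool) : Set where
  constructor aform
  field
    k k' : ℕ
    μ : Bool
    w : List ℕ
    r≡ : r ≡ mark k μ w
    r'≡ : r' ≡ mark k' (choose (k' ≡ᵇ suc k) μ (primed x)) (base x ∷ w)
    o≡ : o ≡ choose (k' ≡ᵇ suc k) (primed x) μ
    hk : Hook k w
    hk' : Hook k' (base x ∷ w)
    pos : All (1 ≤_) (base x ∷ w)

App⇒AForm : ∀ {x r r' o} → App x r r' o → AForm x r r' o
App⇒AForm (appD x π m μ E x≤m s 1≤x) = aform 0 0 μ (m ∷ E) refl refl refl (hook [] m E refl refl tt [] s)
  (hook [] x (m ∷ E) refl refl tt [] (WI-tail≥ x≤m s , s)) (1≤x ∷ WI-tail≥ (≤-trans 1≤x x≤m) s)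
App⇒AForm (appI x π J m μ E d mJ s 1≤m) = aform (length J) (suc (length J)) μ _ (sym (mark-++ J μ m E))
  (trans (sym (mark-++ (x ∷ J) μ m E)) (cong (λ z → mark (suc (length J)) (choose z μ π) (x ∷ J ++ m ∷ E)) (sym (≡ᵇ-refl (length J)))))
  (cong (λ z → choose z π μ) (sym (≡ᵇ-refl (length J))))
  (hook J m E refl refl (proj₂ d) (All.tail mJ) s) (hook (x ∷ J) m E refl refl d mJ s)
  (≤-trans 1≤m (<⇒≤ (All.head mJ)) ∷ All.++⁺ (All.map (λ p → ≤-trans 1≤m (<⇒≤ p)) (All.tail mJ)) (WI-tail≥ 1≤m s))

AForm⇒App : ∀ {x r r' o} → AForm x r r' o → App x r r' o
AForm⇒App {⟨ x , π ⟩} (aform k .0 μ w refl refl refl hk (hook [] .x .w refl refl _ _ (a , s)) (1≤x ∷ p1)) with hk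
... | hook [] m E refl refl _ _ s' = appD x π m μ E (All.head a) s' 1≤x
... | hook (j ∷ J) m E refl refl _ (lt ∷ _) s' = ⊥-elim (<⇒≱ lt (All.head (All.++⁻ʳ J (proj₁ s))))
AForm⇒App {⟨ x , π ⟩} (aform k k' μ w refl refl refl hk (hook (.x ∷ J) m E refl refl d mJ s) (1≤x ∷ p1)) with Hook-unique hk (hook J m E refl refl (proj₂ d) (All.tail mJ) s)
... | refl rewrite ≡ᵇ-refl (length J) | mark-++ J μ m E = appI x π J m μ E d mJ s (All.head (All.++⁻ʳ J p1))

NatF-App : ∀ {o} → NatF (AppR o)
NatF-App {o} = record
  { φ≡ = λ { {i} (appR p) → inv (φW i) (φW-base i) (App⇒AForm p) }
  ; ω≡ = λ { {i} (appR p) → inv (ωW i) (ωW-base i) (App⇒AForm p) }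
  ; simF = λ { (appR p) f → sim (App⇒AForm p) f } }
  where
  inv : ∀ {x r r'} (g : Word → ℕ) → (∀ a → g a ≡ g (up (map base a))) → AForm x r r' o → g (x ∷ r) ≡ g r'
  inv {x} g gb (aform k k' μ w refl refl o≡ hk hk' pos) =
    trans (gb (x ∷ mark k μ w)) (trans (cong (λ z → g (up (base x ∷ z))) (base-mark k μ w)) (trans (cong (g ∘ up) (sym (base-mark k' _ (base x ∷ w)))) (sym (gb _))))
  sim : ∀ {i x r r' b} → AForm x r r' o → F i (x ∷ r) b → ∃ λ b' → F i r' b' × AppR o b b'
  sim {b = []} frm f with F-length f
  ... | ()
  sim {i} {⟨ x , π ⟩} {b = ⟨ x₁ , π₁ ⟩ ∷ b} (aform k k' μ w refl refl refl hk hk' pos) f with F-base f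
  ... | g , bits = _ , F-lift {b = mark k' β (x₁ ∷ w₁)} (primed-mark k' β (x ∷ w) (x₁ ∷ w₁) (cong suc (sym lb))) (subst₂ (F i) (sym (cong up (base-mark k' β (x ∷ w)))) (sym (cong up (base-mark k' β (x₁ ∷ w₁)))) g')
      , appR (AForm⇒App (aform k k' μ w₁ b≡ (cong (λ z → mark k' (choose (k' ≡ᵇ suc k) μ z) (x₁ ∷ w₁)) bx) (cong (λ z → choose (k' ≡ᵇ suc k) z μ) bx) hk₁ (Hook-F hk' g') (F-All {w = x ∷ w} {x₁ ∷ w₁} g' (λ _ → s≤s z≤n) pos)))
    where
    β = choose (k' ≡ᵇ suc k) μ π
    w₁ = map base b
    lb : length w₁ ≡ length w
    lb = trans (length-map base b) (trans (sym (suc-injective (F-length f))) (trans (sym (length-map base (mark k μ w))) (cong length (base-mark k μ w))))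
    g' : F i (up ([ x ] ++ w)) (up ([ x₁ ] ++ w₁))
    g' = subst (λ z → F i (up (x ∷ z)) _) (base-mark k μ w) g
    hk₁ : Hook k w₁
    hk₁ = hook-tail hk g'
    bx : π ≡ π₁
    bx = ∷-injectiveˡ bits
    b≡ : b ≡ mark k μ w₁
    b≡ = pn-≡ b _ (sym (base-mark k μ w₁)) (trans (sym (∷-injectiveʳ bits)) (primed-mark k μ w w₁ (sym lb)))

-- Evaluating decIns on a reversed row

WD SI : List ℕ → Set
WD [] = ⊤
WD (x ∷ xs) = All (_≤ x) xs × WD xs
SI [] = ⊤
SI (x ∷ xs) = All (x <_) xs × SI xs

WD-snoc : ∀ u x → WD u → All (x ≤_) u → WD (u ++ [ x ])
WD-snoc [] x s a = [] , tt
WD-snoc (y ∷ u) x (b , s) (p ∷ a) = All.++⁺ b (p ∷ []) , WD-snoc u x s a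

SI-snoc : ∀ u x → SI u → All (_< x) u → SI (u ++ [ x ])
SI-snoc [] x s a = [] , tt
SI-snoc (y ∷ u) x (b , s) (p ∷ a) = All.++⁺ b (p ∷ []) , SI-snoc u x s a

All-reverse : ∀ {A : Set} {P : A → Set} (u : List A) → All P u → All P (reverse u)
All-reverse [] [] = []
All-reverse (x ∷ u) (p ∷ ps) rewrite unfold-reverse x u = All.++⁺ (All-reverse u ps) (p ∷ [])

WI-reverse : ∀ u → WI u → WD (reverse u)
WI-reverse [] s = tt
WI-reverse (x ∷ u) (a , s) rewrite unfold-reverse x u = WD-snoc (reverse u) x (WI-reverse u s) (All-reverse u a)

SD-reverse : ∀ u → SD u → SI (reverse u)
SD-reverse [] s = tt
SD-reverse (x ∷ u) (a , s) rewrite unfold-reverse x u = SI-snoc (reverse u) x (SD-reverse u s) (All-reverse u a)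

reverse-mid : ∀ {A : Set} (u : List A) x v → reverse (u ++ x ∷ v) ≡ reverse v ++ x ∷ reverse u
reverse-mid u x v = trans (reverse-++ u (x ∷ v)) (trans (cong (_++ reverse u) (unfold-reverse x v)) (++-assoc (reverse v) [ x ] (reverse u)))

≤ᵇ-true : ∀ {m n} → m ≤ n → (m ≤ᵇ n) ≡ true
≤ᵇ-true {m} {n} p with m ≤ᵇ n | ≤⇒≤ᵇ p
... | true | _ = refl

≤ᵇ-false : ∀ {m n} → n < m → (m ≤ᵇ n) ≡ false
≤ᵇ-false {m} {n} p with m ≤ᵇ n in eq
... | false = refl
... | true = ⊥-elim (<⇒≱ p (≤ᵇ⇒≤ m n (subst T (sym eq) tt)))

<ᵇ-true : ∀ {m n} → m < n → (m <ᵇ n) ≡ true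
<ᵇ-true {m} {n} p with m <ᵇ n | <⇒<ᵇ p
... | true | _ = refl

<ᵇ-false : ∀ {m n} → n ≤ m → (m <ᵇ n) ≡ false
<ᵇ-false {m} {n} p with m <ᵇ n in eq
... | false = refl
... | true = ⊥-elim (<⇒≱ (<ᵇ⇒< m n (subst T (sym eq) tt)) p)

data Rises (m : ℕ) : List ℕ → Set where
  stop : Rises m []
  rise : ∀ {y r} → m < y → Rises m (y ∷ r)

midPos-at : ∀ D m R → WD (D ++ [ m ]) → Rises m R → midPos (D ++ m ∷ R) ≡ suc (length D)
midPos-at [] m [] s stop = refl
midPos-at [] m (y ∷ r) s (rise p) rewrite ≤ᵇ-false p = refl
midPos-at (d ∷ []) m R (p ∷ _ , s) q rewrite ≤ᵇ-true p = cong suc (midPos-at [] m R s q)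
midPos-at (d ∷ D@(e ∷ _)) m R (p ∷ _ , s) q = trans (cong (λ z → if z then suc (midPos (D ++ m ∷ R)) else 1) (≤ᵇ-true p)) (cong suc (midPos-at D m R s q))

strictInc-true : ∀ r → SI r → strictIncB r ≡ true
strictInc-true [] s = refl
strictInc-true (x ∷ []) s = refl
strictInc-true (x ∷ r@(y ∷ _)) (p ∷ _ , s) = trans (cong (Data.Bool._∧ strictIncB r) (<ᵇ-true p)) (strictInc-true r s)

∧-zeroʳ : ∀ b → (b Data.Bool.∧ false) ≡ false
∧-zeroʳ true = refl
∧-zeroʳ false = refl

strictInc-false : ∀ P j x → x ≤ j → strictIncB (P ++ j ∷ x ∷ []) ≡ false
strictInc-false [] j x p rewrite <ᵇ-false p = refl
strictInc-false (y ∷ []) j x p = trans (cong ((y <ᵇ j) Data.Bool.∧_) (strictInc-false [] j x p)) (∧-zeroʳ _)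
strictInc-false (y ∷ z ∷ P) j x p = trans (cong ((y <ᵇ z) Data.Bool.∧_) (strictInc-false (z ∷ P) j x p)) (∧-zeroʳ _)

take-prefix : ∀ {A : Set} (D : List A) {R} → take (length D) (D ++ R) ≡ D
take-prefix [] = refl
take-prefix (x ∷ D) = cong (x ∷_) (take-prefix D)

drop-prefix : ∀ {A : Set} (D : List A) {R} → drop (length D) (D ++ R) ≡ R
drop-prefix [] = refl
drop-prefix (x ∷ D) = drop-prefix D

take-at : ∀ {A : Set} (D : List A) m R → take (suc (length D)) (D ++ m ∷ R) ≡ D ++ [ m ]
take-at [] m R = refl
take-at (d ∷ D) m R = cong (d ∷_) (take-at D m R)

drop-at : ∀ {A : Set} (D : List A) m R → drop (length D) (D ++ m ∷ R) ≡ m ∷ R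
drop-at [] m R = refl
drop-at (d ∷ D) m R = drop-at D m R

drop-at′ : ∀ {A : Set} (D : List A) m R → drop (suc (length D)) (D ++ m ∷ R) ≡ R
drop-at′ [] m R = refl
drop-at′ (d ∷ D) m R = drop-at′ D m R

nth-at : ∀ {A : Set} (D : List A) m R → nth (length D) (D ++ m ∷ R) ≡ just m
nth-at [] m R = refl
nth-at (d ∷ D) m R = nth-at D m R

isHookB-at : ∀ D m R → WD (D ++ [ m ]) → Rises m R → isHookB (D ++ m ∷ R) ≡ strictIncB (m ∷ R)
isHookB-at [] m R s q rewrite midPos-at [] m R s q = refl
isHookB-at (d ∷ D) m R s q rewrite midPos-at (d ∷ D) m R s q = cong strictIncB (drop-at D m R)

bumpInc-at : ∀ x P b Q → All (_< x) P → x ≤ b → bumpInc x (P ++ b ∷ Q) ≡ (P ++ x ∷ Q , b)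
bumpInc-at x [] b Q a p rewrite ≤ᵇ-true p = refl
bumpInc-at x (y ∷ P) b Q (q ∷ a) p rewrite ≤ᵇ-false q | bumpInc-at x P b Q a p = refl

bumpDec-at : ∀ b P c Q → All (b ≤_) P → c < b → bumpDec b (P ++ c ∷ Q) ≡ (P ++ b ∷ Q , c)
bumpDec-at b [] c Q a p rewrite <ᵇ-true p = refl
bumpDec-at b (y ∷ P) c Q (q ∷ a) p rewrite <ᵇ-false q | bumpDec-at b P c Q a p = refl

Rises-SI : ∀ {m R} → All (m <_) R → Rises m R
Rises-SI [] = stop
Rises-SI (p ∷ _) = rise p

module _ {k : ℕ} {w : List ℕ} (h : Hook k w) where

  private
    module H = Hook h

  Hook-reverse : reverse w ≡ reverse H.E ++ H.m ∷ reverse H.J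
  Hook-reverse = trans (cong reverse H.eq) (reverse-mid H.J H.m H.E)

  Hook-WD : WD (reverse H.E ++ [ H.m ])
  Hook-WD = subst WD (unfold-reverse H.m H.E) (WI-reverse (H.m ∷ H.E) H.asc)

  Hook-rises : Rises H.m (reverse H.J)
  Hook-rises = Rises-SI (All-reverse H.J H.J>m)

  Hook-midPos : midPos (reverse w) ≡ suc (length H.E)
  Hook-midPos = trans (cong midPos Hook-reverse) (trans (midPos-at (reverse H.E) H.m _ Hook-WD Hook-rises) (cong suc (length-reverse H.E)))

  Hook-isHookB : isHookB (reverse w) ≡ true
  Hook-isHookB = trans (cong isHookB Hook-reverse) (trans (isHookB-at (reverse H.E) H.m _ Hook-WD Hook-rises)
    (strictInc-true (H.m ∷ reverse H.J) (All-reverse H.J H.J>m , SD-reverse H.J H.desc)))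

  up-reverse : ∀ v → up (reverse v) ≡ reverse (up v)
  up-reverse [] = refl
  up-reverse (x ∷ v) rewrite unfold-reverse x v | up-++ (reverse v) [ x ] | unfold-reverse ⟨ x , false ⟩ (up v) = cong (_++ _) (up-reverse v)

  mark-reverse : ∀ μ → reverse (mark k μ w) ≡ up (reverse H.E) ++ ⟨ H.m , μ ⟩ ∷ up (reverse H.J)
  mark-reverse μ = trans (cong₂ (λ z t → reverse (mark z μ t)) (sym H.len) H.eq) (trans (cong reverse (mark-++ H.J μ H.m H.E))
    (trans (reverse-mid (up H.J) _ (up H.E)) (cong₂ (λ z t → z ++ ⟨ H.m , μ ⟩ ∷ t) (sym (up-reverse H.E)) (sym (up-reverse H.J)))))

  base-reverse : ∀ μ → map base (reverse (mark k μ w)) ≡ reverse w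
  base-reverse μ = trans (cong (map base) (mark-reverse μ)) (trans (map-++ base (up (reverse H.E)) _)
    (trans (cong₂ (λ z t → z ++ H.m ∷ t) (base-up (reverse H.E)) (base-up (reverse H.J))) (sym Hook-reverse)))

  private
    lenE : length (up (reverse H.E)) ≡ length H.E
    lenE = trans (length-map _ (reverse H.E)) (length-reverse H.E)

  mid-prime : ∀ μ → Maybe.maybe primed false (nth (length H.E) (reverse (mark k μ w))) ≡ μ
  mid-prime μ = cong (Maybe.maybe primed false) (trans (cong₂ nth (sym lenE) (mark-reverse μ)) (nth-at (up (reverse H.E)) _ _))

  newRow : ∀ β → setAt (length H.E) ⟨ Maybe.maybe (λ z → z) 0 (nth (length H.E) (reverse w)) , β ⟩ (up (reverse w)) ≡ reverse (mark k β w)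
  newRow β = trans (cong₂ (λ z t → setAt z t (up (reverse w))) (sym lenE) (cong (λ z → ⟨ z , β ⟩) nthm))
    (trans (cong (setAt _ _) (trans (cong up Hook-reverse) (up-++ (reverse H.E) _)))
      (trans (modAt-++ (λ _ → ⟨ H.m , β ⟩) (up (reverse H.E)) _ _) (sym (mark-reverse β))))
    where
    nthm : Maybe.maybe (λ z → z) 0 (nth (length H.E) (reverse w)) ≡ H.m
    nthm = cong (Maybe.maybe (λ z → z) 0) (trans (cong₂ nth (sym (length-reverse H.E)) Hook-reverse) (nth-at (reverse H.E) _ _))

≡ᵇ-cong : ∀ {a b c d} → (a ≡ b → c ≡ d) → (c ≡ d → a ≡ b) → (a ≡ᵇ b) ≡ (c ≡ᵇ d)
≡ᵇ-cong {a} {b} {c} {d} f g with a ≟ b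
... | yes refl = trans (≡ᵇ-refl a) (sym (trans (cong (c ≡ᵇ_) (sym (f refl))) (≡ᵇ-refl c)))
... | no q = trans (≢⇒≡ᵇ q) (sym (≢⇒≡ᵇ (λ e → q (g e))))

choose-not : ∀ {A : Set} b {x y : A} → (if not b then x else y) ≡ choose b y x
choose-not true = refl
choose-not false = refl

-- Common to both branches of `decIns`, so that the prime rules are evaluated only once.
decRow : PN → List PN → List ℕ → List PN × Bool
decRow x r u' =
  let p = midPos (map base r)
      mPr = Maybe.maybe primed false (nth (p ∸ 1) r)
      p' = midPos u'
      changed = not (p ≡ᵇ p')
  in setAt (p' ∸ 1) ⟨ Maybe.maybe (λ k → k) 0 (nth (p' ∸ 1) u') , (if changed then primed x else mPr) ⟩ (map (λ k → ⟨ k , false ⟩) u')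
     , (if changed then mPr else primed x)

decRow-≡ : ∀ {k k' w w'} x μ → (h : Hook k w) (h' : Hook k' w') → ∀ t → (length (Hook.E h) ≡ᵇ length (Hook.E h')) ≡ t →
  decRow x (reverse (mark k μ w)) (reverse w') ≡ (reverse (mark k' (choose t μ (primed x)) w') , choose t (primed x) μ)
decRow-≡ {k} {k'} {w} {w'} x μ h h' t e
  rewrite base-reverse h μ | Hook-midPos h | Hook-midPos h' | e | mid-prime h μ | choose-not t {primed x} {μ} | choose-not t {μ} {primed x}
        | newRow h' (choose t μ (primed x)) = refl

decIns-true : ∀ x r rs → isHookB (map base r ++ [ base x ]) ≡ true →
  decIns x (r ∷ rs) ≡ (proj₁ (decRow x r (map base r ++ [ base x ])) ∷ rs , 0 , proj₂ (decRow x r (map base r ++ [ base x ])))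
decIns-true x r rs e with isHookB (map base r ++ [ base x ])
decIns-true x r rs refl | .true = refl

decIns-false : ∀ x r rs → isHookB (map base r ++ [ base x ]) ≡ false →
  let br = bumpRow (base x) (map base r)
      d = decRow x r (proj₁ br)
      rec = decIns ⟨ proj₂ br , proj₂ d ⟩ rs
  in decIns x (r ∷ rs) ≡ (proj₁ d ∷ proj₁ rec , suc (proj₁ (proj₂ rec)) , proj₂ (proj₂ rec))
decIns-false x r rs e with isHookB (map base r ++ [ base x ])
decIns-false x r rs refl | .false = refl

decIns-App : ∀ {x row r' o} T → App x (reverse row) r' o → decIns x (row ∷ T) ≡ (reverse r' ∷ T , 0 , o)
decIns-App {x} {row} T p with App⇒AForm p
... | aform k k' μ w r≡ refl refl hk hk' pos with trans (sym (reverse-involutive row)) (cong reverse r≡)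
...   | refl = trans (decIns-true x _ T (trans (cong isHookB u≡) (Hook-isHookB hk')))
        (cong (λ (z : List PN × Bool) → proj₁ z ∷ T , 0 , proj₂ z) (trans (cong (decRow x (reverse (mark k μ w))) u≡) (decRow-≡ x μ hk hk' _ t≡)))
  where
  u≡ : map base (reverse (mark k μ w)) ++ [ base x ] ≡ reverse (base x ∷ w)
  u≡ = trans (cong (_++ [ base x ]) (base-reverse hk μ)) (sym (unfold-reverse (base x) w))
  module H = Hook hk
  module H' = Hook hk'
  lens : suc (length H.J + suc (length H.E)) ≡ length H'.J + suc (length H'.E)
  lens = trans (cong suc (trans (sym (length-++ H.J)) (cong length (sym H.eq)))) (trans (cong length H'.eq) (length-++ H'.J))
  lens' : suc k + suc (length H.E) ≡ k' + suc (length H'.E)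
  lens' = trans (cong (λ z → suc (z + suc (length H.E))) (sym H.len)) (trans lens (cong (_+ suc (length H'.E)) H'.len))
  t≡ : (length H.E ≡ᵇ length H'.E) ≡ (k' ≡ᵇ suc k)
  t≡ = ≡ᵇ-cong (λ e → sym (+-cancelʳ-≡ (suc (length H.E)) (suc k) k' (trans lens' (cong (λ z → k' + suc z) (sym e)))))
               (λ { refl → suc-injective (+-cancelˡ-≡ (suc k) _ _ lens') })

decIns-Bump : ∀ {x row r' c} T → Bump x (reverse row) r' c →
  decIns x (row ∷ T) ≡ (reverse r' ∷ proj₁ (decIns c T) , suc (proj₁ (proj₂ (decIns c T))) , proj₂ (proj₂ (decIns c T)))
decIns-Bump {x} {row} T p with Bump⇒Form p
... | form k k' μ w w' cb r≡ refl refl hk hk' (seg x₂ A b B A' c B' w≡ v≡ pre@(sd , x≤b , B<x) wi c<b b≤B' l) pos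
  with trans (sym (reverse-involutive row)) (cong reverse r≡) | ∷-injective w≡ | ∷ʳ-injective w' _ v≡
...   | refl | refl , e | refl , refl = trans (decIns-false x _ T nothook) (cong₂ (λ y (z : List PN × Bool) → proj₁ z ∷ proj₁ (decIns ⟨ y , proj₂ z ⟩ T) ,
          suc (proj₁ (proj₂ (decIns ⟨ y , proj₂ z ⟩ T))) , proj₂ (proj₂ (decIns ⟨ y , proj₂ z ⟩ T))) (cong proj₂ br≡)
          (trans (cong (decRow x (reverse (mark k μ w)) ∘ proj₁) br≡) (decRow-≡ x μ hk hk' _ t≡)))
  where
  module H = Hook hk
  module H' = Hook hk'
  JE = ++-inj-len H.J (A ++ b ∷ B) (trans H.len (sym l)) (trans (sym H.eq) e)
  revJ : reverse H.J ≡ reverse B ++ b ∷ reverse A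
  revJ = trans (cong reverse (proj₁ JE)) (reverse-mid A b B)
  revE : reverse H.E ++ [ H.m ] ≡ reverse B' ++ c ∷ reverse A'
  revE = trans (sym (unfold-reverse H.m H.E)) (trans (cong reverse (proj₂ JE)) (reverse-mid A' c B'))
  u≡ : map base (reverse (mark k μ w)) ≡ reverse w
  u≡ = base-reverse hk μ
  shape≡ : reverse w ++ [ base x ] ≡ reverse H.E ++ H.m ∷ (reverse H.J ++ [ base x ])
  shape≡ = trans (cong (_++ [ base x ]) (Hook-reverse hk)) (++-assoc (reverse H.E) _ _)
  head≥ : ∀ A → x₂ ≤ b → All (b <_) A → ∃₂ λ j J₀ → A ++ b ∷ B ≡ j ∷ J₀ × x₂ ≤ j
  head≥ [] p q = b , B , refl , p
  head≥ (j ∷ A) p (q ∷ _) = j , A ++ b ∷ B , refl , ≤-trans p (<⇒≤ q)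
  nothook : isHookB (map base (reverse (mark k μ w)) ++ [ base x ]) ≡ false
  nothook with head≥ A x≤b (All-heads (proj₂ (proj₂ (SD-++⁻ A _ sd))))
  ... | j , J₀ , eqJ , x≤j = trans (cong isHookB (trans (cong (_++ [ base x ]) u≡) shape≡))
      (trans (isHookB-at (reverse H.E) H.m _ (Hook-WD hk) ris) (trans (cong (λ z → strictIncB (H.m ∷ z)) J≡) (strictInc-false (H.m ∷ reverse J₀) j (base x) x≤j)))
    where
    J≡ : reverse H.J ++ [ base x ] ≡ reverse J₀ ++ j ∷ base x ∷ []
    J≡ = trans (cong (λ z → reverse z ++ [ base x ]) (trans (proj₁ JE) eqJ)) (trans (cong (_++ [ base x ]) (unfold-reverse j J₀)) (++-assoc (reverse J₀) _ _))
    -- `J` contains `b` and is not empty, so the row rises right behind its middle element whatever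
    -- is appended, and the middle does not move.
    ris : Rises H.m (reverse H.J ++ [ base x ])
    ris with reverse H.J | Hook-rises hk | revJ
    ... | [] | _ | q = ⊥-elim (nil (reverse B) q)
      where nil : ∀ (u : List ℕ) {y v} → [] ≢ u ++ y ∷ v
            nil [] ()
            nil (_ ∷ _) ()
    ... | _ ∷ _ | rise lt | _ = rise lt
  br≡ : bumpRow (base x) (map base (reverse (mark k μ w))) ≡ (reverse ((A ++ base x ∷ B) ++ A' ++ b ∷ B') , c)
  br≡ rewrite u≡ | Hook-midPos hk = trans (cong₂ (λ s t → let r2 = bumpDec (proj₂ s) t in (proj₁ r2 ++ proj₁ s) , proj₂ r2) inc≡ take≡)
      (trans (cong (λ s → proj₁ s ++ reverse B ++ base x ∷ reverse A , proj₂ s) (bumpDec-at b (reverse B') c (reverse A') (All-reverse B' b≤B') c<b))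
        (cong (_, c) (sym (trans (reverse-++ (A ++ base x ∷ B) _) (cong₂ _++_ (reverse-mid A' b B') (reverse-mid A (base x) B))))))
    where
    lE : suc (length H.E) ≡ suc (length (reverse H.E))
    lE = cong suc (sym (length-reverse H.E))
    inc≡ : bumpInc (base x) (drop (suc (length H.E)) (reverse w)) ≡ (reverse B ++ base x ∷ reverse A , b)
    inc≡ = trans (cong (bumpInc (base x)) (trans (cong₂ drop lE (Hook-reverse hk)) (trans (drop-at′ (reverse H.E) H.m _) revJ)))
      (bumpInc-at (base x) (reverse B) b (reverse A) (All-reverse B B<x) x≤b)
    take≡ : take (suc (length H.E)) (reverse w) ≡ reverse B' ++ c ∷ reverse A'
    take≡ = trans (cong₂ take lE (Hook-reverse hk)) (trans (take-at (reverse H.E) H.m _) revE)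
  lens : k + suc (length H.E) ≡ k' + suc (length H'.E)
  lens = trans (cong (_+ suc (length H.E)) (sym H.len)) (trans (sym (length-++ H.J)) (trans (cong length (trans (sym H.eq) e))
    (trans (trans (length-++ (A ++ b ∷ B)) (trans (cong₂ _+_ (length-swap A) (length-swap A')) (sym (length-++ (A ++ base x ∷ B)))))
      (trans (cong length H'.eq) (trans (length-++ H'.J) (cong (_+ suc (length H'.E)) H'.len))))))
  t≡ : (length H.E ≡ᵇ length H'.E) ≡ (k ≡ᵇ k')
  t≡ = ≡ᵇ-cong (λ q → +-cancelʳ-≡ (suc (length H.E)) k k' (trans lens (cong (λ z → k' + suc z) (sym q))))
               (λ { refl → suc-injective (+-cancelˡ-≡ k _ _ lens) })

-- Every letter can be inserted in every valid row

record RowW (r : Word) : Set where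
  constructor rowW
  field
    k : ℕ
    μ : Bool
    w : List ℕ
    r≡ : r ≡ mark k μ w
    hk : Hook k w
    pos : All (1 ≤_) w

split-SD : ∀ x j J → SD (j ∷ J) → x ≤ j → ∃ λ A → ∃₂ λ b B → j ∷ J ≡ A ++ b ∷ B × x ≤ b × All (_< x) B
split-SD x j [] s p = [] , j , [] , refl , p , []
split-SD x j (j' ∷ J) (a , s) p with x ≤? j'
... | no q = [] , j , j' ∷ J , refl , p , ≰⇒> q ∷ All.map (λ r → <-trans r (≰⇒> q)) (proj₁ s)
... | yes q with split-SD x j' J s q
...   | A , b , B , e , r , t = j ∷ A , b , B , cong (j ∷_) e , r , t

split-WI : ∀ b m E → WI (m ∷ E) → m < b → ∃ λ A → ∃₂ λ c B → m ∷ E ≡ A ++ c ∷ B × c < b × All (b ≤_) B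
split-WI b m [] s p = [] , m , [] , refl , p , []
split-WI b m (m' ∷ E) (a , s) p with m' <? b
... | no q = [] , m , m' ∷ E , refl , p , ≮⇒≥ q ∷ All.map (≤-trans (≮⇒≥ q)) (proj₁ s)
... | yes q with split-WI b m' E s q
...   | A , c , B , e , r , t = m ∷ A , c , B , cong (m ∷_) e , r , t

data Inserted (x : PN) (r : Word) : Set where
  appended : ∀ {r' o} → App x r r' o → Inserted x r
  bumped : ∀ {r' c} → Bump x r r' c → Inserted x r

insert-row : ∀ x r → 1 ≤ base x → RowW r → Inserted x r
insert-row x r 1≤x (rowW k μ w refl hk@(hook [] m E refl refl d m<J s) pos) with base x ≤? m
... | yes p = appended (AForm⇒App (aform 0 0 μ w refl refl refl hk (hook [] (base x) w refl refl tt [] (WI-tail≥ p s , s)) (1≤x ∷ pos)))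
... | no p = appended (AForm⇒App (aform 0 1 μ w refl refl refl hk (hook [ base x ] m E refl refl ([] , tt) (≰⇒> p ∷ []) s) (1≤x ∷ pos)))
insert-row x r 1≤x (rowW k μ w refl hk@(hook (j ∷ J) m E refl refl d (m<j ∷ m<J) s) pos) with base x ≤? j
... | no p = appended (AForm⇒App (aform k (suc k) μ w refl refl refl hk
      (hook (base x ∷ j ∷ J) m E refl refl (≰⇒> p ∷ All.map (λ q → <-trans q (≰⇒> p)) (proj₁ d) , d) (<-trans m<j (≰⇒> p) ∷ m<j ∷ m<J) s) (1≤x ∷ pos)))
... | yes p with split-SD (base x) j J d p
...   | A , b , B , e , x≤b , B<x with split-WI b m E s (All.head (All.++⁻ʳ A (subst (All (m <_)) e (m<j ∷ m<J))))
...     | A' , c , B' , e' , c<b , b≤B' = bumped (Form⇒Bump (form k (proj₁ hk') μ w _ c refl refl refl hk (proj₂ hk') sg (1≤x ∷ pos)))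
  where
  pre : Pre (base x) A b B
  pre = subst SD e d , x≤b , B<x
  sg : Seg k (base x ∷ w) (((A ++ base x ∷ B) ++ A' ++ b ∷ B') ++ [ c ])
  sg = seg (base x) A b B A' c B' (cong (base x ∷_) (cong₂ _++_ e e')) refl pre (subst WI e' s) c<b b≤B' (cong length (sym e))
  m<J' : All (m <_) (A ++ b ∷ B)
  m<J' = subst (All (m <_)) e (m<j ∷ m<J)
  go : ∀ A' → m ∷ E ≡ A' ++ c ∷ B' → ∃ λ k' → Hook k' ((A ++ base x ∷ B) ++ A' ++ b ∷ B')
  go [] refl with snoc (base x) B
  ... | B₀ , y , q = _ , subst (Hook (length (A ++ B₀))) (trans (++-assoc A B₀ _) (trans (cong (A ++_) (trans (sym (++-assoc B₀ [ y ] (b ∷ B'))) (cong (_++ b ∷ B') (sym q)))) (sym (++-assoc A (base x ∷ B) (b ∷ B'))))) (hookN {A = A} q pre b≤B' (proj₂ s))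
  go (.m ∷ A″) refl with base x ≤? m
  ... | no q = _ , hookU {A = A} {A′ = A″} pre (≰⇒> q) m<J' s c<b b≤B'
  ... | yes q with none-below B<x (All.tail (All.++⁻ʳ A m<J')) q
  ...   | refl = _ , subst (Hook (length A)) (sym (++-assoc A [ base x ] _)) (hookX {A = A} {A′ = A″} (proj₁ pre) q m<J' s c<b b≤B')
  hk' = go A' e'

-- The insertion of a letter in a tableau with rows of prescribed lengths, ending
-- in a prescribed row with a prescribed parity, is a natural relation.

data Len (n : ℕ) (R : Rel) : Rel where
  lenr : ∀ {a b} → R a b → length a ≡ n → Len n R a b

data None : Rel where

NatF-Len : ∀ {n R} → NatF R → NatF (Len n R)
NatF-Len r = record { φ≡ = λ { (lenr x _) → R.φ≡ x } ; ω≡ = λ { (lenr x _) → R.ω≡ x }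
  ; simF = λ { (lenr x l) f → let (_ , g , y) = R.simF x f in _ , g , lenr y (trans (sym (F-length f)) l) } }
  where module R = NatF r

NatE-Len : ∀ {n R} → NatE R → NatE (Len n R)
NatE-Len r = record { first≡ = λ { (lenr x _) → R.first≡ x } ; bit≡ = λ { (lenr x _) → R.bit≡ x }
  ; set-R = λ { q (lenr {a} x l) → lenr (R.set-R q x) (trans (setb1-length q a) l) }
  ; simE = λ { (lenr {a} x l) e → let (_ , g , y) = R.simE x e in _ , g , lenr y (trans (E1-length a e) l) } }
  where module R = NatE r

NatF-None : NatF None
NatF-None = record { φ≡ = λ () ; ω≡ = λ () ; simF = λ () }

NatE-None : NatE None
NatE-None = record { first≡ = λ () ; bit≡ = λ () ; set-R = λ _ () ; simE = λ () }

-- Since the row `k` and the parity `o` of the new box are indices, naturality includes that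
-- operators do not change what is recorded. Insertion into an empty tableau is even and ends in row
-- 0; all other indices give the empty relation there.
Chain : List ℕ → ℕ → Bool → Rel
Chain [] zero false = Len 1 _≡_
Chain [] zero true = None
Chain [] (suc k) o = None
Chain (l ∷ sh) zero o = Len (suc l) (AppR o) ⊗ _≡_
Chain (l ∷ sh) (suc k) o = (Len (suc l) (BumpR l) ⊗ _≡_) ⨾ (EqL l ⊗ Chain sh k o)

NatF-Chain : ∀ sh k o → NatF (Chain sh k o)
NatF-Chain [] zero false = NatF-Len NatF-≡
NatF-Chain [] zero true = NatF-None
NatF-Chain [] (suc k) o = NatF-None
NatF-Chain (l ∷ sh) zero o = NatF-⊗ (NatF-Len NatF-App) NatF-≡
NatF-Chain (l ∷ sh) (suc k) o = NatF-⨾ (NatF-⊗ (NatF-Len NatF-Bump) NatF-≡) (NatF-⊗ NatF-EqL (NatF-Chain sh k o))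

NatE-Chain : ∀ sh k o → NatE (Chain sh k o)
NatE-Chain [] zero false = NatE-Len NatE-≡
NatE-Chain [] zero true = NatE-None
NatE-Chain [] (suc k) o = NatE-None
NatE-Chain (l ∷ sh) zero o = NatE-⊗ (NatE-Len NatE-App) NatE-≡
NatE-Chain (l ∷ sh) (suc k) o = NatE-⨾ (NatE-⊗ (NatE-Len NatE-Bump) NatE-≡) (NatE-⊗ NatE-EqL (NatE-Chain sh k o))

incShape : ℕ → List ℕ → List ℕ
incShape _ [] = [ 1 ]
incShape zero (l ∷ sh) = suc l ∷ sh
incShape (suc k) (l ∷ sh) = l ∷ incShape k sh

Form-length : ∀ {x r r' c} → Form x r r' c → length r ≡ length r'
Form-length (form k k' μ w w' cb refl refl refl hk hk' (seg x A b B A' c B' w≡ v≡ pre wi c<b b≤B' l) pos) =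
  trans (length-mark k μ w) (trans (suc-injective (trans (cong length w≡) (trans (cong suc lens) (trans (sym (length-snoc ((A ++ x ∷ B) ++ A' ++ b ∷ B') c)) (trans (cong length (sym v≡)) (length-snoc w' cb)))))) (sym (length-mark k' _ w')))
  where
  lens : length ((A ++ b ∷ B) ++ A' ++ c ∷ B') ≡ length ((A ++ x ∷ B) ++ A' ++ b ∷ B')
  lens = trans (length-++ (A ++ b ∷ B)) (trans (cong₂ _+_ (length-swap A) (length-swap A')) (sym (length-++ (A ++ x ∷ B))))

AForm-length : ∀ {x r r' o} → AForm x r r' o → length r' ≡ suc (length r)
AForm-length (aform k k' μ w refl refl _ _ _ _) = trans (length-mark k' _ _) (cong suc (sym (length-mark k μ w)))

ChainTo : ℕ → Bool → List ℕ → PN → Tableau → Word → Set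
ChainTo k o sh x T Y = ∃ λ T' → decIns x T ≡ (T' , k , o) × revrow T' ≡ Y × shape T' ≡ incShape k sh

-- The lengths built into `Chain` let rows be recovered from the reading word, so a related word is
-- forced to be that of the actual insertion.
chain-decIns : ∀ sh k o x T {Y} → shape T ≡ sh → Chain sh k o (x ∷ revrow T) Y → ChainTo k o sh x T Y
chain-decIns [] zero false x [] e (lenr refl _) = [ x ] ∷ [] , refl , refl , refl
chain-decIns .(length row ∷ shape T) zero o x (row ∷ T) refl c with ⊗⁻ c
... | _ , _ , _ , _ , w≡ , refl , lenr (appR {x = x'} {r} {r'} p) l , refl with ∷-injective w≡
...   | refl , e with ++-inj-len (reverse row) r (trans (length-reverse row) (sym (suc-injective l))) e
...     | refl , refl = _ , decIns-App T p , cong (_++ revrow T) (reverse-involutive r') ,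
            cong (_∷ shape T) (trans (length-reverse r') (trans (AForm-length (App⇒AForm p)) (cong suc (length-reverse row))))
chain-decIns .(length row ∷ shape T) (suc k) o x (row ∷ T) refl (comp c d) with ⊗⁻ c | ⊗⁻ d
... | _ , _ , e , .e , w≡ , m≡ , lenr (bumpR {x = x'} {r} {r'} {y} l' p) l , refl | u , .u , z , z' , m≡' , refl , eql .u lu , ch with ∷-injective w≡
...   | refl , e' with ++-inj-len (reverse row) r (trans (length-reverse row) (sym (suc-injective l))) e'
...     | refl , refl with ++-inj-len r' u (trans l' (sym lu)) (trans (sym (++-assoc r' [ y ] (revrow T))) (trans (sym m≡) m≡'))
...       | refl , refl with chain-decIns (shape T) k o y T refl ch
...         | T' , d≡ , refl , s≡ = _ , trans (decIns-Bump T p) (cong (λ (z : Tableau × ℕ × Bool) → reverse r' ∷ proj₁ z , suc (proj₁ (proj₂ z)) , proj₂ (proj₂ z)) d≡) ,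
              cong (_++ revrow T') (reverse-involutive r') , cong₂ _∷_ (trans (length-reverse r') l') s≡

Valid : Tableau → Set
Valid = All (λ row → RowW (reverse row))

App-valid : ∀ {x r r' o} → App x r r' o → RowW r'
App-valid p with App⇒AForm p
... | aform k k' μ w r≡ r'≡ o≡ hk hk' pos = rowW k' _ _ r'≡ hk' pos

Bump-valid : ∀ {x r r' c} → Bump x r r' c → RowW r' × 1 ≤ base c
Bump-valid p with Bump⇒Form p
... | form k k' μ w w' cb r≡ r'≡ refl hk hk' (seg x₂ A b B A' c B' w≡ v≡ pre wi c<b b≤B' l) pos with ∷ʳ-injective w' _ v≡ | subst (All (1 ≤_)) w≡ pos
...   | refl , refl | 1≤x ∷ p1 = rowW k' _ _ r'≡ hk'
      (All.++⁺ (All.++⁺ (All.++⁻ˡ A AB) (1≤x ∷ All.tail bB)) (All.++⁺ (All.++⁻ˡ A' A'B) (All.head bB ∷ All.tail cB))) , All.head cB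
  where
  AB = All.++⁻ˡ (A ++ b ∷ B) p1
  bB = All.++⁻ʳ A AB
  A'B = All.++⁻ʳ (A ++ b ∷ B) p1
  cB = All.++⁻ʳ A' A'B

record Insertion (x : PN) (T : Tableau) : Set where
  constructor insertion
  field
    k : ℕ
    o : Bool
    T' : Tableau
    ins : decIns x T ≡ (T' , k , o)
    chain : Chain (shape T) k o (x ∷ revrow T) (revrow T')
    valid : Valid T'
    shape≡ : shape T' ≡ incShape k (shape T)

insert : ∀ x T → 1 ≤ base x → Valid T → Insertion x T
insert x [] 1≤x v = insertion 0 false ([ x ] ∷ []) refl (lenr refl refl)
  (rowW 0 (primed x) [ base x ] refl (hook [] (base x) [] refl refl tt [] ([] , tt)) (1≤x ∷ []) ∷ []) refl
insert x (row ∷ T) 1≤x (v ∷ vs) with insert-row x (reverse row) 1≤x v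
... | appended {r'} {o} p = insertion 0 o (reverse r' ∷ T) (decIns-App T p)
      (subst (λ z → Chain (length row ∷ shape T) 0 o (x ∷ reverse row ++ revrow T) (z ++ revrow T)) (sym (reverse-involutive r'))
        (tens (lenr (appR p) (cong suc (length-reverse row))) refl))
      (subst RowW (sym (reverse-involutive r')) (App-valid p) ∷ vs)
      (cong (_∷ shape T) (trans (length-reverse r') (trans (AForm-length (App⇒AForm p)) (cong suc (length-reverse row)))))
... | bumped {r'} {c} p with insert c T (proj₂ (Bump-valid p)) vs
...   | insertion k o T' d≡ ch v' s≡ = insertion (suc k) o (reverse r' ∷ T')
        (trans (decIns-Bump T p) (cong (λ (z : Tableau × ℕ × Bool) → reverse r' ∷ proj₁ z , suc (proj₁ (proj₂ z)) , proj₂ (proj₂ z)) d≡))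
        (comp (tens (lenr (bumpR l p) (cong suc (length-reverse row))) refl)
          (subst₂ (EqL (length row) ⊗ Chain (shape T) k o) (sym (++-assoc r' [ c ] (revrow T))) (cong (_++ revrow T') (sym (reverse-involutive r'))) (tens (eql r' l) ch)))
        (subst RowW (sym (reverse-involutive r')) (proj₁ (Bump-valid p)) ∷ v')
        (cong₂ _∷_ (trans (length-reverse r') l) s≡)
  where
  l : length r' ≡ length row
  l = trans (sym (Form-length (Bump⇒Form p))) (length-reverse row)

-- The insertion tableau

Pos : Word → Set
Pos = All (λ x → 1 ≤ base x)

Pdec-valid : ∀ w → Pos w → Valid (Pdec w)
Pdec-valid [] p = []
Pdec-valid (x ∷ w) (p ∷ ps) with insert x (Pdec w) p (Pdec-valid w ps)
... | insertion k o T' d≡ ch v s = subst Valid (sym (cong proj₁ d≡)) v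

addBox-shape : ∀ k y Q → shape (addBox k y Q) ≡ incShape k (shape Q)
addBox-shape k y [] = refl
addBox-shape zero y (r ∷ Q) = cong (_∷ shape Q) (trans (length-++ r) (+-comm _ 1))
addBox-shape (suc k) y (r ∷ Q) = cong (length r ∷_) (addBox-shape k y Q)

shape-PQ : ∀ w → Pos w → shape (Pdec w) ≡ shape (Qdec w)
shape-PQ [] p = refl
shape-PQ (x ∷ w) (p ∷ ps) with insert x (Pdec w) p (Pdec-valid w ps)
... | insertion k o T' d≡ ch v s = trans (cong (shape ∘ proj₁) d≡) (trans s (trans (cong (incShape k) (shape-PQ w ps))
      (trans (sym (addBox-shape k _ (Qdec w))) (cong (λ z → shape (addBox (proj₁ z) ⟨ suc (proj₂ (proj₂ (PQdec w))) , proj₂ z ⟩ (Qdec w))) (sym (cong proj₂ d≡))))))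

count-PQ : ∀ w → proj₂ (proj₂ (PQdec w)) ≡ length w
count-PQ [] = refl
count-PQ (x ∷ w) = cong suc (count-PQ w)

record PRel (n : ℕ) (q : Tableau) (w V : Word) : Set where
  constructor prel
  field
    len : length w ≡ n
    pos : Pos w
    Q≡ : Qdec w ≡ q
    V≡ : V ≡ revrow (Pdec w)

data One : Rel where
  one : ∀ x → 1 ≤ base x → One [ x ] [ x ]

F-One : ∀ {i x w} → F i [ x ] w → ∃ λ y → w ≡ [ y ] × 1 ≤ base y
F-One (mkF [] p [] refl refl _ _) = _ , refl , s≤s z≤n
F-One (mkF (_ ∷ []) p v () _ _ _)
F-One (mkF (_ ∷ _ ∷ _) p v () _ _ _)

NatF-One : NatF One
NatF-One = record { φ≡ = λ { (one x p) → refl } ; ω≡ = λ { (one x p) → refl } ; simF = sim }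
  where
  sim : ∀ {i a a' b} → One a a' → F i a b → ∃ λ b' → F i a' b' × One b b'
  sim (one x p) f with F-One f
  ... | y , refl , q = _ , f , one y q

NatE-One : NatE One
NatE-One = record { first≡ = λ { (one x p) → refl } ; bit≡ = λ { (one x p) → refl } ; set-R = se ; simE = sim }
  where
  se : ∀ {a b} q → One a b → One (setb1 q a) (setb1 q b)
  se q (one ⟨ 1 , _ ⟩ p) = one _ ≤-refl
  se q (one ⟨ suc (suc y) , b ⟩ p) = one _ p
  sim : ∀ {a a' b} → One a a' → E1 a ≡ just b → ∃ λ b' → E1 a' ≡ just b' × One b b'
  sim (one ⟨ 2 , b ⟩ p) refl = _ , refl , one _ ≤-refl

-- Naturality is local: it is enough that every related pair lies in some natural subrelation. This
-- helps because the row and parity of the last insertion, hence the right `Chain`, depend on the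
-- pair.
record Cover (R : Rel) (a b : Word) : Set₁ where
  constructor cover
  field
    S : Rel
    natF : NatF S
    natE : NatE S
    this : S a b
    back : ∀ {a b} → S a b → R a b

module _ {R : Rel} (c : ∀ {a b} → R a b → Cover R a b) where

  NatF-cover : NatF R
  NatF-cover = record { φ≡ = λ x → NatF.φ≡ (C.natF (c x)) (C.this (c x)) ; ω≡ = λ x → NatF.ω≡ (C.natF (c x)) (C.this (c x))
    ; simF = λ x f → let (_ , g , y) = NatF.simF (C.natF (c x)) (C.this (c x)) f in _ , g , C.back (c x) y }
    where module C = Cover

  NatE-cover : NatE R
  NatE-cover = record { first≡ = λ x → NatE.first≡ (C.natE (c x)) (C.this (c x)) ; bit≡ = λ x → NatE.bit≡ (C.natE (c x)) (C.this (c x))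
    ; set-R = λ q x → C.back (c x) (NatE.set-R (C.natE (c x)) q (C.this (c x)))
    ; simE = λ x f → let (_ , g , y) = NatE.simE (C.natE (c x)) (C.this (c x)) f in _ , g , C.back (c x) y }
    where module C = Cover

-- The subrelation freezes the row and the parity of the last insertion. All its pairs then record
-- the same tableau: the earlier boxes agree by induction, and the new entry is determined by the
-- length.
PRel-cover : ∀ n q {w V} → PRel n q w V → Cover (PRel n q) w V
PRel-cover zero q {[]} (prel refl p refl refl) = cover (EqL 0) NatF-EqL NatE-EqL (eql [] refl) λ { (eql [] _) → prel refl [] refl refl }
PRel-cover (suc n) q {x ∷ w} (prel l (p ∷ ps) refl refl) with insert x (Pdec w) p (Pdec-valid w ps)
... | insertion k o T' d≡ ch _ _ = cover S (NatF-⨾ (NatF-⊗ NatF-One (NatF-cover (PRel-cover n (Qdec w)))) (NatF-Chain (shape (Pdec w)) k o))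
    (NatE-⨾ (NatE-⊗ NatE-One (NatE-cover (PRel-cover n (Qdec w)))) (NatE-Chain (shape (Pdec w)) k o))
    (comp (tens (one x p) (prel (suc-injective l) ps refl refl)) (subst (Chain (shape (Pdec w)) k o (x ∷ revrow (Pdec w))) (cong revrow (sym (cong proj₁ d≡))) ch)) back
  where
  S : Rel
  S = (One ⊗ PRel n (Qdec w)) ⨾ Chain (shape (Pdec w)) k o
  back : ∀ {a b} → S a b → PRel (suc n) (Qdec (x ∷ w)) a b
  back (comp (tens {b = v} (one y 1≤y) (prel lv pv Qv refl)) c)
    with chain-decIns (shape (Pdec w)) k o y (Pdec v) (trans (shape-PQ v pv) (trans (cong shape Qv) (sym (shape-PQ w ps)))) c
  ... | T″ , d≡' , refl , _ = prel (cong suc lv) (1≤y ∷ pv)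
        (trans (cong (λ z → addBox (proj₁ (proj₂ z)) ⟨ suc (proj₂ (proj₂ (PQdec v))) , proj₂ (proj₂ z) ⟩ (Qdec v)) d≡')
          (trans (cong₂ (λ z t → addBox k ⟨ suc z , o ⟩ t) (trans (count-PQ v) (trans lv (trans (sym (suc-injective l)) (sym (count-PQ w))))) Qv)
            (cong (λ z → addBox (proj₁ (proj₂ z)) ⟨ suc (proj₂ (proj₂ (PQdec w))) , proj₂ (proj₂ z) ⟩ (Qdec w)) (sym d≡))))
        (cong revrow (sym (cong proj₁ d≡')))

prel-at : ∀ {w} → Pos w → PRel (length w) (Qdec w) w (revrow (Pdec w))
prel-at p = prel refl p refl refl

module _ {n : ℕ} {q : Tableau} where
  open NatF (NatF-cover (PRel-cover n q)) public renaming (φ≡ to P-φ; ω≡ to P-ω; simF to P-F)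
  open NatE (NatE-cover (PRel-cover n q)) public renaming (first≡ to P-first; bit≡ to P-bit; set-R to P-set; simE to P-E)

-- The operators of the statement and the insertion tableau

IxOK : Idx → Set
IxOK (ix i) = 1 ≤ i
IxOK _ = ⊤

e⇒f : ∀ i {w v} → eW i w ≡ just v → fW i v ≡ just w
e⇒f ī {w} {v} e = trans (f1̄≡F1 v) (E1-F1 w (trans (sym (e1̄≡E1 w)) e))
e⇒f (ix i) e = fI-F (F-eI e)
e⇒f i0 {w} {v} e with bit1 w in q | trans (sym (e0-set w)) e
... | just true | refl = trans (f0-set (setb1 false w)) (trans (cong (λ z → f0-case z (setb1 false w)) (bit1-setb1 false w q))
        (cong just (trans (setb1-setb1 true false w) (setb1-bit1 w q))))

f⇒e : ∀ i {w v} → fW i w ≡ just v → eW i v ≡ just w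
f⇒e ī {w} {v} e = trans (e1̄≡E1 v) (F1-E1 w (trans (sym (f1̄≡F1 w)) e))
f⇒e (ix i) e = eI-F (F-fI e)
f⇒e i0 {w} {v} e with bit1 w in q | trans (sym (f0-set w)) e
... | just false | refl = trans (e0-set (setb1 true w)) (trans (cong (λ z → e0-case z (setb1 true w)) (bit1-setb1 true w q))
        (cong just (trans (setb1-setb1 false true w) (setb1-bit1 w q))))

module _ {P : PN → Set} where

  F-AllW : ∀ {i w w'} → (∀ b → P ⟨ i , b ⟩ → P ⟨ suc i , b ⟩) → F i w w' → All P w → All P w'
  F-AllW g (mkF u p v refl refl _ _) a = All.++⁺ (All.++⁻ˡ u a) (g p (All.head (All.++⁻ʳ u a)) ∷ All.tail (All.++⁻ʳ u a))

  E-AllW : ∀ {i w w'} → (∀ b → P ⟨ suc i , b ⟩ → P ⟨ i , b ⟩) → F i w w' → All P w' → All P w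
  E-AllW g (mkF u p v refl refl _ _) a = All.++⁺ (All.++⁻ˡ u a) (g p (All.head (All.++⁻ʳ u a)) ∷ All.tail (All.++⁻ʳ u a))

bit1-∈ : ∀ {P : PN → Set} w {q} → All P w → bit1 w ≡ just q → P ⟨ 1 , q ⟩
bit1-∈ (⟨ 0 , p ⟩ ∷ w) (_ ∷ a) e = bit1-∈ w a e
bit1-∈ (⟨ 1 , p ⟩ ∷ w) (x ∷ a) refl = x
bit1-∈ (⟨ suc (suc _) , p ⟩ ∷ w) (_ ∷ a) e = bit1-∈ w a e

setb1-All′ : ∀ {P : PN → Set} q w → P ⟨ 1 , q ⟩ → All P w → All P (setb1 q w)
setb1-All′ q [] p a = []
setb1-All′ q (⟨ 0 , _ ⟩ ∷ w) p (x ∷ a) = x ∷ setb1-All′ q w p a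
setb1-All′ q (⟨ 1 , _ ⟩ ∷ w) p (x ∷ a) = p ∷ a
setb1-All′ q (⟨ suc (suc _) , _ ⟩ ∷ w) p (x ∷ a) = x ∷ setb1-All′ q w p a

E1-All : ∀ {P : PN → Set} → (∀ b → P ⟨ 2 , b ⟩ → P ⟨ 1 , b ⟩) → ∀ w {v} → E1 w ≡ just v → All P w → All P v
E1-All g (⟨ 0 , p ⟩ ∷ w) e (x ∷ a) with E1 w in q
E1-All g (⟨ 0 , p ⟩ ∷ w) refl (x ∷ a) | just v = x ∷ E1-All g w q a
E1-All g (⟨ 2 , p ⟩ ∷ w) e (x ∷ a) with bit1 w in q
E1-All g (⟨ 2 , p ⟩ ∷ w) refl (x ∷ a) | nothing = g p x ∷ a
E1-All g (⟨ 2 , p ⟩ ∷ w) refl (x ∷ a) | just r = bit1-∈ w a q ∷ setb1-All′ p w (g p x) a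
E1-All g (⟨ suc (suc (suc _)) , p ⟩ ∷ w) e (x ∷ a) with E1 w in q
E1-All g (⟨ suc (suc (suc _)) , p ⟩ ∷ w) refl (x ∷ a) | just v = x ∷ E1-All g w q a

F1-All : ∀ {P : PN → Set} → (∀ b → P ⟨ 1 , b ⟩ → P ⟨ 2 , b ⟩) → ∀ w {v} → F1 w ≡ just v → All P w → All P v
F1-All g (⟨ 0 , p ⟩ ∷ w) e (x ∷ a) with F1 w in q
F1-All g (⟨ 0 , p ⟩ ∷ w) refl (x ∷ a) | just v = x ∷ F1-All g w q a
F1-All g (⟨ 1 , p ⟩ ∷ w) e (x ∷ a) with bit1 w in q
F1-All g (⟨ 1 , p ⟩ ∷ w) refl (x ∷ a) | nothing = g p x ∷ a
F1-All g (⟨ 1 , p ⟩ ∷ w) refl (x ∷ a) | just r = g r (bit1-∈ w a q) ∷ setb1-All′ p w x a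
F1-All g (⟨ suc (suc (suc _)) , p ⟩ ∷ w) e (x ∷ a) with F1 w in q
F1-All g (⟨ suc (suc (suc _)) , p ⟩ ∷ w) refl (x ∷ a) | just v = x ∷ F1-All g w q a

e0-shape : ∀ {w v} → e0 w ≡ just v → bit1 w ≡ just true × v ≡ setb1 false w
e0-shape {w} e with bit1 w | trans (sym (e0-set w)) e
... | just true | refl = refl , refl

f0-shape : ∀ {w v} → f0 w ≡ just v → bit1 w ≡ just false × v ≡ setb1 true w
f0-shape {w} e with bit1 w | trans (sym (f0-set w)) e
... | just false | refl = refl , refl

e0-at : ∀ {w} → bit1 w ≡ just true → e0 w ≡ just (setb1 false w)
e0-at {w} q = trans (e0-set w) (cong (λ z → e0-case z w) q)

f0-at : ∀ {w} → bit1 w ≡ just false → f0 w ≡ just (setb1 true w)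
f0-at {w} q = trans (f0-set w) (cong (λ z → f0-case z w) q)

f-Pos : ∀ i {w v} → IxOK i → fW i w ≡ just v → Pos w → Pos v
f-Pos ī {w} {v} _ e p = F1-All (λ _ _ → s≤s z≤n) w (trans (sym (f1̄≡F1 w)) e) p
f-Pos i0 {w} _ e p with f0-shape {w} e
... | _ , refl = setb1-All′ true w ≤-refl p
f-Pos (ix i) _ e p = F-AllW (λ _ _ → s≤s z≤n) (F-fI e) p

e-Pos : ∀ i {w v} → IxOK i → eW i w ≡ just v → Pos w → Pos v
e-Pos ī {w} {v} _ e p = E1-All (λ _ _ → s≤s z≤n) w (trans (sym (e1̄≡E1 w)) e) p
e-Pos i0 {w} _ e p with e0-shape {w} e
... | _ , refl = setb1-All′ false w ≤-refl p
e-Pos (ix i) ok e p = E-AllW (λ _ _ → ok) (F-eI e) p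

record Tracks (w v : Word) (g : Word → Maybe Word) : Set where
  constructor tracks
  field
    image : g (revrow (Pdec w)) ≡ just (revrow (Pdec v))
    Q≡ : Qdec v ≡ Qdec w

-- Only `E1` and `F` have been matched, besides the setting of primes. The inverse operators come
-- from a matched step read backwards from its other end, hence the mutual recursion.
sim-e : ∀ i {w v} → IxOK i → Pos w → eW i w ≡ just v → Tracks w v (eW i)
sim-f : ∀ i {w v} → IxOK i → Pos w → fW i w ≡ just v → Tracks w v (fW i)

sim-e ī {w} {v} _ p e with P-E (prel-at p) (trans (sym (e1̄≡E1 w)) e)
... | _ , q , prel _ _ Qe refl = tracks (trans (e1̄≡E1 (revrow (Pdec w))) q) Qe
sim-e i0 {w} {v} _ p e with e0-shape {w} e
... | b , refl with P-set false (prel-at p)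
...   | prel _ _ Qe Ve = tracks (trans (e0-at (trans (sym (P-bit (prel-at p))) b)) (cong just Ve)) Qe
sim-e (ix i) {w} {v} ok p e with sim-f (ix i) ok (e-Pos (ix i) {w} ok e p) (e⇒f (ix i) {w} e)
... | tracks o q = tracks (f⇒e (ix i) {revrow (Pdec v)} {revrow (Pdec w)} o) (sym q)

sim-f ī {w} {v} ok p e with sim-e ī ok (f-Pos ī {w} ok e p) (f⇒e ī {w} e)
... | tracks o q = tracks (e⇒f ī {revrow (Pdec v)} {revrow (Pdec w)} o) (sym q)
sim-f i0 {w} {v} _ p e with f0-shape {w} e
... | b , refl with P-set true (prel-at p)
...   | prel _ _ Qe Ve = tracks (trans (f0-at (trans (sym (P-bit (prel-at p))) b)) (cong just Ve)) Qe
sim-f (ix i) _ p e with P-F (prel-at p) (F-fI e)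
... | _ , q , prel _ _ Qe refl = tracks (fI-F q) Qe

-- Whether an operator vanishes is decided by `first12`, `bit1` and `ωW`, which insertion preserves.
none-e : ∀ i {w} → Pos w → eW i w ≡ nothing → eW i (revrow (Pdec w)) ≡ nothing
none-e ī {w} p e = trans (e1̄≡E1 (revrow (Pdec w))) (go (E1 (revrow (Pdec w))) refl)
  where
  go : ∀ z → E1 (revrow (Pdec w)) ≡ z → E1 (revrow (Pdec w)) ≡ nothing
  go nothing q = q
  go (just v) q = ⊥-elim (E1-none w (trans (sym (e1̄≡E1 w)) e) (trans (P-first (prel-at p)) (E1-some (revrow (Pdec w)) q)))
none-e i0 {w} p e = trans (e0-set V) (trans (cong (λ z → e0-case z V) (sym (P-bit (prel-at p)))) (go (bit1 w) (trans (sym (e0-set w)) e)))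
  where
  V = revrow (Pdec w)
  go : ∀ z → e0-case z w ≡ nothing → e0-case z V ≡ nothing
  go nothing _ = refl
  go (just false) _ = refl
none-e (ix i) {w} p e = eI-nothing i _ (trans (sym (P-ω (prel-at p))) (go (ωW i w) refl))
  where
  go : ∀ z → ωW i w ≡ z → ωW i w ≡ 0
  go zero q = q
  go (suc z) q with E-exists i w (subst (0 <_) (sym q) (s≤s z≤n))
  ... | _ , f with trans (sym e) (eI-F f)
  ...   | ()

none-f : ∀ i {w} → Pos w → fW i w ≡ nothing → fW i (revrow (Pdec w)) ≡ nothing
none-f ī {w} p e = trans (f1̄≡F1 (revrow (Pdec w))) (go (F1 (revrow (Pdec w))) refl)
  where
  go : ∀ z → F1 (revrow (Pdec w)) ≡ z → F1 (revrow (Pdec w)) ≡ nothing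
  go nothing q = q
  go (just v) q = ⊥-elim (F1-none w (trans (sym (f1̄≡F1 w)) e) (trans (P-first (prel-at p)) (F1-some (revrow (Pdec w)) q)))
none-f i0 {w} p e = trans (f0-set V) (trans (cong (λ z → f0-case z V) (sym (P-bit (prel-at p)))) (go (bit1 w) (trans (sym (f0-set w)) e)))
  where
  V = revrow (Pdec w)
  go : ∀ z → f0-case z w ≡ nothing → f0-case z V ≡ nothing
  go nothing _ = refl
  go (just true) _ = refl
none-f (ix i) {w} p e = fI-nothing i _ (trans (sym (P-φ (prel-at p))) (go (φW i w) refl))
  where
  go : ∀ z → φW i w ≡ z → φW i w ≡ 0
  go zero q = q
  go (suc z) q with F-exists i w (subst (0 <_) (sym q) (s≤s z≤n))
  ... | _ , f with trans (sym e) (fI-F f)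
  ...   | ()

-- Paths in the crystal graph, without reference to membership

Step : (Idx → Set) → Rel
Step Ix w v = ∃ λ i → Ix i × fW i w ≡ just v

data Conn (R : Rel) : Rel where
  done : ∀ {a} → Conn R a a
  fwd : ∀ {a b c} → R a b → Conn R b c → Conn R a c
  bwd : ∀ {a b c} → R b a → Conn R b c → Conn R a c

module _ {R : Rel} where

  infixr 5 _◅◅_
  _◅◅_ : ∀ {a b c} → Conn R a b → Conn R b c → Conn R a c
  done ◅◅ q = q
  fwd s p ◅◅ q = fwd s (p ◅◅ q)
  bwd s p ◅◅ q = bwd s (p ◅◅ q)

  Conn-sym : ∀ {a b} → Conn R a b → Conn R b a
  Conn-sym done = done
  Conn-sym (fwd s p) = Conn-sym p ◅◅ bwd s done
  Conn-sym (bwd s p) = Conn-sym p ◅◅ fwd s done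

  Conn-inv : ∀ {P : Word → Set} → (∀ {a b} → R a b → P a → P b) → (∀ {a b} → R a b → P b → P a) → ∀ {a b} → Conn R a b → P a → P b
  Conn-inv f g done p = p
  Conn-inv f g (fwd s c) p = Conn-inv f g c (f s p)
  Conn-inv f g (bwd s c) p = Conn-inv f g c (g s p)

Conn-map : ∀ {R S : Rel} (h : Word → Word) → (∀ {a b} → R a b → Conn S (h a) (h b)) → ∀ {a b} → Conn R a b → Conn S (h a) (h b)
Conn-map h f done = done
Conn-map h f (fwd s c) = f s ◅◅ Conn-map h f c
Conn-map h f (bwd s c) = Conn-sym (f s) ◅◅ Conn-map h f c

module _ {Ix : Idx → Set} (ok : ∀ {i} → Ix i → IxOK i) where

  Step-Pos : ∀ {a b} → Step Ix a b → Pos a → Pos b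
  Step-Pos (i , x , e) = f-Pos i (ok x) e

  Step-Pos⁻ : ∀ {a b} → Step Ix a b → Pos b → Pos a
  Step-Pos⁻ {a} (i , x , e) = e-Pos i (ok x) (f⇒e i {a} e)

  Conn-P : ∀ {a b} → Conn (Step Ix) a b → Pos a → Conn (Step Ix) (revrow (Pdec a)) (revrow (Pdec b)) × Qdec b ≡ Qdec a
  Conn-P done p = done , refl
  Conn-P {a} (fwd s@(i , x , e) c) p with sim-f i (ok x) p e | Conn-P c (Step-Pos s p)
  ... | tracks o q | d , r = fwd (i , x , o) d , trans r q
  Conn-P {a} (bwd {b = b} s@(i , x , e) c) p with sim-f i (ok x) (Step-Pos⁻ s p) e | Conn-P c (Step-Pos⁻ s p)
  ... | tracks o q | d , r = bwd (i , x , o) d , trans r (sym q)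

  record Lift (w V : Word) : Set where
    constructor lift
    field
      to : Word
      path : Conn (Step Ix) w to
      P≡ : revrow (Pdec to) ≡ V

  Lift-path : ∀ {w V} → Pos w → Conn (Step Ix) (revrow (Pdec w)) V → Lift w V
  Lift-path p c = go p refl c
    where
    go : ∀ {w W V} → Pos w → revrow (Pdec w) ≡ W → Conn (Step Ix) W V → Lift w V
    go p refl done = lift _ done refl
    go {w} p refl (fwd (i , x , e) c) with fW i w in q
    ... | nothing with trans (sym e) (none-f i p q)
    ...   | ()
    go {w} p refl (fwd (i , x , e) c) | just v with sim-f i (ok x) p q
    ... | tracks o _ with trans (sym e) o
    ...   | refl with go (f-Pos i (ok x) q p) refl c
    ...     | lift t d z = lift t (fwd (i , x , q) d) z
    go {w} p refl (bwd {b = b} (i , x , e) c) with eW i w in q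
    ... | nothing with trans (sym (f⇒e i {b} e)) (none-e i p q)
    ...   | ()
    go {w} p refl (bwd {b = b} (i , x , e) c) | just v with sim-e i (ok x) p q
    ... | tracks o _ with trans (sym (f⇒e i {b} e)) o
    ...   | refl with go (e-Pos i (ok x) q p) refl c
    ...     | lift t d z = lift t (bwd (i , x , e⇒f i {w} q) d) z

  -- Words with equal insertion tableaux admit the same operators, so a path from one can be copied
  -- for the other. Every step is invertible, so equality of the ends returns to the starting words;
  -- this moves the question of injectivity to the end of a path.
  twin : ∀ {w w' u} → Pos w → Pos w' → revrow (Pdec w) ≡ revrow (Pdec w') → Conn (Step Ix) w u →
    ∃ λ u' → Conn (Step Ix) w' u' × revrow (Pdec u) ≡ revrow (Pdec u') × (u ≡ u' → w ≡ w')
  twin p p' e done = _ , done , e , λ z → z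
  twin {w} {w'} p p' e (fwd {b = v} (i , x , q) c) with sim-f i (ok x) p q | fW i w' in q'
  ... | tracks o _ | nothing with trans (sym o) (trans (cong (fW i) e) (none-f i p' q'))
  ...   | ()
  twin {w} {w'} p p' e (fwd {b = v} (i , x , q) c) | tracks o _ | just v' with sim-f i (ok x) p' q'
  ... | tracks o' _ with twin (f-Pos i (ok x) q p) (f-Pos i (ok x) q' p') (just-injective (trans (sym o) (trans (cong (fW i) e) o'))) c
  ...   | u' , c' , e' , back = u' , fwd (i , x , q') c' , e' , λ z → just-injective (trans (sym (f⇒e i {w} q)) (trans (cong (eW i) (back z)) (f⇒e i {w'} q')))
  twin {w} {w'} p p' e (bwd {b = v} (i , x , q) c) with sim-e i (ok x) p (f⇒e i {v} q) | eW i w' in q'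
  ... | tracks o _ | nothing with trans (sym o) (trans (cong (eW i) e) (none-e i p' q'))
  ...   | ()
  twin {w} {w'} p p' e (bwd {b = v} (i , x , q) c) | tracks o _ | just v' with sim-e i (ok x) p' q'
  ... | tracks o' _ with twin (e-Pos i (ok x) (f⇒e i {v} q) p) (e-Pos i (ok x) q' p') (just-injective (trans (sym o) (trans (cong (eW i) e) o'))) c
  ...   | u' , c' , e' , back = u' , bwd (i , x , e⇒f i {w'} q') c' , e' , λ z → just-injective (trans (sym q) (trans (cong (fW i) (back z)) (e⇒f i {w'} q')))

-- Weights

count-hit : ∀ i p w → count i (⟨ i , p ⟩ ∷ w) ≡ suc (count i w)
count-hit i p w rewrite ≡ᵇ-refl i = refl

count-miss : ∀ {i y} p w → y ≢ i → count i (⟨ y , p ⟩ ∷ w) ≡ count i w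
count-miss p w q rewrite ≢⇒≡ᵇ q = refl

count-++ : ∀ i u v → count i (u ++ v) ≡ count i u + count i v
count-++ i [] v = refl
count-++ i (x ∷ u) v with base x ≡ᵇ i
... | true = cong suc (count-++ i u v)
... | false = count-++ i u v

count≤length : ∀ i w → count i w ≤ length w
count≤length i [] = z≤n
count≤length i (x ∷ w) with base x ≡ᵇ i
... | true = s≤s (count≤length i w)
... | false = m≤n⇒m≤1+n (count≤length i w)

count-base : ∀ i u v → map base u ≡ map base v → count i u ≡ count i v
count-base i [] [] e = refl
count-base i (x ∷ u) (y ∷ v) e with ∷-injective e
... | refl , e' with base x ≡ᵇ i
...   | true = cong suc (count-base i u v e')
...   | false = count-base i u v e'

record Shift (i t : ℕ) (w v : Word) : Set where
  constructor shift
  field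
    lower : count i w ≡ t + count i v
    upper : count (suc i) v ≡ t + count (suc i) w
    others : ∀ j → j ≢ i → j ≢ suc i → count j v ≡ count j w

F-shift : ∀ {i w v} → F i w v → Shift i 1 w v
F-shift {i} (mkF u p v refl refl _ _) = shift
  (trans (count-++ i u _) (trans (cong (count i u +_) (count-hit i p v)) (trans (+-suc _ _) (cong suc (sym (trans (count-++ i u _) (cong (count i u +_) (count-miss p v 1+n≢n))))))))
  (trans (count-++ (suc i) u _) (trans (cong (count (suc i) u +_) (count-hit (suc i) p v)) (trans (+-suc _ _) (cong suc (sym (trans (count-++ (suc i) u _) (cong (count (suc i) u +_) (count-miss p v (λ e → 1+n≢n (sym e))))))))))
  (λ j a b → trans (count-++ j u _) (trans (cong (count j u +_) (trans (count-miss p v (λ e → b (sym e))) (sym (count-miss p v (λ e → a (sym e)))))) (sym (count-++ j u _))))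

E1-base : ∀ w {v} → E1 w ≡ just v → ∃₂ λ u t → map base w ≡ u ++ 2 ∷ t × map base v ≡ u ++ 1 ∷ t × All (λ y → y ≢ 1 × y ≢ 2) u
E1-base (⟨ 0 , p ⟩ ∷ w) e with E1 w in q
E1-base (⟨ 0 , p ⟩ ∷ w) refl | just v with E1-base w q
... | u , t , a , b , c = 0 ∷ u , t , cong (0 ∷_) a , cong (0 ∷_) b , ((λ ()) , (λ ())) ∷ c
E1-base (⟨ 2 , p ⟩ ∷ w) e with bit1 w
E1-base (⟨ 2 , p ⟩ ∷ w) refl | nothing = [] , map base w , refl , refl , []
E1-base (⟨ 2 , p ⟩ ∷ w) refl | just r = [] , map base w , refl , cong (1 ∷_) (base-setb1 p w) , []
E1-base (⟨ suc (suc (suc y)) , p ⟩ ∷ w) e with E1 w in q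
E1-base (⟨ suc (suc (suc y)) , p ⟩ ∷ w) refl | just v with E1-base w q
... | u , t , a , b , c = suc (suc (suc y)) ∷ u , t , cong (_ ∷_) a , cong (_ ∷_) b , ((λ ()) , (λ ())) ∷ c

count-up : ∀ i w → count i w ≡ count i (up (map base w))
count-up i w = count-base i w (up (map base w)) (sym (base-up (map base w)))

E1-shift : ∀ {w v} → E1 w ≡ just v → Shift 1 1 v w
E1-shift {w} {v} e with E1-base w e
... | u , t , a , b , _ = shift (trans (cv 1) (trans s₁ (cong suc (sym (cw 1))))) (trans (cw 2) (trans s₂ (cong suc (sym (cv 2)))))
    (λ j p q → trans (cw j) (trans (s₃ j p q) (sym (cv j))))
  where
  U = up u ; T' = up t
  cw : ∀ j → count j w ≡ count j (U ++ ⟨ 2 , false ⟩ ∷ T')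
  cw j = trans (count-up j w) (cong (count j) (trans (cong up a) (up-++ u _)))
  cv : ∀ j → count j v ≡ count j (U ++ ⟨ 1 , false ⟩ ∷ T')
  cv j = trans (count-up j v) (cong (count j) (trans (cong up b) (up-++ u _)))
  s₁ : count 1 (U ++ ⟨ 1 , false ⟩ ∷ T') ≡ suc (count 1 (U ++ ⟨ 2 , false ⟩ ∷ T'))
  s₁ = trans (count-++ 1 U _) (trans (+-suc _ _) (cong suc (sym (count-++ 1 U _))))
  s₂ : count 2 (U ++ ⟨ 2 , false ⟩ ∷ T') ≡ suc (count 2 (U ++ ⟨ 1 , false ⟩ ∷ T'))
  s₂ = trans (count-++ 2 U _) (trans (+-suc _ _) (cong suc (sym (count-++ 2 U _))))
  s₃ : ∀ j → j ≢ 1 → j ≢ 2 → count j (U ++ ⟨ 2 , false ⟩ ∷ T') ≡ count j (U ++ ⟨ 1 , false ⟩ ∷ T')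
  s₃ j p q = trans (count-++ j U _) (trans (cong (count j U +_) (trans (count-miss false T' (λ z → q (sym z))) (sym (count-miss false T' (λ z → p (sym z)))))) (sym (count-++ j U _)))

sumSq : (ℕ → ℕ) → ℕ → ℕ
sumSq f zero = 0
sumSq f (suc n) = sumSq f n + f (suc n) * f (suc n)

sumSq-cong : ∀ {f g} n → (∀ j → 1 ≤ j → j ≤ n → f j ≡ g j) → sumSq f n ≡ sumSq g n
sumSq-cong zero h = refl
sumSq-cong (suc n) h = cong₂ _+_ (sumSq-cong n (λ j a b → h j a (m≤n⇒m≤1+n b))) (cong (λ z → z * z) (h (suc n) (s≤s z≤n) ≤-refl))

sumSq-two : ∀ {f g} i n → 1 ≤ i → suc i ≤ n → (∀ j → j ≢ i → j ≢ suc i → f j ≡ g j) →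
  sumSq f n + (g i * g i + g (suc i) * g (suc i)) ≡ sumSq g n + (f i * f i + f (suc i) * f (suc i))
sumSq-two {f} {g} i (suc n) 1≤i (s≤s le) h = go (m≤n⇒m<n∨m≡n le) 1≤i
  where
  open ≡-Reasoning
  sq : (ℕ → ℕ) → ℕ → ℕ
  sq k j = k j * k j
  go : i < n ⊎ i ≡ n → 1 ≤ i → sumSq f (suc n) + (sq g i + sq g (suc i)) ≡ sumSq g (suc n) + (sq f i + sq f (suc i))
  go (inj₁ lt) _ = begin
    sumSq f n + sq f (suc n) + G ≡⟨ +-assoc (sumSq f n) _ _ ⟩
    sumSq f n + (sq f (suc n) + G) ≡⟨ cong (sumSq f n +_) (+-comm (sq f (suc n)) G) ⟩
    sumSq f n + (G + sq f (suc n)) ≡⟨ +-assoc (sumSq f n) G _ ⟨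
    sumSq f n + G + sq f (suc n) ≡⟨ cong₂ _+_ (sumSq-two i n 1≤i lt h) sq≡ ⟩
    sumSq g n + H + sq g (suc n) ≡⟨ +-assoc (sumSq g n) H _ ⟩
    sumSq g n + (H + sq g (suc n)) ≡⟨ cong (sumSq g n +_) (+-comm H (sq g (suc n))) ⟩
    sumSq g n + (sq g (suc n) + H) ≡⟨ +-assoc (sumSq g n) _ _ ⟨
    sumSq g n + sq g (suc n) + H ∎
    where
    G = sq g i + sq g (suc i)
    H = sq f i + sq f (suc i)
    sq≡ : sq f (suc n) ≡ sq g (suc n)
    sq≡ = cong (λ z → z * z) (h (suc n) (λ e → <⇒≢ (m<n⇒m<1+n lt) (sym e)) (λ e → <⇒≢ (s≤s lt) (sym e)))
  go (inj₂ refl) (s≤s {n = i₀} z≤n) = begin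
    A + a + b + (c + d) ≡⟨ cong (_+ (c + d)) (+-assoc A a b) ⟩
    A + (a + b) + (c + d) ≡⟨ cong (λ z → z + (a + b) + (c + d)) (sumSq-cong i₀ (λ j p q → h j (λ { refl → <⇒≱ q ≤-refl }) (λ { refl → <⇒≱ (≤-trans (n≤1+n _) q) ≤-refl }))) ⟩
    B + (a + b) + (c + d) ≡⟨ +-assoc B (a + b) (c + d) ⟩
    B + ((a + b) + (c + d)) ≡⟨ cong (B +_) (+-comm (a + b) (c + d)) ⟩
    B + ((c + d) + (a + b)) ≡⟨ +-assoc B (c + d) (a + b) ⟨
    B + (c + d) + (a + b) ≡⟨ cong (_+ (a + b)) (+-assoc B c d) ⟨
    B + c + d + (a + b) ∎
    where
    A = sumSq f i₀ ; B = sumSq g i₀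
    a = sq f i ; b = sq f (suc i) ; c = sq g i ; d = sq g (suc i)

-- The two sides differ by 2t(b - a): t units are moved from the smaller pile to the larger one.
sq-gain : ∀ a b t → a < b → 1 ≤ t → (a + t) * (a + t) + b * b < a * a + (b + t) * (b + t)
sq-gain a b t lt 1≤t = subst₂ _<_ (sym (eq₁ a b t)) (sym (eq₂ a b t)) (+-monoʳ-< (a * a + t * t + b * b) (*-monoˡ-< t {{>-nonZero 1≤t}} (*-monoʳ-< 2 lt)))
  where
  open import Data.Nat.Solver using (module +-*-Solver)
  open +-*-Solver
  eq₁ : ∀ a b t → (a + t) * (a + t) + b * b ≡ (a * a + t * t + b * b) + 2 * a * t
  eq₁ = solve 3 (λ a b t → (a :+ t) :* (a :+ t) :+ b :* b := (a :* a :+ t :* t :+ b :* b) :+ con 2 :* a :* t) refl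
  eq₂ : ∀ a b t → a * a + (b + t) * (b + t) ≡ (a * a + t * t + b * b) + 2 * b * t
  eq₂ = solve 3 (λ a b t → a :* a :+ (b :+ t) :* (b :+ t) := (a :* a :+ t :* t :+ b :* b) :+ con 2 :* b :* t) refl

module _ (n : ℕ) where

  Sq : Word → ℕ
  Sq w = sumSq (λ i → count i w) n

  sq-compare : ∀ {i w v} → 1 ≤ i → suc i ≤ n → (∀ j → j ≢ i → j ≢ suc i → count j v ≡ count j w) →
    count i w * count i w + count (suc i) w * count (suc i) w < count i v * count i v + count (suc i) v * count (suc i) v → Sq w < Sq v
  sq-compare {i} {w} {v} p q h lt = +-cancelʳ-< A' (Sq w) (Sq v) (subst (Sq w + A' <_) (sym (sumSq-two i n p q h)) (+-monoʳ-< (Sq w) lt))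
    where A' = count i w * count i w + count (suc i) w * count (suc i) w

  Sq-bound : ∀ w → Sq w ≤ n * (length w * length w)
  Sq-bound w = go n
    where
    go : ∀ k → sumSq (λ i → count i w) k ≤ k * (length w * length w)
    go zero = z≤n
    go (suc k) = ≤-trans (+-mono-≤ (go k) (*-mono-≤ (count≤length (suc k) w) (count≤length (suc k) w))) (≤-reflexive (+-comm (k * (length w * length w)) (length w * length w)))

-- The effect of applying f_i as often as possible: all unmatched letters `i` are raised at once.
-- The number `c` counts the opening brackets pending from the left.
fmax : ℕ → ℕ → Word → Word
fmaxK : Kind → ℕ → ℕ → PN → Word → Word
fmax i c [] = []
fmax i c (x ∷ w) = fmaxK (kind i (base x)) i c x w
fmaxK op i c x w = x ∷ fmax i (suc c) w
fmaxK cl i zero x w = ⟨ suc i , primed x ⟩ ∷ fmax i 0 w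
fmaxK cl i (suc c) x w = x ∷ fmax i c w
fmaxK ne i c x w = x ∷ fmax i c w

fmax-φ : ∀ i c w → φ c (kinds i (fmax i c w)) ≡ 0
fmax-φ i c [] = refl
fmax-φ i c (x ∷ w) with kind i (base x) in k
... | op rewrite k = fmax-φ i (suc c) w
... | ne rewrite k = fmax-φ i c w
fmax-φ i zero (x ∷ w) | cl rewrite kind-op i = ⇒φ0 1 (kinds i (fmax i 0 w)) (subst (_≤ 1) (sym (fmax-φ i 0 w)) z≤n)
fmax-φ i (suc c) (x ∷ w) | cl rewrite k = fmax-φ i c w

fmax-shift : ∀ i c w → Shift i (φ c (kinds i w)) w (fmax i c w)
fmax-shift i c [] = shift refl refl (λ _ _ _ → refl)
fmax-shift i c (⟨ y , p ⟩ ∷ w) with kind i y in k | kindView i y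
fmax-shift i c (⟨ .(suc i) , p ⟩ ∷ w) | op | isOp with fmax-shift i (suc c) w
... | shift a b h = shift (trans (count-miss p w 1+n≢n) (trans a (cong (φ (suc c) (kinds i w) +_) (sym (count-miss p (fmax i (suc c) w) 1+n≢n)))))
    (trans (count-hit (suc i) p (fmax i (suc c) w)) (trans (cong suc b) (trans (sym (+-suc _ _)) (cong (φ (suc c) (kinds i w) +_) (sym (count-hit (suc i) p w))))))
    (λ j r s → trans (count-miss p (fmax i (suc c) w) (λ e → s (sym e))) (trans (h j r s) (sym (count-miss p w (λ e → s (sym e))))))
fmax-shift i c (⟨ y , p ⟩ ∷ w) | ne | isNe q q' with fmax-shift i c w
... | shift a b h = shift (trans (count-miss p w q) (trans a (cong (φ c (kinds i w) +_) (sym (count-miss p (fmax i c w) q)))))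
    (trans (count-miss p (fmax i c w) q') (trans b (cong (φ c (kinds i w) +_) (sym (count-miss p w q')))))
    h'
  where
  h' : ∀ j → j ≢ i → j ≢ suc i → count j (⟨ y , p ⟩ ∷ fmax i c w) ≡ count j (⟨ y , p ⟩ ∷ w)
  h' j r s with y ≡ᵇ j
  ... | true = cong suc (h j r s)
  ... | false = h j r s
fmax-shift i zero (⟨ .i , p ⟩ ∷ w) | cl | isCl with fmax-shift i 0 w
... | shift a b h = shift (trans (count-hit i p w) (cong suc (trans a (cong (φ 0 (kinds i w) +_) (sym (count-miss p (fmax i 0 w) 1+n≢n))))))
    (trans (count-hit (suc i) p (fmax i 0 w)) (cong suc (trans b (cong (φ 0 (kinds i w) +_) (sym (count-miss p w (λ e → 1+n≢n (sym e))))))))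
    (λ j r s → trans (count-miss p (fmax i 0 w) (λ e → s (sym e))) (trans (h j r s) (sym (count-miss p w (λ e → r (sym e))))))
fmax-shift i (suc c) (⟨ .i , p ⟩ ∷ w) | cl | isCl with fmax-shift i c w
... | shift a b h = shift (trans (count-hit i p w) (trans (cong suc a) (trans (sym (+-suc _ _)) (cong (φ c (kinds i w) +_) (sym (count-hit i p (fmax i c w)))))))
    (trans (count-miss p (fmax i c w) (λ e → 1+n≢n (sym e))) (trans b (cong (φ c (kinds i w) +_) (sym (count-miss p w (λ e → 1+n≢n (sym e)))))))
    (λ j r s → trans (count-miss p (fmax i c w) (λ e → r (sym e))) (trans (h j r s) (sym (count-miss p w (λ e → r (sym e))))))

-- The number of matched pairs is counted twice, once as closing brackets minus the unmatched ones,
-- once as opening brackets, including the `c` initial ones, minus the pending ones.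
balance : ∀ i c w → c + count (suc i) w + φ c (kinds i w) ≡ count i w + ω c (kinds i w)
balance i c [] = trans (+-identityʳ _) (+-identityʳ c)
balance i c (⟨ y , p ⟩ ∷ w) with kind i y in k | kindView i y
balance i c (⟨ .(suc i) , p ⟩ ∷ w) | op | isOp rewrite count-hit (suc i) p w | count-miss p w (1+n≢n {i}) | +-suc c (count (suc i) w) = balance i (suc c) w
balance i c (⟨ y , p ⟩ ∷ w) | ne | isNe q q' rewrite count-miss p w q | count-miss p w q' = balance i c w
balance i zero (⟨ .i , p ⟩ ∷ w) | cl | isCl rewrite count-hit i p w | count-miss p w (λ e → 1+n≢n {i} (sym e)) = trans (+-suc _ _) (cong suc (balance i 0 w))
balance i (suc c) (⟨ .i , p ⟩ ∷ w) | cl | isCl rewrite count-hit i p w | count-miss p w (λ e → 1+n≢n {i} (sym e)) = cong suc (balance i c w)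

-- Connectivity: every word of length at least two is connected to one that
-- starts with n n.  If the sum of the squares of the weights cannot be increased
-- along paths, the weights may be permuted freely by fmax and control the first letters.

firstLE : ℕ → Word → Maybe ℕ
firstLE k [] = nothing
firstLE k (x ∷ w) with base x ≤? k
... | yes _ = just (base x)
... | no _ = firstLE k w

firstLE-hit : ∀ {k x} w → base x ≤ k → firstLE k (x ∷ w) ≡ just (base x)
firstLE-hit {k} {x} w p with base x ≤? k
... | yes _ = refl
... | no q = ⊥-elim (q p)

firstLE-miss : ∀ {k x} w → k < base x → firstLE k (x ∷ w) ≡ firstLE k w
firstLE-miss {k} {x} w p with base x ≤? k
... | yes q = ⊥-elim (<⇒≱ p q)
... | no q = refl

firstLE-≤ : ∀ k w {y} → firstLE k w ≡ just y → y ≤ k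
firstLE-≤ k (x ∷ w) e with base x ≤? k
firstLE-≤ k (x ∷ w) refl | yes p = p
... | no _ = firstLE-≤ k w e

firstLE-pred : ∀ k w {y} → y ≤ k → firstLE (suc k) w ≡ just y → firstLE k w ≡ just y
firstLE-pred k (x ∷ w) p e with base x ≤? suc k
firstLE-pred k (x ∷ w) p refl | yes _ = firstLE-hit w p
... | no q = trans (firstLE-miss w (<-trans (n<1+n k) (≰⇒> q))) (firstLE-pred k w p e)

firstLE-count : ∀ k w → firstLE k w ≡ nothing → ∀ i → i ≤ k → count i w ≡ 0
firstLE-count k [] e i p = refl
firstLE-count k (⟨ y , b ⟩ ∷ w) e i p with y ≤? k
... | no q = trans (count-miss {i} {y} b w (λ { refl → q p })) (firstLE-count k w e i p)

firstLE-∈ : ∀ k w {y} → firstLE k w ≡ just y → 1 ≤ count y w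
firstLE-∈ k (⟨ z , b ⟩ ∷ w) {y} e with z ≤? k
firstLE-∈ k (⟨ z , b ⟩ ∷ w) refl | yes _ = subst (1 ≤_) (sym (count-hit z b w)) (s≤s z≤n)
... | no _ with z ≡ᵇ y
...   | true = s≤s z≤n
...   | false = firstLE-∈ k w e

-- All letters before the first `i` exceed `k`, hence also `suc i`, so this `i` is unmatched and
-- gets raised.
fmax-first : ∀ i k w → suc i ≤ k → firstLE k w ≡ just i → firstLE k (fmax i 0 w) ≡ just (suc i)
fmax-first i k (⟨ y , b ⟩ ∷ w) p e with y ≤? k
fmax-first i k (⟨ .i , b ⟩ ∷ w) p refl | yes _ rewrite kind-cl i = firstLE-hit (fmax i 0 w) p
fmax-first i k (⟨ y , b ⟩ ∷ w) p e | no q rewrite kind-ne {i} {y} (λ { refl → q (≤-trans (n≤1+n i) p) }) (λ { refl → q p }) =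
  trans (firstLE-miss (fmax i 0 w) (≰⇒> q)) (fmax-first i k w p e)

fmax-first-other : ∀ i k c w → suc i ≤ k → firstLE (suc k) w ≡ just (suc k) → firstLE (suc k) (fmax i c w) ≡ just (suc k)
fmax-first-other i k c (⟨ y , b ⟩ ∷ w) p e with y ≤? suc k
fmax-first-other i k c (⟨ .(suc k) , b ⟩ ∷ w) p refl | yes _ rewrite kind-ne {i} {suc k} (λ { refl → <⇒≱ (n<1+n k) (≤-trans (n≤1+n _) p) }) (λ { refl → <-irrefl refl p }) =
  firstLE-hit (fmax i c w) ≤-refl
fmax-first-other i k c (⟨ y , b ⟩ ∷ w) p e | no q rewrite kind-ne {i} {y} (λ { refl → q (≤-trans (n≤1+n i) (m≤n⇒m≤1+n p)) }) (λ { refl → q (m≤n⇒m≤1+n p) }) =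
  trans (firstLE-miss (fmax i c w) (≰⇒> q)) (fmax-first-other i k c w p e)

fmax-first-stays′ : ∀ k c w → firstLE k w ≡ just k → firstLE k (fmax k (suc c) w) ≡ just k
fmax-first-stays′ k c (⟨ y , b ⟩ ∷ w) e with y ≤? k
fmax-first-stays′ k c (⟨ .k , b ⟩ ∷ w) refl | yes _ rewrite kind-cl k = firstLE-hit (fmax k c w) ≤-refl
... | no q with kind k y in eq | kindView k y
...   | .op | isOp = trans (firstLE-miss (fmax k (suc (suc c)) w) (≰⇒> q)) (fmax-first-stays′ k (suc c) w e)
...   | .ne | isNe _ _ = trans (firstLE-miss (fmax k (suc c) w) (≰⇒> q)) (fmax-first-stays′ k c w e)
...   | .cl | isCl = ⊥-elim (q ≤-refl)

-- A letter `suc k` comes before the first `k` and is still pending when it is reached, so this `k`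
-- is matched and survives.
fmax-first-stays : ∀ k w → firstLE (suc k) w ≡ just (suc k) → firstLE k w ≡ just k → firstLE k (fmax k 0 w) ≡ just k
fmax-first-stays k (⟨ y , b ⟩ ∷ w) e e' with y ≤? suc k
fmax-first-stays k (⟨ .(suc k) , b ⟩ ∷ w) refl e' | yes _ rewrite kind-op k =
  trans (firstLE-miss (fmax k 1 w) ≤-refl) (fmax-first-stays′ k 0 w (trans (sym (firstLE-miss {k} {⟨ suc k , b ⟩} w ≤-refl)) e'))
fmax-first-stays k (⟨ y , b ⟩ ∷ w) e e' | no q rewrite kind-ne {k} {y} (λ { refl → q (n≤1+n k) }) (λ { refl → q ≤-refl }) =
  trans (firstLE-miss (fmax k 0 w) (<-trans (n<1+n k) (≰⇒> q)))
    (fmax-first-stays k w e (trans (sym (firstLE-miss {k} {⟨ y , b ⟩} w (<-trans (n<1+n k) (≰⇒> q)))) e'))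

Sorted : ℕ → Word → Set
Sorted k w = ∀ j → 1 ≤ j → suc j ≤ k → count (suc j) w ≤ count j w

sorted-max : ∀ {k} w → Sorted k w → ∀ i → 1 ≤ i → i ≤ k → count i w ≤ count 1 w
sorted-max w s (suc zero) p q = ≤-refl
sorted-max w s (suc (suc i)) p q = ≤-trans (s (suc i) (s≤s z≤n) q) (sorted-max w s (suc i) (s≤s z≤n) (≤-trans (n≤1+n _) q))

module _ {n : ℕ} where

  stepF : ∀ {i w v} → 1 ≤ i → i < n → F i w v → Step (QIdx n) w v
  stepF p q f = ix _ , (p , q) , fI-F f

  stepE : ∀ {w v} → E1 w ≡ just v → Step (QIdx n) v w
  stepE {w} {v} e = ī , tt , trans (f1̄≡F1 v) (E1-F1 w e)

  fmax-Conn : ∀ {i} → 1 ≤ i → i < n → ∀ u c w → ωW i u ≡ c → Conn (Step (QIdx n)) (u ++ w) (u ++ fmax i c w)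
  fmax-Conn p q u c [] e = done
  fmax-Conn {i} p q u c (⟨ y , b ⟩ ∷ w) e with kind i y in k | kindView i y
  ... | op | _ = subst₂ (Conn _) (++-assoc u [ ⟨ y , b ⟩ ] w) (++-assoc u [ ⟨ y , b ⟩ ] _) (fmax-Conn p q (u ++ [ ⟨ y , b ⟩ ]) (suc c) w w')
    where w' : ωW i (u ++ [ ⟨ y , b ⟩ ]) ≡ suc c
          w' rewrite ωW-++ i u [ ⟨ y , b ⟩ ] | k | e = refl
  ... | ne | _ = subst₂ (Conn _) (++-assoc u [ ⟨ y , b ⟩ ] w) (++-assoc u [ ⟨ y , b ⟩ ] _) (fmax-Conn p q (u ++ [ ⟨ y , b ⟩ ]) c w w')
    where w' : ωW i (u ++ [ ⟨ y , b ⟩ ]) ≡ c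
          w' rewrite ωW-++ i u [ ⟨ y , b ⟩ ] | k | e = refl
  fmax-Conn {i} p q u (suc c) (⟨ y , b ⟩ ∷ w) e | cl | _ = subst₂ (Conn _) (++-assoc u [ ⟨ y , b ⟩ ] w) (++-assoc u [ ⟨ y , b ⟩ ] _) (fmax-Conn p q (u ++ [ ⟨ y , b ⟩ ]) c w w')
    where w' : ωW i (u ++ [ ⟨ y , b ⟩ ]) ≡ c
          w' rewrite ωW-++ i u [ ⟨ y , b ⟩ ] | k | e = refl
  fmax-Conn {i} p q u zero (⟨ .i , b ⟩ ∷ w) e | cl | isCl =
    subst₂ (Conn _) (++-assoc u [ ⟨ i , b ⟩ ] w) (++-assoc u [ ⟨ i , b ⟩ ] _) (fmax-Conn p q (u ++ [ ⟨ i , b ⟩ ]) 0 w w')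
      ◅◅ fwd (stepF p q (mkF u b (fmax i 0 w) refl refl e (fmax-φ i 0 w))) done
    where w' : ωW i (u ++ [ ⟨ i , b ⟩ ]) ≡ 0
          w' rewrite ωW-++ i u [ ⟨ i , b ⟩ ] | kind-cl i | e = refl

-- Growth of the sum of squares, and reflections of the weights

module Core (n : ℕ) (2≤n : 2 ≤ n) where

  R : Rel
  R = Step (QIdx n)

  In : Word → Set
  In = All (InAlph n)

  step-In : ∀ {a b} → R a b → In a → In b
  step-In {a} (ī , _ , e) = F1-All (λ _ _ → s≤s z≤n , 2≤n) a (trans (sym (f1̄≡F1 a)) e)
  step-In (ix i , (p , q) , e) = F-AllW (λ _ _ → s≤s z≤n , q) (F-fI e)

  step-In⁻ : ∀ {a b} → R a b → In b → In a
  step-In⁻ {a} {b} (ī , _ , e) = E1-All (λ _ _ → s≤s z≤n , ≤-trans (n≤1+n 1) 2≤n) b (F1-E1 a (trans (sym (f1̄≡F1 a)) e))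
  step-In⁻ (ix i , (p , q) , e) = E-AllW (λ _ _ → p , ≤-trans (n≤1+n i) q) (F-fI e)

  Conn-In : ∀ {a b} → Conn R a b → In a → In b
  Conn-In = Conn-inv step-In step-In⁻

  step-length : ∀ {a b} → R a b → length a ≡ length b
  step-length {a} {b} (ī , _ , e) = E1-length b (F1-E1 a (trans (sym (f1̄≡F1 a)) e))
  step-length (ix i , _ , e) = F-length (F-fI e)

  Conn-length : ∀ {a b} → Conn R a b → length a ≡ length b
  Conn-length done = refl
  Conn-length (fwd s c) = trans (step-length s) (Conn-length c)
  Conn-length (bwd s c) = trans (sym (step-length s)) (Conn-length c)

  S : Word → ℕ
  S = Sq n

  Prog : ℕ → Word → Set
  Prog s w = ∃ λ u → Conn R w u × s < S u

  extend : ∀ {s w v} → Conn R w v → Prog s v → Prog s w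
  extend c (u , d , lt) = u , c ◅◅ d , lt

  gain : ∀ {i} w v → 1 ≤ i → suc i ≤ n → (∀ j → j ≢ i → j ≢ suc i → count j v ≡ count j w) →
    ∀ t → 1 ≤ t → count i v ≡ t + count i w → count (suc i) w ≡ t + count (suc i) v → count (suc i) w ≤ count i w → S w < S v
  gain {i} w v p q h t 1≤t e₁ e₂ le = sq-compare n {i} {w} {v} p q h
    (subst₂ _<_ (trans (cong (λ z → z * z + b * b) (trans (+-comm a t) (sym e₂))) (+-comm (count (suc i) w * count (suc i) w) (b * b)))
      (trans (+-comm (a * a) _) (cong (λ z → z * z + a * a) (trans (+-comm b t) (sym e₁)))) (sq-gain a b t a<b 1≤t))
    where
    a = count (suc i) v
    b = count i w
    a<b : a < b
    a<b = ≤-trans (≤-trans (+-monoˡ-≤ a 1≤t) (≤-reflexive (sym e₂))) le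

  -- Lowering an unmatched `suc i` makes the two weights more unequal, because the weight of `i` is
  -- already the larger or equal one; so the sum of squares grows.
  tight : ∀ {i w} → 1 ≤ i → i < n → count (suc i) w ≤ count i w → Prog (S w) w ⊎ ωW i w ≡ 0
  tight {i} {w} p q le with ωW i w in e
  ... | zero = inj₂ refl
  ... | suc _ with E-exists i w (subst (0 <_) (sym e) (s≤s z≤n))
  ...   | w₀ , f with F-shift f
  ...     | shift a b h = inj₁ (w₀ , bwd (stepF p q f) done , gain w w₀ p q (λ j r s → sym (h j r s)) 1 ≤-refl a b le)

  record Swap (i : ℕ) (w v : Word) : Set where
    constructor swapped
    field
      conn : Conn R w v
      lower : count i v ≡ count (suc i) w
      upper : count (suc i) v ≡ count i w
      others : ∀ j → j ≢ i → j ≢ suc i → count j v ≡ count j w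
      sq : S v ≡ S w

  -- Without unmatched letters `suc i`, `balance` says that the unmatched letters `i` number exactly
  -- the difference of the two weights. Raising all of them interchanges the weights.
  reflect : ∀ {i w} → 1 ≤ i → i < n → count (suc i) w ≤ count i w → Prog (S w) w ⊎ Swap i w (fmax i 0 w)
  reflect {i} {w} p q le with tight {i} {w} p q le
  ... | inj₁ g = inj₁ g
  ... | inj₂ e with fmax-shift i 0 w
  ...   | shift a b h = inj₂ (swapped (fmax-Conn p q [] 0 w refl) lo up' h
          (+-cancelʳ-≡ (sq₂ (count i) (count (suc i)) v) (S v) (S w) (trans (cong (S v +_) (trans (cong₂ (λ y z → y * y + z * z) lo up') (+-comm _ (count i w * count i w)))) (sumSq-two {λ j → count j v} {λ j → count j w} i n p q h))))
    where
    v = fmax i 0 w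
    sq₂ : (f g : Word → ℕ) → Word → ℕ
    sq₂ f g u = f u * f u + g u * g u
    bal : count i w ≡ φW i w + count (suc i) w
    bal = trans (sym (trans (balance i 0 w) (trans (cong (count i w +_) e) (+-identityʳ _)))) (+-comm (count (suc i) w) _)
    lo : count i v ≡ count (suc i) w
    lo = +-cancelˡ-≡ (φW i w) _ _ (trans (sym a) bal)
    up' : count (suc i) v ≡ count i w
    up' = trans b (sym bal)

  record Rot (w : Word) (j : ℕ) (u : Word) : Set where
    constructor rot
    field
      conn : Conn R w u
      sq : S u ≡ S w
      lo : ∀ i → 1 ≤ i → i ≤ j → count i u ≡ count (suc i) w
      mid : count (suc j) u ≡ count 1 w
      hi : ∀ i → suc j < i → count i u ≡ count i w

  rot-step : ∀ {w j u} → suc j < n → count (suc (suc j)) w ≤ count 1 w → Rot w j u → Prog (S w) w ⊎ Rot w (suc j) (fmax (suc j) 0 u)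
  rot-step {w} {j} {u} q le (rot c s lo mid hi) with reflect {suc j} {u} (s≤s z≤n) q (subst₂ _≤_ (sym (hi _ (n<1+n _))) (sym mid) le)
  ... | inj₁ g = inj₁ (extend c (subst (λ z → Prog z u) s g))
  ... | inj₂ (swapped d l' u' h s') = inj₂ (rot (c ◅◅ d) (trans s' s) lo'
        (trans u' mid) (λ i p → trans (h i (λ { refl → <⇒≱ p (n≤1+n _) }) (λ { refl → <-irrefl refl p })) (hi i (<-trans (n<1+n _) p))))
    where
    lo' : ∀ i → 1 ≤ i → i ≤ suc j → count i (fmax (suc j) 0 u) ≡ count (suc i) w
    lo' i p r with m≤n⇒m<n∨m≡n r
    ... | inj₂ refl = trans l' (hi _ (n<1+n _))
    ... | inj₁ (s≤s t) = trans (h i (λ { refl → <-irrefl refl t }) (λ { refl → <⇒≱ t (n≤1+n _) })) (lo i p t)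

  -- The largest weight travels from index 1 to `suc K` by successive reflections, each allowed
  -- because it is at least the next weight. The predicate `P` is a property of the words to be
  -- followed on the way.
  rotate : ∀ {w} (P : ℕ → Word → Set) → P 0 w → ∀ K → suc K ≤ n → (∀ i → 1 ≤ i → i ≤ suc K → count i w ≤ count 1 w) →
    (∀ {j u} → j < K → Rot w j u → P j u → Prog (S w) w ⊎ P (suc j) (fmax (suc j) 0 u)) → Prog (S w) w ⊎ ∃ λ u → Rot w K u × P K u
  rotate P p0 zero q m st = inj₂ (_ , rot done refl (λ { (suc _) _ () }) refl (λ _ _ → refl) , p0)
  rotate {w} P p0 (suc K) q m st with rotate {w} P p0 K (≤-trans (n≤1+n _) q) (λ i a b → m i a (m≤n⇒m≤1+n b)) (λ lt → st (m<n⇒m<1+n lt))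
  ... | inj₁ g = inj₁ g
  ... | inj₂ (u , r , pu) with st ≤-refl r pu | rot-step q (m (suc (suc K)) (s≤s z≤n) ≤-refl) r
  ...   | inj₁ g | _ = inj₁ g
  ...   | inj₂ _ | inj₁ g = inj₁ g
  ...   | inj₂ pu' | inj₂ r' = inj₂ (_ , r' , pu')

  FirstOne : ℕ → Word → Set
  FirstOne k w = firstLE k w ≡ nothing ⊎ firstLE k w ≡ just 1

  first12≡2 : ∀ w → In w → firstLE 2 w ≡ just 2 → first12 w ≡ just 2
  first12≡2 (⟨ 0 , _ ⟩ ∷ w) ((() , _) ∷ p) e
  first12≡2 (⟨ 1 , _ ⟩ ∷ w) (_ ∷ p) ()
  first12≡2 (⟨ 2 , _ ⟩ ∷ w) (_ ∷ p) e = refl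
  first12≡2 (⟨ suc (suc (suc _)) , _ ⟩ ∷ w) (_ ∷ p) e = first12≡2 w p e

  firstLE≥1 : ∀ k w {y} → In w → firstLE k w ≡ just y → 1 ≤ y
  firstLE≥1 k (x ∷ w) (p ∷ ps) e with base x ≤? k
  firstLE≥1 k (x ∷ w) (p ∷ ps) refl | yes _ = proj₁ p
  ... | no _ = firstLE≥1 k w ps e

  nothing≢ : ∀ {k : ℕ} → nothing ≢ just k
  nothing≢ ()

  -- In a word with decreasing weights c₁ ≥ ⋯ ≥ c_k the first letter ≤ k is 1, unless
  -- the sum of squares can grow: if k+1 came first, rotating c₁ to position k+1
  -- would leave decreasing weights on 1,…,k with first letter k.
  first-one-step : ∀ k → 2 ≤ k → suc k ≤ n → (∀ w → In w → Sorted k w → Prog (S w) w ⊎ FirstOne k w) →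
    ∀ w → In w → Sorted (suc k) w → Prog (S w) w ⊎ FirstOne (suc k) w
  first-one-step k 2≤k k≤n ih w iw s with firstLE (suc k) w in e
  ... | nothing = inj₂ (inj₁ refl)
  ... | just y with m≤n⇒m<n∨m≡n (firstLE-≤ (suc k) w e)
  first-one-step k 2≤k k≤n ih w iw s | just y | inj₁ (s≤s y≤k) with ih w iw (λ j a b → s j a (m≤n⇒m≤1+n b))
  ... | inj₁ g = inj₁ g
  ... | inj₂ (inj₁ q) with trans (sym q) (firstLE-pred k w y≤k e)
  ...   | ()
  first-one-step k 2≤k k≤n ih w iw s | just y | inj₁ (s≤s y≤k) | inj₂ (inj₂ q) = inj₂ (inj₂ (trans (sym (firstLE-pred k w y≤k e)) q))
  first-one-step k 2≤k k≤n ih w iw s | just .(suc k) | inj₂ refl with ih w iw (λ j a b → s j a (m≤n⇒m≤1+n b))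
  ... | inj₁ g = inj₁ g
  ... | inj₂ (inj₁ q) = ⊥-elim (<⇒≱ (≤-trans (firstLE-∈ (suc k) w e) (sorted-max w s (suc k) (s≤s z≤n) ≤-refl)) (≤-reflexive (firstLE-count k w q 1 (≤-trans (n≤1+n 1) 2≤k))))
  ... | inj₂ (inj₂ q) with rotate {w} P (inj₁ (≤-trans (n≤1+n 1) 2≤k , e , q)) k k≤n (sorted-max w s) st
    where
    -- While the large weight travels, `suc k` stays the first letter not exceeding `suc k`, and the
    -- first letter not exceeding `k` climbs from 1 to `k`. The last reflection does not raise this
    -- `k`, which is shielded by the `suc k` in front of it.
    P : ℕ → Word → Set
    P j u = (suc j ≤ k × firstLE (suc k) u ≡ just (suc k) × firstLE k u ≡ just (suc j)) ⊎ (j ≡ k × firstLE k u ≡ just k)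
    st : ∀ {j u} → j < k → Rot w j u → P j u → Prog (S w) w ⊎ P (suc j) (fmax (suc j) 0 u)
    st j<k r (inj₂ (refl , _)) = ⊥-elim (<-irrefl refl j<k)
    st {j} {u} j<k r (inj₁ (_ , a , b)) with m≤n⇒m<n∨m≡n j<k
    ... | inj₁ lt = inj₂ (inj₁ (lt , fmax-first-other (suc j) k 0 u lt a , fmax-first (suc j) k u lt b))
    ... | inj₂ refl = inj₂ (inj₂ (refl , fmax-first-stays k u a b))
  ...   | inj₁ g = inj₁ g
  ...   | inj₂ (u , rot c sq lo mid hi , inj₁ (lt , _)) = ⊥-elim (<-irrefl refl lt)
  ...   | inj₂ (u , rot c sq lo mid hi , inj₂ (_ , b)) with ih u (Conn-In c iw)
          (λ j p r → subst₂ _≤_ (sym (lo (suc j) (s≤s z≤n) r)) (sym (lo j p (≤-trans (n≤1+n j) r))) (s (suc j) (s≤s z≤n) (s≤s r)))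
  ...     | inj₁ g = inj₁ (extend c (subst (λ z → Prog z u) sq g))
  ...     | inj₂ (inj₁ t) = ⊥-elim (nothing≢ (trans (sym t) b))
  ...     | inj₂ (inj₂ t) = ⊥-elim (<⇒≢ 2≤k (just-injective (trans (sym t) b)))

  first-one : ∀ k → k ≤ n → ∀ w → In w → Sorted k w → Prog (S w) w ⊎ FirstOne k w
  first-one zero k≤n w iw s with firstLE 0 w in e
  ... | nothing = inj₂ (inj₁ refl)
  ... | just y = ⊥-elim (<⇒≱ (firstLE≥1 0 w iw e) (firstLE-≤ 0 w e))
  first-one (suc zero) k≤n w iw s with firstLE 1 w in e
  ... | nothing = inj₂ (inj₁ refl)
  ... | just y = inj₂ (inj₂ (cong just (≤-antisym (firstLE-≤ 1 w e) (firstLE≥1 1 w iw e))))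
  first-one (suc (suc zero)) k≤n w iw s with firstLE 2 w in e
  ... | nothing = inj₂ (inj₁ refl)
  ... | just y with m≤n⇒m<n∨m≡n (firstLE-≤ 2 w e)
  ...   | inj₁ y<2 = inj₂ (inj₂ (cong just (≤-antisym (≤-pred y<2) (firstLE≥1 2 w iw e))))
  -- The odd operator enters here: a 2 in front of every 1 can be lowered by `E1`, and as the
  -- weights are sorted the sum of squares grows.
  ...   | inj₂ refl with E1 w in q
  ...     | nothing = ⊥-elim (E1-none w q (first12≡2 w iw e))
  ...     | just v with E1-shift {w} {v} q
  ...       | shift a b h = inj₁ (v , bwd (stepE q) done , gain w v ≤-refl k≤n (λ j r t → sym (h j r t)) 1 ≤-refl a b (s 1 ≤-refl ≤-refl))
  first-one (suc k@(suc (suc _))) k≤n = first-one-step k (s≤s (s≤s z≤n)) k≤n (first-one k (≤-trans (n≤1+n k) k≤n))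

-- Sorting the weights, and words that start with n n

Shift-trans : ∀ {i s t u v w} → Shift i s u v → Shift i t v w → Shift i (s + t) u w
Shift-trans {i} {s} {t} {u} (shift a b h) (shift a' b' h') = shift (trans a (trans (cong (s +_) a') (sym (+-assoc s t _))))
  (trans b' (trans (cong (t +_) b) (trans (sym (+-assoc t s _)) (cong (_+ count (suc i) u) (+-comm t s))))) (λ j p q → trans (h' j p q) (h j p q))

total : Word → ℕ
total [] = 0
total (x ∷ w) = base x + total w

total-++ : ∀ u v → total (u ++ v) ≡ total u + total v
total-++ [] v = refl
total-++ (x ∷ u) v = trans (cong (base x +_) (total-++ u v)) (sym (+-assoc (base x) _ _))

F-total : ∀ {i w v} → F i w v → total v ≡ suc (total w)
F-total (mkF u p v refl refl _ _) = trans (total-++ u _) (trans (+-suc _ _) (cong suc (sym (total-++ u _))))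

sorted? : ∀ k w → Sorted k w ⊎ ∃ λ i → 1 ≤ i × suc i ≤ k × count i w < count (suc i) w
sorted? zero w = inj₁ (λ j _ ())
sorted? (suc zero) w = inj₁ (λ { (suc j) _ (s≤s ()) })
sorted? (suc (suc k)) w with sorted? (suc k) w
... | inj₂ (i , p , q , r) = inj₂ (i , p , m≤n⇒m≤1+n q , r)
... | inj₁ s with count (suc (suc k)) w ≤? count (suc k) w
...   | no q = inj₂ (suc k , s≤s z≤n , ≤-refl , ≰⇒> q)
...   | yes q = inj₁ go
  where
  go : Sorted (suc (suc k)) w
  go j p r with m≤n⇒m<n∨m≡n r
  ... | inj₁ lt = s j p (≤-pred lt)
  ... | inj₂ refl = q

Starts : ℕ → Word → Set
Starts n u = ∃ λ p → ∃ λ q → ∃ λ v → u ≡ ⟨ n , p ⟩ ∷ ⟨ n , q ⟩ ∷ v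

fmax-second : ∀ i c y v → base y ≢ 1 → suc i ≢ 1 → ∃₂ λ y' v' → fmax i c (y ∷ v) ≡ y' ∷ v' × base y' ≢ 1
fmax-second i c y v p q with kind i (base y)
... | op = _ , _ , refl , p
... | ne = _ , _ , refl , p
fmax-second i zero y v p q | cl = _ , _ , refl , q
fmax-second i (suc c) y v p q | cl = _ , _ , refl , p

fmax-second₁ : ∀ y v → ∃₂ λ y' v' → fmax 1 0 (y ∷ v) ≡ y' ∷ v' × base y' ≢ 1
fmax-second₁ ⟨ 0 , p ⟩ v = _ , _ , refl , λ ()
fmax-second₁ ⟨ 1 , p ⟩ v = _ , _ , refl , λ ()
fmax-second₁ ⟨ 2 , p ⟩ v = _ , _ , refl , λ ()
fmax-second₁ ⟨ suc (suc (suc _)) , p ⟩ v = _ , _ , refl , λ ()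

module _ (n″ : ℕ) where

  private
    n = suc (suc n″)

  open Core n (s≤s (s≤s z≤n))

  -- The first letter is 1 and climbs to n together with the largest weight; from the first
  -- reflection on, the second letter is never 1. At the end the weights of 1, ..., n-1 are sorted
  -- again, so the first letter below n would have to be 1. Hence the second letter is n.
  sorted-case : ∀ w → In w → 2 ≤ length w → Sorted n w → Prog (S w) w ⊎ ∃ λ u → Conn R w u × Starts n u
  sorted-case w@(⟨ x , p ⟩ ∷ y ∷ v) iw (s≤s (s≤s z≤n)) s with first-one n ≤-refl w iw s
  ... | inj₁ g = inj₁ g
  ... | inj₂ (inj₁ e) = ⊥-elim (nothing≢ (trans (sym e) (firstLE-hit (y ∷ v) (proj₂ (All.head iw)))))
  ... | inj₂ (inj₂ e) with just-injective (trans (sym (firstLE-hit {n} {⟨ x , p ⟩} (y ∷ v) (proj₂ (All.head iw)))) e)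
  ...   | refl = go (rotate P refl (suc n″) ≤-refl (sorted-max w s) st)
    where
    P : ℕ → Word → Set
    P zero u = u ≡ w
    P (suc j) u = ∃ λ q → ∃₂ λ z t → u ≡ ⟨ suc (suc j) , q ⟩ ∷ z ∷ t × base z ≢ 1
    st : ∀ {j u} → j < suc n″ → Rot w j u → P j u → Prog (S w) w ⊎ P (suc j) (fmax (suc j) 0 u)
    st {zero} _ r refl with fmax-second₁ y v
    ... | z , t , e , q = inj₂ (p , z , t , cong (⟨ 2 , p ⟩ ∷_) e , q)
    st {suc j} _ r (b , z , t , refl , q) with fmax-second (suc (suc j)) 0 z t q (λ ())
    ... | z' , t' , e , q' = inj₂ (b , z' , t' , trans hd (cong (⟨ suc (suc (suc j)) , b ⟩ ∷_) e) , q')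
      where
      hd : fmax (suc (suc j)) 0 (⟨ suc (suc j) , b ⟩ ∷ z ∷ t) ≡ ⟨ suc (suc (suc j)) , b ⟩ ∷ fmax (suc (suc j)) 0 (z ∷ t)
      hd rewrite kind-cl (suc (suc j)) = refl
    go : Prog (S w) w ⊎ (∃ λ u → Rot w (suc n″) u × P (suc n″) u) → Prog (S w) w ⊎ ∃ λ u → Conn R w u × Starts (suc (suc n″)) u
    go (inj₁ g) = inj₁ g
    go (inj₂ (u , rot c sq lo mid hi , b , z , t , refl , z≢1)) with m≤n⇒m<n∨m≡n (proj₂ (All.head (All.tail (Conn-In c iw))))
    ... | inj₂ e = inj₂ (u , c , b , primed z , t , cong (λ k → ⟨ suc (suc n″) , b ⟩ ∷ ⟨ k , primed z ⟩ ∷ t) e)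
    ... | inj₁ (s≤s lt) with first-one (suc n″) (n≤1+n _) u (Conn-In c iw)
            (λ j p r → subst₂ _≤_ (sym (lo (suc j) (s≤s z≤n) r)) (sym (lo j p (≤-trans (n≤1+n j) r))) (s (suc j) (s≤s z≤n) (s≤s r)))
    ...   | inj₁ g = inj₁ (extend c (subst (λ z → Prog z u) sq g))
    ...   | inj₂ f with trans (firstLE-miss {suc n″} {⟨ suc (suc n″) , b ⟩} (z ∷ t) ≤-refl) (firstLE-hit t lt)
    ...     | e with f
    ...       | inj₁ e' = ⊥-elim (nothing≢ (trans (sym e') e))
    ...       | inj₂ e' = ⊥-elim (z≢1 (just-injective (trans (sym e) e')))

  lowerLetters : ∀ {i} d w → 1 ≤ i → i < n → d ≤ ωW i w → ∃ λ u → Conn R w u × Shift i d u w × total u + d ≡ total w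
  lowerLetters zero w p q le = w , done , shift refl refl (λ _ _ _ → refl) , +-identityʳ _
  lowerLetters {i} (suc d) w p q le with E-exists i w (≤-trans (s≤s z≤n) le)
  ... | w₀ , f with lowerLetters {i} d w₀ p q (≤-pred (≤-trans le (≤-reflexive (F-ω f))))
  ...   | u , c , sh , t = u , bwd (stepF p q f) c , subst (λ z → Shift i z u w) (+-comm d 1) (Shift-trans sh (F-shift f)) ,
          trans (+-suc _ _) (trans (cong suc t) (sym (F-total f)))

  -- An ascent of the weights is removed by lowering as many unmatched letters as the two weights
  -- differ; `balance` provides enough of them. This interchanges the weights, so the sum of squares
  -- is kept, and the sum of the letters drops, which the fuel bounds.
  sortWeights : ∀ fuel w → total w ≤ fuel → ∃ λ u → Conn R w u × S u ≡ S w × Sorted n u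
  sortWeights fuel w le with sorted? n w
  ... | inj₁ s = w , done , refl , s
  sortWeights fuel w le | inj₂ (i , p , q , lt) with m≤n⇒∃[o]m+o≡n lt
  ... | d , e with lowerLetters {i} (suc d) w p q (+-cancelˡ-≤ (count i w) (suc d) (ωW i w) (≤-trans (≤-reflexive (trans (+-suc _ d) e)) (≤-trans (m≤m+n _ _) (≤-reflexive (balance i 0 w)))))
  ...   | u , c , shift a b h , t with fuel
  ...     | zero = ⊥-elim (<⇒≱ (≤-trans (m≤n+m (suc d) (total u)) (≤-reflexive t)) (≤-trans le z≤n))
  ...     | suc fuel' with sortWeights fuel' u (≤-pred (≤-trans (≤-trans (≤-reflexive (sym (+-comm (total u) 1))) (+-monoʳ-≤ (total u) (s≤s z≤n))) (≤-trans (≤-reflexive t) le)))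
  ...       | v , c' , s≡ , so = v , c ◅◅ c' , trans s≡ Su , so
    where
    ci : count i u ≡ count (suc i) w
    ci = trans a (trans (+-comm (suc d) _) (trans (+-suc _ d) e))
    cs : count (suc i) u ≡ count i w
    cs = +-cancelˡ-≡ (suc d) _ _ (trans (sym b) (trans (sym e) (trans (sym (+-suc _ d)) (+-comm (count i w) (suc d)))))
    Su : S u ≡ S w
    Su = +-cancelʳ-≡ (count i u * count i u + count (suc i) u * count (suc i) u) (S u) (S w)
      (trans (cong (S u +_) (trans (cong₂ (λ y z → y * y + z * z) ci cs) (+-comm _ (count i w * count i w))))
        (sumSq-two {λ j → count j u} {λ j → count j w} i n p q (λ j r t → sym (h j r t))))

  -- The sum of squares grows in every round and is at most n times the square of the length; the
  -- fuel covers what is left of this bound.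
  reach : ∀ fuel w → In w → 2 ≤ length w → n * (length w * length w) < S w + fuel → ∃ λ u → Conn R w u × Starts n u
  reach zero w iw l lt = ⊥-elim (<⇒≱ (≤-trans lt (≤-reflexive (+-identityʳ _))) (Sq-bound n w))
  reach (suc fuel) w iw l lt with sortWeights (total w) w ≤-refl
  ... | v , c , s≡ , so with sorted-case v (Conn-In c iw) (≤-trans l (≤-reflexive (Conn-length c))) so
  ...   | inj₂ (u , d , st) = u , c ◅◅ d , st
  ...   | inj₁ (u , d , g) with reach fuel u (Conn-In (c ◅◅ d) iw) (≤-trans l (≤-reflexive lu))
            (≤-trans (subst (λ z → n * (z * z) < S w + suc fuel) lu lt) (≤-trans (≤-reflexive (trans (+-suc (S w) fuel) (cong (λ z → suc z + fuel) (sym s≡)))) (+-monoˡ-≤ fuel g)))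
    where lu = Conn-length (c ◅◅ d)
  ...     | t , d' , st = t , (c ◅◅ d) ◅◅ d' , st

  reach-nn′ : ∀ w → In w → 2 ≤ length w → ∃ λ u → Conn R w u × Starts n u
  reach-nn′ w iw l = reach (suc (n * (length w * length w))) w iw l (m≤n+m _ (S w))

reach-nn : ∀ n → 2 ≤ n → ∀ w → All (InAlph n) w → 2 ≤ length w → ∃ λ u → Conn (Step (QIdx n)) w u × Starts n u
reach-nn (suc (suc n)) (s≤s (s≤s z≤n)) = reach-nn′ n

-- Lengths of hook subwords are crystal invariants

IsH : List ℕ → Set
IsH s = ∃ λ k → Hook k s

hookOf : ∀ J m E → SD J → All (m <_) J → WI (m ∷ E) → IsH (J ++ m ∷ E)
hookOf J m E d g s = _ , hook J m E refl refl d g s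

-- Replacing x by y between u and v, as done by the operators on the bases of a word
data Cond (u : List ℕ) : ℕ → ℕ → List ℕ → Set where
  up-i : ∀ i {v} → ωu i u ≡ 0 → φu i v ≡ 0 → Cond u i (suc i) v
  down-i : ∀ i {v} → ωu i u ≡ 0 → φu i v ≡ 0 → Cond u (suc i) i v
  up-1 : ∀ {v} → All (3 ≤_) u → Cond u 1 2 v
  down-1 : ∀ {v} → All (3 ≤_) u → Cond u 2 1 v

record Mv (w w' : List ℕ) : Set where
  constructor mv
  field
    u v : List ℕ
    x y : ℕ
    src : w ≡ u ++ x ∷ v
    tgt : w' ≡ u ++ y ∷ v
    cond : Cond u x y v

Cond-mono : ∀ p {u x y v} q → Cond (p ++ u) x y (v ++ q) → Cond u x y v
Cond-mono p {u} {v = v} q (up-i i a b) = up-i i (proj₁ (ω0⇒ (ωu i p) (K i u) (trans (sym (ωu-++ i p u)) a))) (φu-++0⁻ i v q b)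
Cond-mono p {u} {v = v} q (down-i i a b) = down-i i (proj₁ (ω0⇒ (ωu i p) (K i u) (trans (sym (ωu-++ i p u)) a))) (φu-++0⁻ i v q b)
Cond-mono p q (up-1 a) = up-1 (All.++⁻ʳ p a)
Cond-mono p q (down-1 a) = down-1 (All.++⁻ʳ p a)

⊆-split : ∀ (u : List ℕ) {v s} → s ⊆ u ++ v → ∃₂ λ s₁ s₂ → s ≡ s₁ ++ s₂ × s₁ ⊆ u × s₂ ⊆ v
⊆-split [] p = [] , _ , refl , [] , p
⊆-split (x ∷ u) (.x ∷ʳ p) with ⊆-split u p
... | s₁ , s₂ , e , q , r = s₁ , s₂ , e , x ∷ʳ q , r
⊆-split (x ∷ u) (refl ∷ p) with ⊆-split u p
... | s₁ , s₂ , refl , q , r = x ∷ s₁ , s₂ , refl , refl ∷ q , r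

⊆-split-mid : ∀ (s₁ : List ℕ) {x s₂} u → s₁ ++ x ∷ s₂ ⊆ u → ∃₂ λ u₁ u₂ → u ≡ u₁ ++ x ∷ u₂ × s₁ ⊆ u₁ × s₂ ⊆ u₂
⊆-split-mid [] (y ∷ u) (.y ∷ʳ p) with ⊆-split-mid [] u p
... | u₁ , u₂ , refl , q , r = y ∷ u₁ , u₂ , refl , y ∷ʳ q , r
⊆-split-mid [] (y ∷ u) (refl ∷ p) = [] , u , refl , [] , p
⊆-split-mid (z ∷ s₁) (y ∷ u) (.y ∷ʳ p) with ⊆-split-mid (z ∷ s₁) u p
... | u₁ , u₂ , refl , q , r = y ∷ u₁ , u₂ , refl , y ∷ʳ q , r
⊆-split-mid (z ∷ s₁) (y ∷ u) (refl ∷ p) with ⊆-split-mid s₁ u p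
... | u₁ , u₂ , refl , q , r = y ∷ u₁ , u₂ , refl , refl ∷ q , r

has-cl : ∀ i c u → 0 < φ c (K i u) → [ i ] ⊆ u
has-cl i c (y ∷ u) lt with kind i y | kindView i y
... | op | _ = y ∷ʳ has-cl i (suc c) u lt
... | ne | _ = y ∷ʳ has-cl i c u lt
has-cl i c (.i ∷ u) lt | cl | isCl = refl ∷ Sub.minimum u

has-op : ∀ i u → 0 < ωu i u → [ suc i ] ⊆ u
has-op i (y ∷ u) lt with kind i y | kindView i y
has-op i (.(suc i) ∷ u) lt | op | isOp = refl ∷ Sub.minimum u
... | ne | _ = y ∷ʳ has-op i u lt
... | cl | _ = y ∷ʳ has-op i u lt

-- Every `suc i` in `u` is matched by an `i` further right, so there is room for one more letter of
-- the subword.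
close-after : ∀ i s₀ u → ωu i u ≡ 0 → s₀ ++ [ suc i ] ⊆ u → s₀ ++ suc i ∷ i ∷ [] ⊆ u
close-after i s₀ u e p with ⊆-split-mid s₀ u p
... | u₁ , u₂ , refl , q , r = Sub.++⁺ q (refl ∷ has-cl i 0 u₂ (≤-trans (s≤s z≤n) (proj₂ (ω0⇒ (suc (ωu i u₁)) (K i u₂) (trans (sym (trans (ωu-++ i u₁ _) (lem (ωu i u₁)))) e)))))
  where
  lem : ∀ c → ω c (K i (suc i ∷ u₂)) ≡ ω (suc c) (K i u₂)
  lem c rewrite kind-op i = refl

-- Every `i` in `v` is matched by a `suc i` further left, which can be put in front.
open-before : ∀ i r v → φu i v ≡ 0 → i ∷ r ⊆ v → suc i ∷ i ∷ r ⊆ v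
open-before i r v e p with ⊆-split-mid [] v p
... | v₁ , v₂ , refl , _ , q = Sub.++⁺ (has-op i v₁ (go (ωu i v₁) refl)) (refl ∷ q)
  where
  go : ∀ c → ωu i v₁ ≡ c → 0 < ωu i v₁
  go (suc c) eq = subst (0 <_) (sym eq) (s≤s z≤n)
  go zero eq with trans (sym (trans (cong (λ z → φ z (kind i i ∷ K i v₂)) eq) (φ-cl i (K i v₂)))) (m+n≡0⇒n≡0 (φu i v₁) (trans (sym (φu-++ i v₁ _)) e))
  ... | ()

raiseAt lowerAt : ℕ → ℕ → ℕ
raiseAt i y with y ≟ i
... | yes _ = suc i
... | no _ = y
lowerAt i y with y ≟ suc i
... | yes _ = i
... | no _ = y

raise-≥ : ∀ i y → i ≤ y → suc i ≤ raiseAt i y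
raise-≥ i y p with y ≟ i
... | yes _ = ≤-refl
... | no q = ≤∧≢⇒< p (λ e → q (sym e))

raise-mono : ∀ i {x y} → x ≤ y → raiseAt i x ≤ raiseAt i y
raise-mono i {x} {y} p with x ≟ i | y ≟ i
... | yes refl | yes _ = ≤-refl
... | yes refl | no q = ≤∧≢⇒< p (λ e → q (sym e))
... | no q | yes refl = m≤n⇒m≤1+n p
... | no _ | no _ = p

lower-≤ : ∀ i y → y ≤ suc i → lowerAt i y ≤ i
lower-≤ i y p with y ≟ suc i
... | yes _ = ≤-refl
... | no q = ≤-pred (≤∧≢⇒< p q)

lower-mono : ∀ i {x y} → x ≤ y → lowerAt i x ≤ lowerAt i y
lower-mono i {x} {y} p with x ≟ suc i | y ≟ suc i
... | yes refl | yes _ = ≤-refl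
... | yes refl | no q = ≤-trans (n≤1+n i) p
... | no q | yes refl = ≤-pred (≤∧≢⇒< p q)
... | no _ | no _ = p

lower-≤′ : ∀ i y → lowerAt i y ≤ y
lower-≤′ i y with y ≟ suc i
... | yes refl = n≤1+n i
... | no _ = ≤-refl

WI-map : ∀ (f : ℕ → ℕ) → (∀ {x y} → x ≤ y → f x ≤ f y) → ∀ {E} → WI E → WI (map f E)
WI-map f h {[]} s = tt
WI-map f h {x ∷ E} (a , s) = All.map⁺ (All.map h a) , WI-map f h s

map-id-> : ∀ i {E} → All (i <_) E → map (raiseAt i) E ≡ E
map-id-> i [] = refl
map-id-> i {y ∷ E} (p ∷ ps) with y ≟ i
... | yes refl = ⊥-elim (<-irrefl refl p)
... | no _ = cong (y ∷_) (map-id-> i ps)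

-- The letters `i` of `E` come first in it, and each `i` of `v` is matched by a `suc i` further
-- left, possibly one of the `c` initial ones. Trading each `i` for its partner keeps the order.
raise-⊆ : ∀ i c v {E} → φ c (K i v) ≡ 0 → WI E → All (i ≤_) E → E ⊆ v → map (raiseAt i) E ⊆ replicate c (suc i) ++ v
raise-⊆ i c [] e s a [] = Sub.minimum _
raise-⊆ i c (y ∷ v) e s a p with kind i y | kindView i y
raise-⊆ i c (.(suc i) ∷ v) {E} e s a p | op | isOp = go p
  where
  move : ∀ c → suc i ∷ replicate c (suc i) ++ v ≡ replicate c (suc i) ++ suc i ∷ v
  move zero = refl
  move (suc c) = cong (suc i ∷_) (move c)
  go : E ⊆ suc i ∷ v → map (raiseAt i) E ⊆ replicate c (suc i) ++ suc i ∷ v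
  go (_ ∷ʳ q) = subst (map (raiseAt i) E ⊆_) (move c) (raise-⊆ i (suc c) v e s a q)
  go (refl ∷ q) = subst (_⊆ replicate c (suc i) ++ suc i ∷ v) (sym (map-id-> i (≤-refl ∷ All.map (λ t → t) (proj₁ s)))) (Sub.++⁺ˡ (replicate c (suc i)) (refl ∷ q))
raise-⊆ i (suc c) (.i ∷ v) e s a (_ ∷ʳ q) | cl | isCl = _ ∷ʳ Sub.⊆-trans (raise-⊆ i c v e s a q) (Sub.++⁺ (Sub.⊆-refl {x = replicate c (suc i)}) (_ ∷ʳ Sub.⊆-refl))
raise-⊆ i (suc c) (.i ∷ v) {_ ∷ E} e (_ , s) (_ ∷ a) (refl ∷ q) | cl | isCl with i ≟ i
... | no r = ⊥-elim (r refl)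
... | yes _ = refl ∷ Sub.⊆-trans (raise-⊆ i c v e s a q) (Sub.++⁺ (Sub.⊆-refl {x = replicate c (suc i)}) (_ ∷ʳ Sub.⊆-refl))
raise-⊆ i c (y ∷ v) e s a (_ ∷ʳ q) | ne | isNe _ _ = Sub.⊆-trans (raise-⊆ i c v e s a q) (Sub.++⁺ (Sub.⊆-refl {x = replicate c (suc i)}) (_ ∷ʳ Sub.⊆-refl))
raise-⊆ i c (y ∷ v) e s a (refl ∷ q) | ne | isNe n₁ _ =
  subst (_⊆ replicate c (suc i) ++ y ∷ v) (sym (map-id-> i (i<y ∷ All.map (<-≤-trans i<y) (proj₁ s)))) (Sub.++⁺ˡ (replicate c (suc i)) (refl ∷ q))
  where i<y = ≤∧≢⇒< (All.head a) (λ t → n₁ (sym t))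

countℕ : ℕ → List ℕ → ℕ
countℕ i w = count i (up w)

count-⊆ : ∀ i {u v} → u ⊆ v → countℕ i u ≤ countℕ i v
count-⊆ i [] = z≤n
count-⊆ i (y ∷ʳ p) with y ≡ᵇ i
... | true = m≤n⇒m≤1+n (count-⊆ i p)
... | false = count-⊆ i p
count-⊆ i (_∷_ {x} refl p) with x ≡ᵇ i
... | true = s≤s (count-⊆ i p)
... | false = count-⊆ i p

replicate-⊆ : ∀ i a u → a ≤ countℕ i u → replicate a i ⊆ u
replicate-⊆ i zero u le = Sub.minimum u
replicate-⊆ i (suc a) (y ∷ u) le with y ≡ᵇ i in q
... | true = sym (≡ᵇ-true {y} {i} q) ∷ replicate-⊆ i a u (≤-pred le)
... | false = y ∷ʳ replicate-⊆ i (suc a) u le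

count-replicate : ∀ i a → countℕ i (replicate a i) ≡ a
count-replicate i zero = refl
count-replicate i (suc a) = trans (count-hit i false (up (replicate a i))) (cong suc (count-replicate i a))

all-equal : ∀ {x E} → All (x ≤_) E → All (_≤ x) E → E ≡ replicate (length E) x
all-equal [] [] = refl
all-equal (p ∷ a) (q ∷ b) = cong₂ _∷_ (≤-antisym q p) (all-equal a b)

-- The letters `suc i` of `E` come last in it. The part of `u` from the first of them on has no
-- unmatched `suc i`, so by `balance` it contains at least as many letters `i`, which can be used
-- instead.
lower-⊆ : ∀ i u {E} → ωu i u ≡ 0 → WI E → All (_≤ suc i) E → E ⊆ u → map (lowerAt i) E ⊆ u
lower-⊆ i [] e s a [] = []
lower-⊆ i (y ∷ u) e s a p with kind i y in k | kindView i y
lower-⊆ i (.(suc i) ∷ u) e s a (_ ∷ʳ q) | op | isOp = _ ∷ʳ lower-⊆ i u (proj₁ (ω0⇒ 1 (K i u) e)) s a q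
lower-⊆ i (.(suc i) ∷ u) {E@(_ ∷ E₀)} e s a p@(refl ∷ q) | op | isOp = subst (_⊆ suc i ∷ u) (sym eq) (replicate-⊆ i (suc (length E₀)) (suc i ∷ u) le)
  where
  E≡ : E ≡ replicate (suc (length E₀)) (suc i)
  E≡ = all-equal (≤-refl ∷ proj₁ s) a
  lowers : ∀ a → map (lowerAt i) (replicate a (suc i)) ≡ replicate a i
  lowers zero = refl
  lowers (suc a) with suc i ≟ suc i
  ... | yes _ = cong (i ∷_) (lowers a)
  ... | no r = ⊥-elim (r refl)
  eq : map (lowerAt i) E ≡ replicate (suc (length E₀)) i
  eq = trans (cong (map (lowerAt i)) E≡) (lowers (suc (length E₀)))
  w₀ : ωu i (suc i ∷ u) ≡ 0
  w₀ = trans (ω-op i 0 (K i u)) e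
  le : suc (length E₀) ≤ countℕ i (suc i ∷ u)
  le = ≤-trans (≤-reflexive (sym (trans (cong (countℕ (suc i)) E≡) (count-replicate (suc i) (suc (length E₀)))))) (≤-trans (count-⊆ (suc i) p)
    (≤-trans (m≤m+n _ (φu i (suc i ∷ u))) (≤-reflexive (trans (balance i 0 (up (suc i ∷ u))) (trans (cong (countℕ i (suc i ∷ u) +_) w₀) (+-identityʳ _))))))
lower-⊆ i (.i ∷ u) e s a (_ ∷ʳ q) | cl | isCl = _ ∷ʳ lower-⊆ i u e s a q
lower-⊆ i (.i ∷ u) e (_ , s) (_ ∷ a) (refl ∷ q) | cl | isCl with i ≟ suc i
... | yes r = ⊥-elim (1+n≢n (sym r))
... | no _ = refl ∷ lower-⊆ i u e s a q
lower-⊆ i (y ∷ u) e s a (_ ∷ʳ q) | ne | isNe _ _ = _ ∷ʳ lower-⊆ i u e s a q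
lower-⊆ i (y ∷ u) e (_ , s) (_ ∷ a) (refl ∷ q) | ne | isNe _ n₂ with y ≟ suc i
... | yes r = ⊥-elim (n₂ r)
... | no _ = refl ∷ lower-⊆ i u e s a q

data Place (s₁ : List ℕ) (x : ℕ) (s₂ : List ℕ) : Set where
  in-J : ∀ J₂ m E → s₂ ≡ J₂ ++ m ∷ E → SD (s₁ ++ x ∷ J₂) → All (m <_) (s₁ ++ x ∷ J₂) → WI (m ∷ E) → Place s₁ x s₂
  at-m : SD s₁ → All (x <_) s₁ → WI (x ∷ s₂) → Place s₁ x s₂
  in-E : ∀ J m E₁ → s₁ ≡ J ++ m ∷ E₁ → SD J → All (m <_) J → WI (m ∷ E₁ ++ x ∷ s₂) → Place s₁ x s₂

place : ∀ s₁ x s₂ → IsH (s₁ ++ x ∷ s₂) → Place s₁ x s₂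
place s₁ x s₂ (_ , hook J m E eq refl d g s) with ++-split s₁ x s₂ J (m ∷ E) eq
... | inj₁ (J₂ , refl , refl) = in-J J₂ m E refl d g s
... | inj₂ ([] , refl , refl) rewrite ++-identityʳ J = at-m d g s
... | inj₂ (_ ∷ E₁ , refl , refl) = in-E J m E₁ refl d g s

Matching : List ℕ → List ℕ → Set
Matching w s = ∃ λ s' → s' ⊆ w × IsH s' × length s' ≡ length s

length-mid : ∀ (a : List ℕ) {x y : ℕ} {b c : List ℕ} → length b ≡ length c → length (a ++ x ∷ b) ≡ length (a ++ y ∷ c)
length-mid a e = trans (length-++ a) (trans (cong (λ z → length a + suc z) e) (sym (length-++ a)))

last-gt : ∀ {i} J → SD J → All (i <_) J → All (suc i <_) J ⊎ ∃ λ J₀ → J ≡ J₀ ++ [ suc i ] × All (suc i <_) J₀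
last-gt [] s a = inj₁ []
last-gt (y ∷ J) (b , s) (p ∷ a) with last-gt J s a
... | inj₂ (J₀ , refl , c) = inj₂ (y ∷ J₀ , refl , All.head (All.++⁻ʳ J₀ b) ∷ c)
... | inj₁ c with m≤n⇒m<n∨m≡n p
...   | inj₁ q = inj₁ (q ∷ c)
last-gt (y ∷ []) (b , s) (p ∷ a) | inj₁ c | inj₂ refl = inj₂ ([] , refl , [])
last-gt (y ∷ z ∷ J) (b , s) (p ∷ a) | inj₁ (c ∷ _) | inj₂ refl = ⊥-elim (<⇒≱ (All.head b) (<⇒≤ c))

-- Raising `i` inside the hook fails only if the strictly decreasing part already has `suc i` before
-- it. Then the changed letter is dropped and an `i` of `u`, matched with that `suc i`, replaces it.
-- Later letters `i` in the increasing part are raised along.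
hook-raise : ∀ i u v s₁ s₂ → ωu i u ≡ 0 → φu i v ≡ 0 → s₁ ⊆ u → s₂ ⊆ v → Place s₁ i s₂ → Matching (u ++ suc i ∷ v) (s₁ ++ i ∷ s₂)
hook-raise i u v s₁ s₂ a b p q (in-J J₂ m E refl d g s) with SD-++⁻ s₁ (i ∷ J₂) d
... | d₁ , (iJ , d₂) , c with last-gt s₁ d₁ (All-heads c)
...   | inj₁ c' = _ , Sub.++⁺ p (refl ∷ q) , subst IsH (++-assoc s₁ (suc i ∷ J₂) (m ∷ E)) (hookOf (s₁ ++ suc i ∷ J₂) m E
          (SD-++⁺ s₁ _ d₁ (All.map m<n⇒m<1+n iJ , d₂) (All.zipWith (λ (x , y) → x ∷ All.tail y) (c' , c)))
          (All.++⁺ (All.++⁻ˡ s₁ g) (m<n⇒m<1+n (All.head (All.++⁻ʳ s₁ g)) ∷ All.tail (All.++⁻ʳ s₁ g))) s) , length-mid s₁ refl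
...   | inj₂ (J₀ , refl , _) = _ , subst (_⊆ u ++ suc i ∷ v) (trans (++-assoc J₀ (suc i ∷ i ∷ []) _) (sym (++-assoc J₀ [ suc i ] _))) (Sub.++⁺ (close-after i J₀ u a p) (suc i ∷ʳ q)) ,
          subst IsH (++-assoc (J₀ ++ [ suc i ]) (i ∷ J₂) (m ∷ E)) (hookOf ((J₀ ++ [ suc i ]) ++ i ∷ J₂) m E d g s) , refl
hook-raise i u v s₁ s₂ a b p q (at-m d g s) with last-gt s₁ d g
... | inj₁ c = _ , Sub.++⁺ p (refl ∷ raise-⊆ i 0 v b (proj₂ s) (proj₁ s) q) ,
      hookOf s₁ (suc i) (map (raiseAt i) s₂) d c (All.map⁺ (All.map (raise-≥ i _) (proj₁ s)) , WI-map (raiseAt i) (raise-mono i) (proj₂ s)) , length-mid s₁ (length-map _ s₂)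
... | inj₂ (J₀ , refl , c) = _ , subst (_⊆ u ++ suc i ∷ v) (trans (++-assoc J₀ (suc i ∷ i ∷ []) _) (sym (++-assoc J₀ [ suc i ] _)))
        (Sub.++⁺ (close-after i J₀ u a p) (suc i ∷ʳ raise-⊆ i 0 v b (proj₂ s) (proj₁ s) q)) ,
      hookOf (J₀ ++ [ suc i ]) i (map (raiseAt i) s₂) d g (All.map⁺ (All.map (λ t → ≤-trans (n≤1+n i) (raise-≥ i _ t)) (proj₁ s)) , WI-map (raiseAt i) (raise-mono i) (proj₂ s)) ,
      length-mid (J₀ ++ [ suc i ]) (length-map _ s₂)
hook-raise i u v s₁ s₂ a b p q (in-E J m E₁ refl d g s) with WI-++⁻ (m ∷ E₁) (i ∷ s₂) s
... | w₁ , (w₂ , w₃) , w₄ = _ , Sub.++⁺ p (refl ∷ raise-⊆ i 0 v b w₃ w₂ q) ,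
      subst IsH (sym (++-assoc J (m ∷ E₁) _)) (hookOf J m (E₁ ++ suc i ∷ map (raiseAt i) s₂) d g
        (WI-++⁺ (m ∷ E₁) _ w₁ (All.map⁺ (All.map (raise-≥ i _) w₂) , WI-map (raiseAt i) (raise-mono i) w₃)
          (All.map (λ t → m≤n⇒m≤1+n (All.head t) ∷ All.map⁺ (All.map (λ r → ≤-trans (≤-trans (All.head t) (n≤1+n i)) (raise-≥ i _ r)) w₂)) w₄))) ,
      length-mid (J ++ m ∷ E₁) (length-map _ s₂)

-- The mirror image: if an `i` follows in a strictly decreasing stretch, the dropped `suc i` is
-- replaced by one of `v`; inside the increasing part the earlier letters `suc i` are lowered along.
hook-lower : ∀ i u v s₁ s₂ → ωu i u ≡ 0 → φu i v ≡ 0 → s₁ ⊆ u → s₂ ⊆ v → Place s₁ (suc i) s₂ → Matching (u ++ i ∷ v) (s₁ ++ suc i ∷ s₂)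
hook-lower i u v s₁ s₂ a b p q (in-J J₂ m E refl d g s) = go J₂ refl
  where
  dd = SD-++⁻ s₁ (suc i ∷ J₂) d
  stay : ∀ {r} → J₂ ++ m ∷ E ≡ i ∷ r → Matching (u ++ i ∷ v) (s₁ ++ suc i ∷ J₂ ++ m ∷ E)
  stay {r} e = _ , Sub.++⁺ p (i ∷ʳ subst (λ z → suc i ∷ z ⊆ v) (sym e) (open-before i r v b (subst (_⊆ v) e q))) ,
    subst IsH (++-assoc s₁ (suc i ∷ J₂) (m ∷ E)) (hookOf (s₁ ++ suc i ∷ J₂) m E d g s) , refl
  change : All (_< i) J₂ → m < i → Matching (u ++ i ∷ v) (s₁ ++ suc i ∷ J₂ ++ m ∷ E)
  change jl ml = _ , Sub.++⁺ p (refl ∷ q) , subst IsH (++-assoc s₁ (i ∷ J₂) (m ∷ E)) (hookOf (s₁ ++ i ∷ J₂) m E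
      (SD-++⁺ s₁ _ (proj₁ dd) (jl , proj₂ (proj₁ (proj₂ dd))) (All.map (λ t → <⇒≤ (All.head t) ∷ All.tail t) (proj₂ (proj₂ dd))))
      (All.++⁺ (All.++⁻ˡ s₁ g) (ml ∷ All.tail (All.++⁻ʳ s₁ g))) s) , length-mid s₁ refl
  go : ∀ J → J₂ ≡ J → Matching (u ++ i ∷ v) (s₁ ++ suc i ∷ J₂ ++ m ∷ E)
  go [] refl with m≤n⇒m<n∨m≡n (≤-pred (All.head (All.++⁻ʳ s₁ g)))
  ... | inj₁ lt = change [] lt
  ... | inj₂ refl = stay refl
  go (j ∷ J) refl with m≤n⇒m<n∨m≡n (≤-pred (All.head (proj₁ (proj₁ (proj₂ dd)))))
  ... | inj₂ refl = stay refl
  ... | inj₁ lt = change (lt ∷ All.map (λ t → <-trans t lt) (proj₁ (proj₂ (proj₁ (proj₂ dd))))) (<-trans (All.head (All.tail (All.++⁻ʳ s₁ g))) lt)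
hook-lower i u v s₁ s₂ a b p q (at-m d g s) = _ , Sub.++⁺ p (refl ∷ q) , hookOf s₁ i s₂ d (All.map <⇒≤ g) (All.map (≤-trans (n≤1+n i)) (proj₁ s) , proj₂ s) , length-mid s₁ refl
hook-lower i u v s₁ s₂ a b p q (in-E J m E₁ refl d g s) with WI-++⁻ (m ∷ E₁) (suc i ∷ s₂) s | ⊆-split-++ J p
  where
  ⊆-split-++ : ∀ J {Q u} → J ++ Q ⊆ u → ∃₂ λ u₁ u₂ → u ≡ u₁ ++ u₂ × J ⊆ u₁ × Q ⊆ u₂
  ⊆-split-++ [] p = [] , _ , refl , [] , p
  ⊆-split-++ (j ∷ J) (y ∷ʳ p) with ⊆-split-++ (j ∷ J) p
  ... | u₁ , u₂ , refl , q , r = y ∷ u₁ , u₂ , refl , y ∷ʳ q , r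
  ⊆-split-++ (j ∷ J) (refl ∷ p) with ⊆-split-++ J p
  ... | u₁ , u₂ , refl , q , r = j ∷ u₁ , u₂ , refl , refl ∷ q , r
... | w₁ , (w₂ , w₃) , w₄ | u₁ , u₂ , refl , p₁ , p₂ = _ , Sub.++⁺ (Sub.++⁺ p₁ (lower-⊆ i u₂ (proj₁ (ω0⇒ (ωu i u₁) (K i u₂) (trans (sym (ωu-++ i u₁ u₂)) a))) w₁ (All-heads w₄) p₂)) (refl ∷ q) ,
      subst IsH (sym (++-assoc J (lowerAt i m ∷ map (lowerAt i) E₁) _)) (hookOf J (lowerAt i m) (map (lowerAt i) E₁ ++ i ∷ s₂) d (All.map (≤-<-trans (lower-≤′ i m)) g)
        (WI-++⁺ (map (lowerAt i) (m ∷ E₁)) _ (WI-map (lowerAt i) (lower-mono i) w₁) (All.map (≤-trans (n≤1+n i)) w₂ , w₃)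
          (All.map⁺ (All.map (λ t → lower-≤ i _ (All.head t) ∷ All.map (≤-trans (≤-trans (lower-≤ i _ (All.head t)) (n≤1+n i))) w₂) w₄)))) ,
      len
  where
  len : length ((J ++ lowerAt i m ∷ map (lowerAt i) E₁) ++ i ∷ s₂) ≡ length ((J ++ m ∷ E₁) ++ suc i ∷ s₂)
  len = trans (length-++ (J ++ lowerAt i m ∷ map (lowerAt i) E₁)) (trans (cong (_+ suc (length s₂)) (length-mid J (length-map _ E₁))) (sym (length-++ (J ++ m ∷ E₁))))

⊆-All : ∀ {P : ℕ → Set} {u v} → u ⊆ v → All P v → All P u
⊆-All [] a = []
⊆-All (y ∷ʳ p) (_ ∷ a) = ⊆-All p a
⊆-All (refl ∷ p) (x ∷ a) = x ∷ ⊆-All p a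

hook-2→1 : ∀ u v s₁ s₂ → All (3 ≤_) s₁ → All (1 ≤_) s₂ → s₁ ⊆ u → s₂ ⊆ v → Place s₁ 2 s₂ → Matching (u ++ 1 ∷ v) (s₁ ++ 2 ∷ s₂)
hook-2→1 u v s₁ s₂ b 1≤ p q (in-J [] m E refl d g s) with ≤-antisym (≤-pred (All.head (All.++⁻ʳ s₁ g))) (All.head 1≤)
... | refl = _ , Sub.++⁺ p (refl ∷ q) , hookOf s₁ 1 (1 ∷ E) (proj₁ (SD-++⁻ s₁ _ d)) (All.++⁻ˡ s₁ g) (≤-refl ∷ proj₁ s , s) , length-mid s₁ refl
hook-2→1 u v s₁ s₂ b (1≤j ∷ 1≤) p q (in-J (j ∷ J₂) m E refl d g s) =
  ⊥-elim (<⇒≱ (All.head (All.tail (All.++⁻ʳ s₁ g))) (≤-trans (≤-pred (All.head (proj₁ (proj₁ (proj₂ (SD-++⁻ s₁ _ d)))))) (All.head (All.++⁻ʳ J₂ 1≤))))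
hook-2→1 u v s₁ s₂ b 1≤ p q (at-m d g s) = _ , Sub.++⁺ p (refl ∷ q) , hookOf s₁ 1 s₂ d (All.map <⇒≤ g) (All.map (≤-trans (n≤1+n 1)) (proj₁ s) , proj₂ s) , length-mid s₁ refl
hook-2→1 u v s₁ s₂ b 1≤ p q (in-E J m E₁ refl d g s) = ⊥-elim (<⇒≱ (All.head (All.++⁻ʳ J b)) (All.head (All.++⁻ʳ E₁ (proj₁ s))))

hook-1→2 : ∀ u v s₁ s₂ → All (3 ≤_) s₁ → All (1 ≤_) s₂ → s₁ ⊆ u → s₂ ⊆ v → Place s₁ 1 s₂ → Matching (u ++ 2 ∷ v) (s₁ ++ 1 ∷ s₂)
hook-1→2 u v s₁ s₂ b 1≤ p q (in-J J₂ m E refl d g s) = ⊥-elim (<⇒≱ (All.head (All.++⁻ʳ s₁ g)) (All.head (All.++⁻ʳ J₂ 1≤)))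
hook-1→2 u v s₁ [] b 1≤ p q (at-m d g s) = _ , Sub.++⁺ p (refl ∷ q) , hookOf s₁ 2 [] d b ([] , tt) , length-mid s₁ refl
hook-1→2 u v s₁ (y ∷ E) b 1≤ p q (at-m d g ((1≤y ∷ _) , yE , s)) with m≤n⇒m<n∨m≡n 1≤y
... | inj₁ 2≤y = _ , Sub.++⁺ p (refl ∷ q) , hookOf s₁ 2 (y ∷ E) d b ((2≤y ∷ All.map (≤-trans 2≤y) yE) , yE , s) , length-mid s₁ refl
-- Another 1 follows, so the raised letter 2 joins the strictly decreasing part and that 1 becomes
-- the middle element.
... | inj₂ refl = _ , Sub.++⁺ p (refl ∷ q) , subst IsH (++-assoc s₁ [ 2 ] (1 ∷ E)) (hookOf (s₁ ++ [ 2 ]) 1 E (SD-++⁺ s₁ _ d ([] , tt) (All.map (λ t → t ∷ []) b))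
      (All.++⁺ g (≤-refl ∷ [])) (yE , s)) , length-mid s₁ refl
hook-1→2 u v s₁ s₂ b 1≤ p q (in-E J m E₁ refl d g s) = ⊥-elim (<⇒≱ (All.head (All.++⁻ʳ J b)) (≤-trans (All.head (All.++⁻ʳ E₁ (proj₁ s))) (n≤1+n 1)))

hook-move : ∀ {w w' s} → All (1 ≤_) w → Mv w w' → s ⊆ w → IsH s → Matching w' s
hook-move {s = s} pos (mv u v x y refl refl c) p h with ⊆-split u p
... | s₁ , s₂ , refl , p₁ , (.x ∷ʳ p₂) = s₁ ++ s₂ , Sub.++⁺ p₁ (y ∷ʳ p₂) , h , refl
... | s₁ , .x ∷ s₂ , refl , p₁ , (refl ∷ p₂) = go c
  where
  pos₂ = ⊆-All p₂ (All.tail (All.++⁻ʳ u pos))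
  go : Cond u x y v → Matching (u ++ y ∷ v) (s₁ ++ x ∷ s₂)
  go (up-i i a b) = hook-raise i u v s₁ s₂ a b p₁ p₂ (place s₁ i s₂ h)
  go (down-i i a b) = hook-lower i u v s₁ s₂ a b p₁ p₂ (place s₁ (suc i) s₂ h)
  go (up-1 a) = hook-1→2 u v s₁ s₂ (⊆-All p₁ a) pos₂ p₁ p₂ (place s₁ 1 s₂ h)
  go (down-1 a) = hook-2→1 u v s₁ s₂ (⊆-All p₁ a) pos₂ p₁ p₂ (place s₁ 2 s₂ h)

-- The insertion tableau is a decomposition tableau

baseRow : List PN → List ℕ
baseRow row = map base (reverse row)

rowsB : Tableau → List (List ℕ)
rowsB = map baseRow

MH : List ℕ → List ℕ → Set
MH a b = ∀ s → s ⊆ a ++ b → IsH s → length s ≤ length a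

DecR : List (List ℕ) → Set
DecR [] = ⊤
DecR (a ∷ []) = ⊤
DecR (a ∷ b ∷ rs) = length b < length a × MH a b × DecR (b ∷ rs)

concat-rowsB : ∀ T → concat (rowsB T) ≡ map base (revrow T)
concat-rowsB [] = refl
concat-rowsB (row ∷ T) = trans (cong (baseRow row ++_) (concat-rowsB T)) (sym (map-++ base (reverse row) (revrow T)))

lengths-rowsB : ∀ T → map length (rowsB T) ≡ shape T
lengths-rowsB [] = refl
lengths-rowsB (row ∷ T) = cong₂ _∷_ (trans (length-map base (reverse row)) (length-reverse row)) (lengths-rowsB T)

Mv-sym : ∀ {w w'} → Mv w w' → Mv w' w
Mv-sym (mv u v x y s t (up-i i a b)) = mv u v y x t s (down-i i a b)
Mv-sym (mv u v x y s t (down-i i a b)) = mv u v y x t s (up-i i a b)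
Mv-sym (mv u v x y s t (up-1 a)) = mv u v y x t s (down-1 a)
Mv-sym (mv u v x y s t (down-1 a)) = mv u v y x t s (up-1 a)

Cond-monoˡ : ∀ p {u x y v} → Cond (p ++ u) x y v → Cond u x y v
Cond-monoˡ p {u} {x} {y} {v} c = subst (Cond u x y) (++-identityʳ v) (Cond-mono p [] (subst (Cond (p ++ u) x y) (sym (trans (++-identityʳ _) (++-identityʳ v))) c))

Mv-split : ∀ f q {W} → Mv (f ++ q) W → (∃ λ f' → Mv f f' × W ≡ f' ++ q × length f ≡ length f') ⊎ (∃ λ q' → Mv q q' × W ≡ f ++ q')
Mv-split f q (mv u v x y s refl c) with ++-split u x v f q (sym s)
... | inj₁ (r , refl , refl) = inj₁ (_ , mv u r x y refl refl (Cond-mono [] q c) , sym (++-assoc u (y ∷ r) q) , length-swap u)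
... | inj₂ (r , refl , refl) = inj₂ (_ , mv r v x y refl refl c' , ++-assoc f r (y ∷ v))
  where c' = Cond-monoˡ f c

rows-unique : ∀ (rs rs' : List (List ℕ)) → map length rs ≡ map length rs' → concat rs ≡ concat rs' → rs ≡ rs'
rows-unique [] [] l e = refl
rows-unique (a ∷ rs) (b ∷ rs') l e with ++-inj-len a b (∷-injectiveˡ l) e
... | refl , e' = cong (a ∷_) (rows-unique rs rs' (∷-injectiveʳ l) e')

-- If the moved letter lies in one of two adjacent rows, `hook-move` for the reverse move carries
-- hooks of the new rows back to the old ones without loss of length; if it lies further on, the two
-- rows are untouched.
Dec-move : ∀ rs rs' → map length rs ≡ map length rs' → All (1 ≤_) (concat rs') → Mv (concat rs) (concat rs') → DecR rs → DecR rs'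
Dec-move [] [] l p m d = tt
Dec-move (a ∷ []) (a' ∷ []) l p m d = tt
Dec-move (a ∷ rs@(b ∷ r)) (a' ∷ rs'@(b' ∷ r')) l p m (lt , mh , d) = subst₂ _<_ lb la lt , mh' (Mv-split (a ++ b) (concat r) (subst₂ Mv (sym (++-assoc a b (concat r))) refl m)) , rest (Dec-move rs rs' (∷-injectiveʳ l) (All.++⁻ʳ a' p)) (Mv-split a (concat rs) m)
  where
  la = ∷-injectiveˡ l
  lb = ∷-injectiveˡ (∷-injectiveʳ l)
  lab : length (a ++ b) ≡ length (a' ++ b')
  lab = trans (length-++ a) (trans (cong₂ _+_ la lb) (sym (length-++ a')))
  rest : (Mv (concat rs) (concat rs') → DecR rs → DecR rs') → (∃ λ f' → Mv a f' × concat (a' ∷ rs') ≡ f' ++ concat rs × length a ≡ length f') ⊎ (∃ λ q' → Mv (concat rs) q' × concat (a' ∷ rs') ≡ a ++ q') → DecR rs'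
  rest ih (inj₁ (f' , _ , e , lf)) = subst DecR (rows-unique rs rs' (∷-injectiveʳ l) (sym (proj₂ (++-inj-len a' f' (trans (sym la) lf) e)))) d
  rest ih (inj₂ (q' , m' , e)) = ih (subst (Mv (concat rs)) (sym (proj₂ (++-inj-len a' a (sym la) e))) m') d
  mh' : (∃ λ f' → Mv (a ++ b) f' × concat (a' ∷ rs') ≡ f' ++ concat r × length (a ++ b) ≡ length f') ⊎ (∃ λ q' → Mv (concat r) q' × concat (a' ∷ rs') ≡ (a ++ b) ++ q') → MH a' b'
  mh' (inj₁ (f' , m' , e , lf)) s s⊆ h with ++-inj-len (a' ++ b') f' (trans (sym lab) lf) (trans (++-assoc a' b' (concat r')) e)
  ... | refl , _ with hook-move (All.++⁻ˡ (a' ++ b') (subst (All (1 ≤_)) (sym (++-assoc a' b' (concat r'))) p)) (Mv-sym m') s⊆ h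
  ...   | s' , q , h' , ls = subst₂ _≤_ ls la (mh s' q h')
  mh' (inj₂ (q' , m' , e)) s s⊆ h with ++-inj-len (a' ++ b') (a ++ b) (sym lab) (trans (++-assoc a' b' (concat r')) e)
  ... | e' , _ = subst (length s ≤_) la (mh s (subst (s ⊆_) e' s⊆) h)

≥3 : ∀ {u} → All (λ y → y ≢ 1 × y ≢ 2) u → All (1 ≤_) u → All (3 ≤_) u
≥3 [] [] = []
≥3 {1 ∷ u} ((p , _) ∷ a) (_ ∷ b) = ⊥-elim (p refl)
≥3 {2 ∷ u} ((_ , q) ∷ a) (_ ∷ b) = ⊥-elim (q refl)
≥3 {suc (suc (suc _)) ∷ u} (_ ∷ a) (_ ∷ b) = s≤s (s≤s (s≤s z≤n)) ∷ ≥3 a b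

Step-Mv : ∀ {n a b} → Step (QIdx n) a b → Pos a → Mv (map base a) (map base b)
Step-Mv {a = a} {b} (ī , _ , e) p with E1-base b (F1-E1 a (trans (sym (f1̄≡F1 a)) e))
... | u , t , eb , ea , u∌ = mv u t 1 2 ea eb (up-1 (≥3 u∌ (All.++⁻ˡ u (subst (All (1 ≤_)) ea (All.map⁺ p)))))
Step-Mv (ix i , _ , e) p with F-fI {i} e
... | mkF u b v refl refl x y = mv (map base u) (map base v) i (suc i) (map-++ base u _) (map-++ base u _)
      (up-i i (trans (cong (ω 0) (kinds-base i u)) x) (trans (cong (φ 0) (kinds-base i v)) y))

QIdx-ok : ∀ {n i} → QIdx n i → IxOK i
QIdx-ok {i = ī} _ = tt
QIdx-ok {i = ix i} (p , _) = p

Dec : Word → Set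
Dec w = DecR (rowsB (Pdec w))

revrow-Pos : ∀ T → Valid T → Pos (revrow T)
revrow-Pos [] [] = []
revrow-Pos (row ∷ T) (rowW k μ w e hk pos ∷ v) = All.++⁺ (subst Pos (sym e) (All.map⁻ (subst (All (1 ≤_)) (sym (base-mark k μ w)) pos))) (revrow-Pos T v)

module _ {n : ℕ} where

  Dec-step : ∀ {a b} → Step (QIdx n) a b → Pos a → (Dec a → Dec b) × (Dec b → Dec a)
  Dec-step {a} {b} s@(i , x , e) pa with sim-f i (QIdx-ok {n} {i} x) pa e
  ... | tracks im Q≡ = Dec-move (rowsB (Pdec a)) (rowsB (Pdec b)) lens (positive (Pdec b) vb) m , Dec-move (rowsB (Pdec b)) (rowsB (Pdec a)) (sym lens) (positive (Pdec a) va) (Mv-sym m)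
    where
    pb = f-Pos i (QIdx-ok {n} {i} x) e pa
    va = Pdec-valid a pa
    vb = Pdec-valid b pb
    positive : ∀ T → Valid T → All (1 ≤_) (concat (rowsB T))
    positive T v = subst (All (1 ≤_)) (sym (concat-rowsB T)) (All.map⁺ (revrow-Pos T v))
    lens : map length (rowsB (Pdec a)) ≡ map length (rowsB (Pdec b))
    lens = trans (lengths-rowsB (Pdec a)) (trans (trans (shape-PQ a pa) (trans (cong shape (sym Q≡)) (sym (shape-PQ b pb)))) (sym (lengths-rowsB (Pdec b))))
    m : Mv (concat (rowsB (Pdec a))) (concat (rowsB (Pdec b)))
    m = subst₂ Mv (sym (concat-rowsB (Pdec a))) (sym (concat-rowsB (Pdec b))) (Step-Mv {n} (i , x , im) (revrow-Pos _ va))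

  Dec-Conn : ∀ {a b} → Conn (Step (QIdx n)) a b → Pos a → Dec a → Dec b
  Dec-Conn done p d = d
  Dec-Conn (fwd s c) p d = Dec-Conn c (Step-Pos QIdx-ok s p) (proj₁ (Dec-step s p) d)
  Dec-Conn (bwd s c) p d = Dec-Conn c (Step-Pos⁻ QIdx-ok s p) (proj₂ (Dec-step s (Step-Pos⁻ QIdx-ok s p)) d)

-- Insertion permutes the letters; the rows below the first one

Form-perm : ∀ {x r r' c} → Form x r r' c → base x ∷ map base r ↭ map base r' ++ [ base c ]
Form-perm {y} (form k k' μ w w' cb refl refl refl hk hk' (seg x A b B A' c B' w≡ v≡ pre wi c<b b≤B' l) pos) =
  subst₂ _↭_ (trans (sym w≡) (cong (base y ∷_) (sym (base-mark k μ w))))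
    (trans (sym v≡) (cong (_++ [ cb ]) (sym (base-mark k' (choose (k ≡ᵇ k') μ (primed y)) w'))))
  (↭-trans (prep x (Perm.++⁺ (Perm.shift b A B) (Perm.shift c A' B')))
  (↭-trans (prep x (prep b (Perm.shift c (A ++ B) (A' ++ B'))))
  (↭-trans (↭-trans (prep x (swap b c ↭-refl)) (swap x c ↭-refl))
  (↭-trans (prep c (prep x (↭-sym (Perm.shift b (A ++ B) (A' ++ B')))))
  (↭-trans (prep c (Perm.++⁺ (↭-sym (Perm.shift x A B)) (↭-sym (Perm.shift b A' B'))))
    (Perm.∷↭∷ʳ c ((A ++ x ∷ B) ++ A' ++ b ∷ B')))))))

App-base : ∀ {x r r' o} → App x r r' o → map base r' ≡ base x ∷ map base r
App-base {x} a with App⇒AForm a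
... | aform k k' μ w refl refl o≡ hk hk' pos = trans (base-mark k' (choose (k' ≡ᵇ suc k) μ (primed x)) (base x ∷ w)) (cong (base x ∷_) (sym (base-mark k μ w)))

decIns-perm : ∀ x T → 1 ≤ base x → Valid T → base x ∷ map base (revrow T) ↭ map base (revrow (proj₁ (decIns x T)))
decIns-perm x [] p v = ↭-refl
decIns-perm x (row ∷ T) p (v ∷ vs) with insert-row x (reverse row) p v
... | appended {r'} a = ↭-reflexive (trans (cong (base x ∷_) (map-++ base (reverse row) (revrow T))) (trans (cong (_++ map base (revrow T)) (sym (App-base a)))
      (trans (sym (map-++ base r' (revrow T))) (trans (cong (λ z → map base (z ++ revrow T)) (sym (reverse-involutive r'))) (cong (map base ∘ revrow ∘ proj₁) (sym (decIns-App {x} {row} T a)))))))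
... | bumped {r'} {c} b = ↭-trans (↭-reflexive (cong (base x ∷_) (map-++ base (reverse row) (revrow T))))
  (↭-trans (Perm.++⁺ʳ (map base (revrow T)) (Form-perm (Bump⇒Form b))) (↭-trans (↭-reflexive (++-assoc (map base r') [ base c ] _))
    (↭-trans (Perm.++⁺ˡ (map base r') (decIns-perm c T (proj₂ (Bump-valid b)) vs))
      (↭-reflexive (trans (sym (map-++ base r' _)) (trans (cong (λ z → map base (z ++ revrow (proj₁ (decIns c T)))) (sym (reverse-involutive r'))) (cong (map base ∘ revrow ∘ proj₁) (sym (decIns-Bump {x} {row} T b)))))))))

Pdec-perm : ∀ w → Pos w → map base w ↭ map base (revrow (Pdec w))
Pdec-perm [] p = ↭-refl
Pdec-perm (x ∷ w) (p ∷ ps) = ↭-trans (prep (base x) (Pdec-perm w ps)) (decIns-perm x (Pdec w) p (Pdec-valid w ps))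

Pdec-All : ∀ {P : ℕ → Set} w → Pos w → All (P ∘ base) w → All (P ∘ base) (revrow (Pdec w))
Pdec-All w p a = All.map⁻ (Perm.All-resp-↭ (Pdec-perm w p) (All.map⁺ a))

-- The rows below the first one form the insertion tableau of the expelled letters
record Down (P : ℕ → Set) (v : Word) (row : List PN) (rs : Tableau) : Set where
  constructor down
  field
    z : Word
    P≡ : Pdec z ≡ rs
    len : length z + length row ≡ length v
    letters : All (P ∘ base) z
    row-letters : All P (baseRow row)

downward : ∀ {P : ℕ → Set} → (∀ {y} → P y → 1 ≤ y) → ∀ v {row rs} → All (P ∘ base) v → Pdec v ≡ row ∷ rs → Down P v row rs
downward pos (x ∷ v) (p ∷ ps) e with Pdec v in q
downward pos (x ∷ v) (p ∷ ps) refl | [] with v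
... | [] = down [] refl refl [] (p ∷ [])
... | y ∷ v' with shape-PQ (y ∷ v') (All.map pos ps)
...   | s = ⊥-elim (nonempty (trans (cong shape (sym q)) s))
  where
  nonempty : [] ≢ shape (Qdec (y ∷ v'))
  nonempty e' with Qdec v' | proj₁ (proj₂ (decIns y (Pdec v'))) | trans e' (addBox-shape (proj₁ (proj₂ (decIns y (Pdec v')))) _ (Qdec v'))
  ... | [] | _ | ()
  ... | _ ∷ _ | zero | ()
  ... | _ ∷ _ | suc _ | ()
downward {P} pos (x ∷ v) (p ∷ ps) e | row ∷ rs with downward pos v ps q | Pdec-valid v (All.map pos ps)
... | down z z≡ l zl rl | val with insert-row x (reverse row) (pos p) (All.head (subst Valid q val))
...   | appended {r'} a with trans (sym e) (cong proj₁ (decIns-App {x} {row} rs a))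
...     | refl = down z z≡ (trans (cong (length z +_) (trans (length-reverse r') (trans (AForm-length (App⇒AForm a)) (cong suc (length-reverse row))))) (trans (+-suc _ _) (cong suc l))) zl
            (subst (λ t → All P (map base t)) (sym (reverse-involutive r')) (subst (All P) (sym (App-base a)) (p ∷ rl)))
downward {P} pos (x ∷ v) (p ∷ ps) e | row ∷ rs | down z z≡ l zl rl | val | bumped {r'} {c} b with trans (sym e) (cong proj₁ (decIns-Bump {x} {row} rs b))
... | refl = down (c ∷ z) (cong (λ t → proj₁ (decIns c t)) z≡)
      (cong suc (trans (cong (length z +_) (trans (length-reverse r') (trans (sym (Form-length (Bump⇒Form b))) (length-reverse row)))) l))
      (All.head (All.++⁻ʳ (map base r') new) ∷ zl) (subst (λ t → All P (map base t)) (sym (reverse-involutive r')) (All.++⁻ˡ (map base r') new))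
  where
  new : All P (map base r' ++ [ base c ])
  new = Perm.All-resp-↭ (Form-perm (Bump⇒Form b)) (p ∷ rl)

-- Maximality of the rows when the first row becomes constant

IsH-tail : ∀ {x s} → IsH (x ∷ s) → s ≡ [] ⊎ IsH s
IsH-tail (_ , hook [] m [] refl l d g s) = inj₁ refl
IsH-tail (_ , hook [] m (y ∷ E) refl l d g s) = inj₂ (hookOf [] y E tt [] (proj₂ s))
IsH-tail (_ , hook (j ∷ J) m E refl l d g s) = inj₂ (hookOf J m E (proj₂ d) (All.tail g) s)

MH-cons : ∀ x a b → MH a b → MH (x ∷ a) b
MH-cons x a b h s (.x ∷ʳ p) hs = m≤n⇒m≤1+n (h s p hs)
MH-cons x a b h (.x ∷ s) (refl ∷ p) hs with IsH-tail hs
... | inj₁ refl = s≤s z≤n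
... | inj₂ h' = s≤s (h s p h')

base-revrev : ∀ r → baseRow (reverse r) ≡ map base r
base-revrev r = cong (map base) (reverse-involutive r)

dec-app : ∀ {x row r' o} rs → App x (reverse row) r' o → DecR (baseRow row ∷ rowsB rs) → DecR (rowsB (reverse r' ∷ rs))
dec-app [] a d = tt
dec-app {x} {row} {r'} (row₂ ∷ rs) a (lt , h , d) = subst (λ z → length (baseRow row₂) < length z × MH z (baseRow row₂) × DecR (rowsB (row₂ ∷ rs)))
  (sym (trans (base-revrev r') (App-base a))) (m<n⇒m<1+n lt , MH-cons (base x) (baseRow row) (baseRow row₂) h , d)

-- Equal letters at the front rule out a strictly decreasing part above the middle element, so only
-- the weakly increasing part is left.
hook-const : ∀ {n t} → IsH (n ∷ n ∷ t) → WI (n ∷ n ∷ t)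
hook-const (_ , hook [] m E refl l d g s) = s
hook-const (_ , hook (j ∷ []) m E refl l d (lt ∷ _) s) = ⊥-elim (<-irrefl refl lt)
hook-const (_ , hook (j ∷ j' ∷ J) m E refl l ((lt ∷ _) , _) g s) = ⊥-elim (<-irrefl refl lt)

all-const : ∀ {n w} → IsH w → (∃ λ t → w ≡ n ∷ n ∷ t) → All (_≤ n) w → All (n ≡_) w
all-const h (t , refl) le = All.zipWith (λ (p , q) → ≤-antisym p q) (≤-refl ∷ proj₁ (hook-const h) , le)

no-less : ∀ {n y} {A : Set} → n ≡ y → y < n → A
no-less refl lt = ⊥-elim (<-irrefl refl lt)

record Preimage (n : ℕ) (c : PN) (r r' : Word) : Set where
  constructor preimage
  field
    B : List ℕ
    r≡ : map base r ≡ n ∷ base c ∷ B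
    B≡ : All (n ≡_) B
    c<n : base c < n
    r'≡ : All (n ≡_) (map base r')

-- A letter in `A` would exceed `b`, one in `A'` would be at most `c` and so below `b`, and one in
-- `B` would be below `x`, although all of them equal `n`. So these blocks are empty and the old row
-- reads n, c, n, ..., n.
bump-const : ∀ {n x r r' c} → Bump x r r' c → (∃ λ t → map base r' ≡ n ∷ n ∷ t) → All (_≤ n) (map base r') → Preimage n c r r'
bump-const {n} {x} p st le with Bump⇒Form p
... | form k k' μ w w' cb refl refl refl hk hk' (seg x₂ A b B A' c B' w≡ v≡ (sd , x≤b , B<x) wi c<b b≤B' l) pos with ∷ʳ-injective w' _ v≡ | ∷-injective w≡
...   | refl , refl | refl , w≡' = go A A' B sd B<x wi (subst (All (n ≡_)) bw' const) w≡'
  where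
  bw' = base-mark k' (choose (k ≡ᵇ k') μ (primed x)) w'
  const = all-const (k' , subst (Hook k') (sym bw') hk') st le
  go : ∀ A A' B → SD (A ++ b ∷ B) → All (_< base x) B → WI (A' ++ c ∷ B') → All (n ≡_) ((A ++ base x ∷ B) ++ A' ++ b ∷ B') →
    w ≡ (A ++ b ∷ B) ++ A' ++ c ∷ B' → Preimage n ⟨ c , choose (k ≡ᵇ k') (primed x) μ ⟩ (mark k μ w) (mark k' (choose (k ≡ᵇ k') μ (primed x)) w')
  go (a ∷ A) A' B (b<a , _) _ wi (n≡a ∷ q) e = no-less (All.head (All.++⁻ʳ A' (All.++⁻ʳ (A ++ base x ∷ B) q))) (subst (b <_) (sym n≡a) (All.head (All.++⁻ʳ A b<a)))
  go [] (a ∷ A') B sd _ wi q e with All.++⁻ʳ (base x ∷ B) q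
  ... | n≡a ∷ q' = no-less n≡a (≤-<-trans (All.head (All.++⁻ʳ A' (proj₁ wi))) (subst (c <_) (sym (All.head (All.++⁻ʳ A' q'))) c<b))
  go [] [] (y ∷ _) sd (y<x ∷ _) wi (n≡x ∷ q) e = no-less (All.head q) (subst (y <_) (sym n≡x) y<x)
  go [] [] [] sd _ wi (n≡x ∷ n≡b ∷ n≡B') e = preimage B' (trans (base-mark k μ w) (trans e (cong (λ z → z ∷ c ∷ B') (sym n≡b)))) n≡B' (subst (c <_) (sym n≡b) c<b) const

-- A hook with two letters from the constant row is weakly increasing and cannot go on into `b`.
-- With at most one such letter it has at most one letter more than `b`.
MH-const : ∀ {n} a b → All (n ≡_) a → All (_< n) b → length b < length a → MH a b
MH-const {n} a b ca lb lt s p h with ⊆-split a p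
... | [] , s₂ , refl , p₁ , p₂ = ≤-trans (Sub.length-mono-≤ p₂) (<⇒≤ lt)
... | x ∷ [] , s₂ , refl , p₁ , p₂ = ≤-trans (s≤s (Sub.length-mono-≤ p₂)) lt
... | x ∷ y ∷ s₁ , s₂ , refl , p₁ , p₂ with ⊆-All p₁ ca
...   | refl ∷ refl ∷ _ with s₂ | p₂ | All.++⁻ʳ (n ∷ s₁) (proj₁ (hook-const h))
...     | [] | _ | _ rewrite ++-identityʳ s₁ = Sub.length-mono-≤ p₁
...     | z ∷ _ | p₂ | le ∷ _ = ⊥-elim (<⇒≱ (All.head (⊆-All p₂ lb)) le)

-- A letter of `b` that is at least `n` could be added to n, c, n, ..., n, giving a hook longer than
-- the first row.
second-< : ∀ {n c B} b → c < n → All (n ≡_) B → MH (n ∷ c ∷ B) b → All (_< n) b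
second-< {n} {c} {B} b c<n n≡B h = All.tabulate λ {y} y∈ → go y y∈
  where
  WI-snoc : ∀ {E y} → WI E → All (_≤ y) E → WI (E ++ [ y ])
  WI-snoc {E} {y} s a = WI-++⁺ E [ y ] s ([] , tt) (All.map (λ p → p ∷ []) a)
  const-WI : ∀ {B} → All (n ≡_) B → WI B
  const-WI [] = tt
  const-WI (refl ∷ a) = All.map ≤-reflexive a , const-WI a
  go : ∀ y → y ∈ b → y < n
  go y y∈ with y <? n
  ... | yes p = p
  ... | no q = ⊥-elim (<⇒≱ (≤-reflexive (sym (length-snoc (n ∷ c ∷ B) y)))
        (h ((n ∷ c ∷ B) ++ [ y ]) (Sub.++⁺ (Sub.⊆-refl {x = n ∷ c ∷ B}) (Sub.from∈ y∈))
          (hookOf [ n ] c (B ++ [ y ]) ([] , tt) (c<n ∷ []) (WI-snoc (All.map (λ { refl → <⇒≤ c<n }) n≡B , const-WI n≡B)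
            (≤-trans (<⇒≤ c<n) (≮⇒≥ q) ∷ All.map (λ { refl → ≮⇒≥ q }) n≡B)))))

hook-cons : ∀ {n s} → All (_< n) s → IsH s → IsH (n ∷ s)
hook-cons a (_ , hook J m E refl l d g s) = hookOf (_ ∷ J) m E (All.++⁻ˡ J a , d) (All.head (All.++⁻ʳ J a) ∷ g) s

dec-bump : ∀ {n c row r'} rs → Preimage n c (reverse row) r' → length r' ≡ length row → 1 ≤ base c → Valid rs → DecR (baseRow row ∷ rowsB rs) →
  DecR (rowsB (proj₁ (decIns c rs))) → DecR (rowsB (reverse r' ∷ proj₁ (decIns c rs)))
dec-bump {n} {c} {row} {r'} rs (preimage B r≡ B≡ c<n r'≡) lr 1≤c v d dr = subst (λ z → DecR (z ∷ rowsB (proj₁ (decIns c rs)))) (sym (base-revrev r')) (go rs v d dr)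
  where
  la : length (map base r') ≡ suc (suc (length B))
  la = trans (length-map base r') (trans lr (trans (sym (trans (length-map base (reverse row)) (length-reverse row))) (cong length r≡)))
  go : ∀ rs → Valid rs → DecR (baseRow row ∷ rowsB rs) → DecR (rowsB (proj₁ (decIns c rs))) → DecR (map base r' ∷ rowsB (proj₁ (decIns c rs)))
  go [] v d dr = lt , MH-const (map base r') _ r'≡ (c<n ∷ []) lt , tt
    where lt : 1 < length (map base r')
          lt = subst (1 <_) (sym la) (s≤s (s≤s z≤n))
  go (row₂ ∷ rs) (v ∷ vs) (lt , h , d) dr with insert-row c (reverse row₂) 1≤c v
  ... | appended {r₂} a rewrite decIns-App {c} {row₂} rs a | base-revrev r₂ | App-base a = lt' , MH-const (map base r') _ r'≡ (c<n ∷ r₂<n) lt' , dr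
    where
    h' : MH (n ∷ base c ∷ B) (baseRow row₂)
    h' = subst (λ z → MH z (baseRow row₂)) r≡ h
    r₂<n = second-< (baseRow row₂) c<n B≡ h'
    hk : IsH (base c ∷ baseRow row₂)
    hk with App⇒AForm a
    ... | aform k k' μ w e₁ refl o≡ hk hk' pos = k' , subst (Hook k') (cong (base c ∷_) (sym (trans (cong (map base) e₁) (base-mark k μ w)))) hk'
    lt' : suc (length (baseRow row₂)) < length (map base r')
    -- In the old rows n, c and the second row form a hook, so the second row was at least two boxes
    -- shorter than the first and stays shorter after the box is added.
    lt' = subst (suc (length (baseRow row₂)) <_) (sym la) (h' (n ∷ base c ∷ baseRow row₂) (refl ∷ refl ∷ Sub.++⁺ˡ B Sub.⊆-refl) (hook-cons (c<n ∷ r₂<n) hk))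
  ... | bumped {r₂} {c₂} p rewrite decIns-Bump {c} {row₂} rs p | base-revrev r₂ = lt' , MH-const (map base r') _ r'≡
          (All.++⁻ˡ (map base r₂) (Perm.All-resp-↭ (Form-perm (Bump⇒Form p)) (c<n ∷ second-< (baseRow row₂) c<n B≡ (subst (λ z → MH z (baseRow row₂)) r≡ h)))) lt' , dr
    where
    lt' : length (map base r₂) < length (map base r')
    lt' = subst₂ _<_ (trans (length-map base (reverse row₂)) (trans (Form-length (Bump⇒Form p)) (sym (length-map base r₂))))
      (trans (cong length r≡) (sym la)) lt

two-letters : ∀ (u : Word) {y v} → 1 ≤ length u → 2 ≤ length (u ++ y ∷ v)
two-letters (x ∷ []) p = s≤s (s≤s z≤n)
two-letters (x ∷ y ∷ u) p = s≤s (s≤s z≤n)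

bump-length : ∀ {x r r' c} → Bump x r r' c → 2 ≤ length r
bump-length (bumpU x π A b B m μ A′ c B′ _ _ _ _ _ _ _) = two-letters (up (A ++ b ∷ B)) (subst (1 ≤_) (sym (trans (length-map _ (A ++ b ∷ B)) (trans (length-++ A) (+-suc _ _)))) (s≤s z≤n))
bump-length (bumpN x π A b B B₀ y c μ B′ _ _ _ _ _ _ _) = two-letters (up (A ++ b ∷ B)) (subst (1 ≤_) (sym (trans (length-map _ (A ++ b ∷ B)) (trans (length-++ A) (+-suc _ _)))) (s≤s z≤n))
bump-length (bumpX x π A b m μ A′ c B′ _ _ _ _ _ _ _) = two-letters (up (A ++ [ b ])) (subst (1 ≤_) (sym (trans (length-map _ (A ++ [ b ])) (length-snoc A b))) (s≤s z≤n))

revrow-length : ∀ w → Pos w → length (revrow (Pdec w)) ≡ length w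
revrow-length w p = trans (sym (length-map base (revrow (Pdec w)))) (trans (sym (Perm.↭-length (Pdec-perm w p))) (length-map base w))

module _ (n : ℕ) (2≤n : 2 ≤ n) where

  private
    module C = Core n 2≤n

  In-Pos : ∀ {w} → C.In w → Pos w
  In-Pos = All.map proj₁

  Starting : Word → Set
  Starting u = Starts n (revrow (Pdec u))

  to-start : ∀ w → C.In w → 2 ≤ length w → ∃ λ u → Conn C.R w u × Starting u
  to-start w iw l with reach-nn n 2≤n (revrow (Pdec w)) (Pdec-All w (In-Pos iw) iw) (subst (2 ≤_) (sym (revrow-length w (In-Pos iw))) l)
  ... | Z , c , st with Lift-path (QIdx-ok {n}) (In-Pos iw) c
  ...   | lift u d e = u , d , subst (Starts n) (sym e) st

  start-row : ∀ {row rs} → 2 ≤ length row → Starts n (revrow (row ∷ rs)) → ∃ λ t → baseRow row ≡ n ∷ n ∷ t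
  start-row {row} {rs} l (p , q , v , e) = go (reverse row) (subst (2 ≤_) (sym (length-reverse row)) l) e
    where
    go : ∀ r → 2 ≤ length r → r ++ revrow rs ≡ ⟨ n , p ⟩ ∷ ⟨ n , q ⟩ ∷ v → ∃ λ t → map base r ≡ n ∷ n ∷ t
    go (x ∷ []) (s≤s ()) e
    go (x ∷ y ∷ r) l refl = map base r , refl

  -- Two shorter words are used: `v`, without the last inserted letter, settles the old tableau, and
  -- `c ∷ z`, whose tableau consists of the new rows below the first, settles those. The second is
  -- not longer than `v` since the first row is not empty.
  dec-start : ∀ m → (∀ z → length z ≤ m → C.In z → Dec z) → ∀ u → length u ≤ suc m → C.In u → Starting u → Dec u
  dec-start m ih [] l iu st = tt
  dec-start m ih (y ∷ v) (s≤s l) (iy ∷ iv) st with Pdec v in q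
  ... | [] = tt
  ... | row ∷ rs with insert-row y (reverse row) (proj₁ iy) (All.head (subst Valid q (Pdec-valid v (In-Pos iv)))) | ih v l iv
  ...   | appended a | dv rewrite decIns-App {y} {row} rs a = dec-app {y} {row} rs a (subst (DecR ∘ rowsB) q dv)
  ...   | bumped {r'} {c} b | dv with downward {λ z → 1 ≤ z × z ≤ n} proj₁ v iv q
  ...     | down z refl lz zl rl rewrite decIns-Bump {y} {row} (Pdec z) b =
              dec-bump {n} {c} {row} {r'} (Pdec z) (bump-const b st' le') lr (proj₂ (Bump-valid b)) (All.tail (subst Valid q (Pdec-valid v (In-Pos iv)))) (subst (DecR ∘ rowsB) q dv)
                (ih (c ∷ z) (≤-trans (≤-trans (≤-reflexive (+-comm 1 (length z))) (+-monoʳ-≤ (length z) (≤-trans (s≤s z≤n) l2))) (≤-trans (≤-reflexive lz) l)) (All.head (All.++⁻ʳ (map base r') new) ∷ zl))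
    where
    l2 : 2 ≤ length row
    l2 = subst (2 ≤_) (length-reverse row) (bump-length b)
    lr : length r' ≡ length row
    lr = trans (sym (Form-length (Bump⇒Form b))) (length-reverse row)
    new : All (λ t → 1 ≤ t × t ≤ n) (map base r' ++ [ base c ])
    new = Perm.All-resp-↭ (Form-perm (Bump⇒Form b)) (iy ∷ rl)
    le' : All (_≤ n) (map base r')
    le' = All.map proj₂ (All.++⁻ˡ (map base r') new)
    st' : ∃ λ t → map base r' ≡ n ∷ n ∷ t
    st' with start-row {reverse r'} {proj₁ (decIns c (Pdec z))} (subst (2 ≤_) (sym (trans (length-reverse r') lr)) l2) st
    ... | t , e = t , trans (sym (base-revrev r')) e

  dec : ∀ m w → length w ≤ m → C.In w → Dec w
  dec m [] l iw = tt
  dec m (x ∷ []) l iw = tt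
  dec (suc m) w@(x ∷ y ∷ v) l iw with to-start w iw (s≤s (s≤s z≤n))
  ... | u , c , st = Dec-Conn (Conn-sym c) (In-Pos (C.Conn-In c iw)) (dec-start m (dec m) u (≤-trans (≤-reflexive (sym (C.Conn-length c))) l) (C.Conn-In c iw) st)

-- Insertion with constant result rows is invertible

no-gt : ∀ {n x y} {A : Set} → n ≡ x → n ≡ y → x < y → A
no-gt refl refl lt = ⊥-elim (<-irrefl refl lt)

Const : Word → Set
Const r = ∃ λ n → All (n ≡_) (map base r)

record ConstApp (x : PN) (r r' : Word) (o : Bool) : Set where
  constructor constApp
  field
    m : ℕ
    t : Word
    r'≡ : r' ≡ x ∷ ⟨ m , false ⟩ ∷ t
    r≡ : r ≡ ⟨ m , o ⟩ ∷ t

const-App : ∀ {x r r' o} → App x r r' o → Const r' → ConstApp x r r' o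
const-App (appD x π m μ E _ _ _) c = constApp m (up E) refl refl
const-App (appI x π J m μ E d (m<x ∷ _) s p) (n , e ∷ c) = no-gt (All.head (All.++⁻ʳ (map base (up J)) (subst (All (n ≡_)) (map-++ base (up J) _) c))) e m<x

record ConstBump (x : PN) (r r' : Word) (c : PN) : Set where
  constructor constBump
  field
    b : ℕ
    t : Word
    r'≡ : r' ≡ x ∷ ⟨ b , false ⟩ ∷ t
    r≡ : r ≡ ⟨ b , false ⟩ ∷ c ∷ t

-- Only `bumpN` with empty `A` and `B` can leave a constant row. Then the inserted letter stands at
-- the head of `r'` and the expelled one is the old middle element with its prime, so all data are
-- recovered.
const-Bump : ∀ {x r r' c} → Bump x r r' c → Const r' → ConstBump x r r' c
const-Bump (bumpU x π A b B m μ A′ c B′ p m<x _ _ _ _ _) (n , a) with All.++⁻ʳ A (All.++⁻ˡ (A ++ x ∷ B) a') | All.++⁻ʳ (A ++ x ∷ B) a'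
  where a' = subst (All (n ≡_)) (trans (map-++ base (up (A ++ x ∷ B)) _) (cong (_++ m ∷ map base (up (A′ ++ b ∷ B′))) (base-up (A ++ x ∷ B)))) a
... | e ∷ _ | e' ∷ _ = no-gt e' e m<x
const-Bump (bumpX x π A b m μ A′ c B′ _ _ m<J _ _ _ _) (n , a) with All.++⁻ʳ A a'
  where a' = subst (All (n ≡_)) (trans (map-++ base (up A) _) (cong₂ (λ y z → y ++ x ∷ z) (base-up A) (base-up (m ∷ A′ ++ b ∷ B′)))) a
... | _ ∷ e ∷ q = no-gt e (All.head (All.++⁻ʳ A′ q)) (All.head (All.++⁻ʳ A m<J))
const-Bump (bumpN x π A b B B₀ y c μ B′ eq (sd , x≤b , B<x) c<J b≤B′ s _ _) (n , a) = go A B B₀ eq sd B<x a'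
  where
  a' : All (n ≡_) ((A ++ B₀) ++ y ∷ b ∷ B′)
  a' = subst (All (n ≡_)) (trans (map-++ base (up (A ++ B₀)) _) (cong₂ (λ y' z → y' ++ y ∷ z) (base-up (A ++ B₀)) (base-up (b ∷ B′)))) a
  go : ∀ A B B₀ → x ∷ B ≡ B₀ ++ [ y ] → SD (A ++ b ∷ B) → All (_< x) B → All (n ≡_) ((A ++ B₀) ++ y ∷ b ∷ B′) →
    ConstBump ⟨ x , π ⟩ (up (A ++ b ∷ B) ++ ⟨ c , μ ⟩ ∷ up B′) (up (A ++ B₀) ++ ⟨ y , π ⟩ ∷ up (b ∷ B′)) ⟨ c , μ ⟩
  go (z ∷ A) B B₀ eq (b<z , _) _ (e ∷ q) = no-gt (All.head (All.tail (All.++⁻ʳ (A ++ B₀) q))) e (All.head (All.++⁻ʳ A b<z))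
  go [] [] [] refl sd _ q = constBump b (up B′) refl refl
  go [] B (z ∷ B₀) eq sd lt (e ∷ q) with ∷-injective eq
  ... | refl , refl = no-gt (All.head (All.++⁻ʳ B₀ q)) e (All.head (All.++⁻ʳ B₀ lt))

Inserts : PN → Tableau → Tableau → ℕ → Bool → Set
Inserts x T T' k o = decIns x T ≡ (T' , k , o)

reverse-inj : ∀ {A : Set} (u v : List A) → reverse u ≡ reverse v → u ≡ v
reverse-inj u v e = trans (sym (reverse-involutive u)) (trans (cong reverse e) (reverse-involutive v))

const-App-inj : ∀ {x x' r r₂ r' o} → App x r r' o → App x' r₂ r' o → Const r' → x ≡ x' × r ≡ r₂
const-App-inj a b c with const-App a c | const-App b c
... | constApp m t refl refl | constApp m' t' refl refl = refl , refl

const-Bump-inj : ∀ {x x' r r₂ r' c} → Bump x r r' c → Bump x' r₂ r' c → Const r' → x ≡ x' × r ≡ r₂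
const-Bump-inj a b c with const-Bump a c | const-Bump b c
... | constBump m t refl refl | constBump m' t' refl refl = refl , refl

data FirstRow (x : PN) (row : List PN) (T : Tableau) : Tableau → ℕ → Bool → Set where
  firstApp : ∀ {r' o} → App x (reverse row) r' o → FirstRow x row T (reverse r' ∷ T) 0 o
  firstBump : ∀ {r' c T' k o} → Bump x (reverse row) r' c → 1 ≤ base c → Inserts c T T' k o → FirstRow x row T (reverse r' ∷ T') (suc k) o

first-row : ∀ {x row T T' k o} → 1 ≤ base x → RowW (reverse row) → Inserts x (row ∷ T) T' k o → FirstRow x row T T' k o
first-row {x} {row} {T} p v e with insert-row x (reverse row) p v
... | appended a with trans (sym e) (decIns-App {x} {row} T a)
...   | refl = firstApp a
first-row {x} {row} {T} p v e | bumped b with trans (sym e) (decIns-Bump {x} {row} T b)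
... | refl = firstBump b (proj₂ (Bump-valid b)) refl

short : ∀ {x y : PN} {row r' o} → App y (reverse row) r' o → reverse r' ≡ [ x ] → RowW (reverse row) → ⊥
short {row = row} {r'} a e (rowW k μ w r≡ hk _) with trans (sym (length-reverse r')) (cong length e) | AForm-length (App⇒AForm a)
... | l | l' with reverse row | trans (sym l) l'
...   | [] | _ with w | r≡ | hk
...     | [] | _ | hook [] _ _ () _ _ _ _
...     | [] | _ | hook (_ ∷ _) _ _ () _ _ _ _
...     | z ∷ w' | q | _ = nomark k q
  where
  nomark : ∀ k → [] ≡ mark k μ (z ∷ w') → ⊥
  nomark zero ()
  nomark (suc k) ()

insert-inj : ∀ {x x' T U T' k o} → 1 ≤ base x → 1 ≤ base x' → Valid T → Valid U → All (Const ∘ reverse) T' →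
  Inserts x T T' k o → Inserts x' U T' k o → x ≡ x' × T ≡ U
insert-inj {T = []} {[]} 1≤x 1≤x' v v' c refl refl = refl , refl
insert-inj {x} {x'} {[]} {row ∷ U} {T'} {k} {o} 1≤x 1≤x' v (v' ∷ vs') c e e' with first-row {x'} {row} {U} 1≤x' v' e'
... | firstBump b p i with e
...   | ()
insert-inj {x} {x'} {[]} {row ∷ U} {T'} {k} {o} 1≤x 1≤x' v (v' ∷ vs') c e e' | firstApp a = ⊥-elim (short {x} {x'} {row} a (sym (∷-injectiveˡ (cong proj₁ e))) v')
insert-inj {x} {x'} {row ∷ T} {[]} 1≤x 1≤x' (v ∷ vs) v' c e e' with first-row {x} {row} {T} 1≤x v e
... | firstBump b p i with e'
...   | ()
insert-inj {x} {x'} {row ∷ T} {[]} 1≤x 1≤x' (v ∷ vs) v' c e e' | firstApp a = ⊥-elim (short {x'} {x} {row} a (sym (∷-injectiveˡ (cong proj₁ e'))) v)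
insert-inj {x} {x'} {row ∷ T} {row' ∷ U} 1≤x 1≤x' (v ∷ vs) (v' ∷ vs') c e e' = go (first-row {x} {row} {T} 1≤x v e) (first-row {x'} {row'} {U} 1≤x' v' e') refl c
  where
  rows : ∀ {row row' : List PN} {T U : Tableau} → reverse row ≡ reverse row' → T ≡ U → row ∷ T ≡ row' ∷ U
  rows {r} {s} p refl = cong (_∷ _) (reverse-inj r s p)
  go : ∀ {T₁ T₂ k o} → FirstRow x row T T₁ k o → FirstRow x' row' U T₂ k o → T₁ ≡ T₂ → All (Const ∘ reverse) T₁ → x ≡ x' × row ∷ T ≡ row' ∷ U
  go (firstApp {r'} a) (firstApp {r″} b) q (cc ∷ _) with reverse-inj r' r″ (∷-injectiveˡ q)
  ... | refl with const-App-inj a b (subst Const (reverse-involutive r') cc)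
  ...   | refl , r = refl , rows r (∷-injectiveʳ q)
  go (firstBump {r'} a p i) (firstBump {r″} b p' i') q (cc ∷ c) with reverse-inj r' r″ (∷-injectiveˡ q) | ∷-injectiveʳ q
  ... | refl | refl with insert-inj p p' vs vs' c i i'
  ...   | refl , s with const-Bump-inj a b (subst Const (reverse-involutive r') cc)
  ...     | refl , r = refl , rows r s

-- The recording tableau determines its last step

Entries : ℕ → Tableau → Set
Entries m = All (λ r → r ≢ [] × All (λ y → base y ≤ m) r)

addBox-Entries : ∀ {m} k y Q → base y ≤ m → Entries m Q → Entries m (addBox k y Q)
addBox-Entries k y [] p e = ((λ ()) , p ∷ []) ∷ []
addBox-Entries zero y (r ∷ Q) p ((_ , a) ∷ e) = ((λ q → snoc≢ r q) , All.++⁺ a (p ∷ [])) ∷ e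
  where
  snoc≢ : ∀ {y} (r : List PN) → r ++ [ y ] ≢ []
  snoc≢ [] ()
  snoc≢ (_ ∷ _) ()
addBox-Entries (suc k) y (r ∷ Q) p (a ∷ e) = a ∷ addBox-Entries k y Q p e

Qdec-Entries : ∀ w → Entries (length w) (Qdec w)
Qdec-Entries [] = []
Qdec-Entries (x ∷ w) = addBox-Entries (proj₁ (proj₂ (decIns x (Pdec w)))) _ (Qdec w) (≤-reflexive (cong suc (count-PQ w)))
  (All.map (λ (p , q) → p , All.map m≤n⇒m≤1+n q) (Qdec-Entries w))

-- The new entry exceeds all others and thereby marks its box and parity. As no row is empty, a new
-- row of one box cannot be mistaken for an enlarged old row.
addBox-inj : ∀ {m o o'} k k' Q Q' → Entries m Q → Entries m Q' → k ≤ length Q → k' ≤ length Q' →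
  addBox k ⟨ suc m , o ⟩ Q ≡ addBox k' ⟨ suc m , o' ⟩ Q' → k ≡ k' × o ≡ o' × Q ≡ Q'
addBox-inj zero zero [] [] e e' l l' refl = refl , refl , refl
addBox-inj k zero [] (r ∷ Q') e ((ne' , _) ∷ _) l l' q with ∷-injectiveˡ q
addBox-inj k zero [] ([] ∷ Q') e ((ne' , _) ∷ _) l l' q | _ = ⊥-elim (ne' refl)
addBox-inj k zero [] ((_ ∷ []) ∷ Q') e ((ne' , _) ∷ _) l l' q | ()
addBox-inj k zero [] ((_ ∷ _ ∷ _) ∷ Q') e ((ne' , _) ∷ _) l l' q | ()
addBox-inj k (suc k') [] (r ∷ Q') e ((_ , a) ∷ _) l l' q with ∷-injectiveˡ q
... | refl = ⊥-elim (<-irrefl refl (All.head a))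
addBox-inj zero k' (r ∷ Q) [] ((ne' , _) ∷ _) e' l l' q with ∷-injectiveˡ q
addBox-inj zero k' ([] ∷ Q) [] ((ne' , _) ∷ _) e' l l' q | _ = ⊥-elim (ne' refl)
addBox-inj zero k' ((_ ∷ []) ∷ Q) [] ((ne' , _) ∷ _) e' l l' q | ()
addBox-inj zero k' ((_ ∷ _ ∷ _) ∷ Q) [] ((ne' , _) ∷ _) e' l l' q | ()
addBox-inj (suc k) k' (r ∷ Q) [] ((_ , a) ∷ _) e' l l' q with ∷-injectiveˡ q
... | refl = ⊥-elim (<-irrefl refl (All.head a))
addBox-inj zero zero (r ∷ Q) (r' ∷ Q') e e' l l' q with ∷ʳ-injective r r' (∷-injectiveˡ q) | ∷-injectiveʳ q
... | refl , refl | refl = refl , refl , refl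
addBox-inj zero (suc k') (r ∷ Q) (r' ∷ Q') e ((_ , a) ∷ _) l l' q with ∷-injectiveˡ q
... | refl = ⊥-elim (<-irrefl refl (All.head (All.++⁻ʳ r a)))
addBox-inj (suc k) zero (r ∷ Q) (r' ∷ Q') ((_ , a) ∷ _) e' l l' q with ∷-injectiveˡ q
... | refl = ⊥-elim (<-irrefl refl (All.head (All.++⁻ʳ r' a)))
addBox-inj (suc k) (suc k') (r ∷ Q) (r' ∷ Q') (_ ∷ e) (_ ∷ e') l l' q with addBox-inj k k' Q Q' e e' (≤-pred l) (≤-pred l') (∷-injectiveʳ q)
... | refl , refl , refl = refl , refl , cong (_∷ Q) (∷-injectiveˡ q)

decIns-index : ∀ {T' k o} x T → 1 ≤ base x → Valid T → Inserts x T T' k o → k ≤ length T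
decIns-index x [] p v refl = z≤n
decIns-index x (row ∷ T) p (v ∷ vs) e with first-row {x} {row} {T} p v e
... | firstApp a = z≤n
... | firstBump {c = c} b q i = s≤s (decIns-index c T q vs i)

tableau-unique : ∀ (T U : Tableau) → shape T ≡ shape U → revrow T ≡ revrow U → T ≡ U
tableau-unique [] [] s e = refl
tableau-unique (r ∷ T) (r' ∷ U) s e with ++-inj-len (reverse r) (reverse r') (trans (length-reverse r) (trans (∷-injectiveˡ s) (sym (length-reverse r')))) e
... | p , q = cong₂ _∷_ (reverse-inj r r' p) (tableau-unique T U (∷-injectiveʳ s) q)

peel : ∀ x x' v v' → 1 ≤ base x → 1 ≤ base x' → Pos v → Pos v' → length v ≡ length v' → All (Const ∘ reverse) (Pdec (x ∷ v)) →
  Pdec (x ∷ v) ≡ Pdec (x' ∷ v') → Qdec (x ∷ v) ≡ Qdec (x' ∷ v') → x ≡ x' × Pdec v ≡ Pdec v' × Qdec v ≡ Qdec v'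
peel x x' v v' p p' pv pv' l c P≡ Q≡ with decIns x (Pdec v) in i | decIns x' (Pdec v') in i'
... | T₁ , k , o | T₂ , k' , o' rewrite count-PQ v | count-PQ v' | sym l
  with addBox-inj k k' (Qdec v) (Qdec v') (Qdec-Entries v) (subst (λ z → Entries z (Qdec v')) (sym l) (Qdec-Entries v'))
    (subst (k ≤_) (len v pv) (decIns-index x (Pdec v) p (Pdec-valid v pv) i))
    (subst (k' ≤_) (len v' pv') (decIns-index x' (Pdec v') p' (Pdec-valid v' pv') i')) Q≡
  where
  len : ∀ v → Pos v → length (Pdec v) ≡ length (Qdec v)
  len v pv = trans (sym (length-map length (Pdec v))) (trans (cong length (shape-PQ v pv)) (length-map length (Qdec v)))
... | refl , refl , q with insert-inj {x} {x'} {Pdec v} {Pdec v'} p p' (Pdec-valid v pv) (Pdec-valid v' pv') c i (trans i' (cong (_, k , o) (sym P≡)))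
...   | e , t = e , t , q

-- Moving a word until every row of its tableau is constant

-- `z` is the leftmost entry of the row, last in the reversed reading, where every letter that is at
-- least `z` can be added to the hook.
LastH : List ℕ → ℕ → Set
LastH a z = (∃ λ a₀ → a ≡ a₀ ++ [ z ]) × (∀ y → z ≤ y → IsH (a ++ [ y ]))

hook-last : ∀ {a} → IsH a → ∃ λ z → LastH a z
hook-last (_ , hook J m E refl l d g s) with snoc m E
... | E₀ , z , e = z , (J ++ E₀ , trans (cong (J ++_) e) (sym (++-assoc J E₀ [ z ]))) , λ y z≤y → subst IsH (sym (++-assoc J (m ∷ E) [ y ]))
    (hookOf J m (E ++ [ y ]) d g (WI-++⁺ (m ∷ E) [ y ] s ([] , tt) (All.map (λ p → ≤-trans p z≤y ∷ []) all≤z)))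
  where
  all≤z : All (_≤ z) (m ∷ E)
  all≤z = subst (All (_≤ z)) (sym e) (All.++⁺ (All-heads (proj₂ (proj₂ (WI-++⁻ E₀ [ z ] (subst WI e s))))) (≤-refl ∷ []))

MH-below : ∀ {a b z} → MH a b → LastH a z → All (_< z) b
MH-below {a} {b} {z} h (_ , ext) = All.tabulate go
  where
  go : ∀ {y} → y ∈ b → y < z
  go {y} y∈ with y <? z
  ... | yes p = p
  ... | no q = ⊥-elim (<⇒≱ (≤-reflexive (sym (length-snoc a y))) (h (a ++ [ y ]) (Sub.++⁺ (Sub.⊆-refl {x = a}) (Sub.from∈ y∈)) (ext y (≮⇒≥ q))))

-- A letter of the next row that is at least `z` would prolong the hook of the row above. So
-- leftmost entries dominate the next row, and by iteration everything further down.
below : ∀ a rs {z} → DecR (a ∷ rs) → All IsH (a ∷ rs) → LastH a z → All (All (_< z)) rs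
below a [] d h l = []
below a (b ∷ rs) {z} (_ , mh , d) (_ ∷ hb ∷ hs) l with MH-below mh l | hook-last hb
... | b<z | z' , l' = b<z ∷ All.map (All.map (λ p → <-trans p z'<z)) (below b rs d (hb ∷ hs) l')
  where
  z'<z : z' < z
  z'<z with proj₁ l'
  ... | b₀ , refl = All.head (All.++⁻ʳ b₀ b<z)

row-IsH : ∀ {row} → RowW (reverse row) → IsH (baseRow row)
row-IsH (rowW k μ w e hk pos) = k , subst (Hook k) (sym (trans (cong (map base) e) (base-mark k μ w))) hk

rows-IsH : ∀ {T} → Valid T → All IsH (rowsB T)
rows-IsH v = All.map⁺ (All.map (λ {row} r → row-IsH {row} r) v)

row-nonempty : ∀ {r} → RowW r → ∃₂ λ x t → r ≡ x ∷ t × 1 ≤ base x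
row-nonempty (rowW k μ [] e (hook [] m E () _ _ _ _) pos)
row-nonempty (rowW k μ [] e (hook (_ ∷ _) m E () _ _ _ _) pos)
row-nonempty (rowW zero μ (x ∷ w) e hk (p ∷ _)) = _ , _ , e , p
row-nonempty (rowW (suc k) μ (x ∷ w) e hk (p ∷ _)) = _ , _ , e , p

DecR-tail : ∀ a rs → DecR (a ∷ rs) → DecR rs
DecR-tail a [] d = tt
DecR-tail a (b ∷ rs) (_ , _ , d) = d

DecR-suffix : ∀ rs rs' → DecR (rs ++ rs') → DecR rs'
DecR-suffix [] rs' d = d
DecR-suffix (a ∷ rs) rs' d = DecR-suffix rs rs' (DecR-tail a (rs ++ rs') d)

Low : ℕ → Tableau → Set
Low N [] = ⊤
Low N (row ∷ T) = All (N ≡_) (baseRow row) × Low (N ∸ 1) T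

revrow-++ : ∀ T U → revrow (T ++ U) ≡ revrow T ++ revrow U
revrow-++ [] U = refl
revrow-++ (r ∷ T) U = trans (cong (reverse r ++_) (revrow-++ T U)) (sym (++-assoc (reverse r) (revrow T) (revrow U)))

sum-shape : ∀ T → length (revrow T) ≡ sum (shape T)
sum-shape [] = refl
sum-shape (r ∷ T) = trans (length-++ (reverse r)) (cong₂ _+_ (length-reverse r) (sum-shape T))

split-tableau : ∀ T₁ {T₂} (U : Tableau) → shape U ≡ shape T₁ ++ shape T₂ → ∃₂ λ U₁ U₂ → U ≡ U₁ ++ U₂ × shape U₁ ≡ shape T₁ × shape U₂ ≡ shape T₂
split-tableau [] U e = [] , U , refl , refl , e
split-tableau (r ∷ T₁) (r' ∷ U) e with split-tableau T₁ U (∷-injectiveʳ e)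
... | U₁ , U₂ , refl , s₁ , s₂ = r' ∷ U₁ , U₂ , refl , cong₂ _∷_ (∷-injectiveˡ e) s₁ , s₂

inert-prefix : ∀ {M i} V → All (λ x → M < base x) V → i < M → Inert i (map base V)
inert-prefix V a i<M = All.map⁺ (All.map (λ p → gt-ne (≤-<-trans i<M p)) a)

prefix-Step : ∀ {M n V v Z} → 2 ≤ M → M ≤ n → All (λ x → M < base x) V → Step (QIdx M) v Z → Step (QIdx n) (V ++ v) (V ++ Z)
prefix-Step {M} {n} {V} {v} {Z} 2≤M M≤n a (ī , _ , e) = ī , tt , trans (f1̄≡F1 (V ++ v)) (E1-F1 (V ++ Z)
  (trans (E1-++-none V Z (big3-first (All.map (≤-trans (s≤s 2≤M)) a))) (cong (Maybe.map (V ++_)) (F1-E1 v (trans (sym (f1̄≡F1 v)) e)))))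
prefix-Step {M} {n} {V} {v} {Z} 2≤M M≤n a (ix i , (p , q) , e) = ix i , (p , ≤-trans q M≤n) ,
  fI-F (F-joinʳ V f (subst (_< φW i v) (sym (trans (ωW-base i V) (ωu-inert (inert-prefix V a q)))) (F-pos f)))
  where f = F-fI {i} e

reach-top : ∀ M → 2 ≤ M → ∀ v → All (InAlph M) v → 1 ≤ length v → ∃ λ Z → Conn (Step (QIdx M)) v Z × ((∃ λ p → Z ≡ [ ⟨ M , p ⟩ ]) ⊎ Starts M Z)
reach-top M 2≤M (⟨ y , p ⟩ ∷ []) ((1≤y , y≤M) ∷ []) _ with m≤n⇒∃[o]m+o≡n y≤M
... | d , e = _ , go d y 1≤y e , inj₁ (p , refl)
  where
  go : ∀ d y → 1 ≤ y → y + d ≡ M → Conn (Step (QIdx M)) [ ⟨ y , p ⟩ ] [ ⟨ M , p ⟩ ]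
  go zero y 1≤y e rewrite trans (sym (+-identityʳ y)) e = done
  go (suc d) y 1≤y e = fwd (stepF 1≤y (subst (suc y ≤_) (trans (sym (+-suc y d)) e) (m≤m+n (suc y) d)) (mkF [] p [] refl refl refl refl)) (go d (suc y) (s≤s z≤n) (trans (sym (+-suc y d)) e))
reach-top M 2≤M v@(_ ∷ _ ∷ _) a _ with reach-nn M 2≤M v a (s≤s (s≤s z≤n))
... | Z , c , st = Z , c , inj₂ st

module Lowering (n : ℕ) (2≤n : 2 ≤ n) where

  private
    module C = Core n 2≤n
  open C using (R; In)

  Dec-In : ∀ w → In w → Dec w
  Dec-In w iw = dec n 2≤n (length w) w ≤-refl iw

  record Top (M : ℕ) (w : Word) (T₁ : Tableau) : Set where
    constructor top
    field
      u : Word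
      row : List PN
      rs : Tableau
      conn : Conn R w u
      P≡ : Pdec u ≡ T₁ ++ row ∷ rs
      const : All (M ≡_) (baseRow row)

  -- The rows of `T₁` have entries above `M`, on which the operators of index below `M` and the odd
  -- one do not act. So the remaining rows can be moved on their own until their reading word starts
  -- with `M M`, or is the single letter `M`; the path then lifts along insertion.
  top-row : ∀ M → 1 ≤ M → M ≤ n → ∀ w T₁ row rs → In w → Pdec w ≡ T₁ ++ row ∷ rs → All (λ x → M < base x) (revrow T₁) → All (λ x → base x ≤ M) (revrow (row ∷ rs)) →
    Top M w T₁
  top-row M 1≤M M≤n w T₁ row rs iw e gt le with m≤n⇒m<n∨m≡n 1≤M
  ... | inj₂ refl = top w row rs done e (All.zipWith (λ (p , q) → ≤-antisym p q) (All.map⁺ (All.++⁻ˡ (reverse row) pos) , All.map⁺ (All.++⁻ˡ (reverse row) le)))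
    where
    pos : Pos (revrow (row ∷ rs))
    pos = All.++⁻ʳ (revrow T₁) (subst Pos (trans (cong revrow e) (revrow-++ T₁ (row ∷ rs))) (revrow-Pos _ (Pdec-valid w (In-Pos n 2≤n iw))))
  ... | inj₁ 2≤M with reach-top M 2≤M (revrow (row ∷ rs)) inM nonempty
    where
    ew = trans (cong revrow e) (revrow-++ T₁ (row ∷ rs))
    vw = subst Valid e (Pdec-valid w (In-Pos n 2≤n iw))
    inM : All (InAlph M) (revrow (row ∷ rs))
    inM = All.zipWith (λ (p , q) → p , q) (All.++⁻ʳ (revrow T₁) (subst Pos ew (revrow-Pos _ (Pdec-valid w (In-Pos n 2≤n iw)))) , le)
    nonempty : 1 ≤ length (revrow (row ∷ rs))
    nonempty with row-nonempty (All.head (All.++⁻ʳ T₁ vw))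
    ... | x , t , er , _ rewrite er = s≤s z≤n
  ...   | Z , c , z with Lift-path (QIdx-ok {n}) (In-Pos n 2≤n iw) (subst (λ t → Conn R t (revrow T₁ ++ Z)) (sym (trans (cong revrow e) (revrow-++ T₁ (row ∷ rs))))
            (Conn-map (revrow T₁ ++_) (λ s → fwd (prefix-Step 2≤M M≤n gt s) done) c))
  ...     | lift u d ue = fin (split-tableau T₁ {row ∷ rs} (Pdec u) sh) z
    where
    pw = In-Pos n 2≤n iw
    iu = C.Conn-In d iw
    pu = In-Pos n 2≤n iu
    sh : shape (Pdec u) ≡ shape T₁ ++ shape (row ∷ rs)
    sh = trans (shape-PQ u pu) (trans (cong shape (proj₂ (Conn-P (QIdx-ok {n}) d pw))) (trans (sym (shape-PQ w pw)) (trans (cong shape e) (map-++ length T₁ (row ∷ rs)))))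
    leZ : All (λ x → base x ≤ M) Z
    leZ = All.map proj₂ (Core.Conn-In M 2≤M c (All.zipWith (λ (p , q) → p , q) (All.++⁻ʳ (revrow T₁) (subst Pos (trans (cong revrow e) (revrow-++ T₁ (row ∷ rs))) (revrow-Pos _ (Pdec-valid w pw))) , le)))
    fin : (∃₂ λ U₁ U₂ → Pdec u ≡ U₁ ++ U₂ × shape U₁ ≡ shape T₁ × shape U₂ ≡ shape (row ∷ rs)) → ((∃ λ p → Z ≡ [ ⟨ M , p ⟩ ]) ⊎ Starts M Z) → Top M w T₁
    fin (U₁ , row' ∷ rs' , eu , s₁ , s₂) z = top u row' rs' d (trans eu (cong (_++ row' ∷ rs') U₁≡)) (const z)
      where
      spl = ++-inj-len (revrow U₁) (revrow T₁) (trans (sum-shape U₁) (trans (cong sum s₁) (sym (sum-shape T₁))))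
        (trans (sym (trans (cong revrow eu) (revrow-++ U₁ (row' ∷ rs')))) ue)
      U₁≡ : U₁ ≡ T₁
      U₁≡ = tableau-unique U₁ T₁ s₁ (proj₁ spl)
      Z≡ : reverse row' ++ revrow rs' ≡ Z
      Z≡ = proj₂ spl
      vu : Valid (row' ∷ rs')
      vu = All.++⁻ʳ U₁ (subst Valid eu (Pdec-valid u pu))
      du : DecR (rowsB (row' ∷ rs'))
      du = DecR-suffix (rowsB U₁) _ (subst DecR (trans (cong rowsB eu) (map-++ baseRow U₁ (row' ∷ rs'))) (Dec-In u iu))
      const : ((∃ λ p → Z ≡ [ ⟨ M , p ⟩ ]) ⊎ Starts M Z) → All (M ≡_) (map base (reverse row'))
      const z with reverse row' in er | row-nonempty (All.head vu) | Z≡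
      const (inj₁ (p , refl)) | .(x ∷ []) | x , [] , refl , _ | q = sym (cong base (∷-injectiveˡ q)) ∷ []
      const (inj₁ (p , refl)) | .(x ∷ y ∷ t) | x , y ∷ t , refl , _ | ()
      const (inj₂ (p , q' , v , refl)) | .(x ∷ y ∷ t) | x , y ∷ t , refl , _ | q =
        all-const (subst (λ r → IsH (map base r)) er (row-IsH {row'} (All.head vu))) (map base t , cong₂ (λ a b → base a ∷ base b ∷ map base t) (∷-injectiveˡ q) (∷-injectiveˡ (∷-injectiveʳ q)))
          (All.map⁺ (All.++⁻ˡ (x ∷ y ∷ t) (subst (All _) (sym q) leZ)))
      -- If the row had one box, the second `M` would lie in the next row, which is strictly shorter
      -- and hence empty.
      const (inj₂ (p , q' , v , refl)) | .(x ∷ []) | x , [] , refl , _ | q = ⊥-elim (two rs' (All.tail vu) du (∷-injectiveʳ q))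
        where
        two : ∀ rs' → Valid rs' → DecR (rowsB (row' ∷ rs')) → revrow rs' ≡ ⟨ M , q' ⟩ ∷ v → ⊥
        two [] _ _ ()
        two (row₂ ∷ rs') (v₂ ∷ _) (lt , _) _ with row-nonempty v₂
        ... | y , t , e₂ , _ = <⇒≱ (subst₂ _<_ (cong (length ∘ map base) e₂) (cong (length ∘ map base) er) lt) (s≤s z≤n)

  lower-all : ∀ N → N ≤ n → ∀ w T₁ T₂ → In w → Pdec w ≡ T₁ ++ T₂ → All (λ x → N < base x) (revrow T₁) → All (λ x → base x ≤ N) (revrow T₂) →
    ∃₂ λ u U → Conn R w u × Pdec u ≡ T₁ ++ U × Low N U
  lower-all N N≤n w T₁ [] iw e gt le = w , [] , done , e , tt
  lower-all zero N≤n w T₁ (row ∷ rs) iw e gt le with row-nonempty (All.head (All.++⁻ʳ T₁ (subst Valid e (Pdec-valid w (In-Pos n 2≤n iw)))))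
  ... | x , t , er , 1≤x = ⊥-elim (<⇒≱ 1≤x (All.head (subst (All _) (cong (_++ revrow rs) er) le)))
  lower-all (suc N) N≤n w T₁ (row ∷ rs) iw e gt le with top-row (suc N) (s≤s z≤n) N≤n w T₁ row rs iw e gt le
  ... | top u row' rs' c eu const with lower-all N (≤-trans (n≤1+n N) N≤n) u (T₁ ++ [ row' ]) rs' (C.Conn-In c iw) (trans eu (sym (++-assoc T₁ [ row' ] rs')))
        (subst (All _) (sym (trans (revrow-++ T₁ [ row' ]) (cong (revrow T₁ ++_) (++-identityʳ (reverse row'))))) (All.++⁺ (All.map (λ p → <-trans (n<1+n N) p) gt) (All.map⁻ (All.map ≤-reflexive const))))
        rest
    where
    vu : Valid (row' ∷ rs')
    vu = All.++⁻ʳ T₁ (subst Valid eu (Pdec-valid u (In-Pos n 2≤n (C.Conn-In c iw))))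
    du : DecR (rowsB (row' ∷ rs'))
    du = DecR-suffix (rowsB T₁) _ (subst DecR (trans (cong rowsB eu) (map-++ baseRow T₁ (row' ∷ rs'))) (Dec-In u (C.Conn-In c iw)))
    rest : All (λ x → base x ≤ N) (revrow rs')
    rest with hook-last (row-IsH {row'} (All.head vu))
    ... | z , l@((a₀ , ea) , _) with All.head (All.++⁻ʳ a₀ (subst (All _) ea const))
    ...   | refl = All.map⁻ (All.map ≤-pred (subst (All _) (concat-rowsB rs') (All.concat⁺ (below _ _ du (rows-IsH vu) l))))
  ...   | u' , U , c' , eu' , lowU = u' , row' ∷ U , c ◅◅ c' , trans eu' (++-assoc T₁ [ row' ] U) , const , lowU

  lower : ∀ w → In w → ∃ λ u → Conn R w u × Low n (Pdec u)
  lower w iw with lower-all n ≤-refl w [] (Pdec w) iw refl [] (All.map proj₂ (Pdec-All w (In-Pos n 2≤n iw) iw))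
  ... | u , U , c , e , l = u , c , subst (Low n) (sym e) l

  Low⇒Const : ∀ N T → Low N T → All (Const ∘ reverse) T
  Low⇒Const N [] l = []
  Low⇒Const N (row ∷ T) (a , l) = (N , a) ∷ Low⇒Const (N ∸ 1) T l

  P-injective : ∀ m w w' → length w ≡ m → length w' ≡ m → In w → In w' → Pdec w ≡ Pdec w' → Qdec w ≡ Qdec w' → w ≡ w'
  P-injective zero [] [] l l' iw iw' p q = refl
  P-injective (suc m) w w' l l' iw iw' p q with lower w iw
  ... | u , c , low with twin (QIdx-ok {n}) (In-Pos n 2≤n iw) (In-Pos n 2≤n iw') (cong revrow p) c
  ...   | u' , c' , e , back = back (go u u' (trans (sym (C.Conn-length c)) l) (trans (sym (C.Conn-length c')) l') (C.Conn-In c iw) (C.Conn-In c' iw') Pu Qu (Low⇒Const n _ low))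
    where
    pu = In-Pos n 2≤n (C.Conn-In c iw)
    pu' = In-Pos n 2≤n (C.Conn-In c' iw')
    Qu : Qdec u ≡ Qdec u'
    Qu = trans (proj₂ (Conn-P (QIdx-ok {n}) c (In-Pos n 2≤n iw))) (trans q (sym (proj₂ (Conn-P (QIdx-ok {n}) c' (In-Pos n 2≤n iw')))))
    Pu : Pdec u ≡ Pdec u'
    Pu = tableau-unique _ _ (trans (shape-PQ u pu) (trans (cong shape Qu) (sym (shape-PQ u' pu')))) e
    go : ∀ u u' → length u ≡ suc m → length u' ≡ suc m → In u → In u' → Pdec u ≡ Pdec u' → Qdec u ≡ Qdec u' → All (Const ∘ reverse) (Pdec u) → u ≡ u'
    go (x ∷ v) (x' ∷ v') lv lv' (ix₁ ∷ iv) (ix₂ ∷ iv') P Q cs with peel x x' v v' (proj₁ ix₁) (proj₁ ix₂) (In-Pos n 2≤n iv) (In-Pos n 2≤n iv') (suc-injective (trans lv (sym lv'))) cs P Q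
    ... | refl , P' , Q' = cong (x ∷_) (P-injective m v v' (suc-injective lv) (suc-injective lv') iv iv' P' Q')

-- The word of the tableau with rows n ⋯ n, n-1 ⋯ n-1, …, and the change of primes

lowB : ℕ → List ℕ → List ℕ
lowB N [] = []
lowB N (l ∷ sh) = replicate l N ++ lowB (N ∸ 1) sh

HeadLE : List ℕ → ℕ → Set
HeadLE [] a = ⊤
HeadLE (l ∷ _) a = l ≤ a

Descending : List ℕ → Set
Descending [] = ⊤
Descending (l ∷ sh) = HeadLE sh l × Descending sh

replicate-All : ∀ {P : ℕ → Set} a {x} → P x → All P (replicate a x)
replicate-All zero p = []
replicate-All (suc a) p = p ∷ replicate-All a p

lowB-≤ : ∀ N sh → All (_≤ N) (lowB N sh)
lowB-≤ N [] = []
lowB-≤ N (l ∷ sh) = All.++⁺ (replicate-All l ≤-refl) (All.map (λ p → ≤-trans p (m∸n≤m N 1)) (lowB-≤ (N ∸ 1) sh))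

φ-ops : ∀ i c a w → φ c (K i (replicate a (suc i) ++ w)) ≡ φ (a + c) (K i w)
φ-ops i c zero w = refl
φ-ops i c (suc a) w rewrite kind-op i = trans (φ-ops i (suc c) a w) (cong (λ z → φ z (K i w)) (+-suc a c))

φ-cls : ∀ i c l w → l ≤ c → φ c (K i (replicate l i ++ w)) ≡ φ (c ∸ l) (K i w)
φ-cls i c zero w p = refl
φ-cls i (suc c) (suc l) w (s≤s p) rewrite kind-cl i = φ-cls i c l w p

φ-low₀ : ∀ i c sh → 1 ≤ i → HeadLE sh c → φ c (K i (lowB i sh)) ≡ 0
φ-low₀ i c [] p h = refl
φ-low₀ (suc i) c (l ∷ sh) p h = trans (φ-cls (suc i) c l _ h) (trans (φ-∸ (c ∸ l) (K (suc i) (lowB i sh)))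
  (trans (cong (_∸ (c ∸ l)) (φu-inert (All.map (λ q → lt-ne (s≤s q)) (lowB-≤ i sh)))) (0∸n≡0 (c ∸ l))))

-- If `suc i` is `N`, the leading block matches the following row of letters `i`, which is not
-- longer. For smaller `i` the leading block is inert and the next row takes its place.
φ-low : ∀ i c a N sh → 1 ≤ i → i < N → HeadLE sh a → Descending sh → φ c (K i (replicate a N ++ lowB (N ∸ 1) sh)) ≡ 0
φ-low i c a (suc N) sh p (s≤s q) h d with m≤n⇒m<n∨m≡n q
... | inj₂ refl = trans (φ-ops i c a _) (φ-low₀ i (a + c) sh p (mono sh h))
  where
  mono : ∀ sh → HeadLE sh a → HeadLE sh (a + c)
  mono [] h = tt
  mono (l ∷ sh) h = ≤-trans h (m≤m+n a c)
... | inj₁ lt = trans (cong (φ c) (kinds-up-++ i (replicate a (suc N)) (lowB N sh))) (trans (φ-inert c (replicate-All {λ y → kind i y ≡ ne} a (gt-ne (s≤s lt))) _) (go sh h d))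
  where
  go : ∀ sh → HeadLE sh a → Descending sh → φ c (K i (lowB N sh)) ≡ 0
  go [] h d = refl
  go (l ∷ sh) h (h' , d) = φ-low i c l N sh p lt h' d

Low-base : ∀ N U → Low N U → map base (revrow U) ≡ lowB N (shape U)
Low-base N [] l = refl
Low-base N (row ∷ U) (a , l) = trans (map-++ base (reverse row) (revrow U)) (cong₂ _++_
  (trans (all-equal (All.map ≤-reflexive a) (All.map (λ e → ≤-reflexive (sym e)) a)) (cong (λ z → replicate z N) (trans (length-map base (reverse row)) (length-reverse row)))) (Low-base (N ∸ 1) U l))

Descending-shape : ∀ T → DecR (rowsB T) → Descending (shape T)
Descending-shape [] d = tt
Descending-shape (r ∷ []) d = tt , tt
Descending-shape (r ∷ r' ∷ T) (lt , _ , d) = <⇒≤ (subst₂ _<_ (∷-injectiveˡ (lengths-rowsB (r' ∷ T))) (∷-injectiveˡ (lengths-rowsB (r ∷ T))) lt) , Descending-shape (r' ∷ T) d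

const-row : ∀ {N r} → RowW r → All (N ≡_) (map base r) → ∃₂ λ μ l → r ≡ ⟨ N , μ ⟩ ∷ up (replicate l N) × 1 ≤ N
const-row {N} (rowW k μ w refl (hook (j ∷ J) m E refl l d (m<j ∷ _) s) pos) a with subst (All (N ≡_)) (base-mark k μ w) a
... | e ∷ q = no-gt (All.head (All.++⁻ʳ J q)) e m<j
const-row {N} (rowW k μ w refl (hook [] m E refl refl d _ s) (p ∷ pos)) a with subst (All (N ≡_)) (base-mark k μ w) a
... | refl ∷ q = μ , length E , cong (λ z → ⟨ N , μ ⟩ ∷ up z) (all-equal (All.map ≤-reflexive q) (All.map (λ e → ≤-reflexive (sym e)) q)) , p

QIdx⇒⁺ : ∀ {n i} → QIdx n i → QIdx⁺ n i
QIdx⇒⁺ {i = ī} p = p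
QIdx⇒⁺ {i = ix _} p = p

QIdx⁺-ok : ∀ {n i} → QIdx⁺ n i → IxOK i
QIdx⁺-ok {i = ī} _ = tt
QIdx⁺-ok {i = i0} _ = tt
QIdx⁺-ok {i = ix i} (p , _) = p

Conn⇒⁺ : ∀ {n a b} → Conn (Step (QIdx n)) a b → Conn (Step (QIdx⁺ n)) a b
Conn⇒⁺ {n} = Conn-map id (λ { (i , x , e) → fwd (i , QIdx⇒⁺ {n} {i} x , e) done })

module _ {n : ℕ} where

  -- The operators of index 0 only touch a letter 1, so N' is lowered to 1', unprimed and raised
  -- back. It is the letter acted on at every stage: `V` has only larger letters, and `rest` leaves
  -- no closing bracket unmatched.
  unprime-first : ∀ N V μ rest → N ≤ n → 1 ≤ N → All (λ x → N < base x) V → (∀ i → 1 ≤ i → i < N → φW i rest ≡ 0) →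
    Conn (Step (QIdx⁺ n)) (V ++ ⟨ N , μ ⟩ ∷ rest) (V ++ ⟨ N , false ⟩ ∷ rest)
  unprime-first N V false rest N≤n 1≤N a f = done
  unprime-first N V true rest N≤n 1≤N a f = Conn-sym (climb true N 1≤N ≤-refl) ◅◅ bwd flip (climb false N 1≤N ≤-refl)
    where
    climb : ∀ p y → 1 ≤ y → y ≤ N → Conn (Step (QIdx⁺ n)) (V ++ ⟨ 1 , p ⟩ ∷ rest) (V ++ ⟨ y , p ⟩ ∷ rest)
    climb p (suc zero) _ _ = done
    climb p (suc (suc y)) _ le = climb p (suc y) (s≤s z≤n) (≤-trans (n≤1+n _) le) ◅◅
      fwd (ix (suc y) , (s≤s z≤n , ≤-trans le N≤n) , fI-F (mkF V p rest refl refl (trans (ωW-base (suc y) V) (ωu-inert (inert-prefix V a le))) (f (suc y) (s≤s z≤n) le))) done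
    big : Big 2 V
    big = All.map (≤-trans (s≤s 1≤N)) a
    flip : Step (QIdx⁺ n) (V ++ ⟨ 1 , false ⟩ ∷ rest) (V ++ ⟨ 1 , true ⟩ ∷ rest)
    flip = i0 , tt , trans (f0-at (bit1-++-none V _ (big2-bit1 big))) (cong just (setb1-++-none true V _ (big2-bit1 big)))

  unprime-rows : ∀ N V U → N ≤ n → All (λ x → N < base x) V → Low N U → Valid U → DecR (rowsB U) →
    Conn (Step (QIdx⁺ n)) (V ++ revrow U) (V ++ up (lowB N (shape U)))
  unprime-rows N V [] N≤n a l v d = done
  unprime-rows N V (row ∷ U) N≤n a (c , l) (v ∷ vs) d with const-row v c
  ... | μ , k , er , s≤s {n = N₀} z≤n = subst₂ (Conn _) (cong (V ++_) (cong (_++ revrow U) (sym er))) last≡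
        (unprime-first N V μ (up (replicate k N) ++ revrow U) N≤n (s≤s z≤n) a φ0 ◅◅
         subst₂ (Conn _) (++-assoc V (up (replicate (suc k) N)) (revrow U)) (++-assoc V (up (replicate (suc k) N)) _)
           (unprime-rows N₀ (V ++ up (replicate (suc k) N)) U (≤-trans (n≤1+n N₀) N≤n) (All.++⁺ (All.map (<-trans (n<1+n N₀)) a) (All.map⁺ (replicate-All (suc k) ≤-refl))) l vs (DecR-tail _ (rowsB U) d)))
    where
    lk : length row ≡ suc k
    lk = trans (sym (length-reverse row)) (trans (cong length er) (cong suc (trans (length-map _ (replicate k N)) (length-replicate k))))
    last≡ : V ++ up (replicate (suc k) N) ++ up (lowB N₀ (shape U)) ≡ V ++ up (lowB N (shape (row ∷ U)))
    last≡ = cong (V ++_) (trans (sym (up-++ (replicate (suc k) N) _)) (cong (λ z → up (replicate z N ++ lowB N₀ (shape U))) (sym lk)))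
    -- Strictness of the shape matters: without its first letter the row is still at least as long
    -- as the next one and matches it completely.
    hd : ∀ U → DecR (rowsB (row ∷ U)) → HeadLE (shape U) k
    hd [] d = tt
    hd (r ∷ U) (lt , _) = ≤-pred (subst₂ _<_ (∷-injectiveˡ (lengths-rowsB (r ∷ U))) (trans (∷-injectiveˡ (lengths-rowsB (row ∷ U))) lk) lt)
    φ0 : ∀ i → 1 ≤ i → i < N → φW i (up (replicate k N) ++ revrow U) ≡ 0
    φ0 i p q = trans (φW-base i (up (replicate k N) ++ revrow U)) (trans (cong (φu i) (trans (map-++ base (up (replicate k N)) (revrow U)) (cong₂ _++_ (base-up (replicate k N)) (Low-base N₀ U l))))
      (φ-low i 0 k N (shape U) p q (hd U d) (Descending-shape U (DecR-tail _ (rowsB U) d))))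

-- Unprimed words, and canonical ends of paths

unp-up : ∀ w → All Unprimed (up w)
unp-up [] = []
unp-up (x ∷ w) = refl ∷ unp-up w

App-unprimed : ∀ {x r r' o} → App x r r' o → Unprimed x → All Unprimed r → All Unprimed r'
App-unprimed (appD x π m μ E _ _ _) refl a = refl ∷ unp-up (m ∷ E)
App-unprimed (appI x π J m μ E _ _ _ _) e a = All.++⁺ (unp-up (x ∷ J)) (All.++⁻ʳ (up J) a)

Bump-unprimed : ∀ {x r r' c} → Bump x r r' c → Unprimed x → All Unprimed r → All Unprimed r' × Unprimed c
Bump-unprimed (bumpU x π A b B m μ A′ c B′ _ _ _ _ _ _ _) refl a = All.++⁺ (unp-up (A ++ x ∷ B)) (All.head (All.++⁻ʳ (up (A ++ b ∷ B)) a) ∷ unp-up (A′ ++ b ∷ B′)) , refl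
Bump-unprimed (bumpN x π A b B B₀ y c μ B′ _ _ _ _ _ _ _) refl a = All.++⁺ (unp-up (A ++ B₀)) (refl ∷ unp-up (b ∷ B′)) , All.head (All.++⁻ʳ (up (A ++ b ∷ B)) a)
Bump-unprimed (bumpX x π A b m μ A′ c B′ _ _ _ _ _ _ _) refl a = All.++⁺ (unp-up A) (refl ∷ unp-up (m ∷ A′ ++ b ∷ B′)) , All.head (All.++⁻ʳ (up (A ++ [ b ])) a)

decIns-unprimed : ∀ {T' k o} x T → 1 ≤ base x → Valid T → Unprimed x → All Unprimed (revrow T) → Inserts x T T' k o → All Unprimed (revrow T')
decIns-unprimed x [] p v ux u refl = ux ∷ []
decIns-unprimed x (row ∷ T) p (v ∷ vs) ux u e with first-row {x} {row} {T} p v e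
... | firstApp {r'} a = All.++⁺ (subst (All Unprimed) (sym (reverse-involutive r')) (App-unprimed a ux (All.++⁻ˡ (reverse row) u))) (All.++⁻ʳ (reverse row) u)
... | firstBump {r'} {c} b q i with Bump-unprimed b ux (All.++⁻ˡ (reverse row) u)
...   | ur , uc = All.++⁺ (subst (All Unprimed) (sym (reverse-involutive r')) ur) (decIns-unprimed c T q vs uc (All.++⁻ʳ (reverse row) u) i)

Pdec-unprimed : ∀ w → Pos w → All Unprimed w → All Unprimed (revrow (Pdec w))
Pdec-unprimed [] p u = []
Pdec-unprimed (x ∷ w) (p ∷ ps) (u ∷ us) = decIns-unprimed x (Pdec w) p (Pdec-valid w ps) u (Pdec-unprimed w ps us) refl

unprimed-up : ∀ w → All Unprimed w → w ≡ up (map base w)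
unprimed-up [] u = refl
unprimed-up (⟨ x , .false ⟩ ∷ w) (refl ∷ u) = cong (_ ∷_) (unprimed-up w u)

module Canonical (n : ℕ) (2≤n : 2 ≤ n) where

  open Lowering n 2≤n
  private
    module C = Core n 2≤n

  Canon : (Idx → Set) → Word → Set
  Canon Ix w = ∃ λ u → Conn (Step Ix) w u × revrow (Pdec u) ≡ up (lowB n (shape (Qdec w)))

  private
    shape-end : ∀ {w u} → C.In w → Conn C.R w u → shape (Pdec u) ≡ shape (Qdec w)
    shape-end iw c = trans (shape-PQ _ (In-Pos n 2≤n (C.Conn-In c iw))) (cong shape (proj₂ (Conn-P (QIdx-ok {n}) c (In-Pos n 2≤n iw))))

  unprimed-step : ∀ {a b} → Step (QIdx n) a b → (All Unprimed a → All Unprimed b) × (All Unprimed b → All Unprimed a)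
  unprimed-step {a} {b} (ī , _ , e) = F1-All (λ _ p → p) a (trans (sym (f1̄≡F1 a)) e) , E1-All (λ _ p → p) b (F1-E1 a (trans (sym (f1̄≡F1 a)) e))
  unprimed-step (ix i , _ , e) = F-AllW (λ _ p → p) (F-fI e) , E-AllW (λ _ p → p) (F-fI e)

  canonical : ∀ w → C.In w → All Unprimed w → Canon (QIdx n) w
  canonical w iw uw with lower w iw
  ... | u , c , l = u , c , trans (unprimed-up _ (Pdec-unprimed u (In-Pos n 2≤n (C.Conn-In c iw)) (Conn-inv (λ s → proj₁ (unprimed-step s)) (λ s → proj₂ (unprimed-step s)) c uw)))
        (cong up (trans (Low-base n (Pdec u) l) (cong (lowB n) (shape-end iw c))))

  canonical⁺ : ∀ w → C.In w → Canon (QIdx⁺ n) w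
  canonical⁺ w iw with lower w iw
  ... | u , c , l with Lift-path (QIdx⁺-ok {n}) (In-Pos n 2≤n (C.Conn-In c iw)) (unprime-rows n [] (Pdec u) ≤-refl [] l (Pdec-valid u (In-Pos n 2≤n (C.Conn-In c iw))) (Dec-In u (C.Conn-In c iw)))
  ...   | lift t d e = t , Conn⇒⁺ c ◅◅ d , trans e (cong (λ z → up (lowB n z)) (shape-end iw c))

-- Back to the definitions of hook words, primed rows and decomposition tableaux in the statement

WD⇒Linked : ∀ u → WD u → Linked _≥_ u
WD⇒Linked u s = AllPairs⇒Linked (go u s)
  where
  go : ∀ u → WD u → AllPairs _≥_ u
  go [] s = []
  go (x ∷ u) (a , s) = a ∷ go u s

SI⇒Linked : ∀ u → SI u → Linked _<_ u
SI⇒Linked u s = AllPairs⇒Linked (go u s)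
  where
  go : ∀ u → SI u → AllPairs _<_ u
  go [] s = []
  go (x ∷ u) (a , s) = a ∷ go u s

Linked-≥-reverse : ∀ {u} → Linked _≥_ u → WI (reverse u)
Linked-≥-reverse l = go (Linked⇒AllPairs (λ p q → ≤-trans q p) l)
  where
  go : ∀ {u} → AllPairs _≥_ u → WI (reverse u)
  go [] = tt
  go {x ∷ u} (a ∷ s) = subst WI (sym (unfold-reverse x u)) (WI-++⁺ (reverse u) [ x ] (go s) ([] , tt) (All-reverse u (All.map (_∷ []) a)))

Linked-<-reverse : ∀ {u} → Linked _<_ u → SD (reverse u)
Linked-<-reverse l = go (Linked⇒AllPairs <-trans l)
  where
  go : ∀ {u} → AllPairs _<_ u → SD (reverse u)
  go [] = tt
  go {x ∷ u} (a ∷ s) = subst SD (sym (unfold-reverse x u)) (SD-++⁺ (reverse u) [ x ] (go s) ([] , tt) (All-reverse u (All.map (_∷ []) a)))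

split-nth : ∀ q (w : List ℕ) → q < length w → ∃ λ D → ∃₂ λ y R → w ≡ D ++ y ∷ R × length D ≡ q
split-nth zero (y ∷ w) _ = [] , y , w , refl , refl
split-nth (suc q) (x ∷ w) (s≤s p) with split-nth q w p
... | D , y , R , refl , l = x ∷ D , y , R , refl , cong suc l

IsHook⇒IsH : ∀ s → IsHook s → IsH (reverse s)
IsHook⇒IsH s (suc q , _ , q<l , dec₁ , inc) with split-nth q s q<l
... | D , y , R , refl , refl = subst IsH (sym (reverse-mid D y R)) (hookOf (reverse R) y (reverse D)
      (Linked-<-reverse (tail-linked (subst (Linked _<_) (drop-at D y R) inc)))
      (All-reverse R (heads (Linked⇒AllPairs <-trans (subst (Linked _<_) (drop-at D y R) inc))))
      (subst WI (reverse-++ D [ y ]) (Linked-≥-reverse (subst (Linked _≥_) (take-at D y R) dec₁))))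
  where
  tail-linked : ∀ {y R} → Linked _<_ (y ∷ R) → Linked _<_ R
  tail-linked [-] = []
  tail-linked (_ ∷ l) = l
  heads : ∀ {y R} → AllPairs _<_ (y ∷ R) → All (y <_) R
  heads (a ∷ _) = a

module _ {row : List PN} (r : RowW (reverse row)) where

  private
    open RowW r
    module H = Hook hk
    open H using (E; m; J>m; desc)

    row≡ : row ≡ reverse (mark k μ w)
    row≡ = trans (sym (reverse-involutive row)) (cong reverse r≡)

    base≡ : map base row ≡ reverse w
    base≡ = trans (cong (map base) row≡) (base-reverse hk μ)

    mid≡ : midPos (map base row) ≡ suc (length E)
    mid≡ = trans (cong midPos base≡) (Hook-midPos hk)

    form≡ : row ≡ up (reverse E) ++ ⟨ m , μ ⟩ ∷ up (reverse H.J)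
    form≡ = trans row≡ (mark-reverse hk μ)

    lenE : length (up (reverse E)) ≡ length E
    lenE = trans (length-map _ (reverse E)) (length-reverse E)

  row-IsHook : IsHook (map base row)
  row-IsHook = subst IsHook (sym (trans base≡ (Hook-reverse hk))) (suc (length (reverse E)) , s≤s z≤n ,
    subst (suc (length (reverse E)) ≤_) (sym (trans (length-++ (reverse E)) (+-suc _ _))) (s≤s (m≤m+n _ _)) ,
    subst (Linked _≥_) (sym (take-at (reverse E) m _)) (WD⇒Linked _ (Hook-WD hk)) ,
    subst (Linked _<_) (sym (drop-at (reverse E) m _)) (SI⇒Linked (m ∷ reverse H.J) (All-reverse H.J J>m , SD-reverse H.J desc)))

  row-PrimesOnlyMiddle : PrimesOnlyMiddle row
  row-PrimesOnlyMiddle = subst (All Unprimed) (sym take≡) (unp-up (reverse E)) , subst (All Unprimed) (sym drop≡) (unp-up (reverse H.J))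
    where
    take≡ : take (midPos (map base row) ∸ 1) row ≡ up (reverse E)
    take≡ = trans (cong₂ take (trans (cong (_∸ 1) mid≡) (sym lenE)) form≡) (take-prefix (up (reverse E)))
    drop≡ : drop (midPos (map base row)) row ≡ up (reverse H.J)
    drop≡ = trans (cong₂ drop (trans mid≡ (cong suc (sym lenE))) form≡) (drop-at′ (up (reverse E)) _ _)

length-baseRow : ∀ row → length (baseRow row) ≡ length row
length-baseRow row = trans (length-map base (reverse row)) (length-reverse row)

MH⇒MaxHookIn : ∀ ρ ρ' → MH (baseRow ρ) (baseRow ρ') → MaxHookIn (map base ρ) (map base ρ')
MH⇒MaxHookIn ρ ρ' h s sub hs = subst₂ _≤_ (length-reverse s) (trans (length-baseRow ρ) (sym (length-map base ρ)))
  (h (reverse s) (subst (reverse s ⊆_) (trans (reverse-++ (map base ρ') (map base ρ)) (sym (cong₂ _++_ (reverse-map base ρ) (reverse-map base ρ')))) (Sub.reverse⁺ sub)) (IsHook⇒IsH s hs))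

DecR⇒IsDecRows : ∀ T → Valid T → DecR (rowsB T) → IsDecRows T
DecR⇒IsDecRows T v d = All.map (λ {row} r → row-IsHook {row} r) v , go T d
  where
  go : ∀ T → DecR (rowsB T) → Linked (λ ρ ρ' → MaxHookIn (map base ρ) (map base ρ')) T
  go [] d = []
  go (ρ ∷ []) d = [-]
  go (ρ ∷ ρ' ∷ T) (_ , h , d) = MH⇒MaxHookIn ρ ρ' h ∷ go (ρ' ∷ T) d

-- The leftmost entry of a row exceeds all entries below it, so the bound on the entries drops by at
-- least one from row to row.
rows-bound : ∀ {N} rs → DecR rs → All IsH rs → All (All (λ y → 1 ≤ y × y ≤ N)) rs → length rs ≤ N
rows-bound [] d h a = z≤n
rows-bound (a ∷ rs) d hs@(h ∷ _) (b ∷ bs) with hook-last h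
... | z , l@((a₀ , refl) , _) with All.head (All.++⁻ʳ a₀ b)
...   | s≤s z≤n , z≤N = ≤-trans (s≤s (rows-bound rs (DecR-tail a rs d) (All.tail hs)
        (All.zipWith (λ (p , q) → All.zipWith (λ (u , v) → proj₁ u , ≤-pred v) (p , q)) (bs , below a rs d hs l)))) z≤N

revrow-rows : ∀ {P : PN → Set} T → All P (revrow T) → All (All P) T
revrow-rows T a = All.map (λ {row} p → subst (All _) (reverse-involutive row) (All-reverse (reverse row) p)) (All.map⁻ (All.concat⁻ {xss = map reverse T} a))

rowsB-All : ∀ {P : ℕ → Set} T → All (All (P ∘ base)) T → All (All P) (rowsB T)
rowsB-All T a = All.map⁺ (All.map (λ {row} p → All.map⁺ (All-reverse row p)) a)

module _ (n : ℕ) (2≤n : 2 ≤ n) (w : Word) (iw : Core.In n 2≤n w) where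

  private
    pw = In-Pos n 2≤n iw
    vw = Pdec-valid w pw
    dw = Lowering.Dec-In n 2≤n w iw

  Pdec-InAlph : All (All (InAlph n)) (Pdec w)
  Pdec-InAlph = revrow-rows (Pdec w) (Pdec-All w pw iw)

  Pdec-partition : StrictPartitionOf n (length w) (shape (Pdec w))
  Pdec-partition = All.map⁺ (All.map (λ {row} r → nonempty row r) vw) , strict (Pdec w) dw , trans (sym (sum-shape (Pdec w))) (revrow-length w pw) ,
      subst (_≤ n) (trans (length-map baseRow (Pdec w)) (sym (length-map length (Pdec w)))) (rows-bound (rowsB (Pdec w)) dw (rows-IsH vw) (rowsB-All (Pdec w) Pdec-InAlph))
    where
    nonempty : ∀ row → RowW (reverse row) → 1 ≤ length row
    nonempty row r with row-nonempty r
    ... | x , t , e , _ = subst (1 ≤_) (trans (sym (cong length e)) (length-reverse row)) (s≤s z≤n)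
    strict : ∀ T → DecR (rowsB T) → Linked _>_ (shape T)
    strict [] d = []
    strict (ρ ∷ []) d = [-]
    strict (ρ ∷ ρ' ∷ T) (lt , _ , d) = subst₂ _<_ (length-baseRow ρ') (length-baseRow ρ) lt ∷ strict (ρ' ∷ T) d

  Pdec-IsDecTab⁺ : IsDecTab⁺ n (length w) (Pdec w)
  Pdec-IsDecTab⁺ = Pdec-partition , DecR⇒IsDecRows (Pdec w) vw dw , Pdec-InAlph , All.map (λ {row} r → row-PrimesOnlyMiddle {row} r) vw

  Pdec-IsDecTab : All Unprimed w → IsDecTab n (length w) (Pdec w)
  Pdec-IsDecTab u = Pdec-partition , DecR⇒IsDecRows (Pdec w) vw dw ,
    All.zipWith (λ (p , q) → All.zip (p , q)) (Pdec-InAlph , revrow-rows (Pdec w) (Pdec-unprimed w pw u))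

-- Restoring a tableau from its reading word

fromRevrow-revrow : ∀ T → fromRevrow (shape T) (revrow T) ≡ T
fromRevrow-revrow [] = refl
fromRevrow-revrow (r ∷ T) = cong₂ _∷_ (trans (cong reverse (trans (cong (λ l → take l (reverse r ++ revrow T)) (sym (length-reverse r))) (take-prefix (reverse r)))) (reverse-involutive r))
    (trans (cong (fromRevrow (shape T)) (trans (cong (λ l → drop l (reverse r ++ revrow T)) (sym (length-reverse r))) (drop-prefix (reverse r)))) (fromRevrow-revrow T))

revrow-fromRevrow : ∀ sh W → length W ≡ sum sh → revrow (fromRevrow sh W) ≡ W × shape (fromRevrow sh W) ≡ sh
revrow-fromRevrow [] [] l = refl , refl
revrow-fromRevrow (k ∷ sh) W l with revrow-fromRevrow sh (drop k W) (trans (length-drop k W) (trans (cong (_∸ k) l) (m+n∸m≡n k (sum sh))))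
... | p , q = trans (cong₂ _++_ (reverse-involutive (take k W)) p) (take++drop≡id k W) ,
  cong₂ _∷_ (trans (length-reverse (take k W)) (trans (length-take k W) (m≤n⇒m⊓n≡m (≤-trans (m≤m+n k (sum sh)) (≤-reflexive (sym l)))))) q

f-length : ∀ i {w v} → fW i w ≡ just v → length w ≡ length v
f-length ī {w} {v} e = E1-length v (F1-E1 w (trans (sym (f1̄≡F1 w)) e))
f-length i0 {w} e with f0-shape {w} e
... | _ , refl = sym (setb1-length true w)
f-length (ix i) e = F-length (F-fI e)

shape-at : ∀ {x y} → Pos x → Pos y → Qdec y ≡ Qdec x → shape (Pdec y) ≡ shape (Pdec x)
shape-at {x} {y} px py q = trans (shape-PQ y py) (trans (cong shape q) (sym (shape-PQ x px)))

module _ (i : Idx) (ok : IxOK i) {x : Word} (px : Pos x) where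

  fT-P : ∀ {y} → fW i x ≡ just y → fT i (Pdec x) ≡ just (Pdec y)
  fT-P {y} e with sim-f i ok px e
  ... | tracks o q = trans (cong (Maybe.map (fromRevrow (shape (Pdec x)))) o) (cong just
        (trans (cong (λ s → fromRevrow s (revrow (Pdec y))) (sym (shape-at px (f-Pos i ok e px) q))) (fromRevrow-revrow (Pdec y))))

  eT-P : ∀ {y} → eW i x ≡ just y → eT i (Pdec x) ≡ just (Pdec y)
  eT-P {y} e with sim-e i ok px e
  ... | tracks o q = trans (cong (Maybe.map (fromRevrow (shape (Pdec x)))) o) (cong just
        (trans (cong (λ s → fromRevrow s (revrow (Pdec y))) (sym (shape-at px (e-Pos i ok e px) q))) (fromRevrow-revrow (Pdec y))))

  fT-P-none : fW i x ≡ nothing → fT i (Pdec x) ≡ nothing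
  fT-P-none e = cong (Maybe.map _) (none-f i px e)

  f-commutes : Maybe.map Pdec (fW i x) ≡ fT i (Pdec x)
  f-commutes with fW i x in q
  ... | just y = sym (fT-P q)
  ... | nothing = sym (fT-P-none q)

  e-commutes : Maybe.map Pdec (eW i x) ≡ eT i (Pdec x)
  e-commutes with eW i x in q
  ... | just y = sym (eT-P q)
  ... | nothing = sym (cong (Maybe.map _) (none-e i px q))

  -- An edge of tableaux that ends in `Pdec x` is traced back by applying e_i to `x`: insertion
  -- matches this operator, and the shape together with the reading word determines the tableau.
  fT-source : ∀ {T} → fT i T ≡ just (Pdec x) → ∃ λ y → fW i y ≡ just x × Pdec y ≡ T
  fT-source {T} e with fW i (revrow T) in q
  fT-source {T} e | just W with eW i x in r | revrow-fromRevrow (shape T) W (trans (sym (f-length i {revrow T} q)) (sum-shape T))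
  ... | z | W≡ , s≡ with trans (sym W≡) (cong revrow (just-injective e)) | trans (sym (cong shape (just-injective e))) s≡
  fT-source {T} e | just W | nothing | _ | refl | s≡ with trans (sym (none-e i px r)) (f⇒e i {revrow T} q)
  ... | ()
  fT-source {T} e | just W | just y | _ | refl | s≡ with sim-e i ok px r
  ... | tracks o Q≡ = y , e⇒f i {x} r , tableau-unique (Pdec y) T (trans (shape-at px (e-Pos i ok r px) Q≡) s≡) (just-injective (trans (sym o) (f⇒e i {revrow T} q)))

count-↭ : ∀ i {u v} → u ↭ v → count i (up u) ≡ count i (up v)
count-↭ i _↭_.refl = refl
count-↭ i (prep x p) with x ≡ᵇ i
... | true = cong suc (count-↭ i p)
... | false = count-↭ i p
count-↭ i (swap x y p) with x ≡ᵇ i | y ≡ᵇ i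
... | true | true = cong (suc ∘ suc) (count-↭ i p)
... | true | false = cong suc (count-↭ i p)
... | false | true = cong suc (count-↭ i p)
... | false | false = count-↭ i p
count-↭ i (_↭_.trans p q) = trans (count-↭ i p) (count-↭ i q)

wt-P : ∀ n w → Pos w → wtT n (Pdec w) ≡ wtW n w
wt-P n w p = map-cong (λ i → trans (count-up i (revrow (Pdec w))) (trans (sym (count-↭ i (Pdec-perm w p))) (sym (count-up i w)))) (upFrom 1 n)

-- The two isomorphism statements, for a crystal of words with letters satisfying A

module Iso (n m : ℕ) (2≤n : 2 ≤ n) (Ix : Idx → Set) (ok : ∀ {i} → Ix i → IxOK i) (A : PN → Set) (MemT : Tableau → Set)
  (A⇒ : ∀ {x} → A x → InAlph n x)
  (step-A : ∀ {a b} → Step Ix a b → All A a → All A b)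
  (step-A⁻ : ∀ {a b} → Step Ix a b → All A b → All A a)
  (mem-P : ∀ w → length w ≡ m → All A w → MemT (Pdec w))
  (canon : ∀ w → All A w → Canonical.Canon n 2≤n Ix w)
  where

  B C : Crystal
  B = record { Elt = Word ; Mem = λ w → length w ≡ m × All A w ; Ix = Ix ; wt = wtW n ; e = eW ; f = fW }
  C = record { Elt = Tableau ; Mem = MemT ; Ix = Ix ; wt = wtT n ; e = eT ; f = fT }

  MemB : Word → Set
  MemB = Crystal.Mem B

  step-Mem : ∀ {a b} → Step Ix a b → MemB a → MemB b
  step-Mem {a} s@(i , _ , e) (l , p) = trans (sym (f-length i {a} e)) l , step-A s p

  step-Mem⁻ : ∀ {a b} → Step Ix a b → MemB b → MemB a
  step-Mem⁻ {a} s@(i , _ , e) (l , p) = trans (f-length i {a} e) l , step-A⁻ s p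

  Mem-Pos : ∀ {w} → MemB w → Pos w
  Mem-Pos (_ , a) = All.map (proj₁ ∘ A⇒) a

  toConn : ∀ {a b} → Connected B a b → Conn (Step Ix) a b
  toConn Star.ε = done
  toConn (Sym.fwd (i , x , _ , _ , e) Star.◅ c) = fwd (i , x , e) (toConn c)
  toConn (Sym.bwd (i , x , _ , _ , e) Star.◅ c) = bwd (i , x , e) (toConn c)

  fromConn : ∀ {a b} → Conn (Step Ix) a b → MemB a → Connected B a b
  fromConn done p = Star.ε
  fromConn (fwd s@(i , x , e) c) p = Sym.fwd (i , x , p , step-Mem s p , e) Star.◅ fromConn c (step-Mem s p)
  fromConn (bwd s@(i , x , e) c) p = Sym.bwd (i , x , step-Mem⁻ s p , p , e) Star.◅ fromConn c (step-Mem⁻ s p)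

  Connected-Mem : ∀ {a b} → Connected B a b → MemB a → MemB b
  Connected-Mem c = Conn-inv step-Mem step-Mem⁻ (toConn c)

  Connected-Q : ∀ {a b} → Connected B a b → MemB a → Qdec b ≡ Qdec a
  Connected-Q c p = proj₂ (Conn-P ok (toConn c) (Mem-Pos p))

  Edge-P : ∀ {a b} → Edge B a b → Edge C (Pdec a) (Pdec b)
  Edge-P {a} {b} (i , x , p , q , e) = i , x , mem-P a (proj₁ p) (proj₂ p) , mem-P b (proj₁ q) (proj₂ q) , fT-P i (ok x) (Mem-Pos p) e

  Connected-P : ∀ {a b} → Connected B a b → Connected C (Pdec a) (Pdec b)
  Connected-P Star.ε = Star.ε
  Connected-P (Sym.fwd s Star.◅ c) = Sym.fwd (Edge-P s) Star.◅ Connected-P c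
  Connected-P (Sym.bwd s Star.◅ c) = Sym.bwd (Edge-P s) Star.◅ Connected-P c

  onto : ∀ {c z} b → MemB b → Pdec b ≡ c → Connected C c z → ∃ λ x → Connected B b x × Pdec x ≡ z
  onto b p refl Star.ε = b , Star.ε , refl
  onto b p refl (Sym.fwd (i , x , _ , _ , e) Star.◅ c) with fW i b in q
  ... | nothing with trans (sym e) (fT-P-none i (ok x) (Mem-Pos p) q)
  ...   | ()
  onto b p refl (Sym.fwd (i , x , _ , _ , e) Star.◅ c) | just b' with onto b' (step-Mem (i , x , q) p) (just-injective (trans (sym (fT-P i (ok x) (Mem-Pos p) q)) e)) c
  ... | y , d , r = y , Sym.fwd (i , x , p , step-Mem (i , x , q) p , q) Star.◅ d , r
  onto b p refl (Sym.bwd (i , x , _ , _ , e) Star.◅ c) with fT-source i (ok x) (Mem-Pos p) e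
  ... | b' , q , P≡ with onto b' (step-Mem⁻ (i , x , q) p) P≡ c
  ...   | y , d , r = y , Sym.bwd (i , x , step-Mem⁻ (i , x , q) p , p , q) Star.◅ d , r

  In-of : ∀ {w} → MemB w → Core.In n 2≤n w
  In-of (_ , a) = All.map A⇒ a

  quasiIso : QuasiIso B C Pdec
  quasiIso b p = Pdec b , mem-P b (proj₁ p) (proj₂ p) ,
    (λ _ → Connected-P) ,
    (λ x y c d e → let px = Connected-Mem c p ; py = Connected-Mem d p in
      Lowering.P-injective n 2≤n m x y (proj₁ px) (proj₁ py) (In-of px) (In-of py) e (trans (Connected-Q c p) (sym (Connected-Q d p)))) ,
    (λ z → onto b p refl) ,
    (λ x c → wt-P n x (Mem-Pos (Connected-Mem c p))) ,
    (λ i x w c → e-commutes i (ok x) (Mem-Pos (Connected-Mem c p)) , f-commutes i (ok x) (Mem-Pos (Connected-Mem c p)))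

  -- Equal recording tableaux have equal shapes, so both canonical paths end at words with the same
  -- insertion tableau. The recording tableaux of the ends agree as well, so injectivity identifies
  -- them and the paths can be joined.
  Q-classes : ∀ w w' → MemB w → MemB w' → Connected B w w' ⇔ (Qdec w ≡ Qdec w')
  Q-classes w w' p p' = mk⇔ (λ c → sym (Connected-Q c p)) λ q → fromConn (join q (canon w (proj₂ p)) (canon w' (proj₂ p'))) p
    where
    end : ∀ {v u} → Conn (Step Ix) v u → MemB v → MemB u
    end = Conn-inv step-Mem step-Mem⁻
    join : Qdec w ≡ Qdec w' → Canonical.Canon n 2≤n Ix w → Canonical.Canon n 2≤n Ix w' → Conn (Step Ix) w w'
    join q (u , c , e) (u' , c' , e') = c ◅◅ subst (λ z → Conn (Step Ix) z w') (sym u≡) (Conn-sym c')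
      where
      pu = end c p
      pu' = end c' p'
      Q≡ : Qdec u ≡ Qdec u'
      Q≡ = trans (proj₂ (Conn-P ok c (Mem-Pos p))) (trans q (sym (proj₂ (Conn-P ok c' (Mem-Pos p')))))
      u≡ : u ≡ u'
      u≡ = Lowering.P-injective n 2≤n m u u' (proj₁ pu) (proj₁ pu') (In-of pu) (In-of pu')
        (tableau-unique (Pdec u) (Pdec u') (shape-at (Mem-Pos pu') (Mem-Pos pu) Q≡) (trans e (trans (cong (λ z → up (lowB n (shape z))) q) (sym e')))) Q≡

-- The unprimed and the primed crystal as instances

module _ (n m : ℕ) (2≤n : 2 ≤ n) where

  private
    module C = Core n 2≤n
    module N = Canonical n 2≤n

    step⁺ : ∀ {a b} → Step (QIdx⁺ n) a b → C.In a → C.In b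
    step⁺ (ī , x , e) p = C.step-In (ī , x , e) p
    step⁺ (ix i , x , e) p = C.step-In (ix i , x , e) p
    step⁺ {a} (i0 , _ , e) p with f0-shape {a} e
    ... | _ , refl = setb1-All′ true a (s≤s z≤n , ≤-trans (n≤1+n 1) 2≤n) p

    step⁺⁻ : ∀ {a b} → Step (QIdx⁺ n) a b → C.In b → C.In a
    step⁺⁻ (ī , x , e) p = C.step-In⁻ (ī , x , e) p
    step⁺⁻ (ix i , x , e) p = C.step-In⁻ (ix i , x , e) p
    step⁺⁻ {a} {b} (i0 , _ , e) p with e0-shape {b} (f⇒e i0 {a} e)
    ... | _ , refl = setb1-All′ false b (s≤s z≤n , ≤-trans (n≤1+n 1) 2≤n) p

    mem : ∀ w → length w ≡ m → All (λ x → InAlph n x × Unprimed x) w → IsDecTab n m (Pdec w)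
    mem w refl a = Pdec-IsDecTab n 2≤n w (All.map proj₁ a) (All.map proj₂ a)

    mem⁺ : ∀ w → length w ≡ m → All (InAlph n) w → IsDecTab⁺ n m (Pdec w)
    mem⁺ w refl a = Pdec-IsDecTab⁺ n 2≤n w a

  module UnprimedWords = Iso n m 2≤n (QIdx n) (QIdx-ok {n}) (λ x → InAlph n x × Unprimed x) (IsDecTab n m) proj₁
    (λ s a → All.zip (C.step-In s (All.map proj₁ a) , proj₁ (N.unprimed-step s) (All.map proj₂ a)))
    (λ s a → All.zip (C.step-In⁻ s (All.map proj₁ a) , proj₂ (N.unprimed-step s) (All.map proj₂ a)))
    mem (λ w a → N.canonical w (All.map proj₁ a) (All.map proj₂ a))

  module PrimedWords = Iso n m 2≤n (QIdx⁺ n) (QIdx⁺-ok {n}) (InAlph n) (IsDecTab⁺ n m) id step⁺ step⁺⁻ mem⁺ N.canonical⁺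

mainTheorem3 : (n m : ℕ) → 2 ≤ n →
    QuasiIso (BWord n m) (DecTabCrystal n m) Pdec ×
    QuasiIso (BWord⁺ n m) (DecTabCrystal⁺ n m) Pdec ×
    (∀ w w' → Crystal.Mem (BWord n m) w → Crystal.Mem (BWord n m) w' →
    (Connected (BWord n m) w w' ⇔ (Qdec w ≡ Qdec w'))) ×
    (∀ w w' → Crystal.Mem (BWord⁺ n m) w → Crystal.Mem (BWord⁺ n m) w' →
    (Connected (BWord⁺ n m) w w' ⇔ (Qdec w ≡ Qdec w')))
mainTheorem3 n m 2≤n = U.quasiIso , V.quasiIso , U.Q-classes , V.Q-classes
  where
  module U = UnprimedWords n m 2≤n
  module V = PrimedWords n m 2≤n
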